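{- Let $M$ be a cographic binary matroid. Then $M \in \mathcal{C}_3$ if and only if $M$ has no minor isomorphic to $M(F_i)$ for any $i \in \{1,2,\dots,7\}$, where the graphs $F_1,\dots,F_7$ are the following (multigraphs, loops allowed; $K_4$ on $v_1,\dots,v_4$ means all six edges $v_iv_j$, $i<j$): $F_1$: $K_4$ on $v_1,\dots,v_4$ together with one loop at $v_1$. $F_2$: vertices $v_1,\dots,v_4$, edges forming the cycle $v_1v_2, v_2v_3, v_3v_4, v_4v_1$, plus one further edge parallel to each of $v_1v_2$, $v_2v_3$, $v_3v_4$ (7 edges). $F_3$: the complete graph $K_5$ on $x_1,\dots,x_5$ together with a new vertex $x_6$ and a single edge $x_1x_6$. $F_4$: $K_4$ on $v_1,\dots,v_4$ plus two further edges parallel to $v_1v_2$ (so three edges join $v_1,v_2$) and one further edge parallel to $v_3v_4$ (9 edges). $F_5$: vertices $h, r_1, r_2, r_3, r_4$, edges $r_1r_2, r_2r_3, r_3r_4, r_4r_1$, $hr_1, hr_2, hr_3, hr_4$, and one further edge parallel to each of $hr_1$ and $hr_2$ (10 edges). $F_6$: vertices $u_1,\dots,u_6$, edges $u_2u_3, u_5u_6, u_2u_5, u_4u_5, u_3u_4, u_1u_2, u_1u_6, u_1u_5, u_3u_5, u_4u_6$. $F_7$: $K_4$ on $v_1,\dots,v_4$ plus one further edge parallel to $v_1v_2$, one further edge parallel to $v_3v_4$, and a new vertex $v_5$ joined to $v_1$ by a single edge.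
   Context: All matroids are binary. For a binary matroid $M$ represented over $GF(2)$ by a matrix $A$ and a set $S \subseteq E(M)$, let $A_S$ be the matrix obtained from $A$ by appending a new bottom row with entry $1$ in the columns of elements of $S$ and $0$ elsewhere; the splitting matroid is $M_S = M(A_S)$. $\mathcal{C}_3$ denotes the class of cographic binary matroids $M$ such that $M_S$ is graphic for every $S \subseteq E(M)$ with $|S| = 3$. $M(G)$ denotes the cycle matroid of a graph $G$. -}

module Defs where

open import Data.Nat using (ℕ; zero; suc)
open import Data.Bool using (Bool; true; false; _∧_; _xor_)
open import Data.Fin using (Fin; zero; suc; #_)
open import Data.Fin.Subset using (Subset; _∈_; _∉_; _⊆_; _∪_; ⁅_⁆; ∁; Nonempty; ∣_∣)
open import Data.Vec using (Vec; []; _∷_; lookup; _∷ʳ_)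
open import Data.Product using (Σ; ∃; ∃-syntax; _×_; _,_)
open import Data.Sum using (_⊎_)
open import Relation.Nullary using (¬_)
open import Relation.Binary.PropositionalEquality using (_≡_)
open import Function.Definitions using (Injective)

_⇔_ : Set → Set → Set
A ⇔ B = (A → B) × (B → A)
infix 3 _⇔_

-- A matroid on the ground set Fin n, given by its independence predicate
-- on subsets of the ground set.
Matroid : ℕ → Set₁
Matroid n = Subset n → Set

-- Binary matroids: GF(2) = Bool with xor (addition) and ∧ (multiplication)

Mat : ℕ → ℕ → Set
Mat m n = Vec (Vec Bool n) m

-- GF(2) dot product of a row with the indicator vector of Y,
-- i.e. the entry of this row in the sum of the columns indexed by Y
dot : ∀ {n} → Vec Bool n → Subset n → Bool
dot [] [] = false
dot (a ∷ r) (b ∷ Y) = (a ∧ b) xor dot r Y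

ColSumZero : ∀ {m n} → Mat m n → Subset n → Set
ColSumZero A Y = ∀ i → dot (lookup A i) Y ≡ false

-- M(A): X is independent iff the columns indexed by X are linearly
-- independent over GF(2), i.e. no nonempty subset of them sums to zero.
M[_] : ∀ {m n} → Mat m n → Matroid n
M[ A ] X = ¬ (∃[ Y ] (Y ⊆ X × Nonempty Y × ColSumZero A Y))

split : ∀ {m n} → Mat m n → Subset n → Mat (suc m) n
split A S = A ∷ʳ S

Basis : ∀ {n} → Matroid n → Subset n → Set
Basis M B = M B × (∀ e → e ∉ B → ¬ M (⁅ e ⁆ ∪ B))

Dual : ∀ {n} → Matroid n → Matroid n
Dual M X = ∃[ B ] (Basis M B × X ⊆ ∁ B)

MaxIndIn : ∀ {n} → Matroid n → Subset n → Subset n → Set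
MaxIndIn M C B = B ⊆ C × M B × (∀ e → e ∈ C → e ∉ B → ¬ M (⁅ e ⁆ ∪ B))

-- M has a minor isomorphic to N: there are C (contracted set) and an
-- injection φ from E(N) onto E(M) - (C ∪ D) (D = the remaining, deleted
-- elements) such that φ is an isomorphism from N onto (M / C) \ D.
-- Independence in M / C: Z ⊆ E - C is independent iff Z ∪ B is
-- independent in M, where B is a maximal independent subset of C.
HasMinor : ∀ {n k} → Matroid n → Matroid k → Set
HasMinor {n} {k} M N =
  ∃[ C ] ∃[ B ] Σ (Fin k → Fin n) λ φ →
    Injective _≡_ _≡_ φ × (∀ x → φ x ∉ C) × MaxIndIn M C B ×
    (∀ (X : Subset k) (Y : Subset n) →
       (∀ y → (y ∈ Y) ⇔ (y ∈ B ⊎ ∃[ x ] (x ∈ X × φ x ≡ y))) →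
       (N X ⇔ M Y))

Graph : ℕ → ℕ → Set
Graph v e = Fin e → Fin v × Fin v

Joins : ∀ {v e} → Graph v e → Fin e → Fin v → Fin v → Set
Joins G f a b = (G f ≡ (a , b)) ⊎ (G f ≡ (b , a))

next : ∀ {k} → Fin (suc k) → Fin (suc k)
next {zero} zero = zero
next {suc k} zero = suc zero
next {suc k} (suc i) with next {k} i
... | zero = zero
... | suc j = suc (suc j)

-- X is the edge set of a cycle of G: distinct vertices w 0 … w k and
-- distinct edges f 0 … f k with f i joining w i and w (i+1 mod (k+1)).
-- (k = 0: a loop; k = 1: a pair of parallel edges.)
IsCycle : ∀ {v e} → Graph v e → Subset e → Set
IsCycle {v} {e} G X =
  ∃[ k ] Σ (Fin (suc k) → Fin v) λ w → Σ (Fin (suc k) → Fin e) λ f →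
    Injective _≡_ _≡_ w × Injective _≡_ _≡_ f ×
    (∀ i → Joins G (f i) (w i) (w (next i))) ×
    (∀ x → (x ∈ X) ⇔ (∃[ i ] (f i ≡ x)))

MG : ∀ {v e} → Graph v e → Matroid e
MG G X = ∀ Y → Y ⊆ X → ¬ IsCycle G Y

-- M is graphic: M = M(G) for some graph G whose edge set is E(M)
-- (relabelling edges, this is the same as M ≅ M(G))
Graphic : ∀ {n} → Matroid n → Set
Graphic {n} M = ∃[ v ] Σ (Graph v n) λ G → ∀ X → M X ⇔ MG G X

Cographic : ∀ {n} → Matroid n → Set
Cographic M = Graphic (Dual M)

InC₃ : ∀ {m n} → Mat m n → Set
InC₃ {m} {n} A = ∀ (S : Subset n) → ∣ S ∣ ≡ 3 → Graphic M[ split A S ]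

record FinGraph : Set where
  constructor mkGraph
  field
    nV nE : ℕ
    edges : Vec (Fin nV × Fin nV) nE

GraphOf : (F : FinGraph) → Graph (FinGraph.nV F) (FinGraph.nE F)
GraphOf F = lookup (FinGraph.edges F)

-- vertices v₁…v₄ are # 0 … # 3 (and v₅ is # 4)
F₁ : FinGraph
F₁ = mkGraph 4 7
  ( (# 0 , # 1) ∷ (# 0 , # 2) ∷ (# 0 , # 3) ∷ (# 1 , # 2) ∷ (# 1 , # 3) ∷ (# 2 , # 3)
  ∷ (# 0 , # 0) ∷ [])

F₂ : FinGraph
F₂ = mkGraph 4 7
  ( (# 0 , # 1) ∷ (# 1 , # 2) ∷ (# 2 , # 3) ∷ (# 3 , # 0)
  ∷ (# 0 , # 1) ∷ (# 1 , # 2) ∷ (# 2 , # 3) ∷ [])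

-- x₁ … x₆ are # 0 … # 5
F₃ : FinGraph
F₃ = mkGraph 6 11
  ( (# 0 , # 1) ∷ (# 0 , # 2) ∷ (# 0 , # 3) ∷ (# 0 , # 4)
  ∷ (# 1 , # 2) ∷ (# 1 , # 3) ∷ (# 1 , # 4)
  ∷ (# 2 , # 3) ∷ (# 2 , # 4)
  ∷ (# 3 , # 4)
  ∷ (# 0 , # 5) ∷ [])

F₄ : FinGraph
F₄ = mkGraph 4 9
  ( (# 0 , # 1) ∷ (# 0 , # 2) ∷ (# 0 , # 3) ∷ (# 1 , # 2) ∷ (# 1 , # 3) ∷ (# 2 , # 3)
  ∷ (# 0 , # 1) ∷ (# 0 , # 1) ∷ (# 2 , # 3) ∷ [])

-- h = # 0, r₁ … r₄ = # 1 … # 4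
F₅ : FinGraph
F₅ = mkGraph 5 10
  ( (# 1 , # 2) ∷ (# 2 , # 3) ∷ (# 3 , # 4) ∷ (# 4 , # 1)
  ∷ (# 0 , # 1) ∷ (# 0 , # 2) ∷ (# 0 , # 3) ∷ (# 0 , # 4)
  ∷ (# 0 , # 1) ∷ (# 0 , # 2) ∷ [])

-- u₁ … u₆ = # 0 … # 5
F₆ : FinGraph
F₆ = mkGraph 6 10
  ( (# 1 , # 2) ∷ (# 4 , # 5) ∷ (# 1 , # 4) ∷ (# 3 , # 4) ∷ (# 2 , # 3)
  ∷ (# 0 , # 1) ∷ (# 0 , # 5) ∷ (# 0 , # 4) ∷ (# 2 , # 4) ∷ (# 3 , # 5) ∷ [])

F₇ : FinGraph
F₇ = mkGraph 5 9
  ( (# 0 , # 1) ∷ (# 0 , # 2) ∷ (# 0 , # 3) ∷ (# 1 , # 2) ∷ (# 1 , # 3) ∷ (# 2 , # 3)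
  ∷ (# 0 , # 1) ∷ (# 2 , # 3) ∷ (# 0 , # 4) ∷ [])

F : Fin 7 → FinGraph
F zero = F₁
F (suc zero) = F₂
F (suc (suc zero)) = F₃
F (suc (suc (suc zero))) = F₄
F (suc (suc (suc (suc zero)))) = F₅
F (suc (suc (suc (suc (suc zero))))) = F₆
F (suc (suc (suc (suc (suc (suc zero)))))) = F₇

{-# OPTIONS --safe #-}
-- Let Z be the row space of A.  M is cographic when Z is the cycle space of a graph, and M_S is graphic
-- when Z + ⟨S⟩ is the cut space of a graph.  For each i there is a 3-element set S such that M(Fᵢ)_S has
-- a minor F₇, F₇*, M*(K₃,₃) or M*(K₅), and a minor of M carries S back to M: this is one direction.
-- For the other one, series reductions make Z simple.  Take a longest circuit C of Z.  If no subdivided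
-- K₄ occurs in Z, then C together with its chords forms a tree-like family, or C with one ear is a theta
-- graph with long legs, and this part is a direct summand whose splittings can be written down; so Z
-- decomposes.  A subdivided K₄ grows, ear by ear, to a subdivided K₄, W₄, prism or K₃,₃ that is a direct
-- summand, since any other ear produces some M(Fᵢ) or a matroid that is not cographic.  All other elements
-- are then coloops, the excluded minors determine which edges of the pattern may be subdivided, and the
-- splittings of the finitely many remaining patterns are listed.

module Submission where

open import Defs
import Data.Bool.Properties as Bool
import Data.Fin.Properties as Fin
import Data.List.Relation.Unary.All as All
import Data.List.Relation.Unary.All.Properties as All
import Data.List.Relation.Unary.Any as Any
import Data.List.Relation.Unary.Any.Properties as Any
import Data.Nat.Properties as ℕ
import Data.Vec.Properties as Vec
import Data.Fin.Subset.Properties as Sub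
import Data.List as List
import Data.List.Properties as List
import Data.Vec as Vec₀
import Data.Maybe as Maybe
import Data.Maybe.Properties as MaybeP
open import Data.Nat using (_*_; _<_; _≡ᵇ_; _≤?_; _≤_; _≤ᵇ_; suc; s≤s; zero; z≤n; ℕ) renaming (_+_ to _+ℕ_)
open import Data.Bool using (Bool; _xor_; _∧_; _∨_; false; if_then_else_; not; true)
open import Data.Fin using (#_; Fin; _↑ʳ_; _↑ˡ_; fromℕ; inject₁; inject≤; punchIn; splitAt; suc; toℕ; zero)
open import Data.List using (List; []; _++_; _∷_; allFin; concatMap; filter; length; map)
open import Data.List.Relation.Unary.All using (All; []; _∷_)
open import Data.List.Relation.Unary.Any using (Any; here; there)
open import Data.List.Membership.Propositional using (find) renaming (_∈_ to _∈ˡ_)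
open import Data.Product using (_,_; _×_; proj₁; proj₂; Σ; ∃; ∃-syntax)
open import Data.Sum using ([_,_]′; _⊎_; inj₁; inj₂)
open import Data.Empty using (⊥; ⊥-elim)
open import Relation.Nullary using (Dec; no; yes; ¬_)
open import Relation.Nullary.Decidable using (_×-dec_; _→-dec_; _⊎-dec_; decidable-stable; map′; ¬?; ⌊_⌋)
open import Relation.Binary.PropositionalEquality hiding ([_])
open import Function using (_∘_; id)
open import Data.Fin.Subset using (Subset; _∈_; _∉_; _∪_; ⁅_⁆; ∁; ∣_∣)
open import Data.Vec using (Vec; []; _∷_; _∷ʳ_; lookup; tabulate)
open import Function.Definitions using (Injective)
open import Data.Nat.Induction using (<-wellFounded)
open import Induction.WellFounded using (Acc; acc)
open import Data.List.Membership.Propositional.Properties using (∈-++⁺ʳ; ∈-++⁺ˡ; ∈-++⁻; ∈-allFin; ∈-concatMap⁺; ∈-filter⁺; ∈-map⁺; ∈-map⁻)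
open import Data.Maybe using (Maybe; just; nothing)
open import Data.Nat.DivMod using (_%_; _/_)
open import Algebra.Properties.CommutativeSemigroup ℕ.+-commutativeSemigroup using (interchange)

-- A binary matroid determines its cycle space, so every matroid statement becomes an equation
-- between subspaces of GF(2)^n. That `Z` is a cycle space enters only through the four extra
-- forbidden minors; no drawing of a graph for `Z` is used. The cut space of F₂ is the cycle space
-- of four internally disjoint paths of lengths 2, 2, 2, 1. Hence a theta graph with long legs
-- tolerates no further parallel path, and a longest circuit is what makes the legs long. The
-- obstacle is a set `S` spread over several direct summands, since splitting links them. Gluing
-- needs two marked vertices whose potential difference is the coefficient of `S` (`NRep`). A theta
-- graph all of whose legs are split by `S` has none, for they would represent F₇; but if |S| = 3
-- there, `S` misses the other summands and a disjoint union does. Contraction keeps the ground set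
-- `Fin n` and turns the element into a zero column. `U` holds the elements still alive, so that a
-- contracted element is not mistaken for the loop of F₁. Cancelling a series pair inside `S` lowers
-- its size by two, so the induction runs over the sizes one and three.

V : ℕ → Set
V n = Fin n → Bool

infix 4 _≈_
_≈_ : ∀ {n} → V n → V n → Set
u ≈ v = ∀ i → u i ≡ v i

infixl 6 _⊕_
_⊕_ : ∀ {n} → V n → V n → V n
(u ⊕ v) i = u i xor v i

infix 7 _·_
_·_ : ∀ {n} → Bool → V n → V n
(b · u) i = b ∧ u i

0ᵛ : ∀ {n} → V n
0ᵛ _ = false

𝟙 : ∀ {n} → Fin n → V n
𝟙 i j = ⌊ i Fin.≟ j ⌋

𝟙-refl : ∀ {n} (i : Fin n) → 𝟙 i i ≡ true
𝟙-refl i with i Fin.≟ i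
... | yes _ = refl
... | no ¬p = ⊥-elim (¬p refl)

𝟙-≢ : ∀ {n} {i j : Fin n} → i ≢ j → 𝟙 i j ≡ false
𝟙-≢ {i = i} {j} i≢j with i Fin.≟ j
... | yes p = ⊥-elim (i≢j p)
... | no _ = refl

𝟙-true : ∀ {n} {i j : Fin n} → 𝟙 i j ≡ true → i ≡ j
𝟙-true {i = i} {j} eq with i Fin.≟ j
... | yes p = p

≈-refl : ∀ {n} {u : V n} → u ≈ u
≈-refl _ = refl

≈-sym : ∀ {n} {u v : V n} → u ≈ v → v ≈ u
≈-sym p i = sym (p i)

≈-trans : ∀ {n} {u v w : V n} → u ≈ v → v ≈ w → u ≈ w
≈-trans p q i = trans (p i) (q i)

_≈?_ : ∀ {n} (u v : V n) → Dec (u ≈ v)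
u ≈? v = Fin.all? λ i → u i Bool.≟ v i

xor-cancelˡ : ∀ a b → a xor (a xor b) ≡ b
xor-cancelˡ false b = refl
xor-cancelˡ true false = refl
xor-cancelˡ true true = refl

xor-cancelʳ : ∀ a b → (a xor b) xor b ≡ a
xor-cancelʳ a b = trans (cong (_xor b) (Bool.xor-comm a b)) (trans (Bool.xor-comm _ b) (xor-cancelˡ b a))

xor≡false⇒≡ : ∀ {a b} → a xor b ≡ false → a ≡ b
xor≡false⇒≡ {false} {false} _ = refl
xor≡false⇒≡ {true} {true} _ = refl

xor-interchange : ∀ a b c d → (a xor b) xor (c xor d) ≡ (a xor c) xor (b xor d)
xor-interchange false false c d = refl
xor-interchange false true false d = refl
xor-interchange false true true false = refl
xor-interchange false true true true = refl
xor-interchange true false false d = refl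
xor-interchange true false true false = refl
xor-interchange true false true true = refl
xor-interchange true true false false = refl
xor-interchange true true false true = refl
xor-interchange true true true d = refl

true≢false : true ≢ false
true≢false ()

≢true⇒false : ∀ {b} → b ≢ true → b ≡ false
≢true⇒false {false} _ = refl
≢true⇒false {true} p = ⊥-elim (p refl)

≢false⇒true : ∀ {b} → b ≢ false → b ≡ true
≢false⇒true {true} _ = refl
≢false⇒true {false} p = ⊥-elim (p refl)

not-true : ∀ {b} → not b ≡ true → b ≡ false
not-true {false} _ = refl

∨-false₁ : ∀ {x y} → x ∨ y ≡ false → x ≡ false
∨-false₁ {false} _ = refl

∨-false₂ : ∀ {x y} → x ∨ y ≡ false → y ≡ false
∨-false₂ {false} h = h

dec-true : ∀ {A : Set} (d : Dec A) → A → ⌊ d ⌋ ≡ true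
dec-true (yes _) _ = refl
dec-true (no ¬a) a = ⊥-elim (¬a a)

-- The inner product, and search over all vectors

Σ₂ : ∀ {n} → V n → Bool
Σ₂ {zero} u = false
Σ₂ {suc n} u = u zero xor Σ₂ (u ∘ suc)

Σ₂-cong : ∀ {n} {u v : V n} → u ≈ v → Σ₂ u ≡ Σ₂ v
Σ₂-cong {zero} p = refl
Σ₂-cong {suc n} p = cong₂ _xor_ (p zero) (Σ₂-cong (p ∘ suc))

Σ₂-⊕ : ∀ {n} (u v : V n) → Σ₂ (u ⊕ v) ≡ Σ₂ u xor Σ₂ v
Σ₂-⊕ {zero} u v = refl
Σ₂-⊕ {suc n} u v = trans (cong ((u zero xor v zero) xor_) (Σ₂-⊕ (u ∘ suc) (v ∘ suc)))
                         (xor-interchange (u zero) (v zero) _ _)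

Σ₂-0 : ∀ {n} {u : V n} → u ≈ 0ᵛ → Σ₂ u ≡ false
Σ₂-0 {zero} p = refl
Σ₂-0 {suc n} p = cong₂ _xor_ (p zero) (Σ₂-0 (p ∘ suc))

Σ₂-single : ∀ {n} (i : Fin n) {u : V n} → (∀ j → j ≢ i → u j ≡ false) → Σ₂ u ≡ u i
Σ₂-single zero {u} p = trans (cong (u zero xor_) (Σ₂-0 (λ j → p (suc j) λ ()))) (Bool.xor-identityʳ _)
Σ₂-single (suc i) {u} p = cong₂ _xor_ (p zero λ ()) (Σ₂-single i (λ j j≢i → p (suc j) (j≢i ∘ Fin.suc-injective)))

⟨_,_⟩ : ∀ {n} → V n → V n → Bool
⟨ u , v ⟩ = Σ₂ λ i → u i ∧ v i

⟨⟩-cong : ∀ {n} {u u′ v v′ : V n} → u ≈ u′ → v ≈ v′ → ⟨ u , v ⟩ ≡ ⟨ u′ , v′ ⟩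
⟨⟩-cong p q = Σ₂-cong λ i → cong₂ _∧_ (p i) (q i)

⟨⟩-comm : ∀ {n} (u v : V n) → ⟨ u , v ⟩ ≡ ⟨ v , u ⟩
⟨⟩-comm u v = Σ₂-cong λ i → Bool.∧-comm (u i) (v i)

⟨⟩-⊕ʳ : ∀ {n} (u v w : V n) → ⟨ u , v ⊕ w ⟩ ≡ ⟨ u , v ⟩ xor ⟨ u , w ⟩
⟨⟩-⊕ʳ u v w = trans (Σ₂-cong λ i → Bool.∧-distribˡ-xor (u i) (v i) (w i)) (Σ₂-⊕ (λ i → u i ∧ v i) (λ i → u i ∧ w i))

⟨⟩-⊕ˡ : ∀ {n} (u v w : V n) → ⟨ u ⊕ v , w ⟩ ≡ ⟨ u , w ⟩ xor ⟨ v , w ⟩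
⟨⟩-⊕ˡ u v w = trans (⟨⟩-comm (u ⊕ v) w) (trans (⟨⟩-⊕ʳ w u v) (cong₂ _xor_ (⟨⟩-comm w u) (⟨⟩-comm w v)))

⟨⟩-𝟙 : ∀ {n} (i : Fin n) (u : V n) → ⟨ 𝟙 i , u ⟩ ≡ u i
⟨⟩-𝟙 i u = trans (Σ₂-single i λ j j≢i → cong (_∧ u j) (𝟙-≢ (j≢i ∘ sym))) (cong (_∧ u i) (𝟙-refl i))

⟨⟩-0ʳ : ∀ {n} (u : V n) {v : V n} → v ≈ 0ᵛ → ⟨ u , v ⟩ ≡ false
⟨⟩-0ʳ u p = Σ₂-0 λ i → trans (cong (u i ∧_) (p i)) (Bool.∧-zeroʳ (u i))

infixr 5 _◂_
_◂_ : ∀ {n} {A : Set} → A → (Fin n → A) → Fin (suc n) → A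
(b ◂ v) zero = b
(b ◂ v) (suc i) = v i

◂-cong : ∀ {n} {b c : Bool} {u v : V n} → b ≡ c → u ≈ v → (b ◂ u) ≈ (c ◂ v)
◂-cong p q zero = p
◂-cong p q (suc i) = q i

allV : ∀ n → List (V n)
allV zero = (λ ()) ∷ []
allV (suc n) = map (false ◂_) (allV n) ++ map (true ◂_) (allV n)

allV-complete : ∀ {n} (v : V n) → Any (v ≈_) (allV n)
allV-complete {zero} v = here λ ()
allV-complete {suc n} v with v zero in eq
... | false = Any.++⁺ˡ (Any.map⁺ (Any.map (λ p → λ { zero → eq ; (suc i) → p i }) (allV-complete (v ∘ suc))))
... | true = Any.++⁺ʳ (map (false ◂_) (allV n)) (Any.map⁺ (Any.map (λ p → λ { zero → eq ; (suc i) → p i }) (allV-complete (v ∘ suc))))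

Respects : ∀ {n} → (V n → Set) → Set
Respects P = ∀ {u v} → u ≈ v → P u → P v

-- Subsets of a finite set can be searched, which makes the later case distinctions on the existence
-- of a vector constructive. `P` has to respect `_≈_` because vectors are functions and are compared
-- pointwise.
anyV? : ∀ {n} {P : V n → Set} → Respects P → (∀ v → Dec (P v)) → Dec (∃ P)
anyV? {zero} {P} r d with d (λ ())
... | yes p = yes (_ , p)
... | no ¬p = no λ { (v , p) → ¬p (r (λ ()) p) }
anyV? {suc n} {P} r d
  with anyV? {n} {λ v → P (false ◂ v)} (λ p → r (◂-cong refl p)) (λ v → d _)
     | anyV? {n} {λ v → P (true ◂ v)} (λ p → r (◂-cong refl p)) (λ v → d _)
... | yes (v , p) | _ = yes (_ , p)
... | no _ | yes (v , p) = yes (_ , p)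
... | no ¬p | no ¬q = no λ { (v , p) → helper v (v zero) refl p }
  where
  helper : ∀ v b → v zero ≡ b → P v → ⊥
  helper v false eq p = ¬p (v ∘ suc , r (λ { zero → eq ; (suc i) → refl }) p)
  helper v true eq p = ¬q (v ∘ suc , r (λ { zero → eq ; (suc i) → refl }) p)

allV? : ∀ {n} {P : V n → Set} → Respects P → (∀ v → Dec (P v)) → Dec (∀ v → P v)
allV? {P = P} r d with anyV? {P = λ v → ¬ P v} (λ p ¬Pu Pv → ¬Pu (r (≈-sym p) Pv)) (λ v → ¬? (d v))
... | yes (v , ¬p) = no λ f → ¬p (f v)
... | no ¬e = yes λ v → decidable-stable (d v) λ ¬p → ¬e (v , ¬p)

-- Subspaces

record Space (n : ℕ) : Set₁ where
  field
    mem : V n → Set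
    resp≈ : Respects mem
    mem? : ∀ v → Dec (mem v)
    mem0 : mem 0ᵛ
    mem⊕ : ∀ {u v} → mem u → mem v → mem (u ⊕ v)

open Space public

infix 4 _∋_
_∋_ : ∀ {n} → Space n → V n → Set
W ∋ v = mem W v

mem-0 : ∀ {n} (W : Space n) {v} → v ≈ 0ᵛ → W ∋ v
mem-0 W p = resp≈ W (≈-sym p) (mem0 W)

mem-⊕-cancel : ∀ {n} (W : Space n) {u v} → W ∋ u ⊕ v → W ∋ v → W ∋ u
mem-⊕-cancel W {u} {v} p q = resp≈ W (λ i → xor-cancelʳ (u i) (v i)) (mem⊕ W p q)

mem-· : ∀ {n} (W : Space n) b {u} → W ∋ u → W ∋ b · u
mem-· W false p = mem0 W
mem-· W true p = p

infix 3 _≐_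
record _≐_ {n} (W X : Space n) : Set where
  constructor _⸴_
  field
    ≐⇒ : ∀ v → W ∋ v → X ∋ v
    ≐⇐ : ∀ v → X ∋ v → W ∋ v

open _≐_ public

_⊥ᵛ_ : ∀ {n} → Space n → V n → Set
W ⊥ᵛ u = ∀ w → W ∋ w → ⟨ u , w ⟩ ≡ false

⊥ᵛ-dec : ∀ {n} (W : Space n) u → Dec (W ⊥ᵛ u)
⊥ᵛ-dec W u = allV? (λ p f w → trans (⟨⟩-cong {u = u} {u} ≈-refl (≈-sym p)) (f (resp≈ W (≈-sym p) w)))
                   (λ w → mem? W w →-dec (⟨ u , w ⟩ Bool.≟ false))

perp : ∀ {n} → Space n → Space n
mem (perp W) u = W ⊥ᵛ u
resp≈ (perp W) p f w Ww = trans (⟨⟩-cong {v = w} {w} (≈-sym p) ≈-refl) (f w Ww)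
mem? (perp W) = ⊥ᵛ-dec W
mem0 (perp W) w _ = Σ₂-0 {u = λ i → false ∧ w i} λ _ → refl
mem⊕ (perp W) {u} {v} p q w Ww = trans (⟨⟩-⊕ˡ u v w) (cong₂ _xor_ (p w Ww) (q w Ww))

private
  ⊥ˡ : ∀ {n} → List (V n) → V n → Set
  ⊥ˡ L u = All (λ w → ⟨ u , w ⟩ ≡ false) L

  ⊥ˡ-resp : ∀ {n} (L : List (V n)) → Respects (⊥ˡ L)
  ⊥ˡ-resp L p = All.map (λ {w} e → trans (⟨⟩-cong {v = w} {w} (≈-sym p) ≈-refl) e)

  -- Induction over the generators replaces a dimension count. If some `u₀` is orthogonal to the
  -- tail but not to `y`, it is not orthogonal to `r` either; adding `u₀` corrects every `u` that
  -- meets `r`, so `y ⊕ r` satisfies the hypothesis for the tail. If there is no such `u₀`, then `y`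
  -- itself does.
  dperpˡ : ∀ {n} (W : Space n) (L : List (V n)) → All (mem W) L → ∀ y →
           (∀ u → ⊥ˡ L u → ⟨ u , y ⟩ ≡ false) → W ∋ y
  dperpˡ W [] _ y h = mem-0 W λ i → trans (sym (⟨⟩-𝟙 i y)) (h (𝟙 i) [])
  dperpˡ {n} W (r ∷ L) (Wr ∷ WL) y h
    with anyV? {P = λ u → ⊥ˡ L u × ⟨ u , y ⟩ ≡ true}
               (λ p (a , b) → ⊥ˡ-resp L p a , trans (⟨⟩-cong {v = y} {y} (≈-sym p) ≈-refl) b)
               (λ u → All.all? (λ w → ⟨ u , w ⟩ Bool.≟ false) L ×-dec (⟨ u , y ⟩ Bool.≟ true))
  ... | no ¬e = dperpˡ W L WL y λ u p → ≢true⇒false λ q → ¬e (u , p , q)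
  ... | yes (u₀ , p₀ , q₀) with ⟨ u₀ , r ⟩ in eq₀
  ...   | false = ⊥-elim (true≢false (trans (sym q₀) (h u₀ (eq₀ ∷ p₀))))
  ...   | true = mem-⊕-cancel W (dperpˡ W L WL (y ⊕ r) step) Wr
    where
    step : ∀ u → ⊥ˡ L u → ⟨ u , y ⊕ r ⟩ ≡ false
    step u p with ⟨ u , r ⟩ in eq
    ... | false = trans (⟨⟩-⊕ʳ u y r) (cong₂ _xor_ (h u (eq ∷ p)) eq)
    ... | true = trans (⟨⟩-⊕ʳ u y r) (trans (cong₂ _xor_ uy eq) refl)
      where
      p′ : ⊥ˡ L (u ⊕ u₀)
      p′ = All.zipWith (λ {w} (a , b) → trans (⟨⟩-⊕ˡ u u₀ w) (cong₂ _xor_ a b)) (p , p₀)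
      sum0 : ⟨ u ⊕ u₀ , y ⟩ ≡ false
      sum0 = h (u ⊕ u₀) (trans (⟨⟩-⊕ˡ u u₀ r) (cong₂ _xor_ eq eq₀) ∷ p′)
      uy : ⟨ u , y ⟩ ≡ true
      uy = trans (xor≡false⇒≡ (trans (sym (⟨⟩-⊕ˡ u u₀ y)) sum0)) q₀

dperp : ∀ {n} (W : Space n) y → (∀ u → perp W ∋ u → ⟨ u , y ⟩ ≡ false) → W ∋ y
dperp {n} W y h = dperpˡ W L (All.all-filter (mem? W) (allV n)) y λ u p → h u λ w Ww → get u p w Ww
  where
  L = filter (mem? W) (allV n)
  get : ∀ u → ⊥ˡ L u → ∀ w → W ∋ w → ⟨ u , w ⟩ ≡ false
  get u p w Ww with Any.map (λ q → q) (allV-complete w)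
  ... | a = helper (find a)
    where
    helper : ∃ (λ x → x ∈ˡ allV n × w ≈ x) → ⟨ u , w ⟩ ≡ false
    helper (x , x∈ , w≈x) = trans (⟨⟩-cong {u = u} {u} ≈-refl w≈x)
                                  (All.lookup p (∈-filter⁺ (mem? W) x∈ (resp≈ W w≈x Ww)))

perp-perp : ∀ {n} (W : Space n) → perp (perp W) ≐ W
perp-perp W = (λ v p → dperp W v λ u q → trans (⟨⟩-comm u v) (p u q))
            ⸴ (λ v p u q → trans (⟨⟩-comm v u) (q v p))

∈⇒true : ∀ {n} {X : Subset n} {e} → e ∈ X → lookup X e ≡ true
∈⇒true = Vec.[]=⇒lookup

true⇒∈ : ∀ {n} {X : Subset n} {e} → lookup X e ≡ true → e ∈ X
true⇒∈ = Vec.lookup⇒[]= _ _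

-- Cut spaces, as images of the coboundary of vertex potentials, and cycle spaces, as their
-- complements

δ : ∀ {v n} → Graph v n → V v → V n
δ G T e = T (proj₁ (G e)) xor T (proj₂ (G e))

Cut : ∀ {v n} → Graph v n → Space n
mem (Cut G) w = ∃ λ T → w ≈ δ G T
resp≈ (Cut G) p (T , q) = T , λ e → trans (sym (p e)) (q e)
mem? (Cut G) w = anyV? (λ p q e → trans (q e) (cong₂ _xor_ (p _) (p _))) λ T → w ≈? δ G T
mem0 (Cut G) = 0ᵛ , λ _ → refl
mem⊕ (Cut G) (T , p) (T′ , q) = T ⊕ T′ , λ e → trans (cong₂ _xor_ (p e) (q e)) (xor-interchange (T _) _ _ _)

Cyc : ∀ {v n} → Graph v n → Space n
Cyc G = perp (Cut G)

Cyc-δ : ∀ {v n} (G : Graph v n) {y} → Cyc G ∋ y → ∀ T → ⟨ y , δ G T ⟩ ≡ false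
Cyc-δ G p T = p (δ G T) (T , λ _ → refl)

indicator : ∀ {k n} → (Fin k → Fin n) → V n
indicator f e = ⌊ Fin.any? (λ i → f i Fin.≟ e) ⌋

indicator-true : ∀ {k n} (f : Fin k → Fin n) i → indicator f (f i) ≡ true
indicator-true f i with Fin.any? (λ j → f j Fin.≟ f i)
... | yes _ = refl
... | no ¬p = ⊥-elim (¬p (i , refl))

true-indicator : ∀ {k n} (f : Fin k → Fin n) {e} → indicator f e ≡ true → ∃ λ i → f i ≡ e
true-indicator f {e} eq with Fin.any? (λ j → f j Fin.≟ e)
... | yes p = p

indicator-false : ∀ {k n} (f : Fin k → Fin n) {e} → (∀ i → f i ≢ e) → indicator f e ≡ false
indicator-false f {e} h with Fin.any? (λ j → f j Fin.≟ e)
... | yes (i , p) = ⊥-elim (h i p)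
... | no _ = refl

indicator-unique : ∀ {k n} (f : Fin k → Fin n) (u : V n) →
                   (∀ i → u (f i) ≡ true) → (∀ e → u e ≡ true → ∃ λ i → f i ≡ e) → u ≈ indicator f
indicator-unique f u h₁ h₂ e with u e in eq | Fin.any? (λ i → f i Fin.≟ e)
... | true | yes _ = refl
... | false | no _ = refl
... | true | no ¬p = ⊥-elim (¬p (h₂ e eq))
... | false | yes (i , refl) = ⊥-elim (true≢false (trans (sym (h₁ i)) eq))

⟨indicator,⟩ : ∀ {k n} (f : Fin k → Fin n) → Injective _≡_ _≡_ f → ∀ x → ⟨ indicator f , x ⟩ ≡ Σ₂ (x ∘ f)
⟨indicator,⟩ {zero} f inj x = Σ₂-0 {u = λ e → indicator f e ∧ x e} λ e → cong (_∧ x e) (indicator-false f {e} λ ())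
⟨indicator,⟩ {suc k} f inj x =
  trans (⟨⟩-cong {v = x} {x} ind-split ≈-refl)
  (trans (⟨⟩-⊕ˡ (𝟙 (f zero)) (indicator (f ∘ suc)) x)
         (cong₂ _xor_ (⟨⟩-𝟙 (f zero) x) (⟨indicator,⟩ (f ∘ suc) (Fin.suc-injective ∘ inj) x)))
  where
  ind-split : indicator f ≈ 𝟙 (f zero) ⊕ indicator (f ∘ suc)
  ind-split e with f zero Fin.≟ e | Fin.any? (λ i → f (suc i) Fin.≟ e)
  ind-split e | yes refl | yes (i , p) with () ← inj p
  ind-split e | yes refl | no ¬p = refl
  ind-split e | no ¬p | yes q = refl
  ind-split e | no ¬p | no ¬q = refl

Σ₂-last : ∀ {k} (h : V (suc k)) → Σ₂ h ≡ Σ₂ (h ∘ inject₁) xor h (fromℕ k)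
Σ₂-last {zero} h = Bool.xor-identityʳ _
Σ₂-last {suc k} h = trans (cong (h zero xor_) (Σ₂-last (h ∘ suc))) (sym (Bool.xor-assoc (h zero) _ _))

next-inject₁ : ∀ {k} (i : Fin k) → next (inject₁ i) ≡ suc i
next-inject₁ {suc k} zero = refl
next-inject₁ {suc (suc k)} (suc i) with next {suc k} (inject₁ i) | next-inject₁ i
... | _ | refl = refl

next-fromℕ : ∀ k → next (fromℕ k) ≡ zero
next-fromℕ zero = refl
next-fromℕ (suc k) with next (fromℕ k) | next-fromℕ k
... | _ | refl = refl

Σ₂-next : ∀ {k} (h : V (suc k)) → Σ₂ (h ∘ next) ≡ Σ₂ h
Σ₂-next {k} h = trans (Σ₂-last (h ∘ next))
  (trans (cong₂ _xor_ (Σ₂-cong λ i → cong h (next-inject₁ i)) (cong h (next-fromℕ k))) (Bool.xor-comm _ (h zero)))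

δ-joins : ∀ {v n} (G : Graph v n) {e a b} → Joins G e a b → ∀ T → δ G T e ≡ T a xor T b
δ-joins G (inj₁ p) T rewrite p = refl
δ-joins G {a = a} {b} (inj₂ p) T rewrite p = Bool.xor-comm (T b) (T a)

-- Along a cycle the coboundary of `T` telescopes: every vertex contributes once as the start of an
-- edge and once as its end.
cycle⇒Cyc : ∀ {v n} (G : Graph v n) {Y} → IsCycle G Y → Cyc G ∋ lookup Y
cycle⇒Cyc G {Y} (k , w , f , winj , finj , js , X⇔) x (T , x≈) = begin
  ⟨ lookup Y , x ⟩                          ≡⟨ ⟨⟩-cong Y≈ x≈ ⟩
  ⟨ indicator f , δ G T ⟩                   ≡⟨ ⟨indicator,⟩ f finj (δ G T) ⟩
  Σ₂ (δ G T ∘ f)                            ≡⟨ Σ₂-cong (λ i → δ-joins G (js i) T) ⟩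
  Σ₂ ((T ∘ w) ⊕ (T ∘ w ∘ next))             ≡⟨ Σ₂-⊕ (T ∘ w) (T ∘ w ∘ next) ⟩
  Σ₂ (T ∘ w) xor Σ₂ (T ∘ w ∘ next)          ≡⟨ cong (Σ₂ (T ∘ w) xor_) (Σ₂-next (T ∘ w)) ⟩
  Σ₂ (T ∘ w) xor Σ₂ (T ∘ w)                 ≡⟨ Bool.xor-same (Σ₂ (T ∘ w)) ⟩
  false                                     ∎
  where
  open ≡-Reasoning
  Y≈ : lookup Y ≈ indicator f
  Y≈ = indicator-unique f (lookup Y) (λ i → ∈⇒true (proj₂ (X⇔ (f i)) (i , refl)))
                                     (λ e p → proj₁ (X⇔ e) (true⇒∈ p))

cycle-nonempty : ∀ {v n} (G : Graph v n) {Y} → IsCycle G Y → ∃ λ e → lookup Y e ≡ true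
cycle-nonempty G (k , w , f , winj , finj , js , X⇔) = f zero , ∈⇒true (proj₂ (X⇔ (f zero)) (zero , refl))

infixl 5 _▹_
_▹_ : ∀ {k} {A : Set} → (Fin k → A) → A → Fin (suc k) → A
_▹_ {zero} g a _ = a
_▹_ {suc k} g a zero = g zero
_▹_ {suc k} g a (suc i) = (g ∘ suc ▹ a) i

▹-inject₁ : ∀ {k} {A : Set} (g : Fin k → A) a i → (g ▹ a) (inject₁ i) ≡ g i
▹-inject₁ g a zero = refl
▹-inject₁ g a (suc i) = ▹-inject₁ (g ∘ suc) a i

▹-fromℕ : ∀ {k} {A : Set} (g : Fin k → A) a → (g ▹ a) (fromℕ k) ≡ a
▹-fromℕ {zero} g a = refl
▹-fromℕ {suc k} g a = ▹-fromℕ (g ∘ suc) a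

lastView : ∀ {k} (i : Fin (suc k)) → (∃ λ j → i ≡ inject₁ j) ⊎ i ≡ fromℕ k
lastView {zero} zero = inj₂ refl
lastView {suc k} zero = inj₁ (zero , refl)
lastView {suc k} (suc i) with lastView i
... | inj₁ (j , refl) = inj₁ (suc j , refl)
... | inj₂ refl = inj₂ refl

-- A path with vertices vs 0, …, vs j inside the even edge set y is extended at vs 0 until it
-- meets itself.
module FindCycle {v n} (G : Graph v n) (y : V n) (y∈ : Cyc G ∋ y) where

  record Path (j : ℕ) : Set where
    field
      vs : Fin (suc (suc j)) → Fin v
      es : Fin (suc j) → Fin n
      vs-inj : Injective _≡_ _≡_ vs
      joins : ∀ i → Joins G (es i) (vs (inject₁ i)) (vs (suc i))
      es∈y : ∀ i → y (es i) ≡ true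

  Result : Set
  Result = ∃ λ Y → (∀ e → lookup Y e ≡ true → y e ≡ true) × IsCycle G Y

  mkCycle : ∀ k (w : Fin (suc k) → Fin v) (f : Fin (suc k) → Fin n) →
            Injective _≡_ _≡_ w → Injective _≡_ _≡_ f → (∀ i → Joins G (f i) (w i) (w (next i))) →
            (∀ i → y (f i) ≡ true) → Result
  mkCycle k w f wi fi js f∈ = tabulate (indicator f)
    , (λ e p → sub (true-indicator f (trans (sym (Vec.lookup∘tabulate _ e)) p)))
    , k , w , f , wi , fi , js
    , λ x → (λ x∈ → true-indicator f (trans (sym (Vec.lookup∘tabulate _ x)) (∈⇒true x∈)))
          , λ { (i , refl) → true⇒∈ (trans (Vec.lookup∘tabulate _ x) (indicator-true f i)) }
    where
    sub : ∀ {e} → (∃ λ i → f i ≡ e) → y e ≡ true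
    sub (i , refl) = f∈ i

  loop : ∀ e → y e ≡ true → proj₁ (G e) ≡ proj₂ (G e) → Result
  loop e ye p = mkCycle 0 (λ _ → proj₁ (G e)) (λ _ → e) (λ { {zero} {zero} _ → refl }) (λ { {zero} {zero} _ → refl })
                        (λ { zero → inj₁ (cong (proj₁ (G e) ,_) (sym p)) }) (λ _ → ye)

  close : ∀ {j} (P : Path j) (m : Fin (suc j)) (f : Fin n) → y f ≡ true →
          f ≢ Path.es P zero → Joins G f (Path.vs P (suc m)) (Path.vs P zero) → Result
  close {j} P m f yf f≢ jf = mkCycle (suc (toℕ m)) w (g ▹ f) w-inj g-inj js g∈
    where
    open Path P
    q : suc (toℕ m) ≤ suc j
    q = Fin.toℕ<n m
    w : Fin (suc (suc (toℕ m))) → Fin v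
    w t = vs (inject≤ t (s≤s q))
    g : Fin (suc (toℕ m)) → Fin n
    g t = es (inject≤ t q)
    w-inj : Injective _≡_ _≡_ w
    w-inj {a} {b} p = Fin.inject≤-injective (s≤s q) (s≤s q) a b (vs-inj p)
    inj-inj : ∀ s → inject≤ (inject₁ s) (s≤s q) ≡ inject₁ (inject≤ s q)
    inj-inj s = Fin.toℕ-injective (trans (Fin.toℕ-inject≤ (inject₁ s) (s≤s q)) (trans (Fin.toℕ-inject₁ s)
                  (sym (trans (Fin.toℕ-inject₁ (inject≤ s q)) (Fin.toℕ-inject≤ s q)))))
    touch : ∀ {e a b c d} → Joins G e a b → Joins G e c d → (a ≡ c) ⊎ (a ≡ d)
    touch (inj₁ p) (inj₁ r) = inj₁ (cong proj₁ (trans (sym p) r))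
    touch (inj₁ p) (inj₂ r) = inj₂ (cong proj₁ (trans (sym p) r))
    touch (inj₂ p) (inj₁ r) = inj₂ (cong proj₂ (trans (sym p) r))
    touch (inj₂ p) (inj₂ r) = inj₁ (cong proj₂ (trans (sym p) r))
    swap : ∀ {e a b} → Joins G e a b → Joins G e b a
    swap (inj₁ p) = inj₂ p
    swap (inj₂ p) = inj₁ p
    es-inj : ∀ {a b} → es a ≡ es b → a ≡ b
    es-inj {a} {b} p with touch (joins a) (subst (λ e → Joins G e _ _) (sym p) (joins b))
                        | touch (swap (joins a)) (subst (λ e → Joins G e _ _) (sym p) (joins b))
    ... | inj₁ r | _ = Fin.inject₁-injective (vs-inj r)
    ... | inj₂ _ | inj₂ s = Fin.suc-injective (vs-inj s)
    ... | inj₂ r | inj₁ s = ⊥-elim (ℕ.m≢1+n+m (toℕ a) {1} (trans lem₁ (cong suc (sym lem₂))))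
      where
      lem₁ : toℕ a ≡ suc (toℕ b)
      lem₁ = trans (sym (Fin.toℕ-inject₁ a)) (cong toℕ (vs-inj r))
      lem₂ : suc (toℕ a) ≡ toℕ b
      lem₂ = trans (cong toℕ (vs-inj s)) (Fin.toℕ-inject₁ b)
    es≢f : ∀ a → es a ≢ f
    es≢f zero p = f≢ (sym p)
    es≢f (suc a) refl with touch (swap jf) (joins (suc a))
    ... | inj₁ r with () ← vs-inj r
    ... | inj₂ r with () ← vs-inj r
    g-inj : Injective _≡_ _≡_ (g ▹ f)
    g-inj {a} {b} p with lastView a | lastView b
    ... | inj₁ (a′ , refl) | inj₁ (b′ , refl) =
      cong inject₁ (Fin.inject≤-injective q q a′ b′ (es-inj (trans (sym (▹-inject₁ g f a′)) (trans p (▹-inject₁ g f b′)))))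
    ... | inj₁ (a′ , refl) | inj₂ refl = ⊥-elim (es≢f _ (trans (sym (▹-inject₁ g f a′)) (trans p (▹-fromℕ g f))))
    ... | inj₂ refl | inj₁ (b′ , refl) = ⊥-elim (es≢f _ (trans (sym (▹-inject₁ g f b′)) (trans (sym p) (▹-fromℕ g f))))
    ... | inj₂ refl | inj₂ refl = refl
    js : ∀ t → Joins G ((g ▹ f) t) (w t) (w (next t))
    js t with lastView t
    ... | inj₁ (s , refl) rewrite ▹-inject₁ g f s | next-inject₁ s | inj-inj s = joins (inject≤ s q)
    ... | inj₂ refl rewrite ▹-fromℕ g f | next-fromℕ (suc (toℕ m)) =
      subst (λ i → Joins G f (vs i) (vs zero)) (Fin.toℕ-injective (sym (trans (Fin.toℕ-inject≤ (fromℕ (suc (toℕ m))) (s≤s q))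
        (Fin.toℕ-fromℕ (suc (toℕ m)))))) jf
    g∈ : ∀ t → y ((g ▹ f) t) ≡ true
    g∈ t with lastView t
    ... | inj₁ (s , refl) rewrite ▹-inject₁ g f s = es∈y _
    ... | inj₂ refl rewrite ▹-fromℕ g f = yf

  -- Parity: `y` is orthogonal to the star of `x`, so it cannot meet that star in `e` alone. Loops
  -- at `x` do not count, as the star vanishes on them.
  otherEdge : ∀ x e → y e ≡ true → δ G (𝟙 x) e ≡ true → ∃ λ f → y f ≡ true × δ G (𝟙 x) f ≡ true × f ≢ e
  otherEdge x e ye δe with Fin.any? (λ f → (y f Bool.≟ true) ×-dec ((δ G (𝟙 x) f Bool.≟ true) ×-dec ¬? (f Fin.≟ e)))
  ... | yes r = r
  ... | no ¬r = ⊥-elim (true≢false (trans (sym (cong₂ _∧_ ye δe))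
                  (trans (sym (Σ₂-single e (λ f f≢e → none f f≢e))) (Cyc-δ G y∈ (𝟙 x)))))
    where
    none : ∀ f → f ≢ e → y f ∧ δ G (𝟙 x) f ≡ false
    none f f≢e with y f in p | δ G (𝟙 x) f in q
    ... | false | _ = refl
    ... | true | false = refl
    ... | true | true = ⊥-elim (¬r (f , p , q , f≢e))

  endpoint : ∀ x f → δ G (𝟙 x) f ≡ true → ∃ λ u → u ≢ x × Joins G f u x
  endpoint x f p with G f
  ... | a , b with x Fin.≟ a | x Fin.≟ b
  ...   | yes refl | no x≢b = b , x≢b ∘ sym , inj₂ refl
  ...   | no x≢a | yes refl = a , x≢a ∘ sym , inj₁ refl

  -- The vertices of a path are distinct, so at most `v` extensions are possible before it meets
  -- itself.
  grow : ∀ fuel {j} → v ≤ suc j +ℕ fuel → Path j → Result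
  grow zero {j} v≤ P = ⊥-elim (ℕ.<⇒≱ (Fin.injective⇒≤ (Path.vs-inj P)) (ℕ.≤-trans v≤ (ℕ.≤-reflexive (ℕ.+-identityʳ _))))
  grow (suc fuel) {j} v≤ P
    with otherEdge (vs zero) (es zero) (es∈y zero) δ0
    where
    open Path P
    δ0 : δ G (𝟙 (vs zero)) (es zero) ≡ true
    δ0 = trans (δ-joins G (joins zero) (𝟙 (vs zero))) (cong₂ _xor_ (𝟙-refl (vs zero)) (𝟙-≢ λ p → case (vs-inj p)))
      where case : ∀ {k} {i : Fin k} → zero ≡ Fin.suc i → ⊥
            case ()
  ... | f , yf , δf , f≢ with endpoint (Path.vs P zero) f δf
  ...   | u , u≢ , jf with Fin.any? (λ i → Path.vs P i Fin.≟ u)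
  ...     | yes (zero , p) = ⊥-elim (u≢ (sym p))
  ...     | yes (suc m , refl) = close P m f yf f≢ jf
  ...     | no ¬p = grow fuel (ℕ.≤-trans v≤ (ℕ.≤-reflexive (ℕ.+-suc (suc j) fuel))) record
    { vs = u ◂ vs
    ; es = f ◂ es
    ; vs-inj = λ { {zero} {zero} _ → refl
                 ; {zero} {suc b} q → ⊥-elim (¬p (b , sym q))
                 ; {suc a} {zero} q → ⊥-elim (¬p (a , q))
                 ; {suc a} {suc b} q → cong suc (vs-inj q) }
    ; joins = λ { zero → jf ; (suc i) → joins i }
    ; es∈y = λ { zero → yf ; (suc i) → es∈y i } }
    where open Path P

  findCycle : ∀ e → y e ≡ true → Result
  findCycle e ye with proj₁ (G e) Fin.≟ proj₂ (G e)
  ... | yes p = loop e ye p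
  ... | no ¬p = grow v (ℕ.m≤n+m v 1) record
    { vs = proj₁ (G e) ◂ (λ _ → proj₂ (G e))
    ; es = λ _ → e
    ; vs-inj = λ { {zero} {zero} _ → refl
                 ; {zero} {suc zero} q → ⊥-elim (¬p q)
                 ; {suc zero} {zero} q → ⊥-elim (¬p (sym q))
                 ; {suc zero} {suc zero} _ → refl }
    ; joins = λ { zero → inj₁ refl }
    ; es∈y = λ _ → ye }

-- Circuits and independent sets of a space

infix 4 _⊑_
_⊑_ : ∀ {n} → V n → V n → Set
u ⊑ v = ∀ e → u e ≡ true → v e ≡ true

-- independence of X in the matroid with cycle space K
Free : ∀ {n} → Space n → V n → Set
Free K X = ∀ y → K ∋ y → y ⊑ X → y ≈ 0ᵛ

MG⇒Free : ∀ {v n} (G : Graph v n) X → MG G X → Free (Cyc G) (lookup X)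
MG⇒Free G X mg y y∈ y⊑ e with y e in eq
... | false = refl
... | true with FindCycle.findCycle G y y∈ e eq
...   | Y , Y⊑ , cyc = ⊥-elim (mg Y (λ x∈ → true⇒∈ (y⊑ _ (Y⊑ _ (∈⇒true x∈)))) cyc)

Free⇒MG : ∀ {v n} (G : Graph v n) X → Free (Cyc G) (lookup X) → MG G X
Free⇒MG G X fr Y Y⊆X cyc with cycle-nonempty G {Y} cyc
... | e , Ye = true≢false (trans (sym Ye) (fr (lookup Y) (cycle⇒Cyc G cyc) (λ e p → ∈⇒true (Y⊆X (true⇒∈ p))) e))

Nz : ∀ {n} → V n → Set
Nz u = ∃ λ e → u e ≡ true

Nz? : ∀ {n} (u : V n) → Dec (Nz u)
Nz? u = Fin.any? λ e → u e Bool.≟ true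

¬Nz⇒0 : ∀ {n} {u : V n} → ¬ Nz u → u ≈ 0ᵛ
¬Nz⇒0 h e = ≢true⇒false λ p → h (e , p)

Nz-resp : ∀ {n} → Respects {n} Nz
Nz-resp p (e , q) = e , trans (sym (p e)) q

⊑? : ∀ {n} (u v : V n) → Dec (u ⊑ v)
⊑? u v = Fin.all? λ e → (u e Bool.≟ true) →-dec (v e Bool.≟ true)

⊑-respˡ : ∀ {n} {u u′ v : V n} → u ≈ u′ → u ⊑ v → u′ ⊑ v
⊑-respˡ p h e q = h e (trans (p e) q)

⊑-respʳ : ∀ {n} {u v v′ : V n} → v ≈ v′ → u ⊑ v → u ⊑ v′
⊑-respʳ p h e q = trans (sym (p e)) (h e q)

⊑-false : ∀ {n} {u v : V n} → u ⊑ v → ∀ {e} → v e ≡ false → u e ≡ false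
⊑-false h {e} p = ≢true⇒false λ q → true≢false (trans (sym (h e q)) p)

⊑-trans : ∀ {n} {u v w : V n} → u ⊑ v → v ⊑ w → u ⊑ w
⊑-trans p q e r = q e (p e r)

⊑-antisym : ∀ {n} {u v : V n} → u ⊑ v → v ⊑ u → u ≈ v
⊑-antisym {u = u} {v} p q e with u e in a | v e in b
... | true | true = refl
... | false | false = refl
... | true | false = trans (sym (p e a)) b
... | false | true = trans (sym a) (q e b)

⊑-⊕ : ∀ {n} {u v w : V n} → u ⊑ w → v ⊑ w → u ⊕ v ⊑ w
⊑-⊕ {u = u} p q e r with u e in eq
... | true = p e eq
... | false = q e r

b→ℕ : Bool → ℕ
b→ℕ true = 1
b→ℕ false = 0

∥_∥ : ∀ {n} → V n → ℕ
∥_∥ {zero} u = 0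
∥_∥ {suc n} u = b→ℕ (u zero) +ℕ ∥ u ∘ suc ∥

∥∥-cong : ∀ {n} {u v : V n} → u ≈ v → ∥ u ∥ ≡ ∥ v ∥
∥∥-cong {zero} p = refl
∥∥-cong {suc n} p = cong₂ (λ a b → b→ℕ a +ℕ b) (p zero) (∥∥-cong (p ∘ suc))

b→ℕ-mono : ∀ {a b} → (a ≡ true → b ≡ true) → b→ℕ a ≤ b→ℕ b
b→ℕ-mono {false} h = z≤n
b→ℕ-mono {true} h rewrite h refl = ℕ.≤-refl

∥∥-mono : ∀ {n} {u v : V n} → u ⊑ v → ∥ u ∥ ≤ ∥ v ∥
∥∥-mono {zero} h = z≤n
∥∥-mono {suc n} h = ℕ.+-mono-≤ (b→ℕ-mono (h zero)) (∥∥-mono (h ∘ suc))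

∥∥-mono-< : ∀ {n} {u v : V n} → u ⊑ v → ∀ e → u e ≡ false → v e ≡ true → ∥ u ∥ < ∥ v ∥
∥∥-mono-< {suc n} {u} {v} h zero p q rewrite p | q = s≤s (∥∥-mono (h ∘ suc))
∥∥-mono-< {suc n} {u} {v} h (suc e) p q =
  ℕ.+-mono-≤-< (b→ℕ-mono (h zero)) (∥∥-mono-< (h ∘ suc) e p q)

∥∥≤n : ∀ {n} (u : V n) → ∥ u ∥ ≤ n
∥∥≤n {zero} u = z≤n
∥∥≤n {suc n} u with u zero
... | true = s≤s (∥∥≤n (u ∘ suc))
... | false = ℕ.m≤n⇒m≤1+n (∥∥≤n (u ∘ suc))

⊑-≥⇒≈ : ∀ {n} {u v : V n} → u ⊑ v → ∥ v ∥ ≤ ∥ u ∥ → u ≈ v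
⊑-≥⇒≈ {u = u} {v} h le e with u e in a | v e in b
... | true | true = refl
... | false | false = refl
... | true | false = trans (sym (h e a)) b
... | false | true = ⊥-elim (ℕ.<⇒≱ (∥∥-mono-< h e a b) le)

⊕-∥∥-< : ∀ {n} {u v : V n} → v ⊑ u → Nz v → ∥ u ⊕ v ∥ < ∥ u ∥
⊕-∥∥-< {u = u} {v} h (e , p) = ∥∥-mono-< (⊑-⊕ (λ _ q → q) h) e (cong₂ _xor_ (h e p) p) (h e p)

IsCircuit : ∀ {n} → Space n → V n → Set
IsCircuit K c = K ∋ c × Nz c × (∀ u → K ∋ u → u ⊑ c → Nz u → u ≈ c)

circuit-below : ∀ {n} (K : Space n) z → K ∋ z → Nz z → ∃ λ c → c ⊑ z × IsCircuit K c
circuit-below K z Kz nz = go z Kz nz (<-wellFounded _)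
  where
  go : ∀ z → K ∋ z → Nz z → Acc _<_ ∥ z ∥ → ∃ λ c → c ⊑ z × IsCircuit K c
  go z Kz nz (acc rec)
    with anyV? {P = λ u → K ∋ u × u ⊑ z × Nz u × ¬ (u ≈ z)}
               (λ p (a , b , c , d) → resp≈ K p a , ⊑-respˡ p b , Nz-resp p c , λ q → d (≈-trans p q))
               (λ u → mem? K u ×-dec (⊑? u z ×-dec (Nz? u ×-dec ¬? (u ≈? z))))
  ... | no ¬e = z , (λ _ p → p) , Kz , nz , minimal
    where
    minimal : ∀ u → K ∋ u → u ⊑ z → Nz u → u ≈ z
    minimal u Ku u⊑ nzu with u ≈? z
    ... | yes p = p
    ... | no ¬p = ⊥-elim (¬e (u , Ku , u⊑ , nzu , ¬p))
  ... | yes (u , Ku , u⊑ , nzu , ¬p) with go u Ku nzu (rec lt)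
    where
    lt : ∥ u ∥ < ∥ z ∥
    lt with ℕ.<-≤-connex ∥ u ∥ ∥ z ∥
    ... | inj₁ l = l
    ... | inj₂ l = ⊥-elim (¬p (⊑-≥⇒≈ u⊑ l))
  ... | c , c⊑ , circ = c , ⊑-trans c⊑ u⊑ , circ

Free? : ∀ {n} (K : Space n) X → Free K X ⊎ (∃ λ y → K ∋ y × y ⊑ X × Nz y)
Free? K X with anyV? {P = λ y → K ∋ y × y ⊑ X × Nz y}
                     (λ p (a , b , c) → resp≈ K p a , ⊑-respˡ p b , Nz-resp p c)
                     (λ y → mem? K y ×-dec (⊑? y X ×-dec Nz? y))
... | yes p = inj₂ p
... | no ¬p = inj₁ λ y Ky y⊑ → ¬Nz⇒0 λ nz → ¬p (y , Ky , y⊑ , nz)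

¬Free : ∀ {n} {K : Space n} {X} → ¬ Free K X → ∃ λ y → K ∋ y × y ⊑ X × Nz y
¬Free {K = K} {X} h with Free? K X
... | inj₁ f = ⊥-elim (h f)
... | inj₂ r = r

Nz⇒¬Free : ∀ {n} {K : Space n} {X y} → K ∋ y → y ⊑ X → Nz y → ¬ Free K X
Nz⇒¬Free Ky y⊑ (e , p) f = true≢false (trans (sym p) (f _ Ky y⊑ e))

Free-resp : ∀ {n} (K : Space n) → Respects (Free K)
Free-resp K p f y Ky y⊑ = f y Ky (⊑-respʳ (≈-sym p) y⊑)

-- A binary matroid determines its cycle space: a minimal dependent set of one representation is a
-- circuit of the other.
free⇒⊆ : ∀ {n} (K K′ : Space n) → (∀ X → Free K X → Free K′ X) → (∀ X → Free K′ X → Free K X) →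
         ∀ y → K ∋ y → K′ ∋ y
free⇒⊆ {n} K K′ f g y Ky = go y Ky (<-wellFounded _)
  where
  go : ∀ y → K ∋ y → Acc _<_ ∥ y ∥ → K′ ∋ y
  go y Ky (acc rec) with Nz? y
  ... | no ¬nz = mem-0 K′ (¬Nz⇒0 ¬nz)
  ... | yes nz with ¬Free {K = K′} (λ h → Nz⇒¬Free {K = K} Ky (λ _ p → p) nz (g y h))
  ...   | z , K′z , z⊑y , nzz with circuit-below K′ z K′z nzz
  ...     | c , c⊑z , K′c , nzc , min with ¬Free {K = K} (λ h → Nz⇒¬Free {K = K′} K′c (λ _ p → p) nzc (f c h))
  ...       | d , Kd , d⊑c , nzd with ¬Free {K = K′} (λ h → Nz⇒¬Free {K = K} Kd (λ _ p → p) nzd (g d h))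
  ...         | x , K′x , x⊑d , nzx = mem-⊕-cancel K′ (go (y ⊕ c) (mem⊕ K Ky Kc) (rec (⊕-∥∥-< c⊑y nzc))) K′c
    where
    c⊑y : c ⊑ y
    c⊑y = ⊑-trans c⊑z z⊑y
    x≈c : x ≈ c
    x≈c = min x K′x (⊑-trans x⊑d d⊑c) nzx
    Kc : K ∋ c
    Kc = resp≈ K (⊑-antisym d⊑c (⊑-respˡ x≈c x⊑d)) Kd

free⇒≐ : ∀ {n} (K K′ : Space n) → (∀ X → Free K X → Free K′ X) → (∀ X → Free K′ X → Free K X) → K ≐ K′
free⇒≐ K K′ f g = free⇒⊆ K K′ f g ⸴ free⇒⊆ K′ K g f

≐-sym : ∀ {n} {W X : Space n} → W ≐ X → X ≐ W
≐-sym (p ⸴ q) = q ⸴ p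

≐-trans : ∀ {n} {W X Y : Space n} → W ≐ X → X ≐ Y → W ≐ Y
≐-trans (p ⸴ q) (p′ ⸴ q′) = (λ v → p′ v ∘ p v) ⸴ λ v → q v ∘ q′ v

perp-mono : ∀ {n} {W X : Space n} → W ≐ X → perp W ≐ perp X
perp-mono (p ⸴ q) = (λ v h w Xw → h w (q w Xw)) ⸴ λ v h w Ww → h w (p w Ww)

-- K + GF(2)^D
infixl 6 _↑_
_↑_ : ∀ {n} → Space n → V n → Space n
mem (K ↑ D) y = ∃ λ k → K ∋ k × (∀ e → D e ≡ false → y e ≡ k e)
resp≈ (K ↑ D) p (k , Kk , h) = k , Kk , λ e q → trans (sym (p e)) (h e q)
mem? (K ↑ D) y = anyV? (λ p (a , b) → resp≈ K p a , λ e q → trans (b e q) (p e))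
  (λ k → mem? K k ×-dec Fin.all? λ e → (D e Bool.≟ false) →-dec (y e Bool.≟ k e))
mem0 (K ↑ D) = 0ᵛ , mem0 K , λ _ _ → refl
mem⊕ (K ↑ D) (k , Kk , h) (k′ , Kk′ , h′) = k ⊕ k′ , mem⊕ K Kk Kk′ , λ e q → cong₂ _xor_ (h e q) (h′ e q)

↑-base : ∀ {n} {K : Space n} {D} y → K ∋ y → K ↑ D ∋ y
↑-base y Ky = y , Ky , λ _ _ → refl

↑-below : ∀ {n} (K : Space n) {D y} → y ⊑ D → K ↑ D ∋ y
↑-below K {D} {y} y⊑ = 0ᵛ , mem0 K , λ e q → ⊑-false y⊑ q

perp-↑ : ∀ {n} (K : Space n) {D} u → perp (K ↑ D) ∋ u → perp K ∋ u × (∀ e → D e ≡ true → u e ≡ false)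
perp-↑ K {D} u h = (λ w Kw → h w (↑-base {K = K} {D} w Kw))
  , λ e De → trans (sym (⟨⟩-𝟙 e u)) (trans (⟨⟩-comm (𝟙 e) u) (h (𝟙 e) (↑-below K λ x p → subst (λ i → D i ≡ true) (𝟙-true p) De)))

space-units : ∀ {n} (W : Space n) y → (∀ e → y e ≡ true → W ∋ 𝟙 e) → W ∋ y
space-units W y h = dperp W y λ u p → Σ₂-0 λ e → lem u p e
  where
  lem : ∀ u → perp W ∋ u → ∀ e → u e ∧ y e ≡ false
  lem u p e with y e in eq
  ... | false = Bool.∧-zeroʳ (u e)
  ... | true = trans (Bool.∧-identityʳ (u e)) (trans (sym (⟨⟩-𝟙 e u)) (trans (⟨⟩-comm (𝟙 e) u) (p (𝟙 e) (h e eq))))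

infixl 6 _⊔ᵛ_
_⊔ᵛ_ : ∀ {n} → V n → V n → V n
(u ⊔ᵛ v) e = u e ∨ v e

MaxFree : ∀ {n} → Space n → V n → V n → Set
MaxFree K D B = B ⊑ D × Free K B × (∀ e → D e ≡ true → B e ≡ false → ¬ Free K (𝟙 e ⊔ᵛ B))

maxFree : ∀ {n} (K : Space n) D → ∃ λ B → MaxFree K D B
maxFree {n} K D = go n 0ᵛ (λ _ ()) (λ y _ y⊑ e → ≢true⇒false λ p → true≢false (sym (y⊑ e p))) (ℕ.m≤n+m n _)
  where
  go : ∀ fuel B → B ⊑ D → Free K B → n ≤ ∥ B ∥ +ℕ fuel → ∃ λ B → MaxFree K D B
  go fuel B B⊑ fr le
    with Fin.any? (λ e → (D e Bool.≟ true) ×-dec ((B e Bool.≟ false) ×-dec map′ dec₁ dec₂ (isFree (𝟙 e ⊔ᵛ B))))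
    where
    data IsFree (X : V n) : Set where
      free : Free K X → IsFree X
    isFree : ∀ X → Dec (IsFree X)
    isFree X with Free? K X
    ... | inj₁ f = yes (free f)
    ... | inj₂ (y , Ky , y⊑ , nz) = no λ { (free f) → Nz⇒¬Free {K = K} Ky y⊑ nz f }
    dec₁ : ∀ {X} → IsFree X → Free K X
    dec₁ (free f) = f
    dec₂ : ∀ {X} → Free K X → IsFree X
    dec₂ f = free f
  ... | no ¬e = B , B⊑ , fr , λ e p q f → ¬e (e , p , q , f)
  ... | yes (e , De , Be , f) = next-step fuel le
    where
    B′ : V n
    B′ = 𝟙 e ⊔ᵛ B
    B⊑B′ : B ⊑ B′
    B⊑B′ x p = trans (cong (𝟙 e x ∨_) p) (Bool.∨-zeroʳ _)
    lt : ∥ B ∥ < ∥ B′ ∥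
    lt = ∥∥-mono-< B⊑B′ e Be (cong (_∨ B e) (𝟙-refl e))
    B′⊑ : B′ ⊑ D
    B′⊑ x p with 𝟙 e x in eq
    ... | true = subst (λ i → D i ≡ true) (𝟙-true eq) De
    ... | false = B⊑ x p
    next-step : ∀ fuel → n ≤ ∥ B ∥ +ℕ fuel → ∃ λ B → MaxFree K D B
    next-step zero le = ⊥-elim (ℕ.<⇒≱ lt (ℕ.≤-trans (∥∥≤n B′) (ℕ.≤-trans le (ℕ.≤-reflexive (ℕ.+-identityʳ _)))))
    next-step (suc fuel) le = go fuel B′ B′⊑ f (ℕ.≤-trans le (ℕ.≤-trans (ℕ.≤-reflexive (ℕ.+-suc _ fuel)) (ℕ.+-monoˡ-≤ fuel lt)))

-- As `B` is free, a dependency inside `B` and `e` must use `e`; off `B` it then agrees with `𝟙 e`.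
dependent⇒span : ∀ {n} (K : Space n) {B} e → Free K B → ¬ Free K (𝟙 e ⊔ᵛ B) → K ↑ B ∋ 𝟙 e
dependent⇒span K {B} e fr nf with ¬Free {K = K} nf
... | y , Ky , y⊑ , (x , yx) = y , Ky , agree
  where
  ye : y e ≡ true
  ye with y e in eq
  ... | true = refl
  ... | false = ⊥-elim (true≢false (trans (sym yx) (fr y Ky (λ i p → lem i p (y⊑ i p)) x)))
    where
    lem : ∀ i → y i ≡ true → (𝟙 e ⊔ᵛ B) i ≡ true → B i ≡ true
    lem i p q with 𝟙 e i in r
    ... | true = ⊥-elim (true≢false (trans (sym p) (trans (cong y (sym (𝟙-true r))) eq)))
    ... | false = q
  agree : ∀ i → B i ≡ false → 𝟙 e i ≡ y i
  agree i Bi with 𝟙 e i in r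
  ... | true = sym (trans (cong y (sym (𝟙-true r))) ye)
  ... | false = sym (⊑-false y⊑ (trans (cong (_∨ B i) r) Bi))

maxFree-span : ∀ {n} (K : Space n) {D B} → MaxFree K D B → ∀ e → D e ≡ true → K ↑ B ∋ 𝟙 e
maxFree-span K {D} {B} (B⊑ , fr , mx) e De with B e in eq
... | true = ↑-below K λ x p → subst (λ i → B i ≡ true) (𝟙-true p) eq
... | false = dependent⇒span K e fr (mx e De eq)

-- Kernel and row space of a matrix, and matroid duality

dot-⟨⟩ : ∀ {n} (r : Vec Bool n) (Y : Subset n) → dot r Y ≡ ⟨ lookup r , lookup Y ⟩
dot-⟨⟩ [] [] = refl
dot-⟨⟩ (a ∷ r) (b ∷ Y) = cong ((a ∧ b) xor_) (dot-⟨⟩ r Y)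

Ker : ∀ {m n} → Mat m n → Space n
mem (Ker A) y = ∀ i → ⟨ lookup (lookup A i) , y ⟩ ≡ false
resp≈ (Ker A) p h i = trans (⟨⟩-cong {u = lookup (lookup A i)} ≈-refl (≈-sym p)) (h i)
mem? (Ker A) y = Fin.all? λ i → _ Bool.≟ false
mem0 (Ker A) i = ⟨⟩-0ʳ (lookup (lookup A i)) λ _ → refl
mem⊕ (Ker A) {u} {v} p q i = trans (⟨⟩-⊕ʳ (lookup (lookup A i)) u v) (cong₂ _xor_ (p i) (q i))

Row : ∀ {m n} → Mat m n → Space n
Row A = perp (Ker A)

M⇒Free : ∀ {m n} (A : Mat m n) X → M[ A ] X → Free (Ker A) (lookup X)
M⇒Free A X h y Ky y⊑ e = ≢true⇒false λ p → h
  ( tabulate y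
  , (λ {x} x∈ → true⇒∈ (y⊑ x (trans (sym (Vec.lookup∘tabulate y x)) (∈⇒true x∈))))
  , (e , true⇒∈ (trans (Vec.lookup∘tabulate y e) p))
  , λ i → trans (dot-⟨⟩ (lookup A i) (tabulate y))
            (trans (⟨⟩-cong {u = lookup (lookup A i)} ≈-refl (Vec.lookup∘tabulate y)) (Ky i)))

Free⇒M : ∀ {m n} (A : Mat m n) X → Free (Ker A) (lookup X) → M[ A ] X
Free⇒M A X fr (Y , Y⊆ , (e , e∈) , z) = true≢false (trans (sym (∈⇒true e∈))
  (fr (lookup Y) (λ i → trans (sym (dot-⟨⟩ (lookup A i) Y)) (z i)) (λ x p → ∈⇒true (Y⊆ (true⇒∈ p))) e))

lookup-∪ : ∀ {n} (X Y : Subset n) → lookup (X ∪ Y) ≈ lookup X ⊔ᵛ lookup Y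
lookup-∪ X Y i = Vec.lookup-zipWith _∨_ i X Y

lookup-⁅⁆ : ∀ {n} (e : Fin n) → lookup ⁅ e ⁆ ≈ 𝟙 e
lookup-⁅⁆ e x with e Fin.≟ x
... | yes refl = ∈⇒true (Sub.x∈⁅x⁆ e)
... | no e≢x = ≢true⇒false λ p → e≢x (sym (Sub.x∈⁅y⁆⇒x≡y e (true⇒∈ p)))

lookup-⁅⁆∪ : ∀ {n} e (X : Subset n) → lookup (⁅ e ⁆ ∪ X) ≈ 𝟙 e ⊔ᵛ lookup X
lookup-⁅⁆∪ e X i = trans (lookup-∪ ⁅ e ⁆ X i) (cong (_∨ lookup X i) (lookup-⁅⁆ e i))

∉⇒false : ∀ {n} {X : Subset n} {e} → e ∉ X → lookup X e ≡ false
∉⇒false h = ≢true⇒false λ p → h (true⇒∈ p)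

false⇒∉ : ∀ {n} {X : Subset n} {e} → lookup X e ≡ false → e ∉ X
false⇒∉ p q = true≢false (trans (sym (∈⇒true q)) p)

lookup-∁ : ∀ {n} (X : Subset n) e → lookup (∁ X) e ≡ not (lookup X e)
lookup-∁ X e = Vec.lookup-map e not X

-- A cocycle is determined by its values on a basis: modulo the kernel, `𝟙 e` is supported on the
-- basis `B`, where `v` vanishes, and so `v e` is zero.
dual⇒Free : ∀ {m n} (A : Mat m n) X → Dual M[ A ] X → Free (Row A) (lookup X)
dual⇒Free A X (B , (indB , maxB) , X⊆) v v∈ v⊑ e = get (spans e)
  where
  frB : Free (Ker A) (lookup B)
  frB = M⇒Free A B indB
  spans : ∀ e → Ker A ↑ lookup B ∋ 𝟙 e
  spans e = maxFree-span (Ker A) {λ _ → true} ((λ _ _ → refl) , frB , λ x _ Bx f →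
    maxB x (false⇒∉ Bx) (Free⇒M A _ (Free-resp (Ker A) (≈-sym (lookup-⁅⁆∪ x B)) f))) e refl
  v-B : ∀ x → lookup B x ≡ true → v x ≡ false
  v-B x Bx = ≢true⇒false λ p → true≢false
    (trans (sym (∈⇒true (X⊆ (true⇒∈ (v⊑ x p))))) (trans (lookup-∁ B x) (cong not Bx)))
  get : Ker A ↑ lookup B ∋ 𝟙 e → v e ≡ false
  get (k , Kk , h) = trans (sym (⟨⟩-𝟙 e v)) (trans (Σ₂-cong agree) (trans (⟨⟩-comm k v) (v∈ k Kk)))
    where
    agree : ∀ i → 𝟙 e i ∧ v i ≡ k i ∧ v i
    agree i with lookup B i in eq
    ... | true = trans (trans (cong (𝟙 e i ∧_) (v-B i eq)) (Bool.∧-zeroʳ _))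
                       (sym (trans (cong (k i ∧_) (v-B i eq)) (Bool.∧-zeroʳ _)))
    ... | false = cong (_∧ v i) (h i eq)

-- A maximal free subset of the complement of `X` is already a basis of the whole matroid. Otherwise
-- double orthogonality would yield a nonzero member of the row space supported on `X`.
Free⇒dual : ∀ {m n} (A : Mat m n) X → Free (Row A) (lookup X) → Dual M[ A ] X
Free⇒dual {n = n} A X fr with maxFree (Ker A) (λ e → not (lookup X e))
... | B , mf@(B⊑ , frB , mx) = tabulate B , (Free⇒M A _ (Free-resp (Ker A) B≈ frB) , maximal)
                         , λ {x} x∈ → true⇒∈ (trans (lookup-∁ (tabulate B) x) (cong not (trans (sym (B≈ x)) (notB x (∈⇒true x∈)))))
  where
  B≈ : B ≈ lookup (tabulate B)
  B≈ i = sym (Vec.lookup∘tabulate B i)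
  notB : ∀ x → lookup X x ≡ true → B x ≡ false
  notB x p = ⊑-false B⊑ (cong not p)
  D : V n
  D e = not (lookup X e)
  ↑⊆ : ∀ y → Ker A ↑ D ∋ y → Ker A ↑ B ∋ y
  ↑⊆ y (k , Kk , h) = resp≈ (Ker A ↑ B) (λ i → xor-cancelʳ (y i) (k i)) (mem⊕ (Ker A ↑ B) (space-units (Ker A ↑ B) (y ⊕ k) λ e p →
      maxFree-span (Ker A) mf e (De e p)) (↑-base {K = Ker A} k Kk))
    where
    De : ∀ e → (y ⊕ k) e ≡ true → D e ≡ true
    De e p = ≢false⇒true λ q → true≢false (trans (sym p) (trans (cong (_xor k e) (h e q)) (Bool.xor-same (k e))))
  spans : ∀ e → Ker A ↑ B ∋ 𝟙 e
  spans e = ↑⊆ (𝟙 e) (dperp (Ker A ↑ D) (𝟙 e) λ u p → let (u∈ , uD) = perp-↑ (Ker A) u p in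
    trans (⟨⟩-comm u (𝟙 e)) (trans (⟨⟩-𝟙 e u) (fr u u∈ (λ x q → ≢false⇒true λ r → true≢false (trans (sym q) (uD x (cong not r)))) e)))
  maximal : ∀ e → e ∉ tabulate B → ¬ M[ A ] (⁅ e ⁆ ∪ tabulate B)
  maximal e e∉ ind = contra (spans e)
    where
    same : lookup (⁅ e ⁆ ∪ tabulate B) ≈ 𝟙 e ⊔ᵛ B
    same i = trans (lookup-⁅⁆∪ e (tabulate B) i) (cong (𝟙 e i ∨_) (sym (B≈ i)))
    Be : B e ≡ false
    Be = trans (B≈ e) (∉⇒false e∉)
    contra : ¬ (Ker A ↑ B ∋ 𝟙 e)
    contra (k , Kk , h) = Nz⇒¬Free {K = Ker A} Kk k⊑ (e , trans (sym (h e Be)) (𝟙-refl e))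
        (Free-resp (Ker A) {lookup (⁅ e ⁆ ∪ tabulate B)} {𝟙 e ⊔ᵛ B} same (M⇒Free A (⁅ e ⁆ ∪ tabulate B) ind))
      where
      k⊑ : k ⊑ 𝟙 e ⊔ᵛ B
      k⊑ i p with B i in eq
      ... | true = Bool.∨-zeroʳ _
      ... | false = trans (Bool.∨-identityʳ _) (trans (h i eq) p)

cographic⇒cycleSpace : ∀ {m n} (A : Mat m n) → Cographic M[ A ] → ∃ λ v → Σ (Graph v n) λ G → Row A ≐ Cyc G
cographic⇒cycleSpace A (v , G , h) = v , G , free⇒≐ (Row A) (Cyc G)
  (λ X f → Free-resp (Cyc G) (Vec.lookup∘tabulate X) (MG⇒Free G (tabulate X) (proj₁ (h (tabulate X))
     (Free⇒dual A (tabulate X) (Free-resp (Row A) (λ i → sym (Vec.lookup∘tabulate X i)) f)))))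
  (λ X f → Free-resp (Row A) (Vec.lookup∘tabulate X) (dual⇒Free A (tabulate X) (proj₂ (h (tabulate X))
     (Free⇒MG G (tabulate X) (Free-resp (Cyc G) (λ i → sym (Vec.lookup∘tabulate X i)) f)))))

-- Minors of subspaces: contract D (in the matroid), keep the image of φ, delete the rest

Proj : ∀ {n k} → Space n → V n → (Fin k → Fin n) → Space k
mem (Proj Z D φ) w = ∃ λ v → Z ∋ v × (∀ e → D e ≡ true → v e ≡ false) × v ∘ φ ≈ w
resp≈ (Proj Z D φ) p (v , a , b , c) = v , a , b , ≈-trans c p
mem? (Proj Z D φ) w = anyV?
  (λ p (a , b , c) → resp≈ Z p a , (λ e q → trans (sym (p e)) (b e q)) , λ i → trans (sym (p _)) (c i))
  (λ v → mem? Z v ×-dec (Fin.all? (λ e → (D e Bool.≟ true) →-dec (v e Bool.≟ false)) ×-dec ((v ∘ φ) ≈? w)))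
mem0 (Proj Z D φ) = 0ᵛ , mem0 Z , (λ _ _ → refl) , λ _ → refl
mem⊕ (Proj Z D φ) (v , a , b , c) (v′ , a′ , b′ , c′) =
  v ⊕ v′ , mem⊕ Z a a′ , (λ e q → cong₂ _xor_ (b e q) (b′ e q)) , λ i → cong₂ _xor_ (c i) (c′ i)

push : ∀ {n k} → (Fin k → Fin n) → V k → V n
push φ y e = Σ₂ λ x → y x ∧ 𝟙 (φ x) e

push-∘ : ∀ {n k} (φ : Fin k → Fin n) → Injective _≡_ _≡_ φ → ∀ y x → push φ y (φ x) ≡ y x
push-∘ φ inj y x = trans (Σ₂-single x λ z z≢x → trans (cong (y z ∧_) (𝟙-≢ λ p → z≢x (inj p))) (Bool.∧-zeroʳ _))
                         (trans (cong (y x ∧_) (𝟙-refl (φ x))) (Bool.∧-identityʳ _))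

push-∉ : ∀ {n k} (φ : Fin k → Fin n) y e → (∀ x → φ x ≢ e) → push φ y e ≡ false
push-∉ φ y e h = Σ₂-0 λ x → trans (cong (y x ∧_) (𝟙-≢ (h x))) (Bool.∧-zeroʳ _)

push-cong : ∀ {n k} (φ : Fin k → Fin n) {y z} → y ≈ z → push φ y ≈ push φ z
push-cong φ p e = Σ₂-cong λ x → cong (_∧ 𝟙 (φ x) e) (p x)

push-⊕ : ∀ {n k} (φ : Fin k → Fin n) y z → push φ (y ⊕ z) ≈ push φ y ⊕ push φ z
push-⊕ φ y z e = trans (Σ₂-cong λ x → Bool.∧-distribʳ-xor (𝟙 (φ x) e) (y x) (z x))
                       (Σ₂-⊕ (λ x → y x ∧ 𝟙 (φ x) e) (λ x → z x ∧ 𝟙 (φ x) e))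

Σ₂-swap : ∀ {m n} (a : Fin m → V n) → Σ₂ (λ i → Σ₂ (a i)) ≡ Σ₂ (λ j → Σ₂ (λ i → a i j))
Σ₂-swap {zero} a = sym (Σ₂-0 {u = λ j → Σ₂ (λ i → a i j)} λ _ → refl)
Σ₂-swap {suc m} a = trans (cong (Σ₂ (a zero) xor_) (Σ₂-swap (a ∘ suc))) (sym (Σ₂-⊕ (a zero) (λ j → Σ₂ (λ i → a (suc i) j))))

Σ₂-∧ : ∀ {n} b (u : V n) → Σ₂ (λ i → b ∧ u i) ≡ b ∧ Σ₂ u
Σ₂-∧ false u = Σ₂-0 {u = λ i → false ∧ u i} λ _ → refl
Σ₂-∧ true u = refl

⟨,push⟩ : ∀ {n k} (φ : Fin k → Fin n) v y → ⟨ v , push φ y ⟩ ≡ ⟨ v ∘ φ , y ⟩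
⟨,push⟩ φ v y = begin
  Σ₂ (λ e → v e ∧ Σ₂ (λ x → y x ∧ 𝟙 (φ x) e))     ≡⟨ Σ₂-cong (λ e → sym (Σ₂-∧ (v e) (λ x → y x ∧ 𝟙 (φ x) e))) ⟩
  Σ₂ (λ e → Σ₂ (λ x → v e ∧ (y x ∧ 𝟙 (φ x) e)))   ≡⟨ Σ₂-swap (λ e x → v e ∧ (y x ∧ 𝟙 (φ x) e)) ⟩
  Σ₂ (λ x → Σ₂ (λ e → v e ∧ (y x ∧ 𝟙 (φ x) e)))   ≡⟨ Σ₂-cong (λ x → trans (Σ₂-cong λ e → shuffle (v e) (y x) (𝟙 (φ x) e)) (Σ₂-∧ (y x) (λ e → 𝟙 (φ x) e ∧ v e))) ⟩
  Σ₂ (λ x → y x ∧ Σ₂ (λ e → 𝟙 (φ x) e ∧ v e))     ≡⟨ Σ₂-cong (λ x → trans (cong (y x ∧_) (⟨⟩-𝟙 (φ x) v)) (Bool.∧-comm (y x) (v (φ x)))) ⟩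
  Σ₂ (λ x → v (φ x) ∧ y x)                        ∎
  where
  open ≡-Reasoning
  shuffle : ∀ a b c → a ∧ (b ∧ c) ≡ b ∧ (c ∧ a)
  shuffle a b c = trans (Bool.∧-comm a (b ∧ c)) (Bool.∧-assoc b c a)

Con : ∀ {n k} → Space n → V n → (Fin k → Fin n) → Space k
mem (Con K D φ) y = K ↑ D ∋ push φ y
resp≈ (Con K D φ) p h = resp≈ (K ↑ D) (push-cong φ p) h
mem? (Con K D φ) y = mem? (K ↑ D) (push φ y)
mem0 (Con K D φ) = mem-0 (K ↑ D) λ e → Σ₂-0 {u = λ x → false ∧ 𝟙 (φ x) e} λ _ → refl
mem⊕ (Con K D φ) {u} {v} p q = resp≈ (K ↑ D) (≈-sym (push-⊕ φ u v)) (mem⊕ (K ↑ D) p q)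

-- Vanishing on `D` is orthogonal to being arbitrary on `D`, and restriction along `φ` is adjoint to
-- extension by zero. Thus the row space and the cycle space of a minor are complements again.
perp-Proj : ∀ {n k} (K : Space n) D (φ : Fin k → Fin n) → perp (Proj (perp K) D φ) ≐ Con K D φ
perp-Proj K D φ = to ⸴ from
  where
  to : ∀ y → perp (Proj (perp K) D φ) ∋ y → Con K D φ ∋ y
  to y h = dperp (K ↑ D) (push φ y) λ u p → let (u∈ , uD) = perp-↑ K u p in
    trans (⟨,push⟩ φ u y) (trans (⟨⟩-comm (u ∘ φ) y) (h (u ∘ φ) (u , u∈ , uD , λ _ → refl)))
  from : ∀ y → Con K D φ ∋ y → perp (Proj (perp K) D φ) ∋ y
  from y (k , Kk , agree) w (v , v∈ , vD , v≈) = begin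
    ⟨ y , w ⟩        ≡⟨ ⟨⟩-comm y w ⟩
    ⟨ w , y ⟩        ≡⟨ ⟨⟩-cong {v = y} (≈-sym v≈) ≈-refl ⟩
    ⟨ v ∘ φ , y ⟩    ≡⟨ sym (⟨,push⟩ φ v y) ⟩
    ⟨ v , push φ y ⟩ ≡⟨ Σ₂-cong same ⟩
    ⟨ v , k ⟩        ≡⟨ v∈ k Kk ⟩
    false            ∎
    where
    open ≡-Reasoning
    same : ∀ e → v e ∧ push φ y e ≡ v e ∧ k e
    same e with D e in eq
    ... | true = trans (cong (_∧ push φ y e) (vD e eq)) (sym (cong (_∧ k e) (vD e eq)))
    ... | false = cong (v e ∧_) (agree e eq)

perp-flip : ∀ {n} {W X : Space n} → perp W ≐ X → W ≐ perp X
perp-flip {W = W} {X} h = ≐-trans (≐-sym (perp-perp W)) (perp-mono h)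

Proj-mono : ∀ {n k} {Z Z′ : Space n} D (φ : Fin k → Fin n) → Z ≐ Z′ → Proj Z D φ ≐ Proj Z′ D φ
Proj-mono D φ (p ⸴ q) = (λ w (v , a , b) → v , p v a , b) ⸴ λ w (v , a , b) → v , q v a , b

Proj-Proj : ∀ {n k l} (Z : Space n) D (φ : Fin k → Fin n) D′ (φ′ : Fin l → Fin k) → Injective _≡_ _≡_ φ →
            Proj (Proj Z D φ) D′ φ′ ≐ Proj Z (D ⊔ᵛ push φ D′) (φ ∘ φ′)
Proj-Proj Z D φ D′ φ′ inj = to ⸴ from
  where
  to : ∀ w → Proj (Proj Z D φ) D′ φ′ ∋ w → Proj Z (D ⊔ᵛ push φ D′) (φ ∘ φ′) ∋ w
  to w (u , (v , v∈ , vD , v≈) , uD , u≈) = v , v∈ , vD′ , λ i → trans (v≈ (φ′ i)) (u≈ i)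
    where
    vD′ : ∀ e → (D ⊔ᵛ push φ D′) e ≡ true → v e ≡ false
    vD′ e p with D e in eq
    ... | true = vD e eq
    ... | false with Fin.any? (λ x → φ x Fin.≟ e)
    ...   | yes (x , refl) = trans (v≈ x) (uD x (trans (sym (push-∘ φ inj D′ x)) p))
    ...   | no ¬q = ⊥-elim (true≢false (trans (sym p) (push-∉ φ D′ e λ x q → ¬q (x , q))))
  from : ∀ w → Proj Z (D ⊔ᵛ push φ D′) (φ ∘ φ′) ∋ w → Proj (Proj Z D φ) D′ φ′ ∋ w
  from w (v , v∈ , vD , v≈) = v ∘ φ , (v , v∈ , (λ e p → vD e (cong (_∨ push φ D′ e) p)) , λ _ → refl)
    , (λ x p → vD (φ x) (trans (cong (D (φ x) ∨_) (trans (push-∘ φ inj D′ x) p)) (Bool.∨-zeroʳ _))) , v≈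

-- The matroid of `Q` arises by contraction of `D` and deletion of whatever `φ` misses. `U` is the
-- set of live elements: those outside it have to be contracted, so they can never serve as loops of
-- the minor.
record Minor {n k} (Z : Space n) (U : V n) (Q : Space k) : Set where
  field
    φ : Fin k → Fin n
    φ-inj : Injective _≡_ _≡_ φ
    D : V n
    φ∉D : ∀ x → D (φ x) ≡ false
    D⊇ : ∀ e → U e ≡ false → D e ≡ true
    Q≐ : Q ≐ Proj Z D φ

Minor-trans : ∀ {n k l} {Z : Space n} {U} {Q : Space k} {Q′ : Space l} →
              Minor Z U Q → Minor Q (λ _ → true) Q′ → Minor Z U Q′
Minor-trans {Z = Z} {Q′ = Q′} m m′ = record
  { φ = φ m ∘ φ m′
  ; φ-inj = φ-inj m′ ∘ φ-inj m
  ; D = D m ⊔ᵛ push (φ m) (D m′)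
  ; φ∉D = λ x → cong₂ _∨_ (φ∉D m (φ m′ x)) (trans (push-∘ (φ m) (φ-inj m) (D m′) (φ m′ x)) (φ∉D m′ x))
  ; D⊇ = λ e p → cong (_∨ push (φ m) (D m′) e) (D⊇ m e p)
  ; Q≐ = ≐-trans (Q≐ m′) (≐-trans (Proj-mono (D m′) (φ m′) (Q≐ m)) (Proj-Proj Z (D m) (φ m) (D m′) (φ m′) (φ-inj m))) }
  where open Minor

Minor-resp : ∀ {n k} {Z : Space n} {U} {Q Q′ : Space k} → Q ≐ Q′ → Minor Z U Q → Minor Z U Q′
Minor-resp h m = record { φ = φ m ; φ-inj = φ-inj m ; D = D m ; φ∉D = φ∉D m ; D⊇ = D⊇ m ; Q≐ = ≐-trans (≐-sym h) (Q≐ m) }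
  where open Minor

-- Translation to and from HasMinor

module _ {n k} (K : Space n) (D : V n) (φ : Fin k → Fin n) (inj : Injective _≡_ _≡_ φ) (φ∉D : ∀ x → D (φ x) ≡ false)
         (B : V n) (mf : MaxFree K D B) where

  image : V k → V n
  image X e = ⌊ Fin.any? (λ x → (X x Bool.≟ true) ×-dec (φ x Fin.≟ e)) ⌋

  image-φ : ∀ X x → image X (φ x) ≡ X x
  image-φ X x with Fin.any? (λ z → (X z Bool.≟ true) ×-dec (φ z Fin.≟ φ x))
  ... | yes (z , p , q) = sym (trans (cong X (sym (inj q))) p)
  ... | no ¬p = sym (≢true⇒false λ q → ¬p (x , q , refl))

  true-image : ∀ X e → image X e ≡ true → ∃ λ x → X x ≡ true × φ x ≡ e
  true-image X e p with Fin.any? (λ z → (X z Bool.≟ true) ×-dec (φ z Fin.≟ e))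
  ... | yes q = q

  private
    B∌φ : ∀ x → B (φ x) ≡ false
    B∌φ x = ⊑-false (proj₁ mf) (φ∉D x)

  Con-Free⇒ : ∀ X → Free (Con K D φ) X → Free K (B ⊔ᵛ image X)
  Con-Free⇒ X fr y Ky y⊑ = proj₁ (proj₂ mf) y Ky y⊑B
    where
    y∘φ⊑ : y ∘ φ ⊑ X
    y∘φ⊑ x p = trans (sym (image-φ X x)) (trans (cong (_∨ image X (φ x)) (sym (B∌φ x))) (y⊑ (φ x) p))
    agree : ∀ e → D e ≡ false → push φ (y ∘ φ) e ≡ y e
    agree e De with Fin.any? (λ x → φ x Fin.≟ e)
    ... | yes (x , refl) = push-∘ φ inj (y ∘ φ) x
    ... | no ¬p = trans (push-∉ φ (y ∘ φ) e λ x q → ¬p (x , q))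
                    (sym (≢true⇒false λ q → impossible (true-image X e (trans (cong (_∨ image X e) (sym (⊑-false (proj₁ mf) De))) (y⊑ e q)))))
      where
      impossible : ¬ (∃ λ x → X x ≡ true × φ x ≡ e)
      impossible (x , _ , r) = ¬p (x , r)
    zero′ : y ∘ φ ≈ 0ᵛ
    zero′ = fr (y ∘ φ) (y , Ky , agree) y∘φ⊑
    y⊑B : y ⊑ B
    y⊑B e p with B e in eq
    ... | true = refl
    ... | false with true-image X e (trans (cong (_∨ image X e) (sym eq)) (y⊑ e p))
    ...   | x , _ , refl = trans (sym (zero′ x)) p

  -- Modulo `K` the set `D` is spanned by `B`, so arbitrary values on `D` can be pushed into `B`.
  Con-Free⇐ : ∀ X → Free K (B ⊔ᵛ image X) → Free (Con K D φ) X
  Con-Free⇐ X fr y (k , Kk , agree) y⊑ = get toB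
    where
    toB : K ↑ B ∋ push φ y
    toB = resp≈ (K ↑ B) (λ i → xor-cancelʳ (push φ y i) (k i))
      (mem⊕ (K ↑ B) (space-units (K ↑ B) (push φ y ⊕ k) λ e p → maxFree-span K mf e (De e p)) (↑-base {K = K} k Kk))
      where
      De : ∀ e → (push φ y ⊕ k) e ≡ true → D e ≡ true
      De e p = ≢false⇒true λ q → true≢false (trans (sym p) (trans (cong (_xor k e) (agree e q)) (Bool.xor-same (k e))))
    get : K ↑ B ∋ push φ y → y ≈ 0ᵛ
    get (c , Kc , h) x = trans (sym (push-∘ φ inj y x)) (trans (h (φ x) (B∌φ x)) (fr c Kc c⊑ (φ x)))
      where
      c⊑ : c ⊑ B ⊔ᵛ image X
      c⊑ e p with B e in eq
      ... | true = refl
      ... | false with Fin.any? (λ x → φ x Fin.≟ e)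
      ...   | yes (x , refl) = trans (image-φ X x) (y⊑ x (trans (sym (push-∘ φ inj y x)) (trans (h (φ x) eq) p)))
      ...   | no ¬q = ⊥-elim (true≢false (trans (sym p) (trans (sym (h e eq)) (push-∉ φ y e λ x r → ¬q (x , r)))))

⊔ᵛ-true : ∀ {n} {u v : V n} {e} → (u ⊔ᵛ v) e ≡ true → u e ≡ true ⊎ v e ≡ true
⊔ᵛ-true {u = u} {e = e} p with u e
... | true = inj₁ refl
... | false = inj₂ p

minor⇒HasMinor : ∀ {m n v k} (A : Mat m n) U (G : Graph v k) → Minor (Row A) U (Cut G) → HasMinor M[ A ] (MG G)
minor⇒HasMinor {n = n} {k = k} A U G m = build (maxFree (Ker A) D)
  where
  open Minor m
  K = Ker A
  cyc : Con K D φ ≐ Cyc G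
  cyc = ≐-trans (≐-sym (perp-Proj K D φ)) (perp-mono (≐-sym Q≐))
  build : (∃ λ B → MaxFree K D B) → HasMinor M[ A ] (MG G)
  build (B , mf@(B⊑ , frB , mx)) = tabulate D , tabulate B , φ , φ-inj
    , (λ x x∈ → true≢false (trans (sym (∈⇒true x∈)) (trans (Vec.lookup∘tabulate D (φ x)) (φ∉D x))))
    , ( (λ {x} x∈ → true⇒∈ (trans (Vec.lookup∘tabulate D x) (B⊑ x (trans (sym (Vec.lookup∘tabulate B x)) (∈⇒true x∈)))))
      , Free⇒M A _ (Free-resp K B≈ frB)
      , λ e e∈ e∉ ind → mx e (trans (sym (Vec.lookup∘tabulate D e)) (∈⇒true e∈)) (trans (B≈ e) (∉⇒false e∉))
          (Free-resp K {lookup (⁅ e ⁆ ∪ tabulate B)} {𝟙 e ⊔ᵛ B}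
             (λ i → trans (lookup-⁅⁆∪ e (tabulate B) i) (cong (𝟙 e i ∨_) (sym (B≈ i)))) (M⇒Free A (⁅ e ⁆ ∪ tabulate B) ind)))
    , iso
    where
    B≈ : B ≈ lookup (tabulate B)
    B≈ i = sym (Vec.lookup∘tabulate B i)
    img = image K D φ φ-inj φ∉D B mf
    iso : ∀ (X : Subset k) (Y : Subset n) → (∀ y → (y ∈ Y) ⇔ (y ∈ tabulate B ⊎ ∃[ x ] (x ∈ X × φ x ≡ y))) → MG G X ⇔ M[ A ] Y
    iso X Y h = (λ mg → Free⇒M A Y (Free-resp K {B ⊔ᵛ img (lookup X)} {lookup Y} Y≈
                  (Con-Free⇒ K D φ φ-inj φ∉D B mf (lookup X) λ y y∈ → MG⇒Free G X mg y (≐⇒ cyc y y∈))))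
              , λ ind → Free⇒MG G X λ y y∈ → Con-Free⇐ K D φ φ-inj φ∉D B mf (lookup X)
                  (Free-resp K {lookup Y} {B ⊔ᵛ img (lookup X)} (≈-sym Y≈) (M⇒Free A Y ind)) y (≐⇐ cyc y y∈)
      where
      Y≈ : B ⊔ᵛ img (lookup X) ≈ lookup Y
      Y≈ = ⊑-antisym left right
        where
        left : B ⊔ᵛ img (lookup X) ⊑ lookup Y
        left e p with ⊔ᵛ-true {u = B} {img (lookup X)} p
        ... | inj₁ q = ∈⇒true (proj₂ (h e) (inj₁ (true⇒∈ (trans (sym (B≈ e)) q))))
        ... | inj₂ q with true-image K D φ φ-inj φ∉D B mf (lookup X) e q
        ...   | x , r , s = ∈⇒true (proj₂ (h e) (inj₂ (x , true⇒∈ r , s)))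
        right : lookup Y ⊑ B ⊔ᵛ img (lookup X)
        right e p with proj₁ (h e) (true⇒∈ p)
        ... | inj₁ q = cong (_∨ img (lookup X) e) (trans (B≈ e) (∈⇒true q))
        ... | inj₂ (x , q , refl) = trans (cong (B e ∨_) (trans (image-φ K D φ φ-inj φ∉D B mf (lookup X) x) (∈⇒true q))) (Bool.∨-zeroʳ _)

HasMinor⇒minor : ∀ {m n v k} (A : Mat m n) (G : Graph v k) → HasMinor M[ A ] (MG G) → Minor (Row A) (λ _ → true) (Cut G)
HasMinor⇒minor {n = n} {k = k} A G (C , B , φ , φ-inj , φ∉C , (B⊆ , indB , mx) , iso) = record
  { φ = φ ; φ-inj = φ-inj ; D = D ; φ∉D = φ∉D ; D⊇ = λ _ () ; Q≐ = Q≐ }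
  where
  K = Ker A
  D = lookup C
  φ∉D : ∀ x → D (φ x) ≡ false
  φ∉D x = ∉⇒false (φ∉C x)
  mf : MaxFree K D (lookup B)
  mf = (λ e p → ∈⇒true (B⊆ (true⇒∈ p))) , M⇒Free A B indB
     , λ e De Be f → mx e (true⇒∈ De) (false⇒∉ Be) (Free⇒M A (⁅ e ⁆ ∪ B) (Free-resp K {𝟙 e ⊔ᵛ lookup B} {lookup (⁅ e ⁆ ∪ B)} (≈-sym (lookup-⁅⁆∪ e B)) f))
  img = image K D φ φ-inj φ∉D (lookup B) mf
  module _ (X : V k) where
    Y : Subset n
    Y = tabulate (lookup B ⊔ᵛ img X)
    Y≈ : lookup Y ≈ lookup B ⊔ᵛ img X
    Y≈ = Vec.lookup∘tabulate _
    X≈ : lookup (tabulate X) ≈ X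
    X≈ = Vec.lookup∘tabulate X
    Y⇔ : ∀ y → (y ∈ Y) ⇔ (y ∈ B ⊎ ∃[ x ] (x ∈ tabulate X × φ x ≡ y))
    Y⇔ y = to , from
      where
      to : y ∈ Y → y ∈ B ⊎ ∃[ x ] (x ∈ tabulate X × φ x ≡ y)
      to y∈ with ⊔ᵛ-true {u = lookup B} {img X} (trans (sym (Y≈ y)) (∈⇒true y∈))
      ... | inj₁ p = inj₁ (true⇒∈ p)
      ... | inj₂ p with true-image K D φ φ-inj φ∉D (lookup B) mf X y p
      ...   | x , q , r = inj₂ (x , true⇒∈ (trans (X≈ x) q) , r)
      from : y ∈ B ⊎ ∃[ x ] (x ∈ tabulate X × φ x ≡ y) → y ∈ Y
      from (inj₁ y∈) = true⇒∈ (trans (Y≈ y) (cong (_∨ img X y) (∈⇒true y∈)))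
      from (inj₂ (x , x∈ , refl)) = true⇒∈ (trans (Y≈ y) (trans (cong (lookup B y ∨_)
        (trans (image-φ K D φ φ-inj φ∉D (lookup B) mf X x) (trans (sym (X≈ x)) (∈⇒true x∈)))) (Bool.∨-zeroʳ _)))
    f⇒ : Free (Con K D φ) X → Free (Cyc G) X
    f⇒ fr = Free-resp (Cyc G) X≈ (MG⇒Free G (tabulate X) (proj₂ (iso (tabulate X) Y Y⇔)
              (Free⇒M A Y (Free-resp K {lookup B ⊔ᵛ img X} {lookup Y} (≈-sym Y≈) (Con-Free⇒ K D φ φ-inj φ∉D (lookup B) mf X fr)))))
    f⇐ : Free (Cyc G) X → Free (Con K D φ) X
    f⇐ fr = Con-Free⇐ K D φ φ-inj φ∉D (lookup B) mf X (Free-resp K {lookup Y} {lookup B ⊔ᵛ img X} Y≈ (M⇒Free A Y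
              (proj₁ (iso (tabulate X) Y Y⇔) (Free⇒MG G (tabulate X) (Free-resp (Cyc G) (≈-sym X≈) fr)))))
  Q≐ : Cut G ≐ Proj (Row A) D φ
  Q≐ = ≐-trans (≐-sym (perp-perp (Cut G))) (≐-trans (perp-mono (≐-sym (free⇒≐ (Con K D φ) (Cyc G) f⇒ f⇐)))
         (≐-sym (perp-flip {W = Proj (perp K) D φ} (perp-Proj K D φ))))

-- Minors of cut spaces and of cycle spaces

relabel : ∀ {v v′ n} → (Fin v → Fin v′) → Graph v n → Graph v′ n
relabel h G e = h (proj₁ (G e)) , h (proj₂ (G e))

-- The edges of `D` are treated one at a time, each merging the class of one end into that of the
-- other. The two properties say that the potentials constant along `D` are those that factor
-- through `h`.
contract : ∀ {v n} (G : Graph v n) (D : V n) → ∃ λ (h : Fin v → Fin v) →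
           (∀ T → (∀ e → D e ≡ true → δ G T e ≡ false) → T ≈ T ∘ h) ×
           (∀ e → D e ≡ true → h (proj₁ (G e)) ≡ h (proj₂ (G e)))
contract {n = zero} G D = id , (λ _ _ _ → refl) , λ ()
contract {v} {suc n} G D = step (contract (G ∘ suc) (D ∘ suc)) (D zero) refl
  where
  a b : Fin v
  a = proj₁ (G zero)
  b = proj₂ (G zero)
  Contraction : ∀ {m} → Graph v m → V m → (Fin v → Fin v) → Set
  Contraction G D h = (∀ T → (∀ e → D e ≡ true → δ G T e ≡ false) → T ≈ T ∘ h) ×
                      (∀ e → D e ≡ true → h (proj₁ (G e)) ≡ h (proj₂ (G e)))
  step : ∃ (Contraction (G ∘ suc) (D ∘ suc)) → ∀ d → D zero ≡ d → ∃ (Contraction G D)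
  step (h , p , q) false D0 = h , (λ T c → p T (c ∘ suc)) , λ { zero r → ⊥-elim (true≢false (trans (sym r) D0)) ; (suc e) → q e }
  step (h , p , q) true D0 = r ∘ h , p′ , q′
    where
    r : Fin v → Fin v
    r x = if ⌊ x Fin.≟ h b ⌋ then h a else x
    r-hb : r (h b) ≡ h a
    r-hb with h b Fin.≟ h b
    ... | yes _ = refl
    ... | no ¬p = ⊥-elim (¬p refl)
    r-ha : r (h a) ≡ h a
    r-ha with h a Fin.≟ h b
    ... | yes _ = refl
    ... | no _ = refl
    p′ : ∀ T → (∀ e → D e ≡ true → δ G T e ≡ false) → T ≈ T ∘ r ∘ h
    p′ T c x = trans (p T (c ∘ suc) x) (sym (Tr (h x)))
      where
      Tr : ∀ y → T (r y) ≡ T y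
      Tr y with y Fin.≟ h b
      ... | no _ = refl
      ... | yes refl = trans (sym (p T (c ∘ suc) a)) (trans (xor≡false⇒≡ (c zero D0)) (p T (c ∘ suc) b))
    q′ : ∀ e → D e ≡ true → r (h (proj₁ (G e))) ≡ r (h (proj₂ (G e)))
    q′ zero _ = trans r-ha (sym r-hb)
    q′ (suc e) d = cong r (q e d)

Graphical : ∀ {n} → Space n → Set
Graphical {n} W = ∃ λ v → Σ (Graph v n) λ G → W ≐ Cut G

graphical-resp : ∀ {n} {W W′ : Space n} → W ≐ W′ → Graphical W → Graphical W′
graphical-resp h (v , G , p) = v , G , ≐-trans (≐-sym h) p

Proj-Cut : ∀ {v n k} (G : Graph v n) D (φ : Fin k → Fin n) → Graphical (Proj (Cut G) D φ)
Proj-Cut {v} G D φ = build (contract G D)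
  where
  build : _ → Graphical (Proj (Cut G) D φ)
  build (h , p , q) = v , relabel h G ∘ φ
    , ((λ w (x , (T , x≈) , xD , x≈w) → T , λ e → trans (sym (x≈w e)) (trans (x≈ (φ e)) (cong₂ _xor_ (T≈ x T x≈ xD _) (T≈ x T x≈ xD _))))
    ⸴ λ w (T , w≈) → δ G (T ∘ h) , (T ∘ h , λ _ → refl)
        , (λ e d → trans (cong (T (h (proj₁ (G e))) xor_) (cong T (sym (q e d)))) (Bool.xor-same (T (h (proj₁ (G e)))))) , ≈-sym w≈)
    where
    T≈ : ∀ x T → x ≈ δ G T → (∀ e → D e ≡ true → x e ≡ false) → T ≈ T ∘ h
    T≈ x T x≈ xD = p T λ e d → trans (sym (x≈ e)) (xD e d)

graphical-Proj : ∀ {n k} {W : Space n} D (φ : Fin k → Fin n) → Graphical W → Graphical (Proj W D φ)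
graphical-Proj D φ (v , G , p) = graphical-resp (Proj-mono D φ (≐-sym p)) (Proj-Cut G D φ)

-- What one matroid contracts its dual deletes: `E` consists of the elements that are neither in `D`
-- nor in the image of `φ`.
Con≐Proj : ∀ {n k} (K : Space n) D (φ : Fin k → Fin n) → Injective _≡_ _≡_ φ → (∀ x → D (φ x) ≡ false) →
           ∃ λ E → Con K D φ ≐ Proj K E φ
Con≐Proj {n} K D φ inj φ∉D = E , (to ⸴ from)
  where
  E : V n
  E e = not (D e ∨ indicator φ e)
  to : ∀ y → Con K D φ ∋ y → Proj K E φ ∋ y
  to y (k , Kk , h) = k , Kk , kE , λ x → trans (sym (h (φ x) (φ∉D x))) (push-∘ φ inj y x)
    where
    kE : ∀ e → E e ≡ true → k e ≡ false
    kE e p with D e in eq | indicator φ e in eq′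
    ... | false | false = trans (sym (h e eq)) (push-∉ φ y e λ x q →
      true≢false (trans (sym (indicator-true φ x)) (trans (cong (indicator φ) q) eq′)))
  from : ∀ y → Proj K E φ ∋ y → Con K D φ ∋ y
  from y (k , Kk , kE , k≈) = k , Kk , agree
    where
    agree : ∀ e → D e ≡ false → push φ y e ≡ k e
    agree e De with Fin.any? (λ x → φ x Fin.≟ e)
    ... | yes (x , refl) = trans (push-∘ φ inj y x) (sym (k≈ x))
    ... | no ¬p = trans (push-∉ φ y e λ x q → ¬p (x , q))
                    (sym (kE e (cong not (cong₂ _∨_ De (indicator-false φ λ x q → ¬p (x , q))))))

-- A minor of a cycle space is a cycle space, so its orthogonal complement is a cut space.
cycle-minor : ∀ {n k v} (G : Graph v n) {U} {Q : Space k} → Minor (Cyc G) U Q → Graphical (perp Q)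
cycle-minor G {Q = Q} m = build (Con≐Proj (Cut G) D φ φ-inj φ∉D)
  where
  open Minor m
  build : _ → Graphical (perp Q)
  build (E , h) = graphical-resp (≐-sym (≐-trans (perp-mono Q≐) (≐-trans (perp-Proj (Cut G) D φ) h))) (Proj-Cut G E φ)

-- The row space after splitting

Ext : ∀ {n} → Space n → V n → Space n
mem (Ext W S) w = ∃ λ b → W ∋ w ⊕ b · S
resp≈ (Ext W S) p (b , q) = b , resp≈ W (λ i → cong (_xor (b ∧ S i)) (p i)) q
mem? (Ext W S) w with mem? W (w ⊕ false · S) | mem? W (w ⊕ true · S)
... | yes p | _ = yes (false , p)
... | no _ | yes p = yes (true , p)
... | no ¬p | no ¬q = no λ { (false , p) → ¬p p ; (true , q) → ¬q q }
mem0 (Ext W S) = false , mem-0 W λ _ → refl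
mem⊕ (Ext W S) {u} {v} (b , p) (c , q) = (b xor c) , resp≈ W
  (λ i → trans (xor-interchange (u i) (b ∧ S i) (v i) (c ∧ S i))
               (cong ((u i xor v i) xor_) (sym (Bool.∧-distribʳ-xor (S i) b c)))) (mem⊕ W p q)

Ext-base : ∀ {n} {W : Space n} {S} w → W ∋ w → Ext W S ∋ w
Ext-base {W = W} w p = false , resp≈ W (λ i → sym (Bool.xor-identityʳ (w i))) p

Ext-row : ∀ {n} (W : Space n) S → Ext W S ∋ S
Ext-row W S = true , mem-0 W λ i → Bool.xor-same (S i)

Ext-mono : ∀ {n} {W W′ : Space n} S → W ≐ W′ → Ext W S ≐ Ext W′ S
Ext-mono S (p ⸴ q) = (λ w (b , r) → b , p _ r) ⸴ λ w (b , r) → b , q _ r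

-- Only the coset of `S` modulo `W` matters. This allows a splitting set to be exchanged for a
-- smaller or better placed one.
Ext-shift : ∀ {n} (W : Space n) {S S′} → W ∋ S ⊕ S′ → Ext W S ≐ Ext W S′
Ext-shift W {S} {S′} h = (λ w (b , p) → b , resp≈ W (λ i → lem b (w i) (S i) (S′ i)) (mem⊕ W p (mem-· W b h)))
                       ⸴ λ w (b , p) → b , resp≈ W (λ i → lem′ b (w i) (S i) (S′ i)) (mem⊕ W p (mem-· W b h))
  where
  lem : ∀ b w s t → (w xor (b ∧ s)) xor (b ∧ (s xor t)) ≡ w xor (b ∧ t)
  lem false w s t = Bool.xor-identityʳ _
  lem true w s t = trans (Bool.xor-assoc w s (s xor t)) (cong (w xor_) (xor-cancelˡ s t))
  lem′ : ∀ b w s t → (w xor (b ∧ t)) xor (b ∧ (s xor t)) ≡ w xor (b ∧ s)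
  lem′ false w s t = Bool.xor-identityʳ _
  lem′ true w s t = trans (Bool.xor-assoc w t (s xor t)) (cong (w xor_) (trans (cong (t xor_) (Bool.xor-comm s t)) (xor-cancelˡ t s)))

lookup-∷ʳ-inject₁ : ∀ {a} {A : Set a} {n} (xs : Vec A n) y i → lookup (xs ∷ʳ y) (inject₁ i) ≡ lookup xs i
lookup-∷ʳ-inject₁ (x ∷ xs) y zero = refl
lookup-∷ʳ-inject₁ (x ∷ xs) y (suc i) = lookup-∷ʳ-inject₁ xs y i

lookup-∷ʳ-fromℕ : ∀ {a} {A : Set a} {n} (xs : Vec A n) y → lookup (xs ∷ʳ y) (fromℕ n) ≡ y
lookup-∷ʳ-fromℕ [] y = refl
lookup-∷ʳ-fromℕ (x ∷ xs) y = lookup-∷ʳ-fromℕ xs y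

Ker-split : ∀ {m n} (A : Mat m n) S → perp (Ext (Row A) (lookup S)) ≐ Ker (split A S)
Ker-split {m} {n} A S = to ⸴ from
  where
  to : ∀ y → perp (Ext (Row A) (lookup S)) ∋ y → Ker (split A S) ∋ y
  to y h i with lastView i
  ... | inj₁ (j , refl) = subst (λ r → ⟨ lookup r , y ⟩ ≡ false) (sym (lookup-∷ʳ-inject₁ A S j))
        (trans (⟨⟩-comm (lookup (lookup A j)) y) (h _ (Ext-base {W = Row A} (lookup (lookup A j)) λ k Kk → Kk j)))
  ... | inj₂ refl = subst (λ r → ⟨ lookup r , y ⟩ ≡ false) (sym (lookup-∷ʳ-fromℕ A S))
        (trans (⟨⟩-comm (lookup S) y) (h _ (Ext-row (Row A) (lookup S))))
  from : ∀ y → Ker (split A S) ∋ y → perp (Ext (Row A) (lookup S)) ∋ y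
  from y h w (b , p) = begin
    ⟨ y , w ⟩                                    ≡⟨ ⟨⟩-cong {u = y} ≈-refl (λ i → sym (xor-cancelʳ (w i) (b ∧ lookup S i))) ⟩
    ⟨ y , (w ⊕ b · lookup S) ⊕ b · lookup S ⟩    ≡⟨ ⟨⟩-⊕ʳ y (w ⊕ b · lookup S) (b · lookup S) ⟩
    ⟨ y , w ⊕ b · lookup S ⟩ xor ⟨ y , b · lookup S ⟩  ≡⟨ cong₂ _xor_ (trans (⟨⟩-comm y _) (p y yK)) (yS b) ⟩
    false                                        ∎
    where
    open ≡-Reasoning
    yK : Ker A ∋ y
    yK j = trans (cong (λ r → ⟨ lookup r , y ⟩) (sym (lookup-∷ʳ-inject₁ A S j))) (h (inject₁ j))
    yS : ∀ b → ⟨ y , b · lookup S ⟩ ≡ false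
    yS false = ⟨⟩-0ʳ y λ _ → refl
    yS true = trans (⟨⟩-comm y (lookup S)) (trans (cong (λ r → ⟨ lookup r , y ⟩) (sym (lookup-∷ʳ-fromℕ A S))) (h (fromℕ m)))

graphic⇒graphical : ∀ {m n} (A : Mat m n) S → Graphic M[ split A S ] → Graphical (Ext (Row A) (lookup S))
graphic⇒graphical A S (v , G , h) = v , G , ≐-trans (≐-sym (perp-perp W)) (≐-trans (perp-mono (≐-trans (Ker-split A S) K≐)) (perp-perp (Cut G)))
  where
  W = Ext (Row A) (lookup S)
  K≐ : Ker (split A S) ≐ Cyc G
  K≐ = free⇒≐ (Ker (split A S)) (Cyc G)
    (λ X f → Free-resp (Cyc G) (Vec.lookup∘tabulate X) (MG⇒Free G (tabulate X) (proj₁ (h (tabulate X))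
       (Free⇒M (split A S) (tabulate X) (Free-resp (Ker (split A S)) (λ i → sym (Vec.lookup∘tabulate X i)) f)))))
    (λ X f → Free-resp (Ker (split A S)) (Vec.lookup∘tabulate X) (M⇒Free (split A S) (tabulate X) (proj₂ (h (tabulate X))
       (Free⇒MG G (tabulate X) (Free-resp (Cyc G) (λ i → sym (Vec.lookup∘tabulate X i)) f)))))

graphical⇒graphic : ∀ {m n} (A : Mat m n) S → Graphical (Ext (Row A) (lookup S)) → Graphic M[ split A S ]
graphical⇒graphic A S (v , G , h) = v , G , λ X →
    (λ ind → Free⇒MG G X λ y y∈ → M⇒Free (split A S) X ind y (≐⇐ K≐ y y∈))
  , (λ mg → Free⇒M (split A S) X λ y y∈ → MG⇒Free G X mg y (≐⇒ K≐ y y∈))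
  where
  K≐ : Ker (split A S) ≐ Cyc G
  K≐ = ≐-trans (≐-sym (Ker-split A S)) (perp-mono h)

-- Non-graphic spaces.  A cut space of dimension d whose nonzero members have weight at least g is
-- spanned by at least d + 1 nonzero stars, so that (d + 1) g is at most twice the number of edges.

lin : ∀ {d k} → V d → (Fin d → V k) → V k
lin c r e = Σ₂ λ i → c i ∧ r i e

lin-δ : ∀ {d v k} (G : Graph v k) (c : V d) (T : Fin d → V v) → lin c (λ i → δ G (T i)) ≈ δ G (lin c T)
lin-δ G c T e = trans (Σ₂-cong λ i → Bool.∧-distribˡ-xor (c i) (T i (proj₁ (G e))) (T i (proj₂ (G e))))
                      (Σ₂-⊕ (λ i → c i ∧ T i (proj₁ (G e))) (λ i → c i ∧ T i (proj₂ (G e))))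

-- fewer equations than unknowns
solve : ∀ {m d} → m < d → (c : Fin m → V d) → ∃ λ y → Nz y × (∀ i → ⟨ c i , y ⟩ ≡ false)
solve {zero} {suc d} _ c = 𝟙 zero , (zero , refl) , λ ()
solve {suc m} {suc d} (s≤s m<d) c = step (Fin.any? λ i → c i zero Bool.≟ true)
  where
  step : Dec (∃ λ i → c i zero ≡ true) → ∃ λ y → Nz y × (∀ i → ⟨ c i , y ⟩ ≡ false)
  step (no ¬p) = 𝟙 zero , (zero , refl) , λ i → trans (⟨⟩-comm (c i) (𝟙 zero)) (trans (⟨⟩-𝟙 zero (c i)) (≢true⇒false λ q → ¬p (i , q)))
  step (yes (p , cp)) = extend (solve m<d λ i → row (punchIn p i))
    where
    row : Fin (suc m) → V d
    row l = (c l ∘ suc) ⊕ c l zero · (c p ∘ suc)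
    extend : _ → _
    extend (y′ , (j , yj) , h) = b ◂ y′ , (suc j , yj) , eqn
      where
      b = ⟨ c p ∘ suc , y′ ⟩
      row≡ : ∀ l → ⟨ row l , y′ ⟩ ≡ ⟨ c l ∘ suc , y′ ⟩ xor (c l zero ∧ b)
      row≡ l = trans (⟨⟩-⊕ˡ (c l ∘ suc) (c l zero · (c p ∘ suc)) y′)
        (cong (⟨ c l ∘ suc , y′ ⟩ xor_) (trans (Σ₂-cong λ i → Bool.∧-assoc (c l zero) (c p (suc i)) (y′ i)) (Σ₂-∧ (c l zero) λ i → c p (suc i) ∧ y′ i)))
      eqn : ∀ i → ⟨ c i , b ◂ y′ ⟩ ≡ false
      eqn i with p Fin.≟ i
      ... | yes refl rewrite cp = Bool.xor-same b
      ... | no p≢i = trans (Bool.xor-comm (c i zero ∧ b) _) (trans (sym (row≡ i))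
              (subst (λ l → ⟨ row l , y′ ⟩ ≡ false) (Fin.punchIn-punchOut p≢i) (h (Data.Fin.punchOut p≢i))))

sumℕ : ∀ {v} → (Fin v → ℕ) → ℕ
sumℕ {zero} f = 0
sumℕ {suc v} f = f zero +ℕ sumℕ (f ∘ suc)

sumℕ-mono : ∀ {v} {f g : Fin v → ℕ} → (∀ i → f i ≤ g i) → sumℕ f ≤ sumℕ g
sumℕ-mono {zero} h = z≤n
sumℕ-mono {suc v} h = ℕ.+-mono-≤ (h zero) (sumℕ-mono (h ∘ suc))

sumℕ-+ : ∀ {v} (f g : Fin v → ℕ) → sumℕ (λ i → f i +ℕ g i) ≡ sumℕ f +ℕ sumℕ g
sumℕ-+ {zero} f g = refl
sumℕ-+ {suc v} f g = trans (cong (f zero +ℕ g zero +ℕ_) (sumℕ-+ (f ∘ suc) (g ∘ suc)))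
  (interchange (f zero) (g zero) _ _)

∥𝟙∥ : ∀ {v} (a : Fin v) → sumℕ (λ u → b→ℕ (𝟙 u a)) ≡ 1
∥𝟙∥ {suc v} zero = cong suc (zeros v)
  where
  zeros : ∀ v′ → sumℕ {v′} (λ u → b→ℕ (𝟙 (suc u) (zero {n = v′}))) ≡ 0
  zeros v′ = allzero v′ (λ _ → refl)
    where
    allzero : ∀ v″ {f : Fin v″ → ℕ} → (∀ i → f i ≡ 0) → sumℕ f ≡ 0
    allzero zero _ = refl
    allzero (suc v″) h = cong₂ _+ℕ_ (h zero) (allzero v″ (h ∘ suc))
∥𝟙∥ {suc v} (suc a) = trans (sumℕ-cong λ u → cong b→ℕ (𝟙-suc u a)) (∥𝟙∥ a)
  where
  sumℕ-cong : ∀ {v} {f g : Fin v → ℕ} → (∀ i → f i ≡ g i) → sumℕ f ≡ sumℕ g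
  sumℕ-cong {zero} h = refl
  sumℕ-cong {suc v} h = cong₂ _+ℕ_ (h zero) (sumℕ-cong (h ∘ suc))
  𝟙-suc : ∀ {v} (u a : Fin v) → 𝟙 (suc u) (suc a) ≡ 𝟙 u a
  𝟙-suc u a with u Fin.≟ a
  ... | yes _ = refl
  ... | no _ = refl

star : ∀ {v k} → Graph v k → Fin v → V k
star G u = δ G (𝟙 u)

star-sum : ∀ {v k} (G : Graph v k) → sumℕ (λ u → ∥ star G u ∥) ≤ k *  2
star-sum {v} {zero} G = ℕ.≤-reflexive (zeros v)
  where
  zeros : ∀ v → sumℕ {v} (λ _ → 0) ≡ 0
  zeros zero = refl
  zeros (suc v) = zeros v
star-sum {v} {suc k} G = ℕ.≤-trans (ℕ.≤-reflexive (sumℕ-+ {v} (λ u → b→ℕ (star G u zero)) (λ u → ∥ star (G ∘ suc) u ∥)))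
  (ℕ.+-mono-≤ edge (star-sum (G ∘ suc)))
  where
  a = proj₁ (G zero)
  b = proj₂ (G zero)
  b→ℕ-xor : ∀ x y → b→ℕ (x xor y) ≤ b→ℕ x +ℕ b→ℕ y
  b→ℕ-xor false y = ℕ.≤-refl
  b→ℕ-xor true false = ℕ.≤-refl
  b→ℕ-xor true true = z≤n
  edge : sumℕ (λ u → b→ℕ (𝟙 u a xor 𝟙 u b)) ≤ 2
  edge = ℕ.≤-trans (sumℕ-mono λ u → b→ℕ-xor (𝟙 u a) (𝟙 u b))
    (ℕ.≤-reflexive (trans (sumℕ-+ {v} (λ u → b→ℕ (𝟙 u a)) (λ u → b→ℕ (𝟙 u b))) (cong₂ _+ℕ_ (∥𝟙∥ a) (∥𝟙∥ b))))

support : ∀ {v} g (f : Fin v → ℕ) → (∀ u → f u ≡ 0 ⊎ g ≤ f u) →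
          ∃ λ us → (∀ u → f u ≡ 0 ⊎ u ∈ˡ us) × length us * g ≤ sumℕ f
support {zero} g f h = [] , (λ ()) , z≤n
support {suc v} g f h = step (support g (f ∘ suc) (h ∘ suc)) (h zero)
  where
  step : _ → _ → ∃ λ us → (∀ u → f u ≡ 0 ⊎ u ∈ˡ us) × length us * g ≤ sumℕ f
  step (us , c , le) (inj₁ f0) = List.map suc us , cover , ℕ.≤-trans (ℕ.≤-reflexive (cong (_* g) (List.length-map suc us)))
      (ℕ.≤-trans le (ℕ.m≤n+m _ (f zero)))
    where
    cover : ∀ u → f u ≡ 0 ⊎ u ∈ˡ List.map suc us
    cover zero = inj₁ f0
    cover (suc u) with c u
    ... | inj₁ p = inj₁ p
    ... | inj₂ q = inj₂ (∈-map⁺ suc q)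
  step (us , c , le) (inj₂ f0) = zero ∷ List.map suc us , cover , ℕ.+-mono-≤ f0 (ℕ.≤-trans (ℕ.≤-reflexive (cong (_* g) (List.length-map suc us))) le)
    where
    cover : ∀ u → f u ≡ 0 ⊎ u ∈ˡ zero ∷ List.map suc us
    cover zero = inj₂ (here refl)
    cover (suc u) with c u
    ... | inj₁ p = inj₁ p
    ... | inj₂ q = inj₂ (there (∈-map⁺ suc q))

∥∥≡0 : ∀ {n} {u : V n} → ∥ u ∥ ≡ 0 → u ≈ 0ᵛ
∥∥≡0 {suc n} {u} p zero with u zero
... | false = refl
∥∥≡0 {suc n} {u} p (suc i) = ∥∥≡0 {u = u ∘ suc} (ℕ.m+n≡0⇒n≡0 (b→ℕ (u zero)) p) i

-- The dimension is `suc d` here. If at most `suc d` vertices had a nonzero star, then at most `d`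
-- linear conditions would make a nontrivial combination of the potentials `T i` constant on them.
-- Its coboundary would vanish, although the rows are independent through their pivots.
nonGraphical : ∀ {k} d g (W : Space k) (r : Fin (suc d) → V k) (piv : Fin (suc d) → Fin k) →
               (∀ i → W ∋ r i) → (∀ i j → r i (piv j) ≡ 𝟙 i j) →
               (∀ w → W ∋ w → ∥ w ∥ ≡ 0 ⊎ g ≤ ∥ w ∥) → k * 2 < suc (suc d) * g → ¬ Graphical W
nonGraphical {k} d g W r piv r∈ r-piv wt lt (v , G , W≐) =
  main (support g (λ u → ∥ star G u ∥) λ u → wt (star G u) (≐⇐ W≐ _ (𝟙 u , λ _ → refl)))
  where
  T : Fin (suc d) → V v
  T i = proj₁ (≐⇒ W≐ (r i) (r∈ i))
  r≈ : ∀ i → r i ≈ δ G (T i)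
  r≈ i = proj₂ (≐⇒ W≐ (r i) (r∈ i))
  independent : ∀ c → lin c r ≈ 0ᵛ → c ≈ 0ᵛ
  independent c h j = trans (sym (trans (Σ₂-single j λ i i≢j → trans (cong (c i ∧_) (trans (r-piv i j) (𝟙-≢ i≢j))) (Bool.∧-zeroʳ _))
    (trans (cong (c j ∧_) (trans (r-piv j j) (𝟙-refl j))) (Bool.∧-identityʳ _)))) (h (piv j))
  -- a combination of the T i that is constant on the non-isolated vertices
  const⇒ : ∀ us → (∀ u → ∥ star G u ∥ ≡ 0 ⊎ u ∈ˡ us) → ∀ c t → (∀ u → u ∈ˡ us → lin c T u ≡ t) → c ≈ 0ᵛ
  const⇒ us cover c t h = independent c λ e → trans (Σ₂-cong λ i → cong (c i ∧_) (r≈ i e)) (trans (lin-δ G c T e) (edge e))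
    where
    at : ∀ u e → star G u e ≡ true → lin c T u ≡ t
    at u e p with cover u
    ... | inj₁ z = ⊥-elim (true≢false (trans (sym p) (∥∥≡0 {u = star G u} z e)))
    ... | inj₂ u∈ = h u u∈
    edge : ∀ e → δ G (lin c T) e ≡ false
    edge e with proj₁ (G e) Fin.≟ proj₂ (G e)
    ... | yes p = trans (cong (λ x → lin c T x xor lin c T (proj₂ (G e))) p) (Bool.xor-same (lin c T (proj₂ (G e))))
    ... | no ¬p = trans (cong₂ _xor_ (at (proj₁ (G e)) e (cong₂ _xor_ (𝟙-refl (proj₁ (G e))) (𝟙-≢ ¬p)))
                                     (at (proj₂ (G e)) e (cong₂ _xor_ (𝟙-≢ (¬p ∘ sym)) (𝟙-refl (proj₂ (G e)))))) (Bool.xor-same t)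
  main : (∃ λ us → (∀ u → ∥ star G u ∥ ≡ 0 ⊎ u ∈ˡ us) × length us * g ≤ sumℕ (λ u → ∥ star G u ∥)) → ⊥
  main (us , cover , le) = go us cover (ℕ.*-cancelʳ-< g (length us) (suc (suc d)) (ℕ.≤-<-trans le (ℕ.≤-<-trans (star-sum G) lt)))
    where
    go : ∀ us → (∀ u → ∥ star G u ∥ ≡ 0 ⊎ u ∈ˡ us) → length us < suc (suc d) → ⊥
    go [] cover _ = true≢false (const⇒ [] cover (λ _ → true) false (λ u ()) zero)
    go (u₀ ∷ us) cover (s≤s m<d) = finish (solve m<d λ i j → T j (List.lookup us i) xor T j u₀)
      where
      finish : (∃ λ y → Nz y × (∀ i → ⟨ (λ j → T j (List.lookup us i) xor T j u₀) , y ⟩ ≡ false)) → ⊥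
      finish (c , (j , cj) , h) = true≢false (trans (sym cj) (const⇒ (u₀ ∷ us) cover c (lin c T u₀) same j))
        where
        same : ∀ u → u ∈ˡ u₀ ∷ us → lin c T u ≡ lin c T u₀
        same u (here refl) = refl
        same u (there u∈) = subst (λ x → lin c T x ≡ lin c T u₀) (sym (Any.lookup-index u∈)) (xor≡false⇒≡
            (trans (sym (Σ₂-⊕ (λ j → c j ∧ T j (List.lookup us (Any.index u∈))) (λ j → c j ∧ T j u₀)))
            (trans (Σ₂-cong λ j → trans (sym (Bool.∧-distribˡ-xor (c j) (T j (List.lookup us (Any.index u∈))) (T j u₀))) (Bool.∧-comm (c j) (T j (List.lookup us (Any.index u∈)) xor T j u₀))) (h (Any.index u∈)))))

-- Explicit matrices and Boolean tests that are settled by evaluation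

every some : ∀ {A : Set} → (A → Bool) → List A → Bool
every p [] = true
every p (x ∷ xs) = p x ∧ every p xs
some p [] = false
some p (x ∷ xs) = p x ∨ some p xs

∧-true : ∀ {a b} → a ∧ b ≡ true → a ≡ true × b ≡ true
∧-true {true} {true} _ = refl , refl

∨-true : ∀ {a b} → a ∨ b ≡ true → a ≡ true ⊎ b ≡ true
∨-true {true} _ = inj₁ refl
∨-true {false} p = inj₂ p

every-∈ : ∀ {A : Set} (p : A → Bool) {xs} → every p xs ≡ true → ∀ {x} → x ∈ˡ xs → p x ≡ true
every-∈ p {y ∷ xs} h (here refl) = proj₁ (∧-true h)
every-∈ p {y ∷ xs} h (there x∈) = every-∈ p (proj₂ (∧-true {p y} h)) x∈

some-∈ : ∀ {A : Set} (p : A → Bool) {xs} → some p xs ≡ true → ∃ λ x → x ∈ˡ xs × p x ≡ true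
some-∈ p {y ∷ xs} h with p y in eq
... | true = y , here refl , eq
... | false = let (x , x∈ , q) = some-∈ p h in x , there x∈ , q

everyF : ∀ {k} → (Fin k → Bool) → Bool
everyF {zero} p = true
everyF {suc k} p = p zero ∧ everyF (p ∘ suc)

everyF-∀ : ∀ {k} (p : Fin k → Bool) → everyF p ≡ true → ∀ i → p i ≡ true
everyF-∀ p h zero = proj₁ (∧-true h)
everyF-∀ p h (suc i) = everyF-∀ (p ∘ suc) (proj₂ (∧-true {p zero} h)) i

someF : ∀ {k} → (Fin k → Bool) → Bool
someF {zero} p = false
someF {suc k} p = p zero ∨ someF (p ∘ suc)

someF-∃ : ∀ {k} (p : Fin k → Bool) → someF p ≡ true → ∃ λ i → p i ≡ true
someF-∃ {suc k} p h with p zero in eq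
... | true = zero , eq
... | false = let (i , q) = someF-∃ (p ∘ suc) h in suc i , q

_==_ : Bool → Bool → Bool
true == b = b
false == b = not b

==-≡ : ∀ {a b} → a == b ≡ true → a ≡ b
==-≡ {true} {true} _ = refl
==-≡ {false} {false} _ = refl

_=ᵛ_ : ∀ {k} → Vec Bool k → Vec Bool k → Bool
[] =ᵛ [] = true
(a ∷ x) =ᵛ (b ∷ y) = (a == b) ∧ (x =ᵛ y)

=ᵛ-≡ : ∀ {k} (x y : Vec Bool k) → x =ᵛ y ≡ true → x ≡ y
=ᵛ-≡ [] [] _ = refl
=ᵛ-≡ (a ∷ x) (b ∷ y) h = cong₂ _∷_ (==-≡ (proj₁ (∧-true {a == b} h))) (=ᵛ-≡ x y (proj₂ (∧-true {a == b} h)))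

_+ᵛ_ : ∀ {k} → Vec Bool k → Vec Bool k → Vec Bool k
_+ᵛ_ = Vec₀.zipWith _xor_

vecs : ∀ k → List (Vec Bool k)
vecs zero = [] ∷ []
vecs (suc k) = List.map (false ∷_) (vecs k) ++ List.map (true ∷_) (vecs k)

∈-vecs : ∀ {k} (x : Vec Bool k) → x ∈ˡ vecs k
∈-vecs [] = here refl
∈-vecs (false ∷ x) = ∈-++⁺ˡ (∈-map⁺ (false ∷_) (∈-vecs x))
∈-vecs {suc k} (true ∷ x) = ∈-++⁺ʳ (List.map (false ∷_) (vecs k)) (∈-map⁺ (true ∷_) (∈-vecs x))

rows : ∀ {d k} → Mat d k → Fin d → V k
rows g i = lookup (lookup g i)

Span : ∀ {d k} → Mat d k → Space k
mem (Span g) w = ∃ λ c → w ≈ lin c (rows g)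
resp≈ (Span g) p (c , q) = c , ≈-trans (≈-sym p) q
mem? (Span g) w = anyV? (λ p q e → trans (q e) (Σ₂-cong λ i → cong (_∧ rows g i e) (p i))) (λ c → w ≈? lin c (rows g))
mem0 (Span g) = 0ᵛ , λ e → sym (Σ₂-0 {u = λ i → false ∧ rows g i e} λ _ → refl)
mem⊕ (Span g) (c , p) (c′ , p′) = c ⊕ c′ , λ e → trans (cong₂ _xor_ (p e) (p′ e)) (sym (trans
  (Σ₂-cong λ i → Bool.∧-distribʳ-xor (rows g i e) (c i) (c′ i)) (Σ₂-⊕ (λ i → c i ∧ rows g i e) (λ i → c′ i ∧ rows g i e))))

lin-𝟙 : ∀ {d k} (r : Fin d → V k) i → lin (𝟙 i) r ≈ r i
lin-𝟙 r i e = ⟨⟩-𝟙 i (λ j → r j e)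

Span-row : ∀ {d k} (g : Mat d k) i → Span g ∋ rows g i
Span-row g i = 𝟙 i , ≈-sym (lin-𝟙 (rows g) i)

lin-mem : ∀ {d k} (W : Space k) (r : Fin d → V k) → (∀ i → W ∋ r i) → ∀ c → W ∋ lin c r
lin-mem {zero} W r h c = mem-0 W λ _ → refl
lin-mem {suc d} W r h c = mem⊕ W (mem-· W (c zero) (h zero)) (lin-mem W (r ∘ suc) (h ∘ suc) (c ∘ suc))

Span-⊆ : ∀ {d k} (g : Mat d k) (W : Space k) → (∀ i → W ∋ rows g i) → ∀ w → Span g ∋ w → W ∋ w
Span-⊆ g W h w (c , p) = resp≈ W (≈-sym p) (lin-mem W (rows g) h c)

span : ∀ {d k} → Mat d k → List (Vec Bool k)
span [] = Vec₀.replicate _ false ∷ []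
span (r ∷ g) = span g ++ List.map (r +ᵛ_) (span g)

span-complete : ∀ {d k} (g : Mat d k) w → Span g ∋ w → ∃ λ x → x ∈ˡ span g × w ≈ lookup x
span-complete [] w (c , p) = _ , here refl , λ e → trans (p e) (sym (Vec.lookup-replicate e false))
span-complete (r ∷ g) w (c , p) = step (span-complete g (lin (c ∘ suc) (rows g)) (c ∘ suc , λ _ → refl)) (c zero) refl
  where
  step : _ → ∀ b → c zero ≡ b → _
  step (x , x∈ , q) false c0 = x , ∈-++⁺ˡ x∈ , λ e → trans (p e) (trans (cong (λ b → (b ∧ lookup r e) xor lin (c ∘ suc) (rows g) e) c0) (q e))
  step (x , x∈ , q) true c0 = r +ᵛ x , ∈-++⁺ʳ (span g) (∈-map⁺ (r +ᵛ_) x∈) , λ e →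
    trans (p e) (trans (cong₂ (λ b y → (b ∧ lookup r e) xor y) c0 (q e)) (sym (Vec.lookup-zipWith _xor_ e r x)))

span-sound : ∀ {d k} (g : Mat d k) {x} → x ∈ˡ span g → Span g ∋ lookup x
span-sound [] (here refl) = (λ ()) , λ e → Vec.lookup-replicate e false
span-sound (r ∷ g) {x} x∈ with ∈-++⁻ (span g) x∈
... | inj₁ y∈ = let (c , p) = span-sound g y∈ in false ◂ c , p
... | inj₂ y∈ with ∈-map⁻ (r +ᵛ_) y∈
...   | y , y∈′ , refl = let (c , p) = span-sound g y∈′ in true ◂ c , λ e → trans (Vec.lookup-zipWith _xor_ e r y) (cong (lookup r e xor_) (p e))

_∈ᵇ_ : ∀ {k} → Vec Bool k → List (Vec Bool k) → Bool
x ∈ᵇ xs = some (x =ᵛ_) xs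

∈ᵇ-∈ : ∀ {k} {x : Vec Bool k} {xs} → x ∈ᵇ xs ≡ true → x ∈ˡ xs
∈ᵇ-∈ {x = x} h with some-∈ (x =ᵛ_) h
... | y , y∈ , p rewrite =ᵛ-≡ x y p = y∈

-- out-of-range numerals become the last position
pos : ∀ {k} → ℕ → Fin (suc k)
pos zero = zero
pos {zero} (suc m) = zero
pos {suc k} (suc m) = suc (pos m)

places : ∀ k {m} → Vec ℕ m → Vec (Fin (suc k)) m
places k = Vec₀.map (pos {k})

supp : ∀ {k} → List ℕ → Vec Bool k
supp L = tabulate λ e → some (toℕ e ≡ᵇ_) L

mat : ∀ {d k} → Vec (List ℕ) d → Mat d k
mat = Vec₀.map supp

-- Minors of concrete spaces are verified by enumerating both spans.

disjoint : ∀ {k} → Vec Bool k → Vec Bool k → Bool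
disjoint [] [] = true
disjoint (d ∷ D) (x ∷ xs) = not (d ∧ x) ∧ disjoint D xs

disjoint-sound : ∀ {k} (D x : Vec Bool k) → disjoint D x ≡ true → ∀ e → lookup D e ≡ true → lookup x e ≡ false
disjoint-sound (true ∷ D) (false ∷ x) h zero _ = refl
disjoint-sound (d ∷ D) (b ∷ x) h (suc e) p = disjoint-sound D x (proj₂ (∧-true {not (d ∧ b)} h)) e p

disjoint-complete : ∀ {k} (D x : Vec Bool k) → (∀ e → lookup D e ≡ true → lookup x e ≡ false) → disjoint D x ≡ true
disjoint-complete [] [] h = refl
disjoint-complete (false ∷ D) (b ∷ x) h = disjoint-complete D x (h ∘ suc)
disjoint-complete (true ∷ D) (b ∷ x) h rewrite h zero refl = disjoint-complete D x (h ∘ suc)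

restrict : ∀ {k k′} → Vec (Fin k) k′ → Vec Bool k → Vec Bool k′
restrict φ x = Vec₀.map (lookup x) φ

lookup-restrict : ∀ {k k′} (φ : Vec (Fin k) k′) x → lookup (restrict φ x) ≈ lookup x ∘ lookup φ
lookup-restrict φ x i = Vec.lookup-map i (lookup x) φ

-- Two inclusions: combinations of `g` that vanish on `D` restrict into the span of `q`, and every
-- row of `q` is such a restriction.
checkProj : ∀ {d k d′ k′} → Mat d k → Mat d′ k′ → Vec (Fin k) k′ → Vec Bool k → Bool
checkProj g q φ D = every (λ x → not (disjoint D x) ∨ (restrict φ x ∈ᵇ span q)) (span g)
                  ∧ everyF (λ i → some (λ x → disjoint D x ∧ (restrict φ x =ᵛ lookup q i)) (span g))

checkProj-sound : ∀ {d k d′ k′} (g : Mat d k) (q : Mat d′ k′) φ D → checkProj g q φ D ≡ true →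
                  Span q ≐ Proj (Span g) (lookup D) (lookup φ)
checkProj-sound g q φ D h = Span-⊆ q (Proj (Span g) (lookup D) (lookup φ)) row ⸴ from
  where
  h₁ = proj₁ (∧-true {every (λ x → not (disjoint D x) ∨ (restrict φ x ∈ᵇ span q)) (span g)} h)
  h₂ = proj₂ (∧-true {every (λ x → not (disjoint D x) ∨ (restrict φ x ∈ᵇ span q)) (span g)} h)
  row : ∀ i → Proj (Span g) (lookup D) (lookup φ) ∋ rows q i
  row i = build (some-∈ _ (everyF-∀ _ h₂ i))
    where
    build : _ → _
    build (x , x∈ , p) = lookup x , span-sound g x∈ , disjoint-sound D x (proj₁ (∧-true {disjoint D x} p))
      , λ j → trans (sym (lookup-restrict φ x j)) (cong (λ y → lookup y j) (=ᵛ-≡ (restrict φ x) (lookup q i) (proj₂ (∧-true {disjoint D x} p))))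
  from : ∀ w → Proj (Span g) (lookup D) (lookup φ) ∋ w → Span q ∋ w
  from w (v , v∈ , vD , v≈) = build (span-complete g v v∈)
    where
    build : _ → _
    build (x , x∈ , v≈x) = resp≈ (Span q) (λ i → trans (lookup-restrict φ x i) (trans (sym (v≈x _)) (v≈ i)))
        (span-sound q (∈ᵇ-∈ {x = restrict φ x} (pick (every-∈ _ h₁ x∈) (disjoint-complete D x λ e p → trans (sym (v≈x e)) (vD e p)))))
      where
      pick : ∀ {a b} → not a ∨ b ≡ true → a ≡ true → b ≡ true
      pick {true} p _ = p

distinctᵇ : ∀ {k k′} → Vec (Fin k) k′ → Bool
distinctᵇ φ = everyF λ i → everyF λ j → ⌊ i Fin.≟ j ⌋ ∨ not ⌊ lookup φ i Fin.≟ lookup φ j ⌋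

distinct-sound : ∀ {k k′} (φ : Vec (Fin k) k′) → distinctᵇ φ ≡ true → Injective _≡_ _≡_ (lookup φ)
distinct-sound φ h {i} {j} p with i Fin.≟ j | lookup φ i Fin.≟ lookup φ j | everyF-∀ _ (everyF-∀ _ h i) j
... | yes q | _ | _ = q
... | no _ | no ¬q | _ = ⊥-elim (¬q p)

avoidᵇ : ∀ {k k′} → Vec (Fin k) k′ → Vec Bool k → Bool
avoidᵇ φ D = everyF λ i → not (lookup D (lookup φ i))

checkMinor : ∀ {d k d′ k′} → Mat d k → Mat d′ k′ → Vec (Fin k) k′ → Vec Bool k → Bool
checkMinor g q φ D = distinctᵇ φ ∧ (avoidᵇ φ D ∧ checkProj g q φ D)

checkMinor-sound : ∀ {d k d′ k′} (g : Mat d k) (q : Mat d′ k′) φ D → checkMinor g q φ D ≡ true →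
                   Minor (Span g) (λ _ → true) (Span q)
checkMinor-sound g q φ D h = record
  { φ = lookup φ ; φ-inj = distinct-sound φ (proj₁ (∧-true {distinctᵇ φ} h)) ; D = lookup D
  ; φ∉D = λ x → not-true (everyF-∀ _ (proj₁ (∧-true {avoidᵇ φ D} h′)) x) ; D⊇ = λ _ ()
  ; Q≐ = checkProj-sound g q φ D (proj₂ (∧-true {avoidᵇ φ D} h′)) }
  where
  h′ = proj₂ (∧-true {distinctᵇ φ} h)

-- The targets: the seven cut spaces and four spaces that are not cycle spaces

stars : ∀ {v k} → Graph v k → Mat v k
stars G = tabulate λ u → tabulate (star G u)

rows-stars : ∀ {v k} (G : Graph v k) u → rows (stars G) u ≈ star G u
rows-stars G u e = trans (cong (λ r → lookup r e) (Vec.lookup∘tabulate (λ u → tabulate (star G u)) u)) (Vec.lookup∘tabulate (star G u) e)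

lin-stars : ∀ {v k} (G : Graph v k) T → lin T (rows (stars G)) ≈ δ G T
lin-stars G T e = trans (Σ₂-cong λ u → cong (T u ∧_) (rows-stars G u e))
  (trans (lin-δ G T 𝟙 e) (cong₂ _xor_ (at (proj₁ (G e))) (at (proj₂ (G e)))))
  where
  at : ∀ a → lin T 𝟙 a ≡ T a
  at a = trans (Σ₂-single a λ u u≢a → trans (cong (T u ∧_) (𝟙-≢ u≢a)) (Bool.∧-zeroʳ _)) (trans (cong (T a ∧_) (𝟙-refl a)) (Bool.∧-identityʳ _))

Span-stars : ∀ {v k} (G : Graph v k) → Span (stars G) ≐ Cut G
Span-stars G = (λ w (T , p) → T , ≈-trans p (lin-stars G T)) ⸴ λ w (T , p) → T , ≈-trans p (≈-sym (lin-stars G T))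

data Target : Set where
  graph : Fin 7 → Target
  fano fanoDual cutK33 cutK5 : Target

rank size : Target → ℕ
rank (graph i) = FinGraph.nV (F i)
rank fano = 3
rank fanoDual = 4
rank cutK33 = 5
rank cutK5 = 4
size (graph i) = FinGraph.nE (F i)
size fano = 7
size fanoDual = 7
size cutK33 = 9
size cutK5 = 10

-- Rows are given by their supports. In the names below, `cyc` and `cut` tell which space of the
-- graph the rows span: `cutK33M` presents M(K₃,₃), while `cycK33M` presents M*(K₃,₃).
fanoM : Mat 3 7
fanoM = mat ((0 ∷ 1 ∷ 3 ∷ 6 ∷ []) ∷ (0 ∷ 2 ∷ 3 ∷ 5 ∷ []) ∷ (1 ∷ 2 ∷ 3 ∷ 4 ∷ []) ∷ [])

fanoDualM : Mat 4 7
fanoDualM = mat ((0 ∷ 1 ∷ 3 ∷ 6 ∷ []) ∷ (1 ∷ 3 ∷ 5 ∷ []) ∷ (0 ∷ 3 ∷ 4 ∷ []) ∷ (0 ∷ 1 ∷ 2 ∷ []) ∷ [])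

cycK33M : Mat 4 9
cycK33M = mat ((0 ∷ 2 ∷ 6 ∷ 8 ∷ []) ∷ (0 ∷ 1 ∷ 6 ∷ 7 ∷ []) ∷ (0 ∷ 2 ∷ 3 ∷ 5 ∷ []) ∷ (0 ∷ 1 ∷ 3 ∷ 4 ∷ []) ∷ [])

cycK5M : Mat 6 10
cycK5M = mat ((2 ∷ 3 ∷ 9 ∷ []) ∷ (1 ∷ 3 ∷ 8 ∷ []) ∷ (1 ∷ 2 ∷ 7 ∷ []) ∷ (0 ∷ 3 ∷ 6 ∷ []) ∷ (0 ∷ 2 ∷ 5 ∷ []) ∷ (0 ∷ 1 ∷ 4 ∷ []) ∷ [])

cutK33M : Mat 5 9
cutK33M = mat ((0 ∷ 1 ∷ 3 ∷ 4 ∷ 8 ∷ []) ∷ (1 ∷ 4 ∷ 7 ∷ []) ∷ (0 ∷ 3 ∷ 6 ∷ []) ∷ (3 ∷ 4 ∷ 5 ∷ []) ∷ (0 ∷ 1 ∷ 2 ∷ []) ∷ [])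

cutK5M : Mat 4 10
cutK5M = mat ((2 ∷ 5 ∷ 7 ∷ 9 ∷ []) ∷ (1 ∷ 4 ∷ 7 ∷ 8 ∷ []) ∷ (0 ∷ 4 ∷ 5 ∷ 6 ∷ []) ∷ (0 ∷ 1 ∷ 2 ∷ 3 ∷ []) ∷ [])

gens : ∀ t → Mat (rank t) (size t)
gens (graph i) = stars (GraphOf (F i))
gens fano = fanoM
gens fanoDual = fanoDualM
gens cutK33 = cutK33M
gens cutK5 = cutK5M

-- When Z is the cycle space of a graph, the last four targets are excluded automatically.
NoBad : ∀ {n} → Space n → V n → Set
NoBad Z U = ∀ t → ¬ Minor Z U (Span (gens t))

weightᵇ : ∀ {k} → ℕ → Vec Bool k → Bool
weightᵇ g x = (∥ lookup x ∥ ≡ᵇ 0) ∨ (g ≤ᵇ ∥ lookup x ∥)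

weightᵇ-sound : ∀ {k} g (x : Vec Bool k) → weightᵇ g x ≡ true → ∥ lookup x ∥ ≡ 0 ⊎ g ≤ ∥ lookup x ∥
weightᵇ-sound g x h with ∨-true {∥ lookup x ∥ ≡ᵇ 0} h
... | inj₁ p = inj₁ (ℕ.≡ᵇ⇒≡ _ _ (subst Data.Bool.T (sym p) _))
... | inj₂ p = inj₂ (ℕ.≤ᵇ⇒≤ _ _ (subst Data.Bool.T (sym p) _))

checkPivots : ∀ {d k} → Mat d k → Vec (Fin k) d → Bool
checkPivots g piv = everyF λ i → everyF λ j → lookup (lookup g i) (lookup piv j) == 𝟙 i j

checkPivots-sound : ∀ {d k} (g : Mat d k) piv → checkPivots g piv ≡ true → ∀ i j → rows g i (lookup piv j) ≡ 𝟙 i j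
checkPivots-sound g piv h i j = ==-≡ (everyF-∀ _ (everyF-∀ _ h i) j)

span-nonGraphical : ∀ {d k} g (q : Mat (suc d) k) piv → checkPivots q piv ≡ true → every (weightᵇ g) (span q) ≡ true →
                    k * 2 < suc (suc d) * g → ¬ Graphical (Span q)
span-nonGraphical {d} g q piv hp hw = nonGraphical d g (Span q) (rows q) (lookup piv) (Span-row q) (checkPivots-sound q piv hp) wt
  where
  wt : ∀ w → Span q ∋ w → ∥ w ∥ ≡ 0 ⊎ g ≤ ∥ w ∥
  wt w w∈ = go (span-complete q w w∈)
    where
    go : _ → _
    go (x , x∈ , p) = subst (λ m → m ≡ 0 ⊎ g ≤ m) (sym (∥∥-cong p)) (weightᵇ-sound g x (every-∈ (weightᵇ g) hw x∈))

dotᵇ : ∀ {k} → Vec Bool k → Vec Bool k → Bool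
dotᵇ [] [] = false
dotᵇ (a ∷ x) (b ∷ y) = (a ∧ b) xor dotᵇ x y

dotᵇ-⟨⟩ : ∀ {k} (x y : Vec Bool k) → dotᵇ x y ≡ ⟨ lookup x , lookup y ⟩
dotᵇ-⟨⟩ [] [] = refl
dotᵇ-⟨⟩ (a ∷ x) (b ∷ y) = cong ((a ∧ b) xor_) (dotᵇ-⟨⟩ x y)

Orth : ∀ {k} → V k → Space k
mem (Orth u) w = ⟨ u , w ⟩ ≡ false
resp≈ (Orth u) p q = trans (⟨⟩-cong {u = u} ≈-refl (≈-sym p)) q
mem? (Orth u) w = ⟨ u , w ⟩ Bool.≟ false
mem0 (Orth u) = ⟨⟩-0ʳ u λ _ → refl
mem⊕ (Orth u) {v} {w} p q = trans (⟨⟩-⊕ʳ u v w) (cong₂ _xor_ p q)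

-- The rows of `q` supply independent vectors of the complement, and the weight condition is tested
-- on every vector orthogonal to `z`, so no basis of the complement has to be computed.
perp-nonGraphical : ∀ {d d′ k} g (z : Mat d′ k) (q : Mat (suc d) k) piv → checkPivots q piv ≡ true →
                    everyF (λ i → everyF λ j → not (dotᵇ (lookup q i) (lookup z j))) ≡ true →
                    every (λ x → someF (λ j → dotᵇ x (lookup z j)) ∨ weightᵇ g x) (vecs k) ≡ true →
                    k * 2 < suc (suc d) * g → ¬ Graphical (perp (Span z))
perp-nonGraphical {d} {k = k} g z q piv hp hd hw = nonGraphical d g (perp (Span z)) (rows q) (lookup piv) q∈ (checkPivots-sound q piv hp) wt
  where
  q∈ : ∀ i → perp (Span z) ∋ rows q i
  q∈ i w w∈ = Span-⊆ z (Orth (rows q i)) (λ j → trans (sym (dotᵇ-⟨⟩ (lookup q i) (lookup z j)))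
    (not-true (everyF-∀ (λ j → not (dotᵇ (lookup q i) (lookup z j))) (everyF-∀ (λ i → everyF λ j → not (dotᵇ (lookup q i) (lookup z j))) hd i) j))) w w∈
  wt : ∀ w → perp (Span z) ∋ w → ∥ w ∥ ≡ 0 ⊎ g ≤ ∥ w ∥
  wt w w∈ = subst (λ m → m ≡ 0 ⊎ g ≤ m) (∥∥-cong w≈) (weightᵇ-sound g x (pick (∨-true (every-∈ _ hw (∈-vecs x)))))
    where
    x = tabulate w
    w≈ : lookup x ≈ w
    w≈ = Vec.lookup∘tabulate w
    pick : someF (λ j → dotᵇ x (lookup z j)) ≡ true ⊎ weightᵇ g x ≡ true → weightᵇ g x ≡ true
    pick (inj₂ p) = p
    pick (inj₁ p) = let (j , q) = someF-∃ _ p in ⊥-elim (true≢false (trans (sym q)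
      (trans (dotᵇ-⟨⟩ x (lookup z j)) (trans (⟨⟩-cong {v = rows z j} w≈ ≈-refl) (w∈ (rows z j) (Span-row z j))))))

Ext-Span : ∀ {d k} (s : Vec Bool k) (g : Mat d k) {W : Space k} → Span g ≐ W → Ext W (lookup s) ≐ Span (s ∷ g)
Ext-Span s g {W} h = to ⸴ from
  where
  to : ∀ w → Ext W (lookup s) ∋ w → Span (s ∷ g) ∋ w
  to w (b , p) = build (≐⇐ h _ p)
    where
    build : _ → _
    build (c , q) = b ◂ c , λ e → trans (sym (xor-cancelʳ (w e) (b ∧ lookup s e))) (trans (Bool.xor-comm (w e xor (b ∧ lookup s e)) (b ∧ lookup s e)) (cong ((b ∧ lookup s e) xor_) (q e)))
  from : ∀ w → Span (s ∷ g) ∋ w → Ext W (lookup s) ∋ w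
  from w (c , q) = c zero , ≐⇒ h _ (c ∘ suc , λ e → trans (cong (_xor (c zero ∧ lookup s e)) (q e))
    (trans (cong (_xor (c zero ∧ lookup s e)) (Bool.xor-comm (c zero ∧ lookup s e) _)) (xor-cancelʳ _ (c zero ∧ lookup s e))))

-- The forward direction: a 3-element set that spoils each Fᵢ

spoiler : ∀ i → Vec Bool (FinGraph.nE (F i))
spoiler zero = supp (0 ∷ 5 ∷ 6 ∷ [])
spoiler (suc zero) = supp (0 ∷ 1 ∷ 2 ∷ [])
spoiler (suc (suc zero)) = supp (0 ∷ 7 ∷ 10 ∷ [])
spoiler (suc (suc (suc zero))) = supp (0 ∷ 5 ∷ 6 ∷ [])
spoiler (suc (suc (suc (suc zero)))) = supp (2 ∷ 4 ∷ 5 ∷ [])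
spoiler (suc (suc (suc (suc (suc zero))))) = supp (0 ∷ 3 ∷ 7 ∷ [])
spoiler (suc (suc (suc (suc (suc (suc zero)))))) = supp (0 ∷ 5 ∷ 8 ∷ [])

-- The bound `g` is the least weight of a nonzero member: 4 for F₇, 3 for its dual, and the girths 4
-- and 3 of K₃,₃ and K₅. The counts that decide the four cases are 14 < 16, 14 < 15, 18 < 20 and 20
-- < 21.
fano-nonGraphical : ¬ Graphical (Span fanoM)
fano-nonGraphical = span-nonGraphical 4 fanoM (places 6 (6 ∷ 5 ∷ 4 ∷ [])) refl refl (ℕ.≤ᵇ⇒≤ _ _ _)

fanoDual-nonGraphical : ¬ Graphical (Span fanoDualM)
fanoDual-nonGraphical = span-nonGraphical 3 fanoDualM (places 6 (6 ∷ 5 ∷ 4 ∷ 2 ∷ [])) refl refl (ℕ.≤ᵇ⇒≤ _ _ _)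

cycK33-nonGraphical : ¬ Graphical (Span cycK33M)
cycK33-nonGraphical = span-nonGraphical 4 cycK33M (places 8 (8 ∷ 7 ∷ 5 ∷ 4 ∷ [])) refl refl (ℕ.≤ᵇ⇒≤ _ _ _)

cycK5-nonGraphical : ¬ Graphical (Span cycK5M)
cycK5-nonGraphical = span-nonGraphical 3 cycK5M (places 9 (9 ∷ 8 ∷ 7 ∷ 6 ∷ 5 ∷ 4 ∷ [])) refl refl (ℕ.≤ᵇ⇒≤ _ _ _)

Spoiled : Fin 7 → Set
Spoiled i = ¬ Graphical (Ext (Cut (GraphOf (F i))) (lookup (spoiler i)))

spoiled-by : ∀ {d k′} i (q : Mat d k′) φ D →
             checkMinor (spoiler i ∷ stars (GraphOf (F i))) q φ D ≡ true → ¬ Graphical (Span q) → Spoiled i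
spoiled-by i q φ D h ng g = ng (graphical-resp (≐-sym (Q≐ m)) (graphical-Proj (Minor.D m) (Minor.φ m)
    (graphical-resp (Ext-Span s (stars G) (Span-stars G)) g)))
  where
  open Minor using (Q≐)
  G = GraphOf (F i)
  s = spoiler i
  m = checkMinor-sound (s ∷ stars G) q φ D h

spoiled₁ : Spoiled zero
spoiled₁ = spoiled-by zero fanoDualM (places 6 (0 ∷ 1 ∷ 2 ∷ 3 ∷ 4 ∷ 5 ∷ 6 ∷ [])) (supp []) refl fanoDual-nonGraphical

spoiled₂ : Spoiled (suc zero)
spoiled₂ = spoiled-by (suc zero) fanoDualM (places 6 (0 ∷ 1 ∷ 2 ∷ 3 ∷ 4 ∷ 5 ∷ 6 ∷ [])) (supp []) refl fanoDual-nonGraphical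

spoiled₃ : Spoiled (suc (suc zero))
spoiled₃ = spoiled-by (suc (suc zero)) cycK33M (places 10 (1 ∷ 3 ∷ 8 ∷ 5 ∷ 9 ∷ 6 ∷ 7 ∷ 2 ∷ 4 ∷ [])) (supp (0 ∷ 10 ∷ [])) refl cycK33-nonGraphical

spoiled₄ : Spoiled (suc (suc (suc zero)))
spoiled₄ = spoiled-by (suc (suc (suc zero))) fanoM (places 8 (1 ∷ 2 ∷ 8 ∷ 3 ∷ 7 ∷ 6 ∷ 4 ∷ [])) (supp (5 ∷ [])) refl fano-nonGraphical

spoiled₅ : Spoiled (suc (suc (suc (suc zero))))
spoiled₅ = spoiled-by (suc (suc (suc (suc zero)))) cycK33M (places 9 (0 ∷ 4 ∷ 5 ∷ 8 ∷ 3 ∷ 7 ∷ 9 ∷ 6 ∷ 1 ∷ [])) (supp (2 ∷ [])) refl cycK33-nonGraphical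

spoiled₆ : Spoiled (suc (suc (suc (suc (suc zero)))))
spoiled₆ = spoiled-by (suc (suc (suc (suc (suc zero))))) cycK5M (places 9 (0 ∷ 2 ∷ 3 ∷ 4 ∷ 5 ∷ 7 ∷ 8 ∷ 6 ∷ 1 ∷ 9 ∷ [])) (supp []) refl cycK5-nonGraphical

spoiled₇ : Spoiled (suc (suc (suc (suc (suc (suc zero))))))
spoiled₇ = spoiled-by (suc (suc (suc (suc (suc (suc zero)))))) fanoM (places 8 (1 ∷ 2 ∷ 7 ∷ 3 ∷ 6 ∷ 5 ∷ 4 ∷ [])) (supp (0 ∷ 8 ∷ [])) refl fano-nonGraphical

spoiled : ∀ i → Spoiled i
spoiled zero = spoiled₁
spoiled (suc zero) = spoiled₂
spoiled (suc (suc zero)) = spoiled₃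
spoiled (suc (suc (suc zero))) = spoiled₄
spoiled (suc (suc (suc (suc zero)))) = spoiled₅
spoiled (suc (suc (suc (suc (suc zero))))) = spoiled₆
spoiled (suc (suc (suc (suc (suc (suc zero)))))) = spoiled₇

-- Splitting commutes with taking minors as long as `S` avoids the contracted elements, for then
-- adding `S` does not disturb the vanishing on `D`.
Ext-Proj : ∀ {n k} (Z : Space n) D (φ : Fin k → Fin n) {S S′} → (∀ e → D e ≡ true → S e ≡ false) → S ∘ φ ≈ S′ →
           Ext (Proj Z D φ) S′ ≐ Proj (Ext Z S) D φ
Ext-Proj Z D φ {S} {S′} SD S≈ = to ⸴ from
  where
  to : ∀ w → Ext (Proj Z D φ) S′ ∋ w → Proj (Ext Z S) D φ ∋ w
  to w (b , v , v∈ , vD , v≈) = v ⊕ b · S , (b , resp≈ Z (λ i → sym (xor-cancelʳ (v i) (b ∧ S i))) v∈)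
    , (λ e p → trans (cong₂ (λ x y → x xor (b ∧ y)) (vD e p) (SD e p)) (Bool.∧-zeroʳ b))
    , λ i → trans (cong₂ (λ x y → x xor (b ∧ y)) (v≈ i) (S≈ i)) (xor-cancelʳ (w i) (b ∧ S′ i))
  from : ∀ w → Proj (Ext Z S) D φ ∋ w → Ext (Proj Z D φ) S′ ∋ w
  from w (v , (b , v∈) , vD , v≈) = b , v ⊕ b · S , v∈
    , (λ e p → trans (cong₂ (λ x y → x xor (b ∧ y)) (vD e p) (SD e p)) (Bool.∧-zeroʳ b))
    , λ i → cong₂ (λ x y → x xor (b ∧ y)) (v≈ i) (S≈ i)

∣∣-∥∥ : ∀ {n} (S : Vec Bool n) → ∣ S ∣ ≡ ∥ lookup S ∥
∣∣-∥∥ [] = refl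
∣∣-∥∥ (true ∷ S) = cong suc (∣∣-∥∥ S)
∣∣-∥∥ (false ∷ S) = ∣∣-∥∥ S

∥push∥ : ∀ {n k} (φ : Fin k → Fin n) → Injective _≡_ _≡_ φ → ∀ y → ∥ push φ y ∥ ≡ ∥ y ∥
∥push∥ {n} {zero} φ inj y = zeros n
  where
  zeros : ∀ n → ∥_∥ {n} (λ e → false) ≡ 0
  zeros zero = refl
  zeros (suc n) = zeros n
∥push∥ {n} {suc k} φ inj y = trans (add (y zero) (φ zero) (push (φ ∘ suc) (y ∘ suc)) (push-∉ (φ ∘ suc) (y ∘ suc) (φ zero) λ x p → 0≢s (inj p)))
    (cong (b→ℕ (y zero) +ℕ_) (∥push∥ (φ ∘ suc) (Fin.suc-injective ∘ inj) (y ∘ suc)))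
  where
  0≢s : ∀ {x : Fin k} → suc x ≡ zero → ⊥
  0≢s ()
  add : ∀ {n} b (i : Fin n) (u : V n) → u i ≡ false → ∥ (λ e → (b ∧ 𝟙 i e) xor u e) ∥ ≡ b→ℕ b +ℕ ∥ u ∥
  add false i u p = refl
  add true zero u p rewrite p = cong suc (∥∥-cong {u = λ e → (true ∧ 𝟙 zero (suc e)) xor u (suc e)} {u ∘ suc} λ _ → refl)
  add {suc n} true (suc i) u p = trans (cong (b→ℕ (u zero) +ℕ_) (trans (∥∥-cong (λ e → cong (_xor u (suc e)) (𝟙-suc i e))) (add true i (u ∘ suc) p)))
      (ℕ.+-suc (b→ℕ (u zero)) ∥ u ∘ suc ∥)
    where
    𝟙-suc : ∀ {v} (u a : Fin v) → 𝟙 (suc u) (suc a) ≡ 𝟙 u a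
    𝟙-suc u a with u Fin.≟ a
    ... | yes _ = refl
    ... | no _ = refl

inC₃⇒noMinor : ∀ {m n} (A : Mat m n) → InC₃ A → ∀ i → ¬ HasMinor M[ A ] (MG (GraphOf (F i)))
inC₃⇒noMinor A c i hm = spoiled i (graphical-resp (≐-sym (≐-trans (Ext-mono (lookup (spoiler i)) (Q≐ m)) (Ext-Proj (Row A) (D m) (φ m) S-D S-φ)))
    (graphical-Proj (D m) (φ m) (graphic⇒graphical A S (c S size-S))))
  where
  open Minor
  m = HasMinor⇒minor A (GraphOf (F i)) hm
  S₀ = push (φ m) (lookup (spoiler i))
  S = tabulate S₀
  S≈ : lookup S ≈ S₀
  S≈ = Vec.lookup∘tabulate S₀
  S-φ : lookup S ∘ φ m ≈ lookup (spoiler i)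
  S-φ x = trans (S≈ (φ m x)) (push-∘ (φ m) (φ-inj m) (lookup (spoiler i)) x)
  S-D : ∀ e → D m e ≡ true → lookup S e ≡ false
  S-D e De = trans (S≈ e) (push-∉ (φ m) (lookup (spoiler i)) e λ x p → true≢false (trans (sym De) (trans (cong (D m) (sym p)) (φ∉D m x))))
  three : ∀ i → ∥ lookup (spoiler i) ∥ ≡ 3
  three zero = refl
  three (suc zero) = refl
  three (suc (suc zero)) = refl
  three (suc (suc (suc zero))) = refl
  three (suc (suc (suc (suc zero)))) = refl
  three (suc (suc (suc (suc (suc zero))))) = refl
  three (suc (suc (suc (suc (suc (suc zero)))))) = refl
  size-S : ∣ S ∣ ≡ 3
  size-S = trans (∣∣-∥∥ S) (trans (∥∥-cong S≈) (trans (∥push∥ (φ m) (φ-inj m) (lookup (spoiler i))) (three i)))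

perpFano : ¬ Graphical (perp (Span (gens fano)))
perpFano = perp-nonGraphical 3 (gens fano) fanoDualM (places 6 (6 ∷ 5 ∷ 4 ∷ 2 ∷ [])) refl refl refl (ℕ.≤ᵇ⇒≤ _ _ _)

perpFanoDual : ¬ Graphical (perp (Span (gens fanoDual)))
perpFanoDual = perp-nonGraphical 4 (gens fanoDual) fanoM (places 6 (6 ∷ 5 ∷ 4 ∷ [])) refl refl refl (ℕ.≤ᵇ⇒≤ _ _ _)

perpCutK33 : ¬ Graphical (perp (Span (gens cutK33)))
perpCutK33 = perp-nonGraphical 4 (gens cutK33) cycK33M (places 8 (8 ∷ 7 ∷ 5 ∷ 4 ∷ [])) refl refl refl (ℕ.≤ᵇ⇒≤ _ _ _)

perpCutK5 : ¬ Graphical (perp (Span (gens cutK5)))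
perpCutK5 = perp-nonGraphical 3 (gens cutK5) cycK5M (places 9 (9 ∷ 8 ∷ 7 ∷ 6 ∷ 5 ∷ 4 ∷ [])) refl refl refl (ℕ.≤ᵇ⇒≤ _ _ _)

Minor-space : ∀ {n k} {Z Z′ : Space n} {U} {Q : Space k} → Z ≐ Z′ → Minor Z U Q → Minor Z′ U Q
Minor-space h m = record { φ = φ m ; φ-inj = φ-inj m ; D = D m ; φ∉D = φ∉D m ; D⊇ = D⊇ m ; Q≐ = ≐-trans (Q≐ m) (Proj-mono (D m) (φ m) h) }
  where open Minor

noBad : ∀ {m n v} (A : Mat m n) (G : Graph v n) → Row A ≐ Cyc G →
        (∀ i → ¬ HasMinor M[ A ] (MG (GraphOf (F i)))) → NoBad (Row A) (λ _ → true)
noBad A G h f (graph i) m = f i (minor⇒HasMinor A (λ _ → true) (GraphOf (F i)) (Minor-resp (Span-stars (GraphOf (F i))) m))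
noBad A G h f fano m = perpFano (cycle-minor G (Minor-space h m))
noBad A G h f fanoDual m = perpFanoDual (cycle-minor G (Minor-space h m))
noBad A G h f cutK33 m = perpCutK33 (cycle-minor G (Minor-space h m))
noBad A G h f cutK5 m = perpCutK5 (cycle-minor G (Minor-space h m))

-- Restriction to a set, and graphs with two marked vertices

infixl 7 _⊓_
_⊓_ : ∀ {n} → V n → V n → V n
(u ⊓ v) e = u e ∧ v e

infix 8 ~_
~_ : ∀ {n} → V n → V n
(~ u) e = not (u e)

⊓-⊑ʳ : ∀ {n} (u v : V n) → u ⊓ v ⊑ v
⊓-⊑ʳ u v e p with u e
... | true = p

⊓-⊑ˡ : ∀ {n} (u v : V n) → u ⊓ v ⊑ u
⊓-⊑ˡ u v e p with u e
... | true = refl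

⊑⇒⊓ : ∀ {n} {u v : V n} → u ⊑ v → u ⊓ v ≈ u
⊑⇒⊓ {u = u} {v} h e with u e in eq
... | true = h e eq
... | false = refl

⊓-⊕ : ∀ {n} (u v w : V n) → (u ⊕ v) ⊓ w ≈ (u ⊓ w) ⊕ (v ⊓ w)
⊓-⊕ u v w e = Bool.∧-distribʳ-xor (w e) (u e) (v e)

⊓-split : ∀ {n} (u v : V n) → u ≈ (u ⊓ v) ⊕ (u ⊓ ~ v)
⊓-split u v e with u e | v e
... | false | _ = refl
... | true | false = refl
... | true | true = refl

infixl 6 _↾_
_↾_ : ∀ {n} → Space n → V n → Space n
mem (Z ↾ X) v = Z ∋ v × v ⊑ X
resp≈ (Z ↾ X) p (a , b) = resp≈ Z p a , ⊑-respˡ p b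
mem? (Z ↾ X) v = mem? Z v ×-dec ⊑? v X
mem0 (Z ↾ X) = mem0 Z , λ _ ()
mem⊕ (Z ↾ X) (a , b) (a′ , b′) = mem⊕ Z a a′ , ⊑-⊕ b b′

-- A graph with cut space Ext W S in which the coefficient of S is the potential difference of the vertices p and q.
NRep : ∀ {n} → Space n → V n → Set
NRep {n} W S = ∃ λ v → Σ (Graph v n) λ G → ∃ λ p → ∃ λ q →
  (∀ b w → W ∋ w ⊕ b · S → ∃ λ T → T p xor T q ≡ b × w ≈ δ G T) ×
  (∀ T → W ∋ δ G T ⊕ (T p xor T q) · S)

NRep⇒Graphical : ∀ {n} {W : Space n} {S} → NRep W S → Graphical (Ext W S)
NRep⇒Graphical {W = W} {S} (v , G , p , q , f , g) = v , G , ((λ w (b , h) → let (T , _ , w≈) = f b w h in T , w≈)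
  ⸴ λ w (T , w≈) → (T p xor T q) , resp≈ W (λ i → cong (_xor ((T p xor T q) ∧ S i)) (sym (w≈ i))) (g T))

NRep-resp : ∀ {n} {W W′ : Space n} {S} → W ≐ W′ → NRep W S → NRep W′ S
NRep-resp (h ⸴ k) (v , G , p , q , f , g) = v , G , p , q , (λ b w r → f b w (k _ r)) , λ T → h _ (g T)

NRep-shift : ∀ {n} (W : Space n) {S S′} → W ∋ S ⊕ S′ → NRep W S → NRep W S′
NRep-shift W {S} {S′} h (v , G , p , q , f , g) = v , G , p , q
  , (λ b w r → f b w (resp≈ W (λ i → lem b (w i) (S i) (S′ i)) (mem⊕ W r (mem-· W b h))))
  , λ T → resp≈ W (λ i → lem′ (T p xor T q) (δ G T i) (S i) (S′ i)) (mem⊕ W (g T) (mem-· W (T p xor T q) h))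
  where
  lem′ : ∀ b w s t → (w xor (b ∧ s)) xor (b ∧ (s xor t)) ≡ w xor (b ∧ t)
  lem′ false w s t = Bool.xor-identityʳ _
  lem′ true w s t = trans (Bool.xor-assoc w s (s xor t)) (cong (w xor_) (xor-cancelˡ s t))
  lem : ∀ b w s t → (w xor (b ∧ t)) xor (b ∧ (s xor t)) ≡ w xor (b ∧ s)
  lem false w s t = Bool.xor-identityʳ _
  lem true w s t = trans (Bool.xor-assoc w t (s xor t)) (cong (w xor_) (trans (cong (t xor_) (Bool.xor-comm s t)) (xor-cancelˡ t s)))

-- Series reductions

module _ {n} (W : Space n) (e : Fin n) where

  -- The row space after contraction of `e`, on the same ground set; `e` survives as a zero column.
  Avoid : Space n
  mem Avoid w = W ∋ w × w e ≡ false
  resp≈ Avoid p (a , b) = resp≈ W p a , trans (sym (p e)) b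
  mem? Avoid w = mem? W w ×-dec (w e Bool.≟ false)
  mem0 Avoid = mem0 W , refl
  mem⊕ Avoid (a , b) (a′ , b′) = mem⊕ W a a′ , cong₂ _xor_ b b′

  private
    clear : ∀ u → W ∋ u → u e ≡ true → ∀ w → W ∋ w → Avoid ∋ w ⊕ w e · u
    clear u Wu ue w Ww = mem⊕ W Ww (mem-· W (w e) Wu) , trans (cong (λ x → w e xor (w e ∧ x)) ue) (trans (cong (w e xor_) (Bool.∧-identityʳ (w e))) (Bool.xor-same (w e)))

  -- A coloop returns as a pendant edge: `zero` is the new vertex, and the place of attachment is
  -- arbitrary.
  uncontract-coloop : W ∋ 𝟙 e → Graphical Avoid → Graphical W
  uncontract-coloop We (v , G , h) = suc v , H , to ⸴ from
    where
    H : Graph (suc v) n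
    H i with e Fin.≟ i
    ... | yes _ = zero , suc (proj₁ (G i))
    ... | no _ = suc (proj₁ (G i)) , suc (proj₂ (G i))
    He : ∀ T → δ H T e ≡ T zero xor T (suc (proj₁ (G e)))
    He T with e Fin.≟ e
    ... | yes _ = refl
    ... | no ¬p = ⊥-elim (¬p refl)
    H≢ : ∀ T {i} → e ≢ i → δ H T i ≡ δ G (T ∘ suc) i
    H≢ T {i} e≢i with e Fin.≟ i
    ... | yes p = ⊥-elim (e≢i p)
    ... | no _ = refl
    to : ∀ w → W ∋ w → Cut H ∋ w
    to w Ww = build (≐⇒ h _ (clear (𝟙 e) We (𝟙-refl e) w Ww))
      where
      build : _ → _
      build (T , p) = T′ , eq
        where
        T′ : V (suc v)
        T′ = (w e xor T (proj₁ (G e))) ◂ T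
        eq : w ≈ δ H T′
        eq i = case (e Fin.≟ i)
          where
          case : Dec (e ≡ i) → w i ≡ δ H T′ i
          case (yes refl) = sym (trans (He T′) (xor-cancelʳ (w e) (T (proj₁ (G e)))))
          case (no e≢i) = trans (sym (trans (cong (λ x → w i xor (w e ∧ x)) (𝟙-≢ e≢i)) (trans (cong (w i xor_) (Bool.∧-zeroʳ (w e))) (Bool.xor-identityʳ (w i)))))
                            (trans (p i) (sym (H≢ T′ e≢i)))
    from : ∀ w → Cut H ∋ w → W ∋ w
    from w (T , p) = build (≐⇐ h _ (T ∘ suc , λ _ → refl))
      where
      build : _ → _
      build (q , r) = resp≈ W eq (mem⊕ W q (mem-· W (w e) We))
        where
        eq : δ G (T ∘ suc) ⊕ w e · 𝟙 e ≈ w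
        eq i = case (e Fin.≟ i)
          where
          case : Dec (e ≡ i) → (δ G (T ∘ suc) ⊕ w e · 𝟙 e) i ≡ w i
          case (yes refl) = trans (cong₂ (λ x y → x xor (w e ∧ y)) r (𝟙-refl e)) (Bool.∧-identityʳ (w e))
          case (no e≢i) = trans (cong (λ x → δ G (T ∘ suc) i xor (w e ∧ x)) (𝟙-≢ e≢i)) (trans (cong (δ G (T ∘ suc) i xor_) (Bool.∧-zeroʳ (w e)))
            (trans (Bool.xor-identityʳ _) (trans (sym (H≢ T e≢i)) (sym (p i)))))

  -- An element in series with `f` returns by subdividing the edge `f` with the new vertex `zero`.
  uncontract-series : ∀ f → e ≢ f → W ∋ 𝟙 e ⊕ 𝟙 f → Graphical Avoid → Graphical W
  uncontract-series f e≢f Wef (v , G , h) = suc v , H , to ⸴ from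
    where
    u : V n
    u = 𝟙 e ⊕ 𝟙 f
    ue : u e ≡ true
    ue = cong₂ _xor_ (𝟙-refl e) (𝟙-≢ (e≢f ∘ sym))
    uf : u f ≡ true
    uf = cong₂ _xor_ (𝟙-≢ e≢f) (𝟙-refl f)
    u≢ : ∀ {i} → e ≢ i → f ≢ i → u i ≡ false
    u≢ p q = cong₂ _xor_ (𝟙-≢ p) (𝟙-≢ q)
    a = proj₁ (G f)
    b = proj₂ (G f)
    H : Graph (suc v) n
    H i with e Fin.≟ i | f Fin.≟ i
    ... | yes _ | _ = zero , suc b
    ... | no _ | yes _ = suc a , zero
    ... | no _ | no _ = suc (proj₁ (G i)) , suc (proj₂ (G i))
    He : ∀ T → δ H T e ≡ T zero xor T (suc b)
    He T with e Fin.≟ e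
    ... | yes _ = refl
    ... | no ¬p = ⊥-elim (¬p refl)
    Hf : ∀ T → δ H T f ≡ T (suc a) xor T zero
    Hf T with e Fin.≟ f | f Fin.≟ f
    ... | yes p | _ = ⊥-elim (e≢f p)
    ... | no _ | yes _ = refl
    ... | no _ | no ¬p = ⊥-elim (¬p refl)
    H≢ : ∀ T {i} → e ≢ i → f ≢ i → δ H T i ≡ δ G (T ∘ suc) i
    H≢ T {i} p q with e Fin.≟ i | f Fin.≟ i
    ... | yes r | _ = ⊥-elim (p r)
    ... | no _ | yes r = ⊥-elim (q r)
    ... | no _ | no _ = refl
    zap : ∀ x y {b} → b ≡ false → x xor (y ∧ b) ≡ x
    zap x y refl = trans (cong (x xor_) (Bool.∧-zeroʳ y)) (Bool.xor-identityʳ x)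
    keep : ∀ x y {b} → b ≡ true → x xor (y ∧ b) ≡ x xor y
    keep x y refl = cong (x xor_) (Bool.∧-identityʳ y)
    to : ∀ w → W ∋ w → Cut H ∋ w
    to w Ww = build (≐⇒ h _ (clear u Wef ue w Ww))
      where
      build : _ → _
      build (T , p) = T′ , eq
        where
        T′ : V (suc v)
        T′ = (w e xor T b) ◂ T
        eq : w ≈ δ H T′
        eq i = case (e Fin.≟ i) (f Fin.≟ i)
          where
          case : Dec (e ≡ i) → Dec (f ≡ i) → w i ≡ δ H T′ i
          case (yes refl) _ = sym (trans (He T′) (xor-cancelʳ (w e) (T b)))
          case (no _) (yes refl) = begin
            w f                             ≡⟨ sym (xor-cancelʳ (w f) (w e)) ⟩
            (w f xor w e) xor w e           ≡⟨ cong (_xor w e) (trans (sym (keep (w f) (w e) uf)) (p f)) ⟩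
            (T a xor T b) xor w e           ≡⟨ Bool.xor-assoc (T a) (T b) (w e) ⟩
            T a xor (T b xor w e)           ≡⟨ cong (T a xor_) (Bool.xor-comm (T b) (w e)) ⟩
            T a xor (w e xor T b)           ≡⟨ sym (Hf T′) ⟩
            δ H T′ f                        ∎
            where open ≡-Reasoning
          case (no e≢i) (no f≢i) = trans (sym (zap (w i) (w e) (u≢ e≢i f≢i))) (trans (p i) (sym (H≢ T′ e≢i f≢i)))
    from : ∀ w → Cut H ∋ w → W ∋ w
    from w (T , p) = build (≐⇐ h _ (T ∘ suc , λ _ → refl))
      where
      build : _ → _
      build (q , r) = resp≈ W eq (mem⊕ W q (mem-· W (w e) Wef))
        where
        eq : δ G (T ∘ suc) ⊕ w e · u ≈ w
        eq i = case (e Fin.≟ i) (f Fin.≟ i)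
          where
          case : Dec (e ≡ i) → Dec (f ≡ i) → (δ G (T ∘ suc) ⊕ w e · u) i ≡ w i
          case (yes refl) _ = trans (cong₂ (λ x y → x xor (w e ∧ y)) r ue) (Bool.∧-identityʳ (w e))
          case (no _) (yes refl) = begin
            (T (suc a) xor T (suc b)) xor (w e ∧ u f)              ≡⟨ keep (T (suc a) xor T (suc b)) (w e) uf ⟩
            (T (suc a) xor T (suc b)) xor w e                      ≡⟨ cong ((T (suc a) xor T (suc b)) xor_) (trans (p e) (trans (He T) (Bool.xor-comm (T zero) (T (suc b))))) ⟩
            (T (suc a) xor T (suc b)) xor (T (suc b) xor T zero)   ≡⟨ Bool.xor-assoc (T (suc a)) (T (suc b)) _ ⟩
            T (suc a) xor (T (suc b) xor (T (suc b) xor T zero))   ≡⟨ cong (T (suc a) xor_) (xor-cancelˡ (T (suc b)) (T zero)) ⟩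
            T (suc a) xor T zero                                   ≡⟨ sym (trans (p f) (Hf T)) ⟩
            w f                                                    ∎
            where open ≡-Reasoning
          case (no e≢i) (no f≢i) = trans (zap _ (w e) (u≢ e≢i f≢i)) (trans (sym (H≢ T e≢i f≢i)) (sym (p i)))

Avoid-Ext : ∀ {n} (Z : Space n) e {S} → S e ≡ false → Ext (Avoid Z e) S ≐ Avoid (Ext Z S) e
Avoid-Ext Z e {S} Se = (λ w (b , p , q) → (b , p) , trans (sym (lem w b)) q) ⸴ λ w ((b , p) , q) → b , p , trans (lem w b) q
  where
  lem : ∀ w b → w e xor (b ∧ S e) ≡ w e
  lem w b = trans (cong (λ x → w e xor (b ∧ x)) Se) (trans (cong (w e xor_) (Bool.∧-zeroʳ b)) (Bool.xor-identityʳ (w e)))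

-- Direct sums

module _ {n} (Z : Space n) (X Y : V n) (X⊓Y : ∀ e → X e ≡ true → Y e ≡ false)
         (sep : ∀ v → Z ∋ v → v ⊑ X ⊔ᵛ Y → Z ∋ v ⊓ X) where

  private
    X∪Y = X ⊔ᵛ Y

    part : ∀ {v} → v ⊑ X∪Y → v ≈ (v ⊓ X) ⊕ (v ⊓ Y)
    part {v} h e with v e in p | X e in q | Y e in r
    ... | false | _ | _ = refl
    ... | true | true | false = refl
    ... | true | false | true = refl
    ... | true | true | true = ⊥-elim (true≢false (trans (sym r) (X⊓Y e q)))
    ... | true | false | false = ⊥-elim (true≢false (trans (sym (h e p)) (cong₂ _∨_ q r)))

    sepY : ∀ v → Z ∋ v → v ⊑ X∪Y → Z ∋ v ⊓ Y
    sepY v Zv h = resp≈ Z (λ e → trans (cong (_xor (v ⊓ X) e) (part h e)) (lem ((v ⊓ X) e) ((v ⊓ Y) e))) (mem⊕ Z Zv (sep v Zv h))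
      where
      lem : ∀ a b → (a xor b) xor a ≡ b
      lem a b = trans (cong (_xor a) (Bool.xor-comm a b)) (xor-cancelʳ b a)

    -- A potential matters only up to a constant, so one of the two potentials may be normalised to
    -- match the other at the glued vertex.
    flipTo : ∀ {v} (T : V v) p b → ∃ λ (T′ : V v) → T′ p ≡ b × (∀ x y → T′ x xor T′ y ≡ T x xor T y)
    flipTo T p b = (λ x → T x xor (T p xor b)) , xor-cancelˡ (T p) b , λ x y → lem (T x) (T y) (T p xor b)
      where
      lem : ∀ x y c → (x xor c) xor (y xor c) ≡ x xor y
      lem x y c = trans (xor-interchange x c y c) (trans (cong ((x xor y) xor_) (Bool.xor-same c)) (Bool.xor-identityʳ _))

    module Sum {v₁ v₂} (G₁ : Graph v₁ n) (G₂ : Graph v₂ n) (h : Fin v₂ → Fin (v₁ +ℕ v₂)) where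
      G : Graph (v₁ +ℕ v₂) n
      G e with X e | Y e
      ... | true | _ = proj₁ (G₁ e) ↑ˡ v₂ , proj₂ (G₁ e) ↑ˡ v₂
      ... | false | true = h (proj₁ (G₂ e)) , h (proj₂ (G₂ e))
      ... | false | false = h (proj₁ (G₂ e)) , h (proj₁ (G₂ e))

      T₁ : V (v₁ +ℕ v₂) → V v₁
      T₁ T x = T (x ↑ˡ v₂)

      G-δ : ∀ T e → δ G T e ≡ ((δ G₁ (T₁ T) ⊓ X) ⊕ (δ G₂ (T ∘ h) ⊓ Y)) e
      G-δ T e with X e in q | Y e in r
      ... | true | true = ⊥-elim (true≢false (trans (sym r) (X⊓Y e q)))
      ... | true | false = sym (trans (cong₂ _xor_ (Bool.∧-identityʳ (δ G₁ (T₁ T) e)) (Bool.∧-zeroʳ (δ G₂ (T ∘ h) e))) (Bool.xor-identityʳ _))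
      ... | false | true = sym (cong₂ _xor_ (Bool.∧-zeroʳ (δ G₁ (T₁ T) e)) (Bool.∧-identityʳ (δ G₂ (T ∘ h) e)))
      ... | false | false = trans (Bool.xor-same (T (h (proj₁ (G₂ e))))) (sym (cong₂ _xor_ (Bool.∧-zeroʳ (δ G₁ (T₁ T) e)) (Bool.∧-zeroʳ (δ G₂ (T ∘ h) e))))

      cat : V v₁ → V v₂ → V (v₁ +ℕ v₂)
      cat T₁ T₂ x = [ T₁ , T₂ ]′ (splitAt v₁ x)

      cat-ˡ : ∀ T₁ T₂ x → cat T₁ T₂ (x ↑ˡ v₂) ≡ T₁ x
      cat-ˡ T₁ T₂ x = cong [ T₁ , T₂ ]′ (Fin.splitAt-↑ˡ v₁ x v₂)

      cat-ʳ : ∀ T₁ T₂ x → cat T₁ T₂ (v₁ ↑ʳ x) ≡ T₂ x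
      cat-ʳ T₁ T₂ x = cong [ T₁ , T₂ ]′ (Fin.splitAt-↑ʳ v₁ v₂ x)

    mem-⊓ : ∀ {w S} b → w ⊕ b · S ⊑ X∪Y → ∀ A → (w ⊕ b · S) ⊓ A ≈ (w ⊓ A) ⊕ b · (S ⊓ A)
    mem-⊓ {w} {S} b _ A e = trans (⊓-⊕ w (b · S) A e) (cong ((w ⊓ A) e xor_) (Bool.∧-assoc b (S e) (A e)))

    glue⊕ : ∀ {u v : V n} → u ⊑ X → v ⊑ Y → u ⊕ v ⊑ X∪Y
    glue⊕ {u} {v} p q e r with u e in a | v e in b
    ... | true | _ = cong (_∨ Y e) (p e a)
    ... | false | true = trans (cong (X e ∨_) (q e b)) (Bool.∨-zeroʳ (X e))

  -- gluing along p and q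
  NRep-sum : ∀ {S} → S ⊑ X ⊔ᵛ Y → NRep (Z ↾ X) (S ⊓ X) → NRep (Z ↾ Y) (S ⊓ Y) → NRep (Z ↾ (X ⊔ᵛ Y)) S
  NRep-sum {S} S⊑ (v₁ , G₁ , p₁ , q₁ , f₁ , g₁) (v₂ , G₂ , p₂ , q₂ , f₂ , g₂) =
    v₁ +ℕ v₂ , G , p₁ ↑ˡ v₂ , q₁ ↑ˡ v₂ , to , from
    where
    p≢q : p₂ ≢ q₂
    -- The vector `S ⊓ Y` has coefficient one, so some potential differs at `p₂` and `q₂`; without
    -- this the gluing map `h` would not be well defined.
    p≢q = λ { refl → true≢false (trans (sym (proj₁ (proj₂ rep))) (Bool.xor-same (proj₁ rep p₂))) }
      where rep = f₂ true (S ⊓ Y) (mem-0 (Z ↾ Y) λ i → Bool.xor-same ((S ⊓ Y) i))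
    h : Fin v₂ → Fin (v₁ +ℕ v₂)
    h x with x Fin.≟ p₂ | x Fin.≟ q₂
    ... | yes _ | _ = p₁ ↑ˡ v₂
    ... | no _ | yes _ = q₁ ↑ˡ v₂
    ... | no _ | no _ = v₁ ↑ʳ x
    open Sum G₁ G₂ h
    h-p : h p₂ ≡ p₁ ↑ˡ v₂
    h-p with p₂ Fin.≟ p₂
    ... | yes _ = refl
    ... | no ¬p = ⊥-elim (¬p refl)
    h-q : h q₂ ≡ q₁ ↑ˡ v₂
    h-q with q₂ Fin.≟ p₂ | q₂ Fin.≟ q₂
    ... | yes p | _ = ⊥-elim (p≢q (sym p))
    ... | no _ | yes _ = refl
    ... | no _ | no ¬p = ⊥-elim (¬p refl)
    to : ∀ b w → Z ↾ X∪Y ∋ w ⊕ b · S → ∃ λ T → T (p₁ ↑ˡ v₂) xor T (q₁ ↑ˡ v₂) ≡ b × w ≈ δ G T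
    to b w (Zw , w⊑) = build (f₁ b (w ⊓ X) (inX , ⊑-⊕ (⊓-⊑ʳ w X) (λ e p → ⊓-⊑ʳ S X e (⊓-⊑ʳ (λ _ → b) (S ⊓ X) e p))))
                             (f₂ b (w ⊓ Y) (inY , ⊑-⊕ (⊓-⊑ʳ w Y) (λ e p → ⊓-⊑ʳ S Y e (⊓-⊑ʳ (λ _ → b) (S ⊓ Y) e p))))
      where
      inX : Z ∋ (w ⊓ X) ⊕ b · (S ⊓ X)
      inX = resp≈ Z (mem-⊓ {w} {S} b w⊑ X) (sep _ Zw w⊑)
      inY : Z ∋ (w ⊓ Y) ⊕ b · (S ⊓ Y)
      inY = resp≈ Z (mem-⊓ {w} {S} b w⊑ Y) (sepY _ Zw w⊑)
      w⊑′ : w ⊑ X∪Y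
      w⊑′ = ⊑-respˡ (λ i → xor-cancelʳ (w i) (b ∧ S i)) (⊑-⊕ w⊑ (λ e p → S⊑ e (⊓-⊑ʳ (λ _ → b) S e p)))
      build : _ → _ → _
      build (T₁′ , b₁ , e₁) (T₂′ , b₂ , e₂) = go (flipTo T₂′ p₂ (T₁′ p₁))
        where
        go : _ → _
        go (T₂″ , atp , same) = T , trans (cong₂ _xor_ (cat-ˡ T₁′ T₂″ p₁) (cat-ˡ T₁′ T₂″ q₁)) b₁ , eq
          where
          T = cat T₁′ T₂″
          atq : T₂″ q₂ ≡ T₁′ q₁
          atq = xor≡false⇒≡ (trans (cong₂ _xor_ (sym (xor-cancelˡ (T₂″ p₂) (T₂″ q₂))) (sym (xor-cancelˡ (T₁′ p₁) (T₁′ q₁))))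
            (trans (cong₂ (λ x y → (x xor y) xor (T₁′ p₁ xor (T₁′ p₁ xor T₁′ q₁))) atp (trans (same p₂ q₂) (trans b₂ (sym b₁)))) (Bool.xor-same (T₁′ p₁ xor (T₁′ p₁ xor T₁′ q₁)))))
          T-h : ∀ x → T (h x) ≡ T₂″ x
          T-h x = case (x Fin.≟ p₂) (x Fin.≟ q₂)
            where
            case : Dec (x ≡ p₂) → Dec (x ≡ q₂) → T (h x) ≡ T₂″ x
            case (yes refl) _ = trans (cong T h-p) (trans (cat-ˡ T₁′ T₂″ p₁) (sym atp))
            case (no _) (yes refl) = trans (cong T h-q) (trans (cat-ˡ T₁′ T₂″ q₁) (sym atq))
            case (no x≢p) (no x≢q) = trans (cong T (h-else x≢p x≢q)) (cat-ʳ T₁′ T₂″ x)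
              where
              h-else : x ≢ p₂ → x ≢ q₂ → h x ≡ v₁ ↑ʳ x
              h-else a b with x Fin.≟ p₂ | x Fin.≟ q₂
              ... | yes p | _ = ⊥-elim (a p)
              ... | no _ | yes q = ⊥-elim (b q)
              ... | no _ | no _ = refl
          eq : w ≈ δ G T
          eq e = trans (part w⊑′ e) (trans (cong₂ _xor_ left right) (sym (G-δ T e)))
            where
            left : (w ⊓ X) e ≡ (δ G₁ (T₁ T) ⊓ X) e
            left = trans (sym (⊑⇒⊓ (⊓-⊑ʳ w X) e)) (cong (_∧ X e) (trans (e₁ e) (sym (cong₂ _xor_ (cat-ˡ T₁′ T₂″ _) (cat-ˡ T₁′ T₂″ _)))))
            right : (w ⊓ Y) e ≡ (δ G₂ (T ∘ h) ⊓ Y) e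
            right = trans (sym (⊑⇒⊓ (⊓-⊑ʳ w Y) e)) (cong (_∧ Y e) (trans (e₂ e) (trans (sym (same _ _)) (sym (cong₂ _xor_ (T-h _) (T-h _))))))
    from : ∀ T → Z ↾ X∪Y ∋ δ G T ⊕ (T (p₁ ↑ˡ v₂) xor T (q₁ ↑ˡ v₂)) · S
    from T = build (g₁ (T₁ T)) (g₂ (T ∘ h))
      where
      b = T (p₁ ↑ˡ v₂) xor T (q₁ ↑ˡ v₂)
      build : _ → _ → _
      build (z₁ , s₁) (z₂ , s₂) = resp≈ (Z ↾ X∪Y) eq (mem⊕ Z z₁ z₂ , glue⊕ s₁ s₂)
        where
        b₂ : T (h p₂) xor T (h q₂) ≡ b
        b₂ = cong₂ (λ x y → T x xor T y) h-p h-q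
        mask : ∀ (u : V n) A c e → (u ⊕ c · (S ⊓ A)) ⊑ A → (u ⊕ c · (S ⊓ A)) e ≡ (u ⊓ A) e xor (c ∧ (S ⊓ A) e)
        mask u A c e h with A e in q
        ... | true = cong (_xor (c ∧ (S e ∧ true))) (sym (Bool.∧-identityʳ (u e)))
        ... | false = trans (trans (cong (λ a → u e xor (c ∧ (S e ∧ a))) (sym q)) (⊑-false h q)) (sym (trans (cong₂ _xor_ (Bool.∧-zeroʳ (u e))
              (trans (cong (c ∧_) (Bool.∧-zeroʳ (S e))) (Bool.∧-zeroʳ c))) refl))
        eq : (δ G₁ (T₁ T) ⊕ b · (S ⊓ X)) ⊕ (δ G₂ (T ∘ h) ⊕ (T (h p₂) xor T (h q₂)) · (S ⊓ Y)) ≈ δ G T ⊕ b · S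
        eq e = trans (cong₂ _xor_ (mask (δ G₁ (T₁ T)) X b e s₁) (mask (δ G₂ (T ∘ h)) Y (T (h p₂) xor T (h q₂)) e s₂))
              (trans (cong (λ c → ((δ G₁ (T₁ T) ⊓ X) e xor (b ∧ (S ⊓ X) e)) xor ((δ G₂ (T ∘ h) ⊓ Y) e xor (c ∧ (S ⊓ Y) e))) b₂)
              (trans (xor-interchange ((δ G₁ (T₁ T) ⊓ X) e) (b ∧ (S ⊓ X) e) ((δ G₂ (T ∘ h) ⊓ Y) e) (b ∧ (S ⊓ Y) e))
              (cong₂ _xor_ (sym (G-δ T e)) (trans (sym (Bool.∧-distribˡ-xor b ((S ⊓ X) e) ((S ⊓ Y) e))) (cong (b ∧_) (sym (part S⊑ e)))))))

  -- When `S` lies in one summand nothing links the two graphs, and `h` is the inclusion into their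
  -- disjoint union.
  graphical-sum : ∀ {S} → S ⊑ X → Graphical (Ext (Z ↾ X) S) → Graphical (Z ↾ Y) → Graphical (Ext (Z ↾ (X ⊔ᵛ Y)) S)
  graphical-sum {S} S⊑X (v₁ , G₁ , i₁) (v₂ , G₂ , i₂) = v₁ +ℕ v₂ , G , to ⸴ from
    where
    open Sum G₁ G₂ (v₁ ↑ʳ_)
    S⊑Y : ∀ b → (w : V n) → (w ⊕ b · S) ⊓ Y ≈ w ⊓ Y
    S⊑Y b w e with Y e in q
    ... | false = trans (Bool.∧-zeroʳ _) (sym (Bool.∧-zeroʳ (w e)))
    ... | true = cong (_∧ true) (trans (cong (λ s → w e xor (b ∧ s)) (≢true⇒false λ r → true≢false (trans (sym q) (X⊓Y e (S⊑X e r)))))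
                   (trans (cong (w e xor_) (Bool.∧-zeroʳ b)) (Bool.xor-identityʳ (w e))))
    S⊑XY : S ⊑ X∪Y
    S⊑XY e p = cong (_∨ Y e) (S⊑X e p)
    to : ∀ w → Ext (Z ↾ X∪Y) S ∋ w → Cut G ∋ w
    to w (b , Zw , w⊑) = build (≐⇒ i₁ (w ⊓ X) (b , inX , ⊑-⊕ (⊓-⊑ʳ w X) (λ e p → S⊑X e (⊓-⊑ʳ (λ _ → b) S e p))))
                               (≐⇒ i₂ (w ⊓ Y) (resp≈ Z (S⊑Y b w) (sepY _ Zw w⊑) , ⊓-⊑ʳ w Y))
      where
      inX : Z ∋ (w ⊓ X) ⊕ b · S
      inX = resp≈ Z (λ e → trans (mem-⊓ {w} {S} b w⊑ X e) (cong (λ s → (w ⊓ X) e xor (b ∧ s)) (⊑⇒⊓ S⊑X e))) (sep _ Zw w⊑)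
      w⊑′ : w ⊑ X∪Y
      w⊑′ = ⊑-respˡ (λ i → xor-cancelʳ (w i) (b ∧ S i)) (⊑-⊕ w⊑ (λ e p → S⊑XY e (⊓-⊑ʳ (λ _ → b) S e p)))
      build : _ → _ → _
      build (T₁′ , e₁) (T₂′ , e₂) = T , λ e → trans (part w⊑′ e) (trans (cong₂ _xor_ (left e) (right e)) (sym (G-δ T e)))
        where
        T = cat T₁′ T₂′
        left : ∀ e → (w ⊓ X) e ≡ (δ G₁ (T₁ T) ⊓ X) e
        left e = trans (sym (⊑⇒⊓ (⊓-⊑ʳ w X) e)) (cong (_∧ X e) (trans (e₁ e) (sym (cong₂ _xor_ (cat-ˡ T₁′ T₂′ _) (cat-ˡ T₁′ T₂′ _)))))
        right : ∀ e → (w ⊓ Y) e ≡ (δ G₂ (T ∘ (v₁ ↑ʳ_)) ⊓ Y) e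
        right e = trans (sym (⊑⇒⊓ (⊓-⊑ʳ w Y) e)) (cong (_∧ Y e) (trans (e₂ e) (sym (cong₂ _xor_ (cat-ʳ T₁′ T₂′ _) (cat-ʳ T₁′ T₂′ _)))))
    from : ∀ w → Cut G ∋ w → Ext (Z ↾ X∪Y) S ∋ w
    from w (T , w≈) = build (≐⇐ i₁ (δ G₁ (T₁ T)) (T₁ T , λ _ → refl)) (≐⇐ i₂ (δ G₂ (T ∘ (v₁ ↑ʳ_))) (T ∘ (v₁ ↑ʳ_) , λ _ → refl))
      where
      build : _ → _ → _
      build (b , z₁ , s₁) (z₂ , s₂) = b , resp≈ (Z ↾ X∪Y) eq (mem⊕ Z z₁ z₂ , glue⊕ s₁ s₂)
        where
        D₁ = δ G₁ (T₁ T)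
        D₂ = δ G₂ (T ∘ (v₁ ↑ʳ_))
        D₁⊑ : D₁ ⊑ X
        D₁⊑ = ⊑-respˡ (λ i → xor-cancelʳ (D₁ i) (b ∧ S i)) (⊑-⊕ s₁ (λ e p → S⊑X e (⊓-⊑ʳ (λ _ → b) S e p)))
        eq : (D₁ ⊕ b · S) ⊕ D₂ ≈ w ⊕ b · S
        eq e = trans (cong (_xor D₂ e) (Bool.xor-comm (D₁ e) (b ∧ S e))) (trans (Bool.xor-assoc (b ∧ S e) (D₁ e) (D₂ e)) (trans (Bool.xor-comm (b ∧ S e) _)
              (cong (_xor (b ∧ S e)) (trans (cong₂ _xor_ (sym (⊑⇒⊓ D₁⊑ e)) (sym (⊑⇒⊓ s₂ e))) (trans (sym (G-δ T e)) (sym (w≈ e)))))))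

Least : ∀ {n} → (Fin n → ℕ) → V n → Set
Least f Q = ∃ λ z → Q z ≡ true × (∀ y → Q y ≡ true → f z ≤ f y)

argmin : ∀ {n} (f : Fin n → ℕ) (Q : V n) → Least f Q ⊎ (Q ≈ 0ᵛ)
argmin {zero} f Q = inj₂ λ ()
argmin {suc n} f Q = step (Q zero) refl (argmin (f ∘ suc) (Q ∘ suc))
  where
  step : ∀ b → Q zero ≡ b → Least (f ∘ suc) (Q ∘ suc) ⊎ (Q ∘ suc ≈ 0ᵛ) → Least f Q ⊎ (Q ≈ 0ᵛ)
  step false q0 (inj₂ h) = inj₂ λ { zero → q0 ; (suc i) → h i }
  step false q0 (inj₁ (z , qz , m)) = inj₁ (suc z , qz , λ { zero p → ⊥-elim (true≢false (trans (sym p) q0)) ; (suc y) p → m y p })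
  step true q0 (inj₂ h) = inj₁ (zero , q0 , λ { zero p → ℕ.≤-refl ; (suc y) p → ⊥-elim (true≢false (trans (sym p) (h y))) })
  step true q0 (inj₁ (z , qz , m)) with ℕ.≤-total (f zero) (f (suc z))
  ... | inj₁ l = inj₁ (zero , q0 , λ { zero p → ℕ.≤-refl ; (suc y) p → ℕ.≤-trans l (m y p) })
  ... | inj₂ l = inj₁ (suc z , qz , λ { zero p → l ; (suc y) p → m y p })

-- The elements outside a spanning circuit C correspond to bipartitions {P x, C − P x} of C.  If these are
-- pairwise non-crossing they form a tree; the graph is this tree together with an apex, which is split
-- into p and q according to S.
module Chords {n} (Z : Space n) (C Ch : V n) (P : Fin n → V n)
  (ZC : Z ∋ C) (circ : ∀ v → Z ∋ v → v ⊑ C → v ≈ 0ᵛ ⊎ v ≈ C)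
  (Ch∌C : ∀ e → Ch e ≡ true → C e ≡ false)
  (P⊑ : ∀ x → Ch x ≡ true → P x ⊑ C)
  (ZP : ∀ x → Ch x ≡ true → Z ∋ P x ⊕ 𝟙 x)
  where

  X : V n
  X = C ⊔ᵛ Ch

  Sum : V n → V n → Bool
  Sum Q w = Σ₂ λ y → Q y ∧ w y

  Sum-0 : ∀ {Q} → Q ≈ 0ᵛ → ∀ w → Sum Q w ≡ false
  Sum-0 h w = Σ₂-0 λ y → cong (_∧ w y) (h y)

  -- The sum of the members `P x ⊕ 𝟙 x` over the chords `x` in `w`: it agrees with `w` on the chords
  -- and differs from zero elsewhere only on `C`.
  comb : V n → V n
  comb w = lin w (λ x → Ch x · (P x ⊕ 𝟙 x))

  comb∈ : ∀ w → Z ∋ comb w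
  comb∈ w = lin-mem Z (λ x → Ch x · (P x ⊕ 𝟙 x)) mem-row w
    where
    mem-row : ∀ x → Z ∋ Ch x · (P x ⊕ 𝟙 x)
    mem-row x with Ch x in eq
    ... | true = ZP x eq
    ... | false = mem0 Z

  Qc : Fin n → V n
  Qc c y = Ch y ∧ P y c

  P-∉C : ∀ x → Ch x ≡ true → ∀ {e} → C e ≡ false → P x e ≡ false
  P-∉C x cx = ⊑-false (P⊑ x cx)

  comb-C : ∀ w c → C c ≡ true → comb w c ≡ Sum (Qc c) w
  comb-C w c Cc = Σ₂-cong term
    where
    term : ∀ x → w x ∧ (Ch x ∧ (P x c xor 𝟙 x c)) ≡ (Ch x ∧ P x c) ∧ w x
    term x with Ch x in eq
    ... | false = Bool.∧-zeroʳ (w x)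
    ... | true = trans (cong (λ b → w x ∧ (P x c xor b)) (𝟙-≢ λ p → true≢false (trans (sym Cc) (trans (cong C (sym p)) (Ch∌C x eq)))))
                   (trans (cong (w x ∧_) (Bool.xor-identityʳ (P x c))) (Bool.∧-comm (w x) (P x c)))

  comb-else : ∀ w e → C e ≡ false → comb w e ≡ Ch e ∧ w e
  comb-else w e Ce = trans (Σ₂-single e other) at
    where
    other : ∀ x → x ≢ e → w x ∧ (Ch x ∧ (P x e xor 𝟙 x e)) ≡ false
    other x x≢e with Ch x in eq
    ... | false = Bool.∧-zeroʳ (w x)
    ... | true = trans (cong₂ (λ a b → w x ∧ (a xor b)) (P-∉C x eq Ce) (𝟙-≢ x≢e)) (Bool.∧-zeroʳ (w x))
    at : w e ∧ (Ch e ∧ (P e e xor 𝟙 e e)) ≡ Ch e ∧ w e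
    at with Ch e in eq
    ... | false = Bool.∧-zeroʳ (w e)
    ... | true = trans (cong₂ (λ a b → w e ∧ (a xor b)) (P-∉C e eq Ce) (𝟙-refl e)) (Bool.∧-identityʳ (w e))

  ∉X : ∀ {e} → C e ≡ false → Ch e ≡ false → X e ≡ false
  ∉X p q = cong₂ _∨_ p q

  comb⊑ : ∀ w → comb w ⊑ X
  comb⊑ w e p with C e in q
  ... | true = refl
  ... | false with Ch e in r
  ...   | true = refl
  ...   | false = trans (sym (cong (_∧ w e) r)) (trans (sym (comb-else w e q)) p)

  ⊕comb⊑ : ∀ {w} → w ⊑ X → w ⊕ comb w ⊑ C
  ⊕comb⊑ {w} w⊑ e p with C e in q
  ... | true = refl
  ... | false = trans (sym (trans (cong (w e xor_) (trans (comb-else w e q) (Ch∧ (Ch e) refl))) (Bool.xor-same (w e)))) p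
    where
    Ch∧ : ∀ b → Ch e ≡ b → Ch e ∧ w e ≡ w e
    Ch∧ true r = cong (_∧ w e) r
    Ch∧ false r = trans (cong (_∧ w e) r) (sym (⊑-false w⊑ (∉X q r)))

  -- The vector `w ⊕ comb w` lives on the circuit `C`, so it is zero or `C`; the bit `t` tells
  -- which.
  member⇒ : ∀ w → Z ↾ X ∋ w → ∃ λ t → ∀ c → C c ≡ true → w c ≡ t xor Sum (Qc c) w
  member⇒ w (Zw , w⊑) with circ (w ⊕ comb w) (mem⊕ Z Zw (comb∈ w)) (⊕comb⊑ w⊑)
  ... | inj₁ h = false , λ c Cc → trans (xor≡false⇒≡ (h c)) (comb-C w c Cc)
  ... | inj₂ h = true , λ c Cc → trans (sym (xor-cancelʳ (w c) (comb w c))) (cong₂ _xor_ (trans (h c) Cc) (comb-C w c Cc))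

  member⇐ : ∀ w t → w ⊑ X → (∀ c → C c ≡ true → w c ≡ t xor Sum (Qc c) w) → Z ↾ X ∋ w
  member⇐ w t w⊑ h = resp≈ Z eq (mem⊕ Z (mem-· Z t ZC) (comb∈ w)) , w⊑
    where
    eq : t · C ⊕ comb w ≈ w
    eq e with C e in q
    ... | true = trans (cong₂ _xor_ (Bool.∧-identityʳ t) (comb-C w e q)) (sym (h e q))
    ... | false = trans (cong₂ _xor_ (Bool.∧-zeroʳ t) (comb-else w e q)) (Ch∧ (Ch e) refl)
      where
      Ch∧ : ∀ b → Ch e ≡ b → Ch e ∧ w e ≡ w e
      Ch∧ true r = cong (_∧ w e) r
      Ch∧ false r = trans (cong (_∧ w e) r) (sym (⊑-false w⊑ (∉X q r)))

  module Laminar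
    (P-nz : ∀ x → Ch x ≡ true → Nz (P x))
    (P-inj : ∀ x y → Ch x ≡ true → Ch y ≡ true → P x ≈ P y → x ≡ y)
    (laminar : ∀ x y → Ch x ≡ true → Ch y ≡ true → P x ⊑ P y ⊎ P y ⊑ P x ⊎ (∀ e → P x e ≡ true → P y e ≡ false))
    where

    Q≤ Q< : Fin n → V n
    Q≤ x y = Ch y ∧ ⌊ ⊑? (P x) (P y) ⌋
    Q< x y = not (𝟙 x y) ∧ Q≤ x y

    true-dec : ∀ {A : Set} (d : Dec A) → ⌊ d ⌋ ≡ true → A
    true-dec (yes a) _ = a

    ∧-elim : ∀ {a b} → a ∧ b ≡ true → a ≡ true × b ≡ true
    ∧-elim {true} {true} _ = refl , refl

    Q≤-elim : ∀ {x y} → Q≤ x y ≡ true → Ch y ≡ true × P x ⊑ P y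
    Q≤-elim {x} {y} p = proj₁ (∧-elim {Ch y} p) , true-dec (⊑? (P x) (P y)) (proj₂ (∧-elim {Ch y} p))

    Q≤-intro : ∀ {x y} → Ch y ≡ true → P x ⊑ P y → Q≤ x y ≡ true
    Q≤-intro {x} {y} p q = cong₂ _∧_ p (dec-true (⊑? (P x) (P y)) q)

    Q<-elim : ∀ {x y} → Q< x y ≡ true → x ≢ y × Ch y ≡ true × P x ⊑ P y
    Q<-elim {x} {y} p = (λ q → true≢false (trans (sym (proj₁ (∧-elim {not (𝟙 x y)} p))) (trans (cong (λ z → not (𝟙 x z)) (sym q)) (cong not (𝟙-refl x)))))
      , Q≤-elim (proj₂ (∧-elim {not (𝟙 x y)} p))

    Q<-intro : ∀ {x y} → x ≢ y → Ch y ≡ true → P x ⊑ P y → Q< x y ≡ true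
    Q<-intro p q r = cong₂ _∧_ (cong not (𝟙-≢ p)) (Q≤-intro q r)

    bool-≡ : ∀ {a b} → (a ≡ true → b ≡ true) → (b ≡ true → a ≡ true) → a ≡ b
    bool-≡ {true} {b} f g = sym (f refl)
    bool-≡ {false} {true} f g = g refl
    bool-≡ {false} {false} f g = refl

    -- a family of chord sets closed upwards and containing a common point is the set above its minimum
    record Chain (Q : V n) : Set where
      field
        ch : ∀ y → Q y ≡ true → Ch y ≡ true
        point : Fin n
        point∈ : ∀ y → Q y ≡ true → P y point ≡ true
        up : ∀ z y → Q z ≡ true → Ch y ≡ true → P z ⊑ P y → Q y ≡ true

    -- Sides with a common point cannot be disjoint, so laminarity makes them nested and one of
    -- least size lies below all others.
    chain-min : ∀ {Q} → Chain Q → ∀ z → Q z ≡ true → (∀ y → Q y ≡ true → ∥ P z ∥ ≤ ∥ P y ∥) → Q ≈ Q≤ z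
    chain-min {Q} c z Qz m y = bool-≡ f g
      where
      open Chain c
      g : Q≤ z y ≡ true → Q y ≡ true
      g p = up z y Qz (proj₁ (Q≤-elim {z} {y} p)) (proj₂ (Q≤-elim {z} {y} p))
      f : Q y ≡ true → Q≤ z y ≡ true
      f Qy with laminar z y (ch z Qz) (ch y Qy)
      ... | inj₁ p = Q≤-intro {z} {y} (ch y Qy) p
      ... | inj₂ (inj₁ p) = Q≤-intro {z} {y} (ch y Qy) λ e r → trans (⊑-≥⇒≈ p (m y Qy) e) r
      ... | inj₂ (inj₂ d) = ⊥-elim (true≢false (trans (sym (point∈ y Qy)) (d point (point∈ z Qz))))

    Qc-chain : ∀ c → Chain (Qc c)
    Qc-chain c = record { ch = λ y p → proj₁ (∧-elim {Ch y} p) ; point = c ; point∈ = λ y p → proj₂ (∧-elim {Ch y} p)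
      ; up = λ z y p q r → cong₂ _∧_ q (r c (proj₂ (∧-elim {Ch z} p))) }

    Q<-chain : ∀ x → Ch x ≡ true → Chain (Q< x)
    Q<-chain x cx = record
      { ch = λ y p → proj₁ (proj₂ (Q<-elim {x} {y} p))
      ; point = proj₁ (P-nz x cx)
      ; point∈ = λ y p → proj₂ (proj₂ (Q<-elim {x} {y} p)) _ (proj₂ (P-nz x cx))
      ; up = λ z y p q r → Q<-intro {x} {y} (λ { refl → proj₁ (Q<-elim {x} {z} p)
               (P-inj x z cx (proj₁ (proj₂ (Q<-elim {x} {z} p))) (⊑-antisym (proj₂ (proj₂ (Q<-elim {x} {z} p))) r)) }) q
               (⊑-trans (proj₂ (proj₂ (Q<-elim {x} {z} p))) r) }

    Q≤-split : ∀ x → Ch x ≡ true → ∀ w → Sum (Q≤ x) w ≡ w x xor Sum (Q< x) w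
    Q≤-split x cx w = trans (Σ₂-cong term) (trans (Σ₂-⊕ (λ y → 𝟙 x y ∧ w y) (λ y → Q< x y ∧ w y)) (cong (_xor Sum (Q< x) w) (⟨⟩-𝟙 x w)))
      where
      term : ∀ y → Q≤ x y ∧ w y ≡ (𝟙 x y ∧ w y) xor (Q< x y ∧ w y)
      term y with x Fin.≟ y
      ... | yes refl = trans (cong (_∧ w x) (Q≤-intro {x} {x} cx λ _ p → p)) (sym (Bool.xor-identityʳ (w x)))
      ... | no _ = refl

    Vertex : Set
    Vertex = Fin (suc (suc (suc n)))

    p q root : Vertex
    p = zero
    q = suc zero
    root = suc (suc zero)

    node : Fin n → Vertex
    node x = suc (suc (suc x))

    vertexOf : ∀ {Q : V n} → Least (λ y → ∥ P y ∥) Q ⊎ (Q ≈ 0ᵛ) → Vertex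
    vertexOf (inj₁ (z , _)) = node z
    vertexOf (inj₂ _) = root

    parent : V n → Vertex
    parent Q = vertexOf (argmin (λ y → ∥ P y ∥) Q)

    -- a potential that increases by w along the tree edges
    Additive : V (suc (suc (suc n))) → V n → Set
    Additive T w = ∀ x → Ch x ≡ true → T (node x) ≡ T root xor Sum (Q≤ x) w

    parent-T : ∀ {T w} → Additive T w → ∀ {Q} → Chain Q → T (parent Q) ≡ T root xor Sum Q w
    parent-T {T} {w} add {Q} c with argmin (λ y → ∥ P y ∥) Q
    ... | inj₁ (z , Qz , m) = trans (add z (Chain.ch c z Qz)) (cong (T root xor_) (Σ₂-cong λ y → cong (_∧ w y) (sym (chain-min c z Qz m y))))
    ... | inj₂ h = sym (trans (cong (T root xor_) (Sum-0 h w)) (Bool.xor-identityʳ (T root)))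

    module _ (S : V n) (S⊑ : S ⊑ C) where

      apex : Bool → Vertex
      apex true = q
      apex false = p

      -- Each chord owns a node, joined to the node of the next larger side or to the root. An
      -- element of `C` runs from the smallest side containing it to the apex, which is split into
      -- `p` and `q` according to `S`.
      G : Graph (suc (suc (suc n))) n
      G e = if C e then (parent (Qc e) , apex (S e)) else (if Ch e then (node e , parent (Q< e)) else (p , p))

      G-C : ∀ e → C e ≡ true → ∀ T → δ G T e ≡ T (parent (Qc e)) xor T (apex (S e))
      G-C e r T rewrite r = refl

      G-Ch : ∀ e → Ch e ≡ true → ∀ T → δ G T e ≡ T (node e) xor T (parent (Q< e))
      G-Ch e r T rewrite Ch∌C e r | r = refl

      G-else : ∀ e → C e ≡ false → Ch e ≡ false → ∀ T → δ G T e ≡ false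
      G-else e r s T rewrite r | s = Bool.xor-same (T p)

      S-Ch : ∀ e → Ch e ≡ true → S e ≡ false
      S-Ch e r = ⊑-false S⊑ (Ch∌C e r)

      Sum-S : ∀ b w Q → (∀ y → Q y ≡ true → Ch y ≡ true) → Sum Q (w ⊕ b · S) ≡ Sum Q w
      Sum-S b w Q h = Σ₂-cong term
        where
        term : ∀ y → Q y ∧ (w y xor (b ∧ S y)) ≡ Q y ∧ w y
        term y with Q y in r
        ... | false = refl
        ... | true = trans (cong (λ s → w y xor (b ∧ s)) (S-Ch y (h y r))) (trans (cong (w y xor_) (Bool.∧-zeroʳ b)) (Bool.xor-identityʳ (w y)))

      apex-T : ∀ (T : V (suc (suc (suc n)))) s → T (apex s) ≡ T p xor ((T p xor T q) ∧ s)
      apex-T T false = sym (trans (cong (T p xor_) (Bool.∧-zeroʳ (T p xor T q))) (Bool.xor-identityʳ (T p)))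
      apex-T T true = sym (trans (cong (T p xor_) (Bool.∧-identityʳ (T p xor T q))) (xor-cancelˡ (T p) (T q)))

      rep : NRep (Z ↾ X) S
      rep = suc (suc (suc n)) , G , p , q , to , from
        where
        to : ∀ b w → Z ↾ X ∋ w ⊕ b · S → ∃ λ T → T p xor T q ≡ b × w ≈ δ G T
        to b w h@(_ , ⊑X) = build (member⇒ (w ⊕ b · S) h)
          where
          build : (∃ λ t → ∀ c → C c ≡ true → (w ⊕ b · S) c ≡ t xor Sum (Qc c) (w ⊕ b · S)) →
                  ∃ λ T → T p xor T q ≡ b × w ≈ δ G T
          build (t , eqn) = T , refl , eq
            where
            T : V (suc (suc (suc n)))
            T zero = false
            T (suc zero) = b
            T (suc (suc zero)) = t
            T (suc (suc (suc x))) = t xor Sum (Q≤ x) w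
            add : Additive T w
            add x _ = refl
            eq : w ≈ δ G T
            eq e = case (C e) refl (Ch e) refl
              where
              case : ∀ a → C e ≡ a → ∀ b′ → Ch e ≡ b′ → w e ≡ δ G T e
              case true r _ _ = sym (begin
                δ G T e                                    ≡⟨ G-C e r T ⟩
                T (parent (Qc e)) xor T (apex (S e))       ≡⟨ cong₂ _xor_ (parent-T {T} {w} add (Qc-chain e)) (apex-T T (S e)) ⟩
                (t xor Sum (Qc e) w) xor (b ∧ S e)         ≡⟨ cong (λ x → (t xor x) xor (b ∧ S e)) (sym (Sum-S b w (Qc e) (Chain.ch (Qc-chain e)))) ⟩
                (t xor Sum (Qc e) (w ⊕ b · S)) xor (b ∧ S e) ≡⟨ cong (_xor (b ∧ S e)) (sym (eqn e r)) ⟩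
                (w e xor (b ∧ S e)) xor (b ∧ S e)          ≡⟨ xor-cancelʳ (w e) (b ∧ S e) ⟩
                w e                                        ∎)
                where open ≡-Reasoning
              case false r true s = sym (begin
                δ G T e                                           ≡⟨ G-Ch e s T ⟩
                T (node e) xor T (parent (Q< e))                  ≡⟨ cong₂ _xor_ (cong (t xor_) (Q≤-split e s w)) (parent-T {T} {w} add (Q<-chain e s)) ⟩
                (t xor (w e xor Sum (Q< e) w)) xor (t xor Sum (Q< e) w) ≡⟨ xor-interchange t (w e xor Sum (Q< e) w) t (Sum (Q< e) w) ⟩
                (t xor t) xor ((w e xor Sum (Q< e) w) xor Sum (Q< e) w) ≡⟨ cong₂ _xor_ (Bool.xor-same t) (xor-cancelʳ (w e) (Sum (Q< e) w)) ⟩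
                w e                                               ∎)
                where open ≡-Reasoning
              case false r false s = trans (sym (trans (cong (λ x → w e xor (b ∧ x)) (⊑-false S⊑ r)) (trans (cong (w e xor_) (Bool.∧-zeroʳ b)) (Bool.xor-identityʳ (w e)))))
                (trans (⊑-false ⊑X (∉X r s)) (sym (G-else e r s T)))
        from : ∀ T → Z ↾ X ∋ δ G T ⊕ (T p xor T q) · S
        from T = member⇐ (w ⊕ b · S) (T root xor T p) ⊑X eqn
          where
          w = δ G T
          b = T p xor T q
          ⊑X : w ⊕ b · S ⊑ X
          ⊑X e h = ≢false⇒true λ r → true≢false (trans (sym h) (trans (cong₂ (λ x y → x xor (b ∧ y))
              (G-else e (∨-false₁ r) (∨-false₂ {C e} r) T) (⊑-false S⊑ (∨-false₁ r))) (Bool.∧-zeroʳ b)))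
          -- Induction from larger sides to smaller ones: the parent of a chord has a strictly
          -- larger side, and no side exceeds `n`.
          add-fuel : ∀ m x → n ≤ ∥ P x ∥ +ℕ m → Ch x ≡ true → T (node x) ≡ T root xor Sum (Q≤ x) w
          add-fuel m x le cx = trans lem (trans (cong (w x xor_) (par (argmin (λ y → ∥ P y ∥) (Q< x)) refl)) (trans (rot (w x) (T root) (Sum (Q< x) w)) (cong (T root xor_) (sym (Q≤-split x cx w)))))
            where
            rot : ∀ a b c → a xor (b xor c) ≡ b xor (a xor c)
            rot a b c = trans (sym (Bool.xor-assoc a b c)) (trans (cong (_xor c) (Bool.xor-comm a b)) (Bool.xor-assoc b a c))
            lem : T (node x) ≡ w x xor T (parent (Q< x))
            lem = sym (trans (cong (_xor T (parent (Q< x))) (G-Ch x cx T)) (xor-cancelʳ (T (node x)) (T (parent (Q< x)))))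
            par : ∀ a → argmin (λ y → ∥ P y ∥) (Q< x) ≡ a → T (vertexOf a) ≡ T root xor Sum (Q< x) w
            par (inj₂ h) _ = sym (trans (cong (T root xor_) (Sum-0 h w)) (Bool.xor-identityʳ (T root)))
            par (inj₁ (z , Qz , mz)) _ = trans (up m le) (cong (T root xor_) (Σ₂-cong λ y → cong (_∧ w y) (sym (chain-min (Q<-chain x cx) z Qz mz y))))
              where
              x≢z = proj₁ (Q<-elim {x} {z} Qz)
              cz = proj₁ (proj₂ (Q<-elim {x} {z} Qz))
              x⊑z = proj₂ (proj₂ (Q<-elim {x} {z} Qz))
              lt : ∥ P x ∥ < ∥ P z ∥
              lt with ℕ.<-≤-connex ∥ P x ∥ ∥ P z ∥
              ... | inj₁ l = l
              ... | inj₂ l = ⊥-elim (x≢z (P-inj x z cx cz (⊑-≥⇒≈ x⊑z l)))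
              up : ∀ m → n ≤ ∥ P x ∥ +ℕ m → T (node z) ≡ T root xor Sum (Q≤ z) w
              up zero le = ⊥-elim (ℕ.<⇒≱ lt (ℕ.≤-trans (∥∥≤n (P z)) (ℕ.≤-trans le (ℕ.≤-reflexive (ℕ.+-identityʳ _)))))
              up (suc m) le = add-fuel m z (ℕ.≤-trans le (ℕ.≤-trans (ℕ.≤-reflexive (ℕ.+-suc _ m)) (ℕ.+-monoˡ-≤ m lt))) cz
          add : Additive T w
          add x cx = add-fuel n x (ℕ.m≤n+m n _) cx
          eqn : ∀ c → C c ≡ true → (w ⊕ b · S) c ≡ (T root xor T p) xor Sum (Qc c) (w ⊕ b · S)
          eqn c r = begin
            δ G T c xor (b ∧ S c)                                                  ≡⟨ cong (_xor (b ∧ S c)) (trans (G-C c r T) (cong₂ _xor_ (parent-T {T} {w} add (Qc-chain c)) (apex-T T (S c)))) ⟩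
            ((T root xor Sum (Qc c) w) xor (T p xor (b ∧ S c))) xor (b ∧ S c)      ≡⟨ cong (_xor (b ∧ S c)) (sym (Bool.xor-assoc (T root xor Sum (Qc c) w) (T p) (b ∧ S c))) ⟩
            (((T root xor Sum (Qc c) w) xor T p) xor (b ∧ S c)) xor (b ∧ S c)      ≡⟨ xor-cancelʳ ((T root xor Sum (Qc c) w) xor T p) (b ∧ S c) ⟩
            (T root xor Sum (Qc c) w) xor T p                                      ≡⟨ Bool.xor-assoc (T root) (Sum (Qc c) w) (T p) ⟩
            T root xor (Sum (Qc c) w xor T p)                                      ≡⟨ cong (T root xor_) (Bool.xor-comm (Sum (Qc c) w) (T p)) ⟩
            T root xor (T p xor Sum (Qc c) w)                                      ≡⟨ sym (Bool.xor-assoc (T root) (T p) (Sum (Qc c) w)) ⟩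
            (T root xor T p) xor Sum (Qc c) w                                      ≡⟨ cong ((T root xor T p) xor_) (sym (Sum-S b w (Qc c) (Chain.ch (Qc-chain c)))) ⟩
            (T root xor T p) xor Sum (Qc c) (w ⊕ b · S)                            ∎
            where open ≡-Reasoning

    -- Adding `comb S` moves `S` onto the circuit without changing its coset, and there the tree
    -- with a split apex applies.
    universal : ∀ S → S ⊑ X → NRep (Z ↾ X) S
    universal S S⊑ = NRep-shift (Z ↾ X) (resp≈ (Z ↾ X) (λ i → sym (lem (S i) (comb S i))) (comb∈ S , comb⊑ S)) (rep (S ⊕ comb S) (⊕comb⊑ S⊑))
      where
      lem : ∀ a b → (a xor b) xor a ≡ b
      lem a b = trans (cong (_xor a) (Bool.xor-comm a b)) (xor-cancelʳ b a)

-- Generators, and minors read off from chosen elements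

record GenBy {n d} (Z : Space n) (X : V n) (gv : Fin d → V n) : Set where
  field
    member : ∀ i → Z ↾ X ∋ gv i
    generate : ∀ z → Z ↾ X ∋ z → ∃ λ c → z ≈ lin c gv

open GenBy

GenBy-lin : ∀ {n d} {Z : Space n} {X} {gv : Fin d → V n} → GenBy Z X gv → ∀ c → Z ↾ X ∋ lin c gv
GenBy-lin {Z = Z} {X} {gv} G c = lin-mem (Z ↾ X) gv (member G) c

-- Contract everything outside `X` and delete the elements of `X` that `φ` misses; what remains is
-- the matrix of the generators at the chosen elements.
minorOf : ∀ {n d k} {Z : Space n} {U X} {gv : Fin d → V n} → GenBy Z X gv → X ⊑ U →
          (φ : Fin k → Fin n) → Injective _≡_ _≡_ φ → (∀ j → X (φ j) ≡ true) →
          (M : Mat d k) → (∀ i j → rows M i j ≡ gv i (φ j)) → Minor Z U (Span M)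
minorOf {Z = Z} {U} {X} {gv} G X⊑U φ inj φ∈ M M≡ = record
  { φ = φ ; φ-inj = inj ; D = ~ X ; φ∉D = λ x → cong not (φ∈ x)
  ; D⊇ = λ e p → cong not (⊑-false X⊑U p)
  ; Q≐ = (λ w (c , w≈) → lin c gv , proj₁ (GenBy-lin G c) , (λ e p → ⊑-false (proj₂ (GenBy-lin G c)) (not-true p))
           , λ j → trans (Σ₂-cong λ i → cong (c i ∧_) (sym (M≡ i j))) (sym (w≈ j)))
       ⸴ λ w (v , Zv , vD , v≈) → let (c , eq) = generate G v (Zv , λ e p → ≢false⇒true λ q → true≢false (trans (sym p) (vD e (cong not q)))) in
           c , λ j → trans (sym (v≈ j)) (trans (eq (φ j)) (Σ₂-cong λ i → cong (c i ∧_) (sym (M≡ i j)))) }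

-- Legs: κ sends the elements of X to the legs of a small pattern

legBit : ∀ {k} → V k → Maybe (Fin k) → Bool
legBit u (just l) = u l
legBit u nothing = false

pull : ∀ {n k} → (Fin n → Maybe (Fin k)) → V k → V n
pull κ u e = legBit u (κ e)

dom : ∀ {n k} → (Fin n → Maybe (Fin k)) → V n
dom κ e = legBit (λ _ → true) (κ e)

pull⊑dom : ∀ {n k} (κ : Fin n → Maybe (Fin k)) u → pull κ u ⊑ dom κ
pull⊑dom κ u e p with κ e
... | just l = refl

pull-lin : ∀ {n k d} (κ : Fin n → Maybe (Fin k)) c (r : Fin d → V k) → pull κ (lin c r) ≈ lin c (pull κ ∘ r)
pull-lin κ c r e with κ e
... | just l = refl
... | nothing = sym (Σ₂-0 {u = λ i → c i ∧ false} λ i → Bool.∧-zeroʳ (c i))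

pull-cong : ∀ {n k} (κ : Fin n → Maybe (Fin k)) {u v} → u ≈ v → pull κ u ≈ pull κ v
pull-cong κ p e with κ e
... | just l = p l
... | nothing = refl

pull-just : ∀ {n k} {κ : Fin n → Maybe (Fin k)} u {e l} → κ e ≡ just l → pull κ u e ≡ u l
pull-just u p = cong (legBit u) p

dom-just : ∀ {n k} {κ : Fin n → Maybe (Fin k)} {e l} → κ e ≡ just l → dom κ e ≡ true
dom-just p = cong (legBit (λ _ → true)) p

just-dom : ∀ {n k} (κ : Fin n → Maybe (Fin k)) {e} → dom κ e ≡ true → ∃ λ l → κ e ≡ just l
just-dom κ {e} p with κ e
... | just l = l , refl

-- On `dom κ` the space `Z` is the pattern `g` with every edge replaced by a leg, a nonempty set of
-- elements lying in the same members. `rep` is the witness of nonemptiness.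
record Real {n d k} (Z : Space n) (g : Mat d k) : Set where
  field
    κ : Fin n → Maybe (Fin k)
    rep : Fin k → Fin n
    κ-rep : ∀ l → κ (rep l) ≡ just l
    gen : GenBy Z (dom κ) (pull κ ∘ rows g)

-- the leg of an element (nothing outside the pattern) and its value in a further vector of Z
Label : ℕ → Set
Label k = Maybe (Fin k) × Bool

earMat : ∀ {d k m} → Mat d k → Vec (Label k) m → Mat (suc d) m
earMat g ls = Vec₀.map proj₂ ls ∷ Vec₀.map (λ r → Vec₀.map (λ l → legBit (lookup r) (proj₁ l)) ls) g

rows-earMat₀ : ∀ {d k m} (g : Mat d k) (ls : Vec (Label k) m) j → rows (earMat g ls) zero j ≡ proj₂ (lookup ls j)
rows-earMat₀ g ls j = Vec.lookup-map j proj₂ ls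

rows-earMat : ∀ {d k m} (g : Mat d k) (ls : Vec (Label k) m) i j →
              rows (earMat g ls) (suc i) j ≡ legBit (rows g i) (proj₁ (lookup ls j))
rows-earMat g ls i j = trans (cong (λ r → lookup r j) (Vec.lookup-map i _ g)) (Vec.lookup-map j _ ls)

eqMaybe : ∀ {k} → Maybe (Fin k) → Maybe (Fin k) → Bool
eqMaybe (just a) (just b) = ⌊ a Fin.≟ b ⌋
eqMaybe nothing nothing = true
eqMaybe _ _ = false

eqMaybe-refl : ∀ {k} (a : Maybe (Fin k)) → eqMaybe a a ≡ true
eqMaybe-refl (just a) with a Fin.≟ a
... | yes _ = refl
... | no ¬p = ⊥-elim (¬p refl)
eqMaybe-refl nothing = refl

eqMaybe-≡ : ∀ {k} (a b : Maybe (Fin k)) → eqMaybe a b ≡ true → a ≡ b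
eqMaybe-≡ (just a) (just b) h with a Fin.≟ b
... | yes refl = refl
eqMaybe-≡ nothing nothing h = refl

==-refl : ∀ b → b == b ≡ true
==-refl true = refl
==-refl false = refl

eqLabel : ∀ {k} → Label k → Label k → Bool
eqLabel (a , b) (c , d) = eqMaybe a c ∧ (b == d)

eqLabel-refl : ∀ {k} (l : Label k) → eqLabel l l ≡ true
eqLabel-refl (a , b) = cong₂ _∧_ (eqMaybe-refl a) (==-refl b)

eqLabel-≡ : ∀ {k} (l m : Label k) → eqLabel l m ≡ true → l ≡ m
eqLabel-≡ (a , b) (c , d) h = cong₂ _,_ (eqMaybe-≡ a c (proj₁ (∧-true {eqMaybe a c} h))) (==-≡ (proj₂ (∧-true {eqMaybe a c} h)))

listed : ∀ {m} → Fin m → Fin m → List (Fin m × Fin m) → Bool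
listed i j = some (λ (a , b) → (⌊ i Fin.≟ a ⌋ ∧ ⌊ j Fin.≟ b ⌋) ∨ (⌊ i Fin.≟ b ⌋ ∧ ⌊ j Fin.≟ a ⌋))

-- Different labels force different elements, so only pairs with equal labels need a separate proof
-- of distinctness; `D` has to list them.
dupsOnly : ∀ {k m} → Vec (Label k) m → List (Fin m × Fin m) → Bool
dupsOnly ls D = everyF λ i → everyF λ j → ⌊ i Fin.≟ j ⌋ ∨ (not (eqLabel (lookup ls i) (lookup ls j)) ∨ listed i j D)

⌊⌋-true : ∀ {A : Set} {d : Dec A} → ⌊ d ⌋ ≡ true → A
⌊⌋-true {d = yes a} _ = a

-- `keep` lists the columns that become the elements of the target, in the order of the target, and
-- `con` marks the contracted columns; all other columns are deleted.
record Wit (m : ℕ) : Set where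
  constructor wit
  field
    target : Target
    keep : Vec (Fin m) (size target)
    con : Vec Bool m

okWit : ∀ {d m} → Mat d m → Wit m → Bool
okWit M (wit t φ D) = checkMinor M (gens t) φ D

covers : ∀ {d k} → Mat d k → Bool
covers g = everyF λ l → someF λ i → rows g i l

L∙ : ∀ {k} → Label k
L∙ = nothing , true

legLabels : ∀ {k} → Vec Bool k → Vec (Label k) k
legLabels r = tabulate λ l → just l , lookup r l

unit : ∀ {k} → Fin k → Vec Bool k
unit j = tabulate (𝟙 j)

-- The label rejected here belongs to an element that lies neither in the pattern nor on the ear,
-- hence not in the set whose minors are considered.
valid : ∀ {k} → Label k → Bool
valid (just _ , _) = true
valid (nothing , b) = b

checkBad : ∀ {d k m} → Mat d k → Vec (Label k) m → List (Fin m × Fin m) → Wit m → Bool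
checkBad g ls D w = dupsOnly ls D ∧ (everyF (valid ∘ lookup ls) ∧ okWit (earMat g ls) w)

near : ∀ {d k} → Mat d k → Vec Bool k → Vec Bool k → Bool
near g r x = (r +ᵛ x) ∈ᵇ span g

near-sound : ∀ {d k} (g : Mat d k) r x → near g r x ≡ true → Span g ∋ lookup r ⊕ lookup x
near-sound g r x h = resp≈ (Span g) (λ e → Vec.lookup-zipWith _xor_ e r x) (span-sound g (∈ᵇ-∈ {x = r +ᵛ x} h))

-- Ears of a realised pattern

Simple : ∀ {n} → Space n → Set
Simple Z = ∀ e f → e ≢ f → ¬ (Z ∋ 𝟙 e ⊕ 𝟙 f)

-- Minimality outside `X` is what makes `Z` on `X ⊔ᵛ v` exceed `Z` on `X` by the single generator
-- `v`.
record EarOn {n} (Z : Space n) (X v : V n) : Set where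
  field
    v∈ : Z ∋ v
    v∉ : ¬ (Z ∋ v ⊓ X)
    minimal : ∀ z → Z ∋ z → z ⊓ ~ X ⊑ v ⊓ ~ X → z ⊓ ~ X ≈ 0ᵛ ⊎ z ⊓ ~ X ≈ v ⊓ ~ X

open EarOn

-- Descent on the size outside `X`. A smaller `z` either is itself not separated by `X` and replaces
-- `v`, or has its outer part in `Z`; subtracting that part from `v` leaves `v ⊓ X` unchanged and
-- makes the outer part of `v` smaller.
findEarOn : ∀ {n} (Z : Space n) X v → Z ∋ v → ¬ (Z ∋ v ⊓ X) → ∃ (EarOn Z X)
findEarOn {n} Z X v v∈ v∉ = go v v∈ v∉ (<-wellFounded _)
  where
  Better : V n → V n → Set
  Better v u = Z ∋ u × (¬ (Z ∋ u ⊓ X)) × ∥ u ⊓ ~ X ∥ < ∥ v ⊓ ~ X ∥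
  better? : ∀ v → Dec (∃ (Better v))
  better? v = anyV? (λ {a} {b} p (x , y , z) → resp≈ Z p x , (λ q → y (resp≈ Z (λ i → cong (_∧ X i) (sym (p i))) q))
                      , ℕ.≤-trans (ℕ.≤-reflexive (cong suc (∥∥-cong λ i → cong (_∧ not (X i)) (sym (p i))))) z)
                    (λ u → mem? Z u ×-dec (¬? (mem? Z (u ⊓ X)) ×-dec (suc ∥ u ⊓ ~ X ∥ ℕ.≤? ∥ v ⊓ ~ X ∥)))
  go : ∀ v → Z ∋ v → ¬ (Z ∋ v ⊓ X) → Acc _<_ ∥ v ⊓ ~ X ∥ → ∃ (EarOn Z X)
  go v v∈ v∉ (acc rec) = step (better? v)
    where
    step : Dec (∃ (Better v)) → ∃ (EarOn Z X)
    step (yes (u , u∈ , u∉ , lt)) = go u u∈ u∉ (rec lt)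
    step (no ¬b) = v , record { v∈ = v∈ ; v∉ = v∉ ; minimal = min }
      where
      min : ∀ z → Z ∋ z → z ⊓ ~ X ⊑ v ⊓ ~ X → z ⊓ ~ X ≈ 0ᵛ ⊎ z ⊓ ~ X ≈ v ⊓ ~ X
      min z z∈ z⊑ with (z ⊓ ~ X) ≈? (v ⊓ ~ X) | Nz? (z ⊓ ~ X) | mem? Z (z ⊓ X)
      ... | yes p | _ | _ = inj₂ p
      ... | no _ | no ¬nz | _ = inj₁ (¬Nz⇒0 ¬nz)
      ... | no ¬p | yes nz | no z∉ = ⊥-elim (¬b (z , z∈ , z∉ , smaller))
        where
        smaller : ∥ z ⊓ ~ X ∥ < ∥ v ⊓ ~ X ∥
        smaller with ℕ.<-≤-connex ∥ z ⊓ ~ X ∥ ∥ v ⊓ ~ X ∥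
        ... | inj₁ l = l
        ... | inj₂ l = ⊥-elim (¬p (⊑-≥⇒≈ z⊑ l))
      ... | no ¬p | yes nz | yes zX = ⊥-elim (¬b (v ⊕ z′ , mem⊕ Z v∈ z′∈ , (λ q → v∉ (resp≈ Z onX q))
            , ℕ.≤-trans (ℕ.≤-reflexive (cong suc (∥∥-cong off))) (⊕-∥∥-< z⊑ nz)))
        where
        z′ = z ⊓ ~ X
        z′∈ : Z ∋ z′
        z′∈ = resp≈ Z (λ e → trans (cong (_xor (z ⊓ X) e) (⊓-split z X e)) (trans (cong (_xor (z ⊓ X) e) (Bool.xor-comm ((z ⊓ X) e) (z′ e))) (xor-cancelʳ (z′ e) ((z ⊓ X) e)))) (mem⊕ Z z∈ zX)
        onX : (v ⊕ z′) ⊓ X ≈ v ⊓ X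
        onX e with X e
        ... | false = trans (Bool.∧-zeroʳ _) (sym (Bool.∧-zeroʳ (v e)))
        ... | true = cong (_∧ true) (trans (cong (v e xor_) (Bool.∧-zeroʳ (z e))) (Bool.xor-identityʳ (v e)))
        off : (v ⊕ z′) ⊓ ~ X ≈ (v ⊓ ~ X) ⊕ z′
        off e with X e
        ... | false = trans (Bool.∧-identityʳ _) (cong (_xor (z e ∧ true)) (sym (Bool.∧-identityʳ (v e))))
        ... | true = trans (Bool.∧-zeroʳ _) (sym (cong₂ _xor_ (Bool.∧-zeroʳ (v e)) (Bool.∧-zeroʳ (z e))))

module Ears {n d k} {Z : Space n} {U : V n} (nb : NoBad Z U) (ZU : ∀ v → Z ∋ v → v ⊑ U)
            {g : Mat d k} (cov : covers g ≡ true) (R : Real Z g) where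
  open Real R

  X : V n
  X = dom κ

  X⊑U : X ⊑ U
  X⊑U e p with just-dom κ p
  ... | l , q with someF-∃ (λ i → rows g i l) (everyF-∀ (λ l → someF λ i → rows g i l) cov l)
  ...   | i , r = ZU _ (proj₁ (member gen i)) e (trans (pull-just {κ = κ} (rows g i) q) r)

  pull∈ : ∀ u → Span g ∋ u → Z ↾ X ∋ pull κ u
  pull∈ u (c , p) = resp≈ (Z ↾ X) (λ e → sym (trans (pull-cong κ p e) (pull-lin κ c (rows g) e))) (GenBy-lin gen c)

  Ear : V n → Set
  Ear v = EarOn Z X v

  outside : ∀ {v} → Ear v → Nz (v ⊓ ~ X)
  outside {v} E with Nz? (v ⊓ ~ X)
  ... | yes p = p
  ... | no ¬p = ⊥-elim (v∉ E (resp≈ Z (λ e → trans (⊓-split v X e) (trans (cong ((v ⊓ X) e xor_) (¬Nz⇒0 ¬p e)) (Bool.xor-identityʳ _))) (v∈ E)))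

  outside-κ : ∀ {v e} → (v ⊓ ~ X) e ≡ true → κ e ≡ nothing × v e ≡ true
  outside-κ {v} {e} p with κ e | v e
  ... | nothing | true = refl , refl
  ... | just l | true = ⊥-elim (true≢false (sym p))

  findEar : ∀ v → Z ∋ v → ¬ (Z ∋ v ⊓ X) → ∃ Ear
  findEar = findEarOn Z X

  shift : ∀ {v} z → Z ↾ X ∋ z → Ear v → Ear (v ⊕ z)
  shift {v} z (z∈ , z⊑) E = record
    { v∈ = mem⊕ Z (v∈ E) z∈
    ; v∉ = λ p → v∉ E (resp≈ Z (λ e → trans (cong (_xor z e) (trans (⊓-⊕ v z X e) (cong ((v ⊓ X) e xor_) (⊑⇒⊓ z⊑ e)))) (xor-cancelʳ ((v ⊓ X) e) (z e))) (mem⊕ Z p z∈))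
    ; minimal = λ y y∈ y⊑ → tr (minimal E y y∈ (⊑-respʳ same y⊑)) }
    where
    same : (v ⊕ z) ⊓ ~ X ≈ v ⊓ ~ X
    same e with X e in q
    ... | true = trans (Bool.∧-zeroʳ _) (sym (Bool.∧-zeroʳ (v e)))
    ... | false = cong (_∧ true) (trans (cong (v e xor_) (⊑-false z⊑ q)) (Bool.xor-identityʳ (v e)))
    tr : ∀ {y} → y ⊓ ~ X ≈ 0ᵛ ⊎ y ⊓ ~ X ≈ v ⊓ ~ X → y ⊓ ~ X ≈ 0ᵛ ⊎ y ⊓ ~ X ≈ (v ⊕ z) ⊓ ~ X
    tr (inj₁ p) = inj₁ p
    tr (inj₂ p) = inj₂ (≈-trans p (≈-sym same))

  -- By minimality a member inside `X ⊔ᵛ v` has the same outer part as zero or as `v`, and in the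
  -- second case adding `v` brings it into `X`.
  earGen : ∀ {v} → Ear v → GenBy Z (X ⊔ᵛ v) (v ◂ (pull κ ∘ rows g))
  earGen {v} E = record { member = mem-i ; generate = gn }
    where
    ⊑ˡ : ∀ {u} → u ⊑ X → u ⊑ X ⊔ᵛ v
    ⊑ˡ h e p = cong (_∨ v e) (h e p)
    mem-i : ∀ i → Z ↾ (X ⊔ᵛ v) ∋ (v ◂ (pull κ ∘ rows g)) i
    mem-i zero = v∈ E , λ e p → trans (cong (X e ∨_) p) (Bool.∨-zeroʳ (X e))
    mem-i (suc i) = proj₁ (member gen i) , ⊑ˡ (proj₂ (member gen i))
    gn : ∀ z → Z ↾ (X ⊔ᵛ v) ∋ z → ∃ λ c → z ≈ lin c (v ◂ (pull κ ∘ rows g))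
    gn z (z∈ , z⊑) = step (minimal E z z∈ below)
      where
      below : z ⊓ ~ X ⊑ v ⊓ ~ X
      below e p with z e in a | X e in b
      ... | true | false = trans (Bool.∧-identityʳ (v e)) (trans (sym (cong (_∨ v e) b)) (z⊑ e a))
      step : z ⊓ ~ X ≈ 0ᵛ ⊎ z ⊓ ~ X ≈ v ⊓ ~ X → ∃ λ c → z ≈ lin c (v ◂ (pull κ ∘ rows g))
      step (inj₁ h) = let (c , eq) = generate gen z (z∈ , z⊑X) in false ◂ c , eq
        where
        z⊑X : z ⊑ X
        z⊑X e p = ≢false⇒true λ q → true≢false (trans (sym (cong₂ _∧_ p (cong not q))) (h e))
      step (inj₂ h) = let (c , eq) = generate gen (v ⊕ z) (mem⊕ Z (v∈ E) z∈ , ⊑X) in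
          true ◂ c , λ e → trans (sym (xor-cancelˡ (v e) (z e))) (cong (v e xor_) (eq e))
        where
        ⊑X : v ⊕ z ⊑ X
        ⊑X e p = ≢false⇒true λ q → true≢false (trans (sym p) (trans (cong₂ _xor_ (at v q) (trans (at z q) (h e))) (Bool.xor-same ((v ⊓ ~ X) e))))
          where
          at : ∀ u → X e ≡ false → u e ≡ (u ⊓ ~ X) e
          at u q = sym (trans (cong (λ b → u e ∧ not b) q) (Bool.∧-identityʳ (u e)))

  lab : V n → Fin n → Label k
  lab v e = κ e , v e

  badWith : ∀ {v Y m} → Y ⊑ U → GenBy Z Y (v ◂ (pull κ ∘ rows g)) → (es : Vec (Fin n) m) (ls : Vec (Label k) m) →
            (∀ j → lab v (lookup es j) ≡ lookup ls j) → Injective _≡_ _≡_ (lookup es) → (∀ j → Y (lookup es j) ≡ true) →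
            ∀ w → okWit (earMat g ls) w ≡ true → ⊥
  badWith {v} Y⊑U G es ls es≡ inj in-Y (wit t φ D) h = nb t (Minor-trans (minorOf G Y⊑U (lookup es) inj in-Y (earMat g ls) M≡)
      (checkMinor-sound (earMat g ls) (gens t) φ D h))
    where
    M≡ : ∀ i j → rows (earMat g ls) i j ≡ (v ◂ (pull κ ∘ rows g)) i (lookup es j)
    M≡ zero j = trans (rows-earMat₀ g ls j) (cong proj₂ (sym (es≡ j)))
    M≡ (suc i) j = trans (rows-earMat g ls i j) (cong (legBit (rows g i) ∘ proj₁) (sym (es≡ j)))

  badEar : ∀ {v m} → Ear v → (es : Vec (Fin n) m) (ls : Vec (Label k) m) → (∀ j → lab v (lookup es j) ≡ lookup ls j) →
           ∀ D w → checkBad g ls D w ≡ true → All (λ (i , j) → lookup es i ≢ lookup es j) D → ⊥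
  badEar {v} {m} E es ls es≡ D w h diff = badWith X′⊑U (earGen E) es ls es≡ inj in-X′ w (proj₂ (∧-true {everyF (valid ∘ lookup ls)} h₂))
    where
    h₁ = proj₁ (∧-true {dupsOnly ls D} h)
    h₂ = proj₂ (∧-true {dupsOnly ls D} h)
    X′⊑U : X ⊔ᵛ v ⊑ U
    X′⊑U e p with ⊔ᵛ-true {u = X} {v} p
    ... | inj₁ q = X⊑U e q
    ... | inj₂ q = ZU v (v∈ E) e q
    in-X′ : ∀ j → (X ⊔ᵛ v) (lookup es j) ≡ true
    in-X′ j = go (κ (lookup es j)) refl (v (lookup es j)) refl
      where
      go : ∀ a → κ (lookup es j) ≡ a → ∀ b → v (lookup es j) ≡ b → (X ⊔ᵛ v) (lookup es j) ≡ true
      go (just l) p _ _ = cong (_∨ v (lookup es j)) (dom-just {κ = κ} p)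
      go nothing p true q = trans (cong (X (lookup es j) ∨_) q) (Bool.∨-zeroʳ _)
      go nothing p false q = ⊥-elim (true≢false (trans (sym (everyF-∀ (valid ∘ lookup ls) (proj₁ (∧-true {everyF (valid ∘ lookup ls)} h₂)) j))
                               (cong valid (trans (sym (es≡ j)) (cong₂ _,_ p q)))))
    listed-diff : ∀ i j D → listed i j D ≡ true → All (λ (i , j) → lookup es i ≢ lookup es j) D → lookup es i ≢ lookup es j
    listed-diff i j ((a , b) ∷ D) p (ne ∷ rest) with ∨-true {(⌊ i Fin.≟ a ⌋ ∧ ⌊ j Fin.≟ b ⌋) ∨ (⌊ i Fin.≟ b ⌋ ∧ ⌊ j Fin.≟ a ⌋)} p
    ... | inj₂ q = listed-diff i j D q rest
    ... | inj₁ q with ∨-true {⌊ i Fin.≟ a ⌋ ∧ ⌊ j Fin.≟ b ⌋} q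
    ...   | inj₁ r rewrite ⌊⌋-true {d = i Fin.≟ a} (proj₁ (∧-true {⌊ i Fin.≟ a ⌋} r)) | ⌊⌋-true {d = j Fin.≟ b} (proj₂ (∧-true {⌊ i Fin.≟ a ⌋} r)) = ne
    ...   | inj₂ r rewrite ⌊⌋-true {d = i Fin.≟ b} (proj₁ (∧-true {⌊ i Fin.≟ b ⌋} r)) | ⌊⌋-true {d = j Fin.≟ a} (proj₂ (∧-true {⌊ i Fin.≟ b ⌋} r)) = ne ∘ sym
    inj : Injective _≡_ _≡_ (lookup es)
    inj {i} {j} p with ∨-true {⌊ i Fin.≟ j ⌋} (everyF-∀ (λ j → ⌊ i Fin.≟ j ⌋ ∨ (not (eqLabel (lookup ls i) (lookup ls j)) ∨ listed i j D))
                         (everyF-∀ (λ i → everyF λ j → ⌊ i Fin.≟ j ⌋ ∨ (not (eqLabel (lookup ls i) (lookup ls j)) ∨ listed i j D)) h₁ i) j)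
    ... | inj₁ q = ⌊⌋-true {d = i Fin.≟ j} q
    ... | inj₂ q with ∨-true {not (eqLabel (lookup ls i) (lookup ls j))} q
    ...   | inj₁ r = ⊥-elim (true≢false (trans (sym r) (cong not (trans (cong (eqLabel (lookup ls i)) (trans (sym (es≡ j)) (trans (cong (lab v) (sym p)) (es≡ i)))) (eqLabel-refl (lookup ls i))))))
    ...   | inj₂ r = ⊥-elim (listed-diff i j D r diff p)

  -- a choice of one element from every leg, with prescribed values of v
  record Res (v : V n) (r : V k) (ρ : Fin k → Fin n) : Set where
    constructor mkRes
    field
      at : ∀ l → κ (ρ l) ≡ just l × v (ρ l) ≡ r l

  open Res public

  Res-shift : ∀ {v r ρ} → Res v r ρ → ∀ u → Res (v ⊕ pull κ u) (r ⊕ u) ρ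
  Res-shift {v} {r} {ρ} h u = mkRes λ l → proj₁ (at h l) , cong₂ _xor_ (proj₂ (at h l)) (pull-just {κ = κ} u (proj₁ (at h l)))

  Res-cong : ∀ {v r r′ ρ} → r ≈ r′ → Res v r ρ → Res v r′ ρ
  Res-cong p h = mkRes λ l → proj₁ (at h l) , trans (proj₂ (at h l)) (p l)

  legs-es : ∀ {v ρ} (r : Vec Bool k) → Res v (lookup r) ρ → ∀ j → lab v (lookup (tabulate ρ) j) ≡ lookup (legLabels r) j
  legs-es {v} {ρ} r h j = trans (cong (lab v) (Vec.lookup∘tabulate ρ j)) (trans (cong₂ _,_ (proj₁ (at h j)) (proj₂ (at h j)))
                            (sym (Vec.lookup∘tabulate (λ l → just l , lookup r l) j)))

  ear-lab : ∀ {v} (E : Ear v) → lab v (proj₁ (outside E)) ≡ L∙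
  ear-lab {v} E = let (p , q) = outside-κ {v} (proj₂ (outside E)) in cong₂ _,_ p q

  -- A member of the pattern may be added to an ear without changing it outside, so an excluded
  -- minor for one vector of the coset serves for all of them.
  badCoset : ∀ {v ρ} → Ear v → ∀ (r x : Vec Bool k) → Res v (lookup r) ρ → near g r x ≡ true →
             ∀ w → checkBad g (L∙ ∷ legLabels x) [] w ≡ true → ⊥
  badCoset {v} {ρ} E r x res nr w ok = badEar E′ (proj₁ (outside E′) ∷ tabulate ρ) (L∙ ∷ legLabels x)
      (λ { zero → ear-lab E′ ; (suc j) → legs-es x res′ j }) [] w ok []
    where
    u = lookup r ⊕ lookup x
    E′ = shift (pull κ u) (pull∈ u (near-sound g r x nr)) E
    res′ : Res (v ⊕ pull κ u) (lookup x) ρ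
    res′ = Res-cong (λ l → xor-cancelˡ (lookup r l) (lookup x l)) (Res-shift res u)

  -- the ear is parallel to a part of leg j
  subleg : ∀ {v ρ} → Simple Z → Ear v → ∀ j → Res v (𝟙 j) ρ → (∀ e i → κ e ≡ just i → i ≢ j → v e ≡ false) →
           ∀ w w′ → checkBad g (L∙ ∷ (just j , true) ∷ legLabels (unit j)) ((suc zero , suc (suc j)) ∷ []) w ≡ true →
           checkBad g (L∙ ∷ L∙ ∷ legLabels (unit j)) ((zero , suc zero) ∷ []) w′ ≡ true → ⊥
  subleg {v} {ρ} simple E j res off w w′ ok ok′ = step (Fin.any? λ e → (v e Bool.≟ true) ×-dec (¬? (e Fin.≟ x) ×-dec ¬? (e Fin.≟ y)))
    where
    y = proj₁ (outside E)
    x = ρ j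
    res′ : Res v (lookup (unit j)) ρ
    res′ = Res-cong (λ l → sym (Vec.lookup∘tabulate (𝟙 j) l)) res
    x≢y : x ≢ y
    x≢y p = case (trans (sym (proj₁ (at res j))) (trans (cong κ p) (proj₁ (outside-κ {v} (proj₂ (outside E))))))
      where
      case : just j ≡ nothing → ⊥
      case ()
    vy : v y ≡ true
    vy = proj₂ (outside-κ {v} (proj₂ (outside E)))
    vx : v x ≡ true
    vx = trans (proj₂ (at res j)) (𝟙-refl j)
    step : Dec (∃ λ e → v e ≡ true × e ≢ x × e ≢ y) → ⊥
    -- Here `v` consists of `x` and `y` alone, a series pair. A third element lengthens either the
    -- ear or the part of leg `j` parallel to it, and each has its own witness.
    step (no ¬e) = simple x y x≢y (resp≈ Z eq (v∈ E))
      where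
      eq : v ≈ 𝟙 x ⊕ 𝟙 y
      eq e with x Fin.≟ e | y Fin.≟ e
      ... | yes refl | yes q = ⊥-elim (x≢y (sym q))
      ... | yes refl | no _ = vx
      ... | no _ | yes refl = vy
      ... | no p | no q = ≢true⇒false λ r → ¬e (e , r , p ∘ sym , q ∘ sym)
    step (yes (e , ve , e≢x , e≢y)) = go (κ e) refl
      where
      go : ∀ a → κ e ≡ a → ⊥
      go nothing p = badEar E (e ∷ y ∷ tabulate ρ) (L∙ ∷ L∙ ∷ legLabels (unit j))
        (λ { zero → cong₂ _,_ p ve ; (suc zero) → ear-lab E ; (suc (suc l)) → legs-es (unit j) res′ l }) ((zero , suc zero) ∷ []) w′ ok′ (e≢y ∷ [])
      go (just l) p with l Fin.≟ j
      ... | no l≢j = true≢false (trans (sym ve) (off e l p l≢j))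
      ... | yes refl = badEar E (y ∷ e ∷ tabulate ρ) (L∙ ∷ (just j , true) ∷ legLabels (unit j))
        (λ { zero → ear-lab E ; (suc zero) → cong₂ _,_ p ve ; (suc (suc l)) → legs-es (unit j) res′ l }) ((suc zero , suc (suc j)) ∷ []) w ok
        ((λ q → e≢x (trans q (Vec.lookup∘tabulate ρ j))) ∷ [])

-- Tables for a pattern that admits no further ears
record Tables {d k} (g : Mat d k) : Set where
  field
    bad : List (Vec Bool k × Wit (suc k))
    -- For `(i , j)`: at the representatives the ear is parallel to leg `j`, but it also meets a
    -- further element of leg `i`.
    mixed : List ((Fin k × Fin k) × Wit (suc (suc k)))
    longLeg longEar : Vec (Wit (suc (suc k))) k

  badOk mixedOk longOk classOk pairOk : Bool
  badOk = every (λ (r , w) → checkBad g (L∙ ∷ legLabels r) [] w) bad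
  mixedOk = every (λ ((i , j) , w) → checkBad g (L∙ ∷ (just i , true) ∷ legLabels (unit j)) [] w) mixed
  longOk = everyF λ j → checkBad g (L∙ ∷ (just j , true) ∷ legLabels (unit j)) ((suc zero , suc (suc j)) ∷ []) (lookup longLeg j)
                      ∧ checkBad g (L∙ ∷ L∙ ∷ legLabels (unit j)) ((zero , suc zero) ∷ []) (lookup longEar j)
  isBad : Vec Bool k → Bool
  isBad r = some (λ (x , _) → near g r x) bad
  -- Completeness: every coset of the pattern space is trivial, contains a single leg, or is listed
  -- as bad.
  classOk = every (λ r → (r ∈ᵇ span g) ∨ (someF (λ j → near g r (unit j)) ∨ isBad r)) (vecs k)
  pairOk = everyF λ i → everyF λ j → ⌊ i Fin.≟ j ⌋ ∨ (isBad (unit j +ᵛ unit i) ∨ some (λ ((a , b) , _) → ⌊ i Fin.≟ a ⌋ ∧ ⌊ j Fin.≟ b ⌋) mixed)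

open Tables

∉nothing : ∀ {k} {i : Fin k} → just i ≡ nothing → ⊥
∉nothing ()

some-bad : ∀ {d k} {g : Mat d k} (t : Tables g) r → isBad t r ≡ true → badOk t ≡ true →
           ∃ λ x → ∃ λ w → near g r x ≡ true × checkBad g (L∙ ∷ legLabels x) [] w ≡ true
some-bad {g = g} t r h ok = build (some-∈ (λ (x , _) → near g r x) h)
  where
  build : (∃ λ y → y ∈ˡ bad t × near g r (proj₁ y) ≡ true) → ∃ λ x → ∃ λ w → near g r x ≡ true × checkBad g (L∙ ∷ legLabels x) [] w ≡ true
  build ((x , w) , x∈ , p) = x , w , p , every-∈ (λ (r , w) → checkBad g (L∙ ∷ legLabels r) [] w) ok x∈

module Closed {n d k} {Z : Space n} {U : V n} (nb : NoBad Z U) (ZU : ∀ v → Z ∋ v → v ⊑ U) (simple : Simple Z)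
              {g : Mat d k} (cov : covers g ≡ true) (R : Real Z g) (t : Tables g)
              (b-ok : badOk t ≡ true) (m-ok : mixedOk t ≡ true) (l-ok : longOk t ≡ true)
              (c-ok : classOk t ≡ true) (p-ok : pairOk t ≡ true) where
  open Real R
  open Ears nb ZU cov R

  noBadCoset : ∀ {v ρ} → Ear v → ∀ r → Res v (lookup r) ρ → isBad t r ≡ true → ⊥
  noBadCoset E r res h = build (some-bad t r h b-ok)
    where
    build : (∃ λ x → ∃ λ w → near g r x ≡ true × checkBad g (L∙ ∷ legLabels x) [] w ≡ true) → ⊥
    build (x , w , nr , ok) = badCoset E r x res nr w ok

  update : (Fin k → Fin n) → Fin k → Fin n → Fin k → Fin n
  update ρ i e l = if ⌊ i Fin.≟ l ⌋ then e else ρ l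

  Res-update : ∀ {v r ρ} → Res v r ρ → ∀ i e → κ e ≡ just i → v e ≡ not (r i) → Res v (r ⊕ 𝟙 i) (update ρ i e)
  Res-update {v} {r} {ρ} res i e p q = mkRes at′
    where
    at′ : ∀ l → κ (update ρ i e l) ≡ just l × v (update ρ i e l) ≡ (r ⊕ 𝟙 i) l
    at′ l with i Fin.≟ l
    ... | yes refl = p , trans q (Bool.xor-comm true (r i))
    ... | no _ = proj₁ (at res l) , trans (proj₂ (at res l)) (sym (Bool.xor-identityʳ (r l)))

  -- If `v` met another leg `i` in some element, taking that element as representative of `i` would
  -- give the coset of `i` and `j` together, which is bad or covered by `mixed`. So `v` meets only
  -- leg `j` of the pattern, and `subleg` applies.
  noUnit : ∀ {v ρ} → Ear v → ∀ j → Res v (𝟙 j) ρ → ⊥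
  noUnit {v} {ρ} E j res = subleg simple E j res off (lookup (longLeg t) j) (lookup (longEar t) j)
      (proj₁ (∧-true {checkBad g (L∙ ∷ (just j , true) ∷ legLabels (unit j)) ((suc zero , suc (suc j)) ∷ []) (lookup (longLeg t) j)} lj))
      (proj₂ (∧-true {checkBad g (L∙ ∷ (just j , true) ∷ legLabels (unit j)) ((suc zero , suc (suc j)) ∷ []) (lookup (longLeg t) j)} lj))
    where
    lj = everyF-∀ (λ j → checkBad g (L∙ ∷ (just j , true) ∷ legLabels (unit j)) ((suc zero , suc (suc j)) ∷ []) (lookup (longLeg t) j)
                      ∧ checkBad g (L∙ ∷ L∙ ∷ legLabels (unit j)) ((zero , suc zero) ∷ []) (lookup (longEar t) j)) l-ok j
    res′ : Res v (lookup (unit j)) ρ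
    res′ = Res-cong (λ l → sym (Vec.lookup∘tabulate (𝟙 j) l)) res
    off : ∀ e i → κ e ≡ just i → i ≢ j → v e ≡ false
    off e i p i≢j = ≢true⇒false λ q → contra q
      where
      contra : v e ≡ true → ⊥
      contra q with ∨-true {⌊ i Fin.≟ j ⌋} (everyF-∀ (λ j → ⌊ i Fin.≟ j ⌋ ∨ (isBad t (unit j +ᵛ unit i) ∨ some (λ ((a , b) , _) → ⌊ i Fin.≟ a ⌋ ∧ ⌊ j Fin.≟ b ⌋) (mixed t)))
                      (everyF-∀ (λ i → everyF λ j → ⌊ i Fin.≟ j ⌋ ∨ (isBad t (unit j +ᵛ unit i) ∨ some (λ ((a , b) , _) → ⌊ i Fin.≟ a ⌋ ∧ ⌊ j Fin.≟ b ⌋) (mixed t))) p-ok i) j)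
      ... | inj₁ r = i≢j (⌊⌋-true {d = i Fin.≟ j} r)
      ... | inj₂ r with ∨-true {isBad t (unit j +ᵛ unit i)} r
      ...   | inj₁ s = noBadCoset E (unit j +ᵛ unit i)
                (Res-cong (λ l → sym (trans (Vec.lookup-zipWith _xor_ l (unit j) (unit i)) (cong₂ _xor_ (Vec.lookup∘tabulate (𝟙 j) l) (Vec.lookup∘tabulate (𝟙 i) l))))
                  (Res-update res i e p (trans q (sym (cong not (𝟙-≢ (i≢j ∘ sym))))))) s
      ...   | inj₂ s = build (some-∈ (λ ((a , b) , _) → ⌊ i Fin.≟ a ⌋ ∧ ⌊ j Fin.≟ b ⌋) s)
        where
        build : (∃ λ x → x ∈ˡ mixed t × (⌊ i Fin.≟ proj₁ (proj₁ x) ⌋ ∧ ⌊ j Fin.≟ proj₂ (proj₁ x) ⌋) ≡ true) → ⊥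
        build (((a , b) , w) , x∈ , same) = finish (⌊⌋-true {d = i Fin.≟ a} (proj₁ (∧-true {⌊ i Fin.≟ a ⌋} same))) (⌊⌋-true {d = j Fin.≟ b} (proj₂ (∧-true {⌊ i Fin.≟ a ⌋} same)))
                                          (every-∈ (λ ((i , j) , w) → checkBad g (L∙ ∷ (just i , true) ∷ legLabels (unit j)) [] w) m-ok x∈)
          where
          finish : i ≡ a → j ≡ b → checkBad g (L∙ ∷ (just a , true) ∷ legLabels (unit b)) [] w ≡ true → ⊥
          finish refl refl ok = badEar E (proj₁ (outside E) ∷ e ∷ tabulate ρ) (L∙ ∷ (just i , true) ∷ legLabels (unit j))
            (λ { zero → ear-lab E ; (suc zero) → cong₂ _,_ p q ; (suc (suc l)) → legs-es (unit j) res′ l }) [] w ok []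

  noZero : ∀ {v ρ} → Ear v → Res v 0ᵛ ρ → ⊥
  noZero {v} {ρ} E res = step (Fin.any? λ e → (X e Bool.≟ true) ×-dec (v e Bool.≟ true))
    where
    step : Dec (∃ λ e → X e ≡ true × v e ≡ true) → ⊥
    step (no ¬e) = v∉ E (mem-0 Z λ e → ≢true⇒false λ p → ¬e (e , ⊓-⊑ʳ v X e p , ⊓-⊑ˡ v X e p))
    step (yes (e , Xe , ve)) = build (just-dom κ Xe)
      where
      build : (∃ λ l → κ e ≡ just l) → ⊥
      build (i , p) = noUnit E i (Res-cong (λ _ → refl) (Res-update res i e p ve))

  -- The values of `v` at the representatives form one of finitely many cosets. A bad one is
  -- excluded at once; a trivial one or that of one leg is first shifted to zero or to a unit
  -- vector.
  noEar : ∀ {v} → Ear v → ⊥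
  noEar {v} E = go (∨-true {r ∈ᵇ span g} (every-∈ (λ r → (r ∈ᵇ span g) ∨ (someF (λ j → near g r (unit j)) ∨ isBad t r)) c-ok (∈-vecs r)))
    where
    r : Vec Bool k
    r = tabulate (v ∘ rep)
    res : Res v (lookup r) rep
    res = mkRes λ l → κ-rep l , sym (Vec.lookup∘tabulate (v ∘ rep) l)
    go : r ∈ᵇ span g ≡ true ⊎ (someF (λ j → near g r (unit j)) ∨ isBad t r) ≡ true → ⊥
    go (inj₁ h) = noZero (shift (pull κ (lookup r)) (pull∈ (lookup r) (span-sound g (∈ᵇ-∈ {x = r} h))) E)
      (Res-cong (λ l → Bool.xor-same (lookup r l)) (Res-shift res (lookup r)))
    go (inj₂ h) with ∨-true {someF (λ j → near g r (unit j))} h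
    ... | inj₂ b = noBadCoset E r res b
    ... | inj₁ s = build (someF-∃ (λ j → near g r (unit j)) s)
      where
      build : (∃ λ j → near g r (unit j) ≡ true) → ⊥
      build (j , nr) = noUnit (shift (pull κ u) (pull∈ u (near-sound g r (unit j) nr)) E) j
          (Res-cong (λ l → trans (xor-cancelˡ (lookup r l) (lookup (unit j) l)) (Vec.lookup∘tabulate (𝟙 j) l)) (Res-shift res u))
        where u = lookup r ⊕ lookup (unit j)

  closed : ∀ v → Z ∋ v → Z ∋ v ⊓ X
  closed v v∈ with mem? Z (v ⊓ X)
  ... | yes p = p
  ... | no ¬p = ⊥-elim (noEar (proj₂ (findEar v v∈ ¬p)))

-- Passing to a larger pattern

findLabel : ∀ {k m} → Vec (Label k) m → Label k → Maybe (Fin m)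
findLabel [] l = nothing
findLabel (x ∷ ls) l = if eqLabel x l then just zero else Maybe.map suc (findLabel ls l)

findLabel-sound : ∀ {k m} (ls : Vec (Label k) m) l {j} → findLabel ls l ≡ just j → lookup ls j ≡ l
findLabel-sound (x ∷ ls) l p with eqLabel x l in eq
findLabel-sound (x ∷ ls) l refl | true = eqLabel-≡ x l eq
findLabel-sound (x ∷ ls) l p | false with findLabel ls l in eq′
findLabel-sound (x ∷ ls) l refl | false | just i = findLabel-sound ls l eq′

has : ∀ {k m} → Vec (Label k) m → Label k → Bool
has ls l = someF λ j → eqLabel (lookup ls j) l

findLabel-complete : ∀ {k m} (ls : Vec (Label k) m) l → has ls l ≡ true → ∃ λ j → findLabel ls l ≡ just j
findLabel-complete (x ∷ ls) l h with eqLabel x l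
... | true = zero , refl
... | false = let (j , p) = findLabel-complete ls l h in suc j , cong (Maybe.map suc) p

sameSpan : ∀ {d d′ k} → Mat d k → Mat d′ k → Bool
sameSpan g h = everyF (λ i → lookup g i ∈ᵇ span h) ∧ everyF (λ i → lookup h i ∈ᵇ span g)

sameSpan-sound : ∀ {d d′ k} (g : Mat d k) (h : Mat d′ k) → sameSpan g h ≡ true → Span g ≐ Span h
sameSpan-sound g h p = Span-⊆ g (Span h) (λ i → span-sound h (∈ᵇ-∈ {x = lookup g i} (everyF-∀ (λ i → lookup g i ∈ᵇ span h) (proj₁ (∧-true {everyF (λ i → lookup g i ∈ᵇ span h)} p)) i)))
  ⸴ Span-⊆ h (Span g) (λ i → span-sound g (∈ᵇ-∈ {x = lookup h i} (everyF-∀ (λ i → lookup h i ∈ᵇ span g) (proj₂ (∧-true {everyF (λ i → lookup g i ∈ᵇ span h)} p)) i)))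

GenBy-pull : ∀ {n d d′ k} {Z : Space n} {X} (κ : Fin n → Maybe (Fin k)) (g : Mat d k) (h : Mat d′ k) → Span g ≐ Span h →
             GenBy Z X (pull κ ∘ rows g) → GenBy Z X (pull κ ∘ rows h)
GenBy-pull {Z = Z} {X} κ g h same G = record
  { member = λ i → from (rows h i) (≐⇐ same _ (Span-row h i))
  ; generate = λ z z∈ → build z (generate G z z∈) }
  where
  from : ∀ u → Span g ∋ u → Z ↾ X ∋ pull κ u
  from u (c , p) = resp≈ (Z ↾ X) (λ e → sym (trans (pull-cong κ p e) (pull-lin κ c (rows g) e))) (GenBy-lin G c)
  build : ∀ z → (∃ λ c → z ≈ lin c (pull κ ∘ rows g)) → ∃ λ c → z ≈ lin c (pull κ ∘ rows h)
  build z (c , p) = let (c′ , q) = ≐⇒ same (lin c (rows g)) (c , λ _ → refl) in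
    c′ , λ e → trans (p e) (trans (sym (pull-lin κ c (rows g) e)) (trans (pull-cong κ q e) (pull-lin κ c′ (rows h) e)))

-- The elements of X, labelled by their leg and a bit, realise the pattern whose legs are the labels ls.
module Relabel {n d k m} {Z : Space n} (κ : Fin n → Maybe (Fin k)) (v X : V n) (g : Mat d k)
               (G : GenBy Z X (v ◂ (pull κ ∘ rows g))) (ls : Vec (Label k) m)
               (complete : ∀ e → X e ≡ true → has ls (κ e , v e) ≡ true)
               (ρ : Fin m → Fin n) (ρ-lab : ∀ j → (κ (ρ j) , v (ρ j)) ≡ lookup ls j) (ρ-X : ∀ j → X (ρ j) ≡ true)
               (distinct : everyF (λ i → everyF λ j → ⌊ i Fin.≟ j ⌋ ∨ not (eqLabel (lookup ls i) (lookup ls j))) ≡ true) where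

  κ′ : Fin n → Maybe (Fin m)
  κ′ e = if X e then findLabel ls (κ e , v e) else nothing

  κ′-sound : ∀ e j → κ′ e ≡ just j → X e ≡ true × lookup ls j ≡ (κ e , v e)
  κ′-sound e j p with X e
  ... | true = refl , findLabel-sound ls (κ e , v e) p

  κ′-complete : ∀ e → X e ≡ true → ∃ λ j → κ′ e ≡ just j
  κ′-complete e p rewrite p = findLabel-complete ls (κ e , v e) (complete e p)

  X≈ : X ≈ dom κ′
  X≈ = ⊑-antisym (λ e p → dom-just {κ = κ′} (proj₂ (κ′-complete e p))) (λ e p → let (j , q) = just-dom κ′ p in proj₁ (κ′-sound e j q))

  labels-inj : ∀ i j → lookup ls i ≡ lookup ls j → i ≡ j
  labels-inj i j p with ∨-true {⌊ i Fin.≟ j ⌋} (everyF-∀ (λ j → ⌊ i Fin.≟ j ⌋ ∨ not (eqLabel (lookup ls i) (lookup ls j)))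
                        (everyF-∀ (λ i → everyF λ j → ⌊ i Fin.≟ j ⌋ ∨ not (eqLabel (lookup ls i) (lookup ls j))) distinct i) j)
  ... | inj₁ q = ⌊⌋-true {d = i Fin.≟ j} q
  ... | inj₂ q = ⊥-elim (true≢false (trans (sym q) (cong not (trans (cong (eqLabel (lookup ls i)) (sym p)) (eqLabel-refl (lookup ls i))))))

  M : Mat (suc d) m
  M = earMat g ls

  gens≈ : ∀ i → (v ◂ (pull κ ∘ rows g)) i ≈ pull κ′ (rows M i)
  gens≈ i e = go (X e) refl
    where
    go : ∀ b → X e ≡ b → (v ◂ (pull κ ∘ rows g)) i e ≡ pull κ′ (rows M i) e
    go false p = trans (⊑-false (proj₂ (member G i)) p) (sym (⊑-false (⊑-respʳ (≈-sym X≈) (pull⊑dom κ′ (rows M i))) p))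
    go true p = build (κ′-complete e p)
      where
      build : (∃ λ j → κ′ e ≡ just j) → (v ◂ (pull κ ∘ rows g)) i e ≡ pull κ′ (rows M i) e
      build (j , q) = trans (at i) (sym (pull-just {κ = κ′} (rows M i) q))
        where
        lj = proj₂ (κ′-sound e j q)
        at : ∀ i → (v ◂ (pull κ ∘ rows g)) i e ≡ rows M i j
        at zero = sym (trans (rows-earMat₀ g ls j) (cong proj₂ lj))
        at (suc i) = sym (trans (rows-earMat g ls i j) (cong (legBit (rows g i) ∘ proj₁) lj))

  relabelled : ∀ {d′} (h : Mat d′ m) → sameSpan M h ≡ true → Real Z h
  relabelled h same = record
    { κ = κ′
    ; rep = ρ
    ; κ-rep = λ j → let (i , p) = κ′-complete (ρ j) (ρ-X j) in
        trans p (cong just (labels-inj i j (trans (proj₂ (κ′-sound (ρ j) i p)) (ρ-lab j))))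
    ; gen = GenBy-pull κ′ M h (sameSpan-sound M h same) record
        { member = λ i → let (a , b) = member G i in resp≈ Z (gens≈ i) a , ⊑-respʳ X≈ (⊑-respˡ (gens≈ i) b)
        ; generate = λ z (z∈ , z⊑) → let (c , p) = generate G z (z∈ , ⊑-respʳ (≈-sym X≈) z⊑) in
            c , λ e → trans (p e) (Σ₂-cong λ i → cong (c i ∧_) (gens≈ i e)) } }

-- States: which values v takes on each leg

sel : Bool × Bool → Bool → Bool
sel (a , b) false = a
sel (a , b) true = b

-- Adding the member `z` exchanges the two values on every leg that `z` contains, hence the `xor`
-- with `lookup z l`.
pres : ∀ {k} → Vec (Bool × Bool) k → Vec Bool k → Label k → Bool
pres s z (just l , b) = sel (lookup s l) (b xor lookup z l)
pres s z (nothing , b) = b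

allPres : ∀ {k m} → Vec (Bool × Bool) k → Vec Bool k → Vec (Label k) m → Bool
allPres s z ls = everyF λ j → pres s z (lookup ls j)

-- The counterpart of `allPres`: every label that occurs is listed. A new pattern needs both
-- directions, an excluded minor only `allPres`.
covered : ∀ {k m} → Vec (Bool × Bool) k → Vec Bool k → Vec (Label k) m → Bool
covered s z ls = everyF (λ l → everyB λ b → not (pres s z (just l , b)) ∨ has ls (just l , b)) ∧ has ls L∙
  where
  everyB : (Bool → Bool) → Bool
  everyB f = f false ∧ f true

distinctL : ∀ {k m} → Vec (Label k) m → Bool
distinctL ls = everyF λ i → everyF λ j → ⌊ i Fin.≟ j ⌋ ∨ not (eqLabel (lookup ls i) (lookup ls j))

module States {n d k} {Z : Space n} {U : V n} (nb : NoBad Z U) (ZU : ∀ v → Z ∋ v → v ⊑ U)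
              {g : Mat d k} (cov : covers g ≡ true) (R : Real Z g) where
  open Real R
  open Ears nb ZU cov R

  Takes : V n → Fin k → Bool → Set
  Takes v l b = ∃ λ e → κ e ≡ just l × v e ≡ b

  onLeg? : ∀ e l → Dec (κ e ≡ just l)
  onLeg? e l = map′ (eqMaybe-≡ (κ e) (just l)) (λ p → trans (cong (λ a → eqMaybe a (just l)) p) (eqMaybe-refl (just l)))
                    (eqMaybe (κ e) (just l) Bool.≟ true)

  takes? : ∀ v l b → Dec (Takes v l b)
  takes? v l b = Fin.any? λ e → onLeg? e l ×-dec (v e Bool.≟ b)

  state : V n → Vec (Bool × Bool) k
  state v = tabulate λ l → ⌊ takes? v l false ⌋ , ⌊ takes? v l true ⌋

  sel-state : ∀ v l b → sel (lookup (state v) l) b ≡ ⌊ takes? v l b ⌋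
  sel-state v l false = cong (λ s → sel s false) (Vec.lookup∘tabulate (λ l → ⌊ takes? v l false ⌋ , ⌊ takes? v l true ⌋) l)
  sel-state v l true = cong (λ s → sel s true) (Vec.lookup∘tabulate (λ l → ⌊ takes? v l false ⌋ , ⌊ takes? v l true ⌋) l)

  nonempty : ∀ v l → (sel (lookup (state v) l) false ∨ sel (lookup (state v) l) true) ≡ true
  nonempty v l = go (v (rep l)) refl
    where
    hit : ∀ b → v (rep l) ≡ b → sel (lookup (state v) l) b ≡ true
    hit b p = trans (sel-state v l b) (dec-true (takes? v l b) (rep l , κ-rep l , p))
    go : ∀ b → v (rep l) ≡ b → (sel (lookup (state v) l) false ∨ sel (lookup (state v) l) true) ≡ true
    go false p = cong (_∨ sel (lookup (state v) l) true) (hit false p)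
    go true p = trans (cong (sel (lookup (state v) l) false ∨_) (hit true p)) (Bool.∨-zeroʳ _)

  module _ {v} (E : Ear v) (z : Vec Bool k) (z∈ : Span g ∋ lookup z) where

    v′ : V n
    v′ = v ⊕ pull κ (lookup z)

    E′ : Ear v′
    E′ = shift (pull κ (lookup z)) (pull∈ (lookup z) z∈) E

    find-pres : ∀ l → pres (state v) z l ≡ true → ∃ λ e → lab v′ e ≡ l × (X ⊔ᵛ v′) e ≡ true
    find-pres (just l , b) p = build (⌊⌋-true {d = takes? v l (b xor lookup z l)} (trans (sym (sel-state v l (b xor lookup z l))) p))
      where
      build : Takes v l (b xor lookup z l) → ∃ λ e → lab v′ e ≡ (just l , b) × (X ⊔ᵛ v′) e ≡ true
      build (e , q , r) = e , cong₂ _,_ q (trans (cong₂ _xor_ r (pull-just {κ = κ} (lookup z) q)) (xor-cancelʳ b (lookup z l)))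
        , cong (_∨ v′ e) (dom-just {κ = κ} q)
    find-pres (nothing , true) p = proj₁ (outside E′) , ear-lab E′
        , trans (cong (X (proj₁ (outside E′)) ∨_) (proj₂ (outside-κ {v′} (proj₂ (outside E′))))) (Bool.∨-zeroʳ _)

    pres-of : ∀ {e l} → κ e ≡ just l → pres (state v) z (just l , v′ e) ≡ true
    pres-of {e} {l} q = trans (sel-state v l (v′ e xor lookup z l)) (dec-true (takes? v l (v′ e xor lookup z l))
        (e , q , sym (trans (cong (λ x → (v e xor x) xor lookup z l) (pull-just {κ = κ} (lookup z) q)) (xor-cancelʳ (v e) (lookup z l)))))

    has-label : ∀ {m} (ls : Vec (Label k) m) → covered (state v) z ls ≡ true → ∀ e → (X ⊔ᵛ v′) e ≡ true → has ls (lab v′ e) ≡ true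
    has-label ls c e p = go (κ e) refl (v′ e) refl
      where
      legs : Fin k → Bool
      legs l = (not (pres (state v) z (just l , false)) ∨ has ls (just l , false)) ∧ (not (pres (state v) z (just l , true)) ∨ has ls (just l , true))
      onLeg : ∀ l b → (not (pres (state v) z (just l , b)) ∨ has ls (just l , b)) ≡ true
      onLeg l false = proj₁ (∧-true (everyF-∀ legs (proj₁ (∧-true {everyF legs} c)) l))
      onLeg l true = proj₂ (∧-true {not (pres (state v) z (just l , false)) ∨ has ls (just l , false)} (everyF-∀ legs (proj₁ (∧-true {everyF legs} c)) l))
      go : ∀ a → κ e ≡ a → ∀ b → v′ e ≡ b → has ls (κ e , v′ e) ≡ true
      go (just l) q b r = trans (cong (λ a → has ls (a , v′ e)) q) (pick (onLeg l (v′ e)) (pres-of q))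
        where
        pick : ∀ {a b} → not a ∨ b ≡ true → a ≡ true → b ≡ true
        pick {true} p _ = p
      go nothing q true r = trans (cong₂ (λ a b → has ls (a , b)) q r) (proj₂ (∧-true {everyF legs} c))
      go nothing q false r = ⊥-elim (true≢false (trans (sym p) (cong₂ _∨_ (cong (legBit (λ _ → true)) q) r)))

    newPattern : ∀ {m d′} (ls : Vec (Label k) m) (h : Mat d′ m) → allPres (state v) z ls ≡ true → covered (state v) z ls ≡ true →
                 distinctL ls ≡ true → sameSpan (earMat g ls) h ≡ true → Real Z h
    newPattern ls h ap c dl same = Relabel.relabelled κ v′ (X ⊔ᵛ v′) g (earGen E′) ls (has-label ls c)
        (λ j → proj₁ (found j)) (λ j → proj₁ (proj₂ (found j))) (λ j → proj₂ (proj₂ (found j))) dl h same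
      where
      found : ∀ j → ∃ λ e → lab v′ e ≡ lookup ls j × (X ⊔ᵛ v′) e ≡ true
      found j = find-pres (lookup ls j) (everyF-∀ (λ j → pres (state v) z (lookup ls j)) ap j)

    newBad : ∀ {m} (ls : Vec (Label k) m) w → allPres (state v) z ls ≡ true → checkBad g ls [] w ≡ true → ⊥
    newBad {m} ls w ap ok = badEar E′ (tabulate (λ j → proj₁ (found j))) ls
        (λ j → trans (cong (lab v′) (Vec.lookup∘tabulate (λ j → proj₁ (found j)) j)) (proj₁ (proj₂ (found j)))) [] w ok []
      where
      found : ∀ j → ∃ λ e → lab v′ e ≡ lookup ls j × (X ⊔ᵛ v′) e ≡ true
      found j = find-pres (lookup ls j) (everyF-∀ (λ j → pres (state v) z (lookup ls j)) ap j)

    noZeroState : everyF (λ l → not (pres (state v) z (just l , true))) ≡ true → ⊥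
    noZeroState h = v∉ E′ (mem-0 Z λ e → ≢true⇒false λ p → contra e (just-dom κ (⊓-⊑ʳ v′ X e p)) (⊓-⊑ˡ v′ X e p))
      where
      contra : ∀ e → (∃ λ l → κ e ≡ just l) → v′ e ≡ true → ⊥
      contra e (l , q) p = true≢false (trans (sym (trans (cong (λ b → pres (state v) z (just l , b)) (sym p)) (pres-of q)))
        (not-true (everyF-∀ (λ l → not (pres (state v) z (just l , true))) h l)))

    off-state : ∀ j → everyF (λ l → ⌊ l Fin.≟ j ⌋ ∨ not (pres (state v) z (just l , true))) ≡ true →
                ∀ e i → κ e ≡ just i → i ≢ j → v′ e ≡ false
    off-state j h e i q i≢j = ≢true⇒false λ p → contra p (∨-true {⌊ i Fin.≟ j ⌋} (everyF-∀ (λ l → ⌊ l Fin.≟ j ⌋ ∨ not (pres (state v) z (just l , true))) h i))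
      where
      contra : v′ e ≡ true → ⌊ i Fin.≟ j ⌋ ≡ true ⊎ not (pres (state v) z (just i , true)) ≡ true → ⊥
      contra p (inj₁ r) = i≢j (⌊⌋-true {d = i Fin.≟ j} r)
      contra p (inj₂ r) = true≢false (trans (sym (trans (cong (λ b → pres (state v) z (just i , b)) (sym p)) (pres-of q))) (not-true r))

    unitRes : ∀ j → everyF (λ l → ⌊ l Fin.≟ j ⌋ ∨ not (pres (state v) z (just l , true))) ≡ true →
              pres (state v) z (just j , true) ≡ true → ∃ λ ρ → Res v′ (𝟙 j) ρ
    unitRes j h pj = ρ , mkRes at-ρ
      where
      hit = find-pres (just j , true) pj
      ρ : Fin k → Fin n
      ρ l = if ⌊ j Fin.≟ l ⌋ then proj₁ hit else rep l
      at-ρ : ∀ l → κ (ρ l) ≡ just l × v′ (ρ l) ≡ 𝟙 j l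
      at-ρ l with j Fin.≟ l
      ... | yes refl = cong proj₁ (proj₁ (proj₂ hit)) , cong proj₂ (proj₁ (proj₂ hit))
      ... | no j≢l = κ-rep l , off-state j h (rep l) l (κ-rep l) (j≢l ∘ sym)

onlyOn : ∀ {k} → Vec (Bool × Bool) k → Vec Bool k → Fin k → Bool
onlyOn s z j = everyF λ l → ⌊ l Fin.≟ j ⌋ ∨ not (pres s z (just l , true))

-- A leg is nonempty and so takes at least one value, which leaves three states per leg.
states : ∀ k → List (Vec (Bool × Bool) k)
states zero = [] ∷ []
states (suc k) = List.map ((true , false) ∷_) (states k) ++ (List.map ((false , true) ∷_) (states k) ++ List.map ((true , true) ∷_) (states k))

∈-states : ∀ {k} (s : Vec (Bool × Bool) k) → (∀ l → (sel (lookup s l) false ∨ sel (lookup s l) true) ≡ true) → s ∈ˡ states k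
∈-states [] h = here refl
∈-states {suc k} ((true , false) ∷ s) h = ∈-++⁺ˡ (∈-map⁺ ((true , false) ∷_) (∈-states s (h ∘ suc)))
∈-states {suc k} ((false , true) ∷ s) h = ∈-++⁺ʳ (List.map ((true , false) ∷_) (states k)) (∈-++⁺ˡ (∈-map⁺ ((false , true) ∷_) (∈-states s (h ∘ suc))))
∈-states {suc k} ((true , true) ∷ s) h = ∈-++⁺ʳ (List.map ((true , false) ∷_) (states k)) (∈-++⁺ʳ (List.map ((false , true) ∷_) (states k)) (∈-map⁺ ((true , true) ∷_) (∈-states s (h ∘ suc))))
∈-states ((false , false) ∷ s) h = ⊥-elim (true≢false (sym (h zero)))

-- Excluded minors for the ears of K₄, W₄, the prism and K₃,₃

w₁ w₂ : ∀ {m} → Vec ℕ 7 → List ℕ → Wit (suc m)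
w₁ φ D = wit (graph zero) (places _ φ) (supp D)
w₂ φ D = wit (graph (suc zero)) (places _ φ) (supp D)

w₄ : ∀ {m} → Vec ℕ 9 → List ℕ → Wit (suc m)
w₄ φ D = wit (graph (suc (suc (suc zero)))) (places _ φ) (supp D)

w₅ w₆ : ∀ {m} → Vec ℕ 10 → List ℕ → Wit (suc m)
w₅ φ D = wit (graph (suc (suc (suc (suc zero))))) (places _ φ) (supp D)
w₆ φ D = wit (graph (suc (suc (suc (suc (suc zero)))))) (places _ φ) (supp D)

w₇ : ∀ {m} → Vec ℕ 9 → List ℕ → Wit (suc m)
w₇ φ D = wit (graph (suc (suc (suc (suc (suc (suc zero))))))) (places _ φ) (supp D)

wFano wFano* : ∀ {m} → Vec ℕ 7 → List ℕ → Wit (suc m)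
wFano φ D = wit fano (places _ φ) (supp D)
wFano* φ D = wit fanoDual (places _ φ) (supp D)

wK33 : ∀ {m} → Vec ℕ 9 → List ℕ → Wit (suc m)
wK33 φ D = wit cutK33 (places _ φ) (supp D)

wK5 : ∀ {m} → Vec ℕ 10 → List ℕ → Wit (suc m)
wK5 φ D = wit cutK5 (places _ φ) (supp D)

-- Cycle spaces.  The edges of K₄ are 01, 02, 03, 12, 13, 23; those of W₄ are the spokes 1–4 and the rims
-- 12, 23, 34, 41; those of the prism 01, 12, 02, 34, 45, 35 and the matching; the edge ij of K₃,₃ is 3i + j.
thetaM : Mat 2 3
thetaM = mat ((0 ∷ 2 ∷ []) ∷ (0 ∷ 1 ∷ []) ∷ [])

k4M : Mat 3 6
k4M = mat ((1 ∷ 2 ∷ 5 ∷ []) ∷ (0 ∷ 2 ∷ 4 ∷ []) ∷ (0 ∷ 1 ∷ 3 ∷ []) ∷ [])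

w4M : Mat 4 8
w4M = mat ((0 ∷ 3 ∷ 7 ∷ []) ∷ (2 ∷ 3 ∷ 6 ∷ []) ∷ (1 ∷ 2 ∷ 5 ∷ []) ∷ (0 ∷ 1 ∷ 4 ∷ []) ∷ [])

prismM : Mat 4 9
prismM = mat ((0 ∷ 1 ∷ 3 ∷ 4 ∷ 6 ∷ 8 ∷ []) ∷ (0 ∷ 3 ∷ 6 ∷ 7 ∷ []) ∷ (3 ∷ 4 ∷ 5 ∷ []) ∷ (0 ∷ 1 ∷ 2 ∷ []) ∷ [])

k33M : Mat 4 9
k33M = mat ((0 ∷ 2 ∷ 6 ∷ 8 ∷ []) ∷ (0 ∷ 1 ∷ 6 ∷ 7 ∷ []) ∷ (0 ∷ 2 ∷ 3 ∷ 5 ∷ []) ∷ (0 ∷ 1 ∷ 3 ∷ 4 ∷ []) ∷ [])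

k4BadWit : Wit 7
k4BadWit = wFano* (0 ∷ 1 ∷ 6 ∷ 2 ∷ 5 ∷ 4 ∷ 3 ∷ []) []

-- Column 0 is the ear, column 1 the second element of leg `j` or, in `k4LongEar`, of the ear, and
-- columns 2 to 7 are the six legs. All entries are F₂: two parallel paths, one of them of length
-- two, together with the paths through the rest of the pattern.
k4LongLeg : Vec (Wit 8) 6
k4LongLeg =
    w₂ (1 ∷ 3 ∷ 4 ∷ 0 ∷ 2 ∷ 5 ∷ 6 ∷ []) (7 ∷ [])
  ∷ w₂ (1 ∷ 2 ∷ 4 ∷ 0 ∷ 3 ∷ 5 ∷ 7 ∷ []) (6 ∷ [])
  ∷ w₂ (1 ∷ 2 ∷ 3 ∷ 0 ∷ 4 ∷ 6 ∷ 7 ∷ []) (5 ∷ [])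
  ∷ w₂ (1 ∷ 2 ∷ 6 ∷ 0 ∷ 5 ∷ 3 ∷ 7 ∷ []) (4 ∷ [])
  ∷ w₂ (1 ∷ 2 ∷ 5 ∷ 0 ∷ 6 ∷ 4 ∷ 7 ∷ []) (3 ∷ [])
  ∷ w₂ (1 ∷ 3 ∷ 5 ∷ 0 ∷ 7 ∷ 4 ∷ 6 ∷ []) (2 ∷ [])
  ∷ []

k4LongEar : Vec (Wit 8) 6
k4LongEar =
    w₂ (0 ∷ 3 ∷ 4 ∷ 2 ∷ 1 ∷ 5 ∷ 6 ∷ []) (7 ∷ [])
  ∷ w₂ (0 ∷ 2 ∷ 4 ∷ 3 ∷ 1 ∷ 5 ∷ 7 ∷ []) (6 ∷ [])
  ∷ w₂ (0 ∷ 2 ∷ 3 ∷ 4 ∷ 1 ∷ 6 ∷ 7 ∷ []) (5 ∷ [])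
  ∷ w₂ (0 ∷ 2 ∷ 6 ∷ 5 ∷ 1 ∷ 3 ∷ 7 ∷ []) (4 ∷ [])
  ∷ w₂ (0 ∷ 2 ∷ 5 ∷ 6 ∷ 1 ∷ 4 ∷ 7 ∷ []) (3 ∷ [])
  ∷ w₂ (0 ∷ 3 ∷ 5 ∷ 7 ∷ 1 ∷ 4 ∷ 6 ∷ []) (2 ∷ [])
  ∷ []

-- W₄ has 16 cosets of its cycle space, the prism and K₃,₃ have 32 each. Without the trivial coset
-- and those of single legs, 7, 22 and 22 remain, one for each entry of the three lists of bad
-- cosets. Column 0 is the ear and column `l + 1` is leg `l`.
w4Bad : List (Vec Bool 8 × Wit 9)
w4Bad =
    (supp (0 ∷ 2 ∷ []) , w₂ (1 ∷ 5 ∷ 7 ∷ 0 ∷ 3 ∷ 6 ∷ 8 ∷ []) (2 ∷ 4 ∷ []))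
  ∷ (supp (1 ∷ 3 ∷ []) , w₂ (2 ∷ 5 ∷ 6 ∷ 0 ∷ 4 ∷ 8 ∷ 7 ∷ []) (1 ∷ 3 ∷ []))
  ∷ (supp (2 ∷ 4 ∷ []) , wFano (0 ∷ 2 ∷ 4 ∷ 5 ∷ 8 ∷ 7 ∷ 6 ∷ []) (1 ∷ 3 ∷ []))
  ∷ (supp (3 ∷ 4 ∷ []) , wFano (0 ∷ 1 ∷ 3 ∷ 5 ∷ 6 ∷ 7 ∷ 8 ∷ []) (2 ∷ 4 ∷ []))
  ∷ (supp (3 ∷ 5 ∷ []) , wFano (0 ∷ 1 ∷ 3 ∷ 5 ∷ 6 ∷ 8 ∷ 7 ∷ []) (2 ∷ 4 ∷ []))
  ∷ (supp (0 ∷ 6 ∷ []) , wFano (0 ∷ 2 ∷ 4 ∷ 5 ∷ 8 ∷ 6 ∷ 7 ∷ []) (1 ∷ 3 ∷ []))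
  ∷ (supp (4 ∷ 6 ∷ []) , wK33 (0 ∷ 5 ∷ 7 ∷ 6 ∷ 2 ∷ 3 ∷ 8 ∷ 1 ∷ 4 ∷ []) [])
  ∷ []

w4Mixed : List ((Fin 8 × Fin 8) × Wit 10)
w4Mixed =
    ((# 0 , # 1) , w₂ (1 ∷ 4 ∷ 5 ∷ 3 ∷ 2 ∷ 7 ∷ 9 ∷ []) (0 ∷ 8 ∷ []))
  ∷ ((# 0 , # 3) , w₂ (1 ∷ 4 ∷ 5 ∷ 3 ∷ 2 ∷ 7 ∷ 9 ∷ []) (0 ∷ 8 ∷ []))
  ∷ ((# 0 , # 4) , w₂ (1 ∷ 4 ∷ 5 ∷ 3 ∷ 2 ∷ 7 ∷ 9 ∷ []) (0 ∷ 8 ∷ []))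
  ∷ ((# 0 , # 7) , w₂ (1 ∷ 4 ∷ 5 ∷ 3 ∷ 2 ∷ 7 ∷ 9 ∷ []) (0 ∷ 8 ∷ []))
  ∷ ((# 1 , # 0) , w₂ (1 ∷ 4 ∷ 5 ∷ 2 ∷ 3 ∷ 7 ∷ 9 ∷ []) (0 ∷ 8 ∷ []))
  ∷ ((# 1 , # 2) , w₂ (1 ∷ 4 ∷ 5 ∷ 2 ∷ 3 ∷ 7 ∷ 9 ∷ []) (0 ∷ 8 ∷ []))
  ∷ ((# 1 , # 4) , w₂ (1 ∷ 4 ∷ 5 ∷ 2 ∷ 3 ∷ 7 ∷ 9 ∷ []) (0 ∷ 8 ∷ []))
  ∷ ((# 1 , # 5) , w₂ (1 ∷ 4 ∷ 5 ∷ 2 ∷ 3 ∷ 7 ∷ 9 ∷ []) (0 ∷ 8 ∷ []))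
  ∷ ((# 2 , # 1) , w₂ (1 ∷ 2 ∷ 3 ∷ 5 ∷ 4 ∷ 9 ∷ 7 ∷ []) (0 ∷ 6 ∷ []))
  ∷ ((# 2 , # 3) , w₂ (1 ∷ 2 ∷ 3 ∷ 5 ∷ 4 ∷ 9 ∷ 7 ∷ []) (0 ∷ 6 ∷ []))
  ∷ ((# 2 , # 5) , w₂ (1 ∷ 2 ∷ 3 ∷ 5 ∷ 4 ∷ 9 ∷ 7 ∷ []) (0 ∷ 6 ∷ []))
  ∷ ((# 2 , # 6) , w₂ (1 ∷ 2 ∷ 3 ∷ 5 ∷ 4 ∷ 9 ∷ 7 ∷ []) (0 ∷ 6 ∷ []))
  ∷ ((# 3 , # 0) , w₂ (1 ∷ 2 ∷ 3 ∷ 4 ∷ 5 ∷ 9 ∷ 7 ∷ []) (0 ∷ 6 ∷ []))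
  ∷ ((# 3 , # 2) , w₂ (1 ∷ 2 ∷ 3 ∷ 4 ∷ 5 ∷ 9 ∷ 7 ∷ []) (0 ∷ 6 ∷ []))
  ∷ ((# 3 , # 6) , w₂ (1 ∷ 2 ∷ 3 ∷ 4 ∷ 5 ∷ 9 ∷ 7 ∷ []) (0 ∷ 6 ∷ []))
  ∷ ((# 3 , # 7) , w₂ (1 ∷ 2 ∷ 3 ∷ 4 ∷ 5 ∷ 9 ∷ 7 ∷ []) (0 ∷ 6 ∷ []))
  ∷ ((# 4 , # 0) , w₆ (0 ∷ 8 ∷ 1 ∷ 7 ∷ 3 ∷ 2 ∷ 5 ∷ 9 ∷ 6 ∷ 4 ∷ []) [])
  ∷ ((# 4 , # 1) , w₆ (0 ∷ 8 ∷ 1 ∷ 9 ∷ 2 ∷ 3 ∷ 4 ∷ 7 ∷ 6 ∷ 5 ∷ []) [])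
  ∷ ((# 5 , # 1) , w₆ (0 ∷ 9 ∷ 1 ∷ 8 ∷ 4 ∷ 3 ∷ 2 ∷ 6 ∷ 7 ∷ 5 ∷ []) [])
  ∷ ((# 5 , # 2) , w₆ (0 ∷ 9 ∷ 1 ∷ 6 ∷ 3 ∷ 4 ∷ 5 ∷ 8 ∷ 7 ∷ 2 ∷ []) [])
  ∷ ((# 6 , # 2) , w₆ (0 ∷ 6 ∷ 1 ∷ 9 ∷ 5 ∷ 4 ∷ 3 ∷ 7 ∷ 8 ∷ 2 ∷ []) [])
  ∷ ((# 6 , # 3) , w₆ (0 ∷ 6 ∷ 1 ∷ 7 ∷ 4 ∷ 5 ∷ 2 ∷ 9 ∷ 8 ∷ 3 ∷ []) [])
  ∷ ((# 7 , # 0) , w₆ (0 ∷ 7 ∷ 1 ∷ 8 ∷ 5 ∷ 2 ∷ 3 ∷ 6 ∷ 9 ∷ 4 ∷ []) [])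
  ∷ ((# 7 , # 3) , w₆ (0 ∷ 7 ∷ 1 ∷ 6 ∷ 2 ∷ 5 ∷ 4 ∷ 8 ∷ 9 ∷ 3 ∷ []) [])
  ∷ []

w4LongLeg : Vec (Wit 10) 8
w4LongLeg =
    w₂ (1 ∷ 4 ∷ 5 ∷ 3 ∷ 2 ∷ 7 ∷ 9 ∷ []) (0 ∷ 8 ∷ [])
  ∷ w₂ (1 ∷ 4 ∷ 5 ∷ 2 ∷ 3 ∷ 7 ∷ 9 ∷ []) (0 ∷ 8 ∷ [])
  ∷ w₂ (1 ∷ 2 ∷ 3 ∷ 5 ∷ 4 ∷ 9 ∷ 7 ∷ []) (0 ∷ 6 ∷ [])
  ∷ w₂ (1 ∷ 2 ∷ 3 ∷ 4 ∷ 5 ∷ 9 ∷ 7 ∷ []) (0 ∷ 6 ∷ [])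
  ∷ w₂ (1 ∷ 3 ∷ 7 ∷ 0 ∷ 6 ∷ 5 ∷ 8 ∷ []) (2 ∷ 4 ∷ [])
  ∷ w₂ (1 ∷ 3 ∷ 6 ∷ 0 ∷ 7 ∷ 5 ∷ 9 ∷ []) (2 ∷ 4 ∷ [])
  ∷ w₂ (1 ∷ 4 ∷ 7 ∷ 0 ∷ 8 ∷ 5 ∷ 9 ∷ []) (2 ∷ 3 ∷ [])
  ∷ w₂ (1 ∷ 3 ∷ 7 ∷ 0 ∷ 9 ∷ 5 ∷ 8 ∷ []) (2 ∷ 4 ∷ [])
  ∷ []

w4LongEar : Vec (Wit 10) 8
w4LongEar =
    w₂ (0 ∷ 4 ∷ 5 ∷ 3 ∷ 1 ∷ 7 ∷ 9 ∷ []) (2 ∷ 8 ∷ [])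
  ∷ w₂ (0 ∷ 6 ∷ 7 ∷ 3 ∷ 1 ∷ 9 ∷ 8 ∷ []) (2 ∷ 4 ∷ [])
  ∷ w₂ (0 ∷ 6 ∷ 8 ∷ 4 ∷ 1 ∷ 7 ∷ 9 ∷ []) (3 ∷ 5 ∷ [])
  ∷ w₂ (0 ∷ 6 ∷ 7 ∷ 5 ∷ 1 ∷ 9 ∷ 8 ∷ []) (2 ∷ 4 ∷ [])
  ∷ w₂ (0 ∷ 3 ∷ 7 ∷ 6 ∷ 1 ∷ 5 ∷ 8 ∷ []) (2 ∷ 4 ∷ [])
  ∷ w₂ (0 ∷ 3 ∷ 6 ∷ 7 ∷ 1 ∷ 5 ∷ 9 ∷ []) (2 ∷ 4 ∷ [])
  ∷ w₂ (0 ∷ 4 ∷ 7 ∷ 8 ∷ 1 ∷ 5 ∷ 9 ∷ []) (2 ∷ 3 ∷ [])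
  ∷ w₂ (0 ∷ 3 ∷ 7 ∷ 9 ∷ 1 ∷ 5 ∷ 8 ∷ []) (2 ∷ 4 ∷ [])
  ∷ []

prismBad : List (Vec Bool 9 × Wit 10)
prismBad =
    (supp (0 ∷ 3 ∷ []) , wK33 (0 ∷ 1 ∷ 4 ∷ 7 ∷ 3 ∷ 6 ∷ 8 ∷ 2 ∷ 5 ∷ []) [])
  ∷ (supp (1 ∷ 3 ∷ []) , wFano (0 ∷ 3 ∷ 9 ∷ 5 ∷ 8 ∷ 7 ∷ 6 ∷ []) (2 ∷ 4 ∷ []))
  ∷ (supp (2 ∷ 3 ∷ []) , wFano (0 ∷ 3 ∷ 9 ∷ 5 ∷ 8 ∷ 7 ∷ 6 ∷ []) (2 ∷ 4 ∷ []))
  ∷ (supp (0 ∷ 4 ∷ []) , wFano (0 ∷ 3 ∷ 7 ∷ 4 ∷ 8 ∷ 9 ∷ 6 ∷ []) (1 ∷ 5 ∷ []))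
  ∷ (supp (1 ∷ 4 ∷ []) , wK33 (0 ∷ 2 ∷ 5 ∷ 8 ∷ 1 ∷ 4 ∷ 9 ∷ 3 ∷ 6 ∷ []) [])
  ∷ (supp (2 ∷ 4 ∷ []) , wFano (0 ∷ 3 ∷ 7 ∷ 4 ∷ 8 ∷ 9 ∷ 6 ∷ []) (1 ∷ 5 ∷ []))
  ∷ (supp (0 ∷ 5 ∷ []) , wFano (0 ∷ 2 ∷ 8 ∷ 4 ∷ 7 ∷ 9 ∷ 5 ∷ []) (1 ∷ 6 ∷ []))
  ∷ (supp (1 ∷ 5 ∷ []) , wFano (0 ∷ 2 ∷ 8 ∷ 4 ∷ 7 ∷ 9 ∷ 5 ∷ []) (1 ∷ 6 ∷ []))
  ∷ (supp (2 ∷ 5 ∷ []) , wK33 (0 ∷ 3 ∷ 6 ∷ 7 ∷ 1 ∷ 4 ∷ 9 ∷ 2 ∷ 5 ∷ []) [])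
  ∷ (supp (0 ∷ 6 ∷ []) , w₂ (3 ∷ 4 ∷ 6 ∷ 0 ∷ 7 ∷ 8 ∷ 9 ∷ []) (1 ∷ 5 ∷ []))
  ∷ (supp (1 ∷ 6 ∷ []) , wFano (0 ∷ 1 ∷ 8 ∷ 3 ∷ 9 ∷ 6 ∷ 7 ∷ []) (2 ∷ 4 ∷ []))
  ∷ (supp (2 ∷ 6 ∷ []) , w₂ (3 ∷ 4 ∷ 6 ∷ 0 ∷ 7 ∷ 8 ∷ 9 ∷ []) (1 ∷ 5 ∷ []))
  ∷ (supp (3 ∷ 6 ∷ []) , w₂ (2 ∷ 4 ∷ 5 ∷ 0 ∷ 8 ∷ 7 ∷ 9 ∷ []) (1 ∷ 6 ∷ []))
  ∷ (supp (4 ∷ 6 ∷ []) , wFano (0 ∷ 3 ∷ 7 ∷ 4 ∷ 8 ∷ 6 ∷ 9 ∷ []) (1 ∷ 5 ∷ []))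
  ∷ (supp (5 ∷ 6 ∷ []) , w₂ (3 ∷ 5 ∷ 6 ∷ 0 ∷ 9 ∷ 8 ∷ 7 ∷ []) (2 ∷ 4 ∷ []))
  ∷ (supp (1 ∷ 7 ∷ []) , w₂ (2 ∷ 4 ∷ 5 ∷ 0 ∷ 8 ∷ 7 ∷ 9 ∷ []) (1 ∷ 6 ∷ []))
  ∷ (supp (2 ∷ 7 ∷ []) , wFano (0 ∷ 1 ∷ 7 ∷ 2 ∷ 9 ∷ 5 ∷ 8 ∷ []) (3 ∷ 4 ∷ []))
  ∷ (supp (4 ∷ 7 ∷ []) , w₂ (3 ∷ 5 ∷ 6 ∷ 0 ∷ 9 ∷ 8 ∷ 7 ∷ []) (2 ∷ 4 ∷ []))
  ∷ (supp (5 ∷ 7 ∷ []) , wFano (0 ∷ 2 ∷ 8 ∷ 4 ∷ 7 ∷ 5 ∷ 9 ∷ []) (1 ∷ 6 ∷ []))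
  ∷ (supp (0 ∷ 8 ∷ []) , wFano (0 ∷ 2 ∷ 8 ∷ 3 ∷ 7 ∷ 6 ∷ 9 ∷ []) (1 ∷ 5 ∷ []))
  ∷ (supp (3 ∷ 8 ∷ []) , wFano (0 ∷ 3 ∷ 9 ∷ 5 ∷ 8 ∷ 6 ∷ 7 ∷ []) (2 ∷ 4 ∷ []))
  ∷ (supp (1 ∷ 4 ∷ 6 ∷ []) , wFano (0 ∷ 3 ∷ 9 ∷ 5 ∷ 8 ∷ 6 ∷ 7 ∷ []) (2 ∷ 4 ∷ []))
  ∷ []

prismMixed : List ((Fin 9 × Fin 9) × Wit 11)
prismMixed =
    ((# 0 , # 1) , w₂ (1 ∷ 5 ∷ 7 ∷ 4 ∷ 2 ∷ 9 ∷ 10 ∷ []) (0 ∷ 6 ∷ []))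
  ∷ ((# 0 , # 2) , w₂ (1 ∷ 5 ∷ 7 ∷ 4 ∷ 2 ∷ 9 ∷ 10 ∷ []) (0 ∷ 6 ∷ []))
  ∷ ((# 1 , # 0) , w₂ (1 ∷ 6 ∷ 7 ∷ 4 ∷ 3 ∷ 9 ∷ 8 ∷ []) (0 ∷ 5 ∷ []))
  ∷ ((# 1 , # 2) , w₂ (1 ∷ 6 ∷ 7 ∷ 4 ∷ 3 ∷ 9 ∷ 8 ∷ []) (0 ∷ 5 ∷ []))
  ∷ ((# 2 , # 0) , w₂ (1 ∷ 6 ∷ 7 ∷ 3 ∷ 4 ∷ 9 ∷ 8 ∷ []) (0 ∷ 5 ∷ []))
  ∷ ((# 2 , # 1) , w₂ (1 ∷ 6 ∷ 7 ∷ 3 ∷ 4 ∷ 9 ∷ 8 ∷ []) (0 ∷ 5 ∷ []))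
  ∷ ((# 3 , # 4) , w₂ (1 ∷ 2 ∷ 4 ∷ 7 ∷ 5 ∷ 9 ∷ 10 ∷ []) (0 ∷ 3 ∷ []))
  ∷ ((# 3 , # 5) , w₂ (1 ∷ 2 ∷ 4 ∷ 7 ∷ 5 ∷ 9 ∷ 10 ∷ []) (0 ∷ 3 ∷ []))
  ∷ ((# 4 , # 3) , w₂ (1 ∷ 3 ∷ 4 ∷ 7 ∷ 6 ∷ 9 ∷ 8 ∷ []) (0 ∷ 2 ∷ []))
  ∷ ((# 4 , # 5) , w₂ (1 ∷ 3 ∷ 4 ∷ 7 ∷ 6 ∷ 9 ∷ 8 ∷ []) (0 ∷ 2 ∷ []))
  ∷ ((# 5 , # 3) , w₂ (1 ∷ 3 ∷ 4 ∷ 6 ∷ 7 ∷ 9 ∷ 8 ∷ []) (0 ∷ 2 ∷ []))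
  ∷ ((# 5 , # 4) , w₂ (1 ∷ 3 ∷ 4 ∷ 6 ∷ 7 ∷ 9 ∷ 8 ∷ []) (0 ∷ 2 ∷ []))
  ∷ []

prismLongLeg : Vec (Wit 11) 9
prismLongLeg =
    w₂ (1 ∷ 5 ∷ 7 ∷ 4 ∷ 2 ∷ 9 ∷ 10 ∷ []) (0 ∷ 6 ∷ [])
  ∷ w₂ (1 ∷ 6 ∷ 7 ∷ 4 ∷ 3 ∷ 9 ∷ 8 ∷ []) (0 ∷ 5 ∷ [])
  ∷ w₂ (1 ∷ 6 ∷ 7 ∷ 3 ∷ 4 ∷ 9 ∷ 8 ∷ []) (0 ∷ 5 ∷ [])
  ∷ w₂ (1 ∷ 2 ∷ 4 ∷ 7 ∷ 5 ∷ 9 ∷ 10 ∷ []) (0 ∷ 3 ∷ [])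
  ∷ w₂ (1 ∷ 3 ∷ 4 ∷ 7 ∷ 6 ∷ 9 ∷ 8 ∷ []) (0 ∷ 2 ∷ [])
  ∷ w₂ (1 ∷ 3 ∷ 4 ∷ 6 ∷ 7 ∷ 9 ∷ 8 ∷ []) (0 ∷ 2 ∷ [])
  ∷ w₂ (1 ∷ 5 ∷ 7 ∷ 0 ∷ 8 ∷ 9 ∷ 10 ∷ []) (2 ∷ 6 ∷ [])
  ∷ w₂ (1 ∷ 5 ∷ 6 ∷ 0 ∷ 9 ∷ 8 ∷ 10 ∷ []) (2 ∷ 7 ∷ [])
  ∷ w₂ (1 ∷ 6 ∷ 7 ∷ 0 ∷ 10 ∷ 9 ∷ 8 ∷ []) (2 ∷ 5 ∷ [])
  ∷ []

prismLongEar : Vec (Wit 11) 9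
prismLongEar =
    w₂ (0 ∷ 5 ∷ 7 ∷ 4 ∷ 1 ∷ 9 ∷ 10 ∷ []) (2 ∷ 6 ∷ [])
  ∷ w₂ (0 ∷ 6 ∷ 7 ∷ 4 ∷ 1 ∷ 9 ∷ 8 ∷ []) (3 ∷ 5 ∷ [])
  ∷ w₂ (0 ∷ 6 ∷ 7 ∷ 4 ∷ 1 ∷ 9 ∷ 8 ∷ []) (3 ∷ 5 ∷ [])
  ∷ w₂ (0 ∷ 6 ∷ 8 ∷ 5 ∷ 1 ∷ 7 ∷ 9 ∷ []) (2 ∷ 10 ∷ [])
  ∷ w₂ (0 ∷ 5 ∷ 9 ∷ 6 ∷ 1 ∷ 7 ∷ 10 ∷ []) (2 ∷ 4 ∷ [])
  ∷ w₂ (0 ∷ 5 ∷ 8 ∷ 7 ∷ 1 ∷ 6 ∷ 10 ∷ []) (2 ∷ 3 ∷ [])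
  ∷ w₂ (0 ∷ 5 ∷ 7 ∷ 8 ∷ 1 ∷ 9 ∷ 10 ∷ []) (2 ∷ 6 ∷ [])
  ∷ w₂ (0 ∷ 5 ∷ 6 ∷ 9 ∷ 1 ∷ 8 ∷ 10 ∷ []) (2 ∷ 7 ∷ [])
  ∷ w₂ (0 ∷ 6 ∷ 7 ∷ 10 ∷ 1 ∷ 9 ∷ 8 ∷ []) (2 ∷ 5 ∷ [])
  ∷ []

k33Bad : List (Vec Bool 9 × Wit 10)
k33Bad =
    (supp (0 ∷ 1 ∷ []) , w₂ (0 ∷ 2 ∷ 5 ∷ 8 ∷ 7 ∷ 3 ∷ 6 ∷ []) (1 ∷ 4 ∷ []))
  ∷ (supp (0 ∷ 2 ∷ []) , w₂ (0 ∷ 2 ∷ 5 ∷ 9 ∷ 7 ∷ 3 ∷ 6 ∷ []) (1 ∷ 4 ∷ []))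
  ∷ (supp (1 ∷ 2 ∷ []) , w₂ (2 ∷ 5 ∷ 8 ∷ 0 ∷ 3 ∷ 6 ∷ 9 ∷ []) (1 ∷ 4 ∷ []))
  ∷ (supp (0 ∷ 3 ∷ []) , w₂ (0 ∷ 4 ∷ 5 ∷ 6 ∷ 3 ∷ 7 ∷ 8 ∷ []) (1 ∷ 2 ∷ []))
  ∷ (supp (1 ∷ 3 ∷ []) , wFano (3 ∷ 4 ∷ 7 ∷ 5 ∷ 8 ∷ 9 ∷ 6 ∷ []) (1 ∷ 2 ∷ []))
  ∷ (supp (2 ∷ 3 ∷ []) , wFano (2 ∷ 4 ∷ 7 ∷ 5 ∷ 8 ∷ 9 ∷ 6 ∷ []) (1 ∷ 3 ∷ []))
  ∷ (supp (2 ∷ 4 ∷ []) , wFano (1 ∷ 4 ∷ 7 ∷ 5 ∷ 8 ∷ 9 ∷ 6 ∷ []) (2 ∷ 3 ∷ []))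
  ∷ (supp (0 ∷ 6 ∷ []) , w₂ (0 ∷ 4 ∷ 5 ∷ 9 ∷ 3 ∷ 7 ∷ 8 ∷ []) (1 ∷ 2 ∷ []))
  ∷ (supp (1 ∷ 6 ∷ []) , wFano (3 ∷ 4 ∷ 7 ∷ 5 ∷ 8 ∷ 6 ∷ 9 ∷ []) (1 ∷ 2 ∷ []))
  ∷ (supp (2 ∷ 6 ∷ []) , wFano (2 ∷ 4 ∷ 7 ∷ 5 ∷ 8 ∷ 6 ∷ 9 ∷ []) (1 ∷ 3 ∷ []))
  ∷ (supp (3 ∷ 6 ∷ []) , w₂ (4 ∷ 5 ∷ 6 ∷ 0 ∷ 7 ∷ 8 ∷ 9 ∷ []) (1 ∷ 2 ∷ []))
  ∷ (supp (4 ∷ 6 ∷ []) , wFano (1 ∷ 2 ∷ 3 ∷ 6 ∷ 7 ∷ 8 ∷ 9 ∷ []) (4 ∷ 5 ∷ []))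
  ∷ (supp (5 ∷ 6 ∷ []) , wFano (1 ∷ 2 ∷ 3 ∷ 5 ∷ 7 ∷ 8 ∷ 9 ∷ []) (4 ∷ 6 ∷ []))
  ∷ (supp (2 ∷ 7 ∷ []) , wFano (1 ∷ 4 ∷ 7 ∷ 5 ∷ 8 ∷ 6 ∷ 9 ∷ []) (2 ∷ 3 ∷ []))
  ∷ (supp (5 ∷ 7 ∷ []) , wFano (1 ∷ 2 ∷ 3 ∷ 4 ∷ 7 ∷ 8 ∷ 9 ∷ []) (5 ∷ 6 ∷ []))
  ∷ (supp (0 ∷ 1 ∷ 2 ∷ []) , wFano (0 ∷ 1 ∷ 7 ∷ 2 ∷ 8 ∷ 9 ∷ 3 ∷ []) (4 ∷ 5 ∷ []))
  ∷ (supp (1 ∷ 2 ∷ 3 ∷ []) , wFano (0 ∷ 4 ∷ 7 ∷ 5 ∷ 8 ∷ 9 ∷ 6 ∷ []) (1 ∷ 2 ∷ []))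
  ∷ (supp (1 ∷ 2 ∷ 6 ∷ []) , wFano (0 ∷ 4 ∷ 7 ∷ 5 ∷ 8 ∷ 6 ∷ 9 ∷ []) (1 ∷ 2 ∷ []))
  ∷ (supp (0 ∷ 3 ∷ 6 ∷ []) , wFano (0 ∷ 1 ∷ 3 ∷ 4 ∷ 6 ∷ 9 ∷ 7 ∷ []) (2 ∷ 5 ∷ []))
  ∷ (supp (1 ∷ 3 ∷ 6 ∷ []) , wFano (0 ∷ 2 ∷ 3 ∷ 5 ∷ 6 ∷ 9 ∷ 8 ∷ []) (1 ∷ 4 ∷ []))
  ∷ (supp (2 ∷ 3 ∷ 6 ∷ []) , wFano (0 ∷ 2 ∷ 3 ∷ 5 ∷ 6 ∷ 8 ∷ 9 ∷ []) (1 ∷ 4 ∷ []))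
  ∷ (supp (2 ∷ 4 ∷ 6 ∷ []) , wK33 (1 ∷ 5 ∷ 9 ∷ 6 ∷ 7 ∷ 2 ∷ 8 ∷ 3 ∷ 4 ∷ []) [])
  ∷ []

k33LongLeg : Vec (Wit 11) 9
k33LongLeg =
    w₂ (1 ∷ 4 ∷ 8 ∷ 6 ∷ 2 ∷ 7 ∷ 9 ∷ []) (0 ∷ 10 ∷ [])
  ∷ w₂ (1 ∷ 4 ∷ 8 ∷ 5 ∷ 3 ∷ 7 ∷ 9 ∷ []) (0 ∷ 10 ∷ [])
  ∷ w₂ (1 ∷ 3 ∷ 5 ∷ 8 ∷ 4 ∷ 9 ∷ 7 ∷ []) (0 ∷ 6 ∷ [])
  ∷ w₂ (1 ∷ 4 ∷ 8 ∷ 3 ∷ 5 ∷ 7 ∷ 9 ∷ []) (0 ∷ 10 ∷ [])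
  ∷ w₂ (1 ∷ 3 ∷ 5 ∷ 10 ∷ 6 ∷ 4 ∷ 8 ∷ []) (0 ∷ 2 ∷ [])
  ∷ w₂ (1 ∷ 3 ∷ 5 ∷ 9 ∷ 7 ∷ 4 ∷ 8 ∷ []) (0 ∷ 2 ∷ [])
  ∷ w₂ (1 ∷ 3 ∷ 5 ∷ 4 ∷ 8 ∷ 9 ∷ 7 ∷ []) (0 ∷ 6 ∷ [])
  ∷ w₂ (1 ∷ 3 ∷ 5 ∷ 7 ∷ 9 ∷ 4 ∷ 8 ∷ []) (0 ∷ 2 ∷ [])
  ∷ w₂ (1 ∷ 3 ∷ 5 ∷ 6 ∷ 10 ∷ 4 ∷ 8 ∷ []) (0 ∷ 2 ∷ [])
  ∷ []

k33LongEar : Vec (Wit 11) 9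
k33LongEar =
    w₂ (0 ∷ 4 ∷ 8 ∷ 6 ∷ 1 ∷ 7 ∷ 9 ∷ []) (2 ∷ 10 ∷ [])
  ∷ w₂ (0 ∷ 4 ∷ 8 ∷ 5 ∷ 1 ∷ 7 ∷ 9 ∷ []) (3 ∷ 10 ∷ [])
  ∷ w₂ (0 ∷ 6 ∷ 9 ∷ 4 ∷ 1 ∷ 7 ∷ 10 ∷ []) (2 ∷ 5 ∷ [])
  ∷ w₂ (0 ∷ 6 ∷ 7 ∷ 5 ∷ 1 ∷ 9 ∷ 10 ∷ []) (2 ∷ 3 ∷ [])
  ∷ w₂ (0 ∷ 5 ∷ 7 ∷ 6 ∷ 1 ∷ 8 ∷ 10 ∷ []) (2 ∷ 3 ∷ [])
  ∷ w₂ (0 ∷ 5 ∷ 6 ∷ 7 ∷ 1 ∷ 8 ∷ 9 ∷ []) (2 ∷ 3 ∷ [])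
  ∷ w₂ (0 ∷ 6 ∷ 7 ∷ 8 ∷ 1 ∷ 9 ∷ 10 ∷ []) (2 ∷ 3 ∷ [])
  ∷ w₂ (0 ∷ 5 ∷ 7 ∷ 9 ∷ 1 ∷ 8 ∷ 10 ∷ []) (2 ∷ 3 ∷ [])
  ∷ w₂ (0 ∷ 5 ∷ 6 ∷ 10 ∷ 1 ∷ 8 ∷ 9 ∷ []) (2 ∷ 3 ∷ [])
  ∷ []

w4T : Tables w4M
w4T = record { bad = w4Bad ; mixed = w4Mixed ; longLeg = w4LongLeg ; longEar = w4LongEar }

prismT : Tables prismM
prismT = record { bad = prismBad ; mixed = prismMixed ; longLeg = prismLongLeg ; longEar = prismLongEar }

k33T : Tables k33M
k33T = record { bad = k33Bad ; mixed = [] ; longLeg = k33LongLeg ; longEar = k33LongEar }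

w4-bad : Tables.badOk w4T ≡ true
w4-bad = refl

w4-mixed : Tables.mixedOk w4T ≡ true
w4-mixed = refl

w4-long : Tables.longOk w4T ≡ true
w4-long = refl

w4-class : Tables.classOk w4T ≡ true
w4-class = refl

w4-pair : Tables.pairOk w4T ≡ true
w4-pair = refl

prism-bad : Tables.badOk prismT ≡ true
prism-bad = refl

prism-mixed : Tables.mixedOk prismT ≡ true
prism-mixed = refl

prism-long : Tables.longOk prismT ≡ true
prism-long = refl

prism-class : Tables.classOk prismT ≡ true
prism-class = refl

prism-pair : Tables.pairOk prismT ≡ true
prism-pair = refl

k33-bad : Tables.badOk k33T ≡ true
k33-bad = refl

k33-mixed : Tables.mixedOk k33T ≡ true
k33-mixed = refl

k33-long : Tables.longOk k33T ≡ true
k33-long = refl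

k33-class : Tables.classOk k33T ≡ true
k33-class = refl

k33-pair : Tables.pairOk k33T ≡ true
k33-pair = refl

lsW4 : Vec (Label 6) 8
lsW4 = (just (# 1) , true) ∷ (just (# 5) , false) ∷ (just (# 3) , false) ∷ L∙ ∷ (just (# 2) , false) ∷ (just (# 4) , false) ∷ (just (# 0) , false) ∷ (just (# 0) , true) ∷ []

lsPrism : Vec (Label 6) 9
lsPrism = (just (# 0) , true) ∷ (just (# 1) , true) ∷ L∙ ∷ (just (# 4) , false) ∷ (just (# 5) , false) ∷ (just (# 3) , false) ∷ (just (# 0) , false) ∷ (just (# 2) , false) ∷ (just (# 1) , false) ∷ []

lsK33 : Vec (Label 6) 9
lsK33 = (just (# 0) , false) ∷ (just (# 0) , true) ∷ L∙ ∷ (just (# 3) , false) ∷ (just (# 1) , true) ∷ (just (# 5) , true) ∷ (just (# 4) , false) ∷ (just (# 2) , false) ∷ (just (# 5) , false) ∷ []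

-- The ear splits each of the legs 01, 02, 12, as if it had three feet. The ten labels together form
-- the cut space of K₅.
lsTriangle : Vec (Label 6) 10
lsTriangle = L∙ ∷ (just (# 0) , true) ∷ (just (# 1) , true) ∷ (just (# 3) , true) ∷ (just (# 0) , false) ∷ (just (# 1) , false) ∷ (just (# 2) , false) ∷ (just (# 3) , false) ∷ (just (# 4) , false) ∷ (just (# 5) , false) ∷ []

triangleWit : Wit 10
triangleWit = wK5 (0 ∷ 1 ∷ 2 ∷ 3 ∷ 4 ∷ 5 ∷ 7 ∷ 6 ∷ 8 ∷ 9 ∷ []) []

-- the automorphisms of K₄, acting on its edges
k4Perms : List (Vec (Fin 6) 6)
k4Perms =
    places 5 (0 ∷ 1 ∷ 2 ∷ 3 ∷ 4 ∷ 5 ∷ [])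
  ∷ places 5 (0 ∷ 2 ∷ 1 ∷ 4 ∷ 3 ∷ 5 ∷ [])
  ∷ places 5 (1 ∷ 0 ∷ 2 ∷ 3 ∷ 5 ∷ 4 ∷ [])
  ∷ places 5 (1 ∷ 2 ∷ 0 ∷ 5 ∷ 3 ∷ 4 ∷ [])
  ∷ places 5 (2 ∷ 0 ∷ 1 ∷ 4 ∷ 5 ∷ 3 ∷ [])
  ∷ places 5 (2 ∷ 1 ∷ 0 ∷ 5 ∷ 4 ∷ 3 ∷ [])
  ∷ places 5 (0 ∷ 3 ∷ 4 ∷ 1 ∷ 2 ∷ 5 ∷ [])
  ∷ places 5 (0 ∷ 4 ∷ 3 ∷ 2 ∷ 1 ∷ 5 ∷ [])
  ∷ places 5 (3 ∷ 0 ∷ 4 ∷ 1 ∷ 5 ∷ 2 ∷ [])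
  ∷ places 5 (3 ∷ 4 ∷ 0 ∷ 5 ∷ 1 ∷ 2 ∷ [])
  ∷ places 5 (4 ∷ 0 ∷ 3 ∷ 2 ∷ 5 ∷ 1 ∷ [])
  ∷ places 5 (4 ∷ 3 ∷ 0 ∷ 5 ∷ 2 ∷ 1 ∷ [])
  ∷ places 5 (1 ∷ 3 ∷ 5 ∷ 0 ∷ 2 ∷ 4 ∷ [])
  ∷ places 5 (1 ∷ 5 ∷ 3 ∷ 2 ∷ 0 ∷ 4 ∷ [])
  ∷ places 5 (3 ∷ 1 ∷ 5 ∷ 0 ∷ 4 ∷ 2 ∷ [])
  ∷ places 5 (3 ∷ 5 ∷ 1 ∷ 4 ∷ 0 ∷ 2 ∷ [])
  ∷ places 5 (5 ∷ 1 ∷ 3 ∷ 2 ∷ 4 ∷ 0 ∷ [])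
  ∷ places 5 (5 ∷ 3 ∷ 1 ∷ 4 ∷ 2 ∷ 0 ∷ [])
  ∷ places 5 (2 ∷ 4 ∷ 5 ∷ 0 ∷ 1 ∷ 3 ∷ [])
  ∷ places 5 (2 ∷ 5 ∷ 4 ∷ 1 ∷ 0 ∷ 3 ∷ [])
  ∷ places 5 (4 ∷ 2 ∷ 5 ∷ 0 ∷ 3 ∷ 1 ∷ [])
  ∷ places 5 (4 ∷ 5 ∷ 2 ∷ 3 ∷ 0 ∷ 1 ∷ [])
  ∷ places 5 (5 ∷ 2 ∷ 4 ∷ 1 ∷ 3 ∷ 0 ∷ [])
  ∷ places 5 (5 ∷ 4 ∷ 2 ∷ 3 ∷ 1 ∷ 0 ∷ [])
  ∷ []

-- The ear joins the interiors of the legs 0 and 1. In `lsThree` all three legs are split, and the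
-- seven labels form F₇.
lsK4 : Vec (Label 3) 6
lsK4 = (just (# 0) , false) ∷ (just (# 0) , true) ∷ L∙ ∷ (just (# 2) , false) ∷ (just (# 1) , false) ∷ (just (# 1) , true) ∷ []

lsThree : Vec (Label 3) 7
lsThree = L∙ ∷ (just (# 0) , true) ∷ (just (# 1) , true) ∷ (just (# 2) , true) ∷ (just (# 0) , false) ∷ (just (# 1) , false) ∷ (just (# 2) , false) ∷ []

threeWit : Wit 7
threeWit = wFano (0 ∷ 1 ∷ 4 ∷ 2 ∷ 5 ∷ 6 ∷ 3 ∷ []) []

thetaPerms : List (Vec (Fin 3) 3)
thetaPerms = places 2 (0 ∷ 1 ∷ 2 ∷ []) ∷ places 2 (0 ∷ 2 ∷ 1 ∷ []) ∷ places 2 (1 ∷ 0 ∷ 2 ∷ []) ∷ places 2 (1 ∷ 2 ∷ 0 ∷ []) ∷ places 2 (2 ∷ 0 ∷ 1 ∷ []) ∷ places 2 (2 ∷ 1 ∷ 0 ∷ []) ∷ []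

thetaLongLeg thetaLongEar : Vec (Wit 7) 3
thetaLongLeg = w₂ (1 ∷ 2 ∷ 3 ∷ 0 ∷ 4 ∷ 5 ∷ 6 ∷ []) [] ∷ w₂ (1 ∷ 2 ∷ 3 ∷ 0 ∷ 5 ∷ 4 ∷ 6 ∷ []) [] ∷ w₂ (1 ∷ 2 ∷ 3 ∷ 0 ∷ 6 ∷ 4 ∷ 5 ∷ []) [] ∷ []
thetaLongEar = w₂ (0 ∷ 2 ∷ 3 ∷ 4 ∷ 1 ∷ 5 ∷ 6 ∷ []) [] ∷ w₂ (0 ∷ 2 ∷ 3 ∷ 5 ∷ 1 ∷ 4 ∷ 6 ∷ []) [] ∷ w₂ (0 ∷ 2 ∷ 3 ∷ 6 ∷ 1 ∷ 4 ∷ 5 ∷ []) [] ∷ []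

-- Case analysis of an ear of K₄ or of a theta graph

moveLegs : ∀ {k m} → Vec (Fin k) k → Vec (Label k) m → Vec (Label k) m
moveLegs b = Vec₀.map λ (a , x) → Maybe.map (lookup b) a , x

matched : ∀ {k m} → Vec (Bool × Bool) k → Vec Bool k → Vec (Label k) m → Bool
matched s z ls = allPres s z ls ∧ covered s z ls

k4Flaw k4Unit k4Moves k4Case : Vec (Bool × Bool) 6 → Bool
k4Turn : Vec (Bool × Bool) 6 → Vec (Fin 6) 6 → Vec Bool 6 → Bool

-- The cycle space of K₄ has eight cosets: the trivial one, six containing a single leg, and one
-- containing all three perfect matchings. The last is tested here on the matching 03, 12.
k4FlawLabels : Vec (Label 6) 7
k4FlawLabels = L∙ ∷ legLabels (supp (2 ∷ 3 ∷ []))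

k4Flaw s = some (λ z → allPres s z k4FlawLabels) (span k4M)
k4Unit s = someF λ j → some (λ z → onlyOn s z j) (span k4M)
k4Turn s b z = matched s z (moveLegs b lsW4) ∨ (matched s z (moveLegs b lsPrism) ∨
               (matched s z (moveLegs b lsK33) ∨ allPres s z (moveLegs b lsTriangle)))
k4Moves s = some (λ b → some (k4Turn s b) (span k4M)) k4Perms
k4Case s = k4Flaw s ∨ (k4Unit s ∨ k4Moves s)

∨-split : ∀ a b → a ∨ b ≡ true → a ≡ true ⊎ b ≡ true
∨-split a b = ∨-true {a} {b}

∧₁ : ∀ a b → a ∧ b ≡ true → a ≡ true
∧₁ a b h = proj₁ (∧-true {a} {b} h)

∧₂ : ∀ a b → a ∧ b ≡ true → b ≡ true
∧₂ a b h = proj₂ (∧-true {a} {b} h)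

check-∈ : ∀ {A : Set} (p : A → Bool) xs → every p xs ≡ true → ∀ x → x ∈ˡ xs → p x ≡ true
check-∈ p xs h x = every-∈ p {xs} h {x}

-- membership data packaged so that the Boolean tests are not unfolded later
record Hit {A : Set} (xs : List A) (p : A → Bool) : Set where
  constructor hit
  field
    elem : A
    elem∈ : elem ∈ˡ xs
    test : p elem ≡ true

toHit : ∀ {A : Set} (p : A → Bool) xs → some p xs ≡ true → Hit xs p
toHit p xs h = let (x , x∈ , q) = some-∈ p h in hit x x∈ q

data K4Turn (s : Vec (Bool × Bool) 6) (b : Vec (Fin 6) 6) (z : Vec Bool 6) : Set where
  toW4 : matched s z (moveLegs b lsW4) ≡ true → K4Turn s b z
  toPrism : matched s z (moveLegs b lsPrism) ≡ true → K4Turn s b z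
  toK33 : matched s z (moveLegs b lsK33) ≡ true → K4Turn s b z
  toTriangle : allPres s z (moveLegs b lsTriangle) ≡ true → K4Turn s b z

∨-elim : ∀ {A : Set} a b → (a ≡ true → A) → (b ≡ true → A) → a ∨ b ≡ true → A
∨-elim a b f g h = [ f , g ]′ (∨-split a b h)

k4Turn-view : ∀ s b z → k4Turn s b z ≡ true → K4Turn s b z
k4Turn-view s b z = ∨-elim (matched s z (moveLegs b lsW4)) _ toW4
  (∨-elim (matched s z (moveLegs b lsPrism)) _ toPrism (∨-elim (matched s z (moveLegs b lsK33)) _ toK33 toTriangle))

data K4View (s : Vec (Bool × Bool) 6) : Set where
  flaw : Hit (span k4M) (λ z → allPres s z k4FlawLabels) → K4View s
  only : ∀ j → Hit (span k4M) (λ z → onlyOn s z j) → K4View s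
  turn : ∀ b → b ∈ˡ k4Perms → ∀ z → z ∈ˡ span k4M → K4Turn s b z → K4View s

k4View : ∀ s → k4Case s ≡ true → K4View s
k4View s = ∨-elim (k4Flaw s) (k4Unit s ∨ k4Moves s) (λ p → flaw (toHit (λ z → allPres s z k4FlawLabels) (span k4M) p))
  (∨-elim (k4Unit s) (k4Moves s) fromUnit fromMoves)
  where
  fromUnit : k4Unit s ≡ true → K4View s
  fromUnit p = let (j , q) = someF-∃ (λ j → some (λ z → onlyOn s z j) (span k4M)) p in only j (toHit (λ z → onlyOn s z j) (span k4M) q)
  fromTurn : ∀ b → b ∈ˡ k4Perms → Hit (span k4M) (k4Turn s b) → K4View s
  fromTurn b b∈ (hit z z∈ r) = turn b b∈ z z∈ (k4Turn-view s b z r)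
  fromPerm : Hit k4Perms (λ b → some (k4Turn s b) (span k4M)) → K4View s
  fromPerm (hit b b∈ q) = fromTurn b b∈ (toHit (k4Turn s b) (span k4M) q)
  fromMoves : k4Moves s ≡ true → K4View s
  fromMoves p = fromPerm (toHit (λ b → some (k4Turn s b) (span k4M)) k4Perms p)

-- All 729 states of the six legs are tried; symmetry enters only through the search over `k4Perms`
-- inside `k4Moves`.
k4Cases : every k4Case (states 6) ≡ true
k4Cases = refl

realises : ∀ {d k d′ m} → Mat d k → Mat d′ m → Vec (Label k) m → Vec (Fin k) k → Bool
realises g h ls b = distinctL (moveLegs b ls) ∧ sameSpan (earMat g (moveLegs b ls)) h

k4-w4 : every (realises k4M w4M lsW4) k4Perms ≡ true
k4-w4 = refl

k4-prism : every (realises k4M prismM lsPrism) k4Perms ≡ true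
k4-prism = refl

k4-k33 : every (realises k4M k33M lsK33) k4Perms ≡ true
k4-k33 = refl

k4-triangle : every (λ b → checkBad k4M (moveLegs b lsTriangle) [] triangleWit) k4Perms ≡ true
k4-triangle = refl

k4-bad : checkBad k4M k4FlawLabels [] k4BadWit ≡ true
k4-bad = refl

k4-longLeg : everyF (λ j → checkBad k4M (L∙ ∷ (just j , true) ∷ legLabels (unit j)) ((suc zero , suc (suc j)) ∷ []) (lookup k4LongLeg j)) ≡ true
k4-longLeg = refl

k4-longEar : everyF (λ j → checkBad k4M (L∙ ∷ L∙ ∷ legLabels (unit j)) ((zero , suc zero) ∷ []) (lookup k4LongEar j)) ≡ true
k4-longEar = refl

thetaUnit thetaMoves thetaCase : Vec (Bool × Bool) 3 → Bool
thetaTurn : Vec (Bool × Bool) 3 → Vec (Fin 3) 3 → Vec Bool 3 → Bool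
thetaUnit s = someF λ j → some (λ z → onlyOn s z j) (span thetaM)
thetaTurn s b z = matched s z (moveLegs b lsK4) ∨ allPres s z lsThree
thetaMoves s = some (λ b → some (thetaTurn s b) (span thetaM)) thetaPerms
thetaCase s = thetaUnit s ∨ thetaMoves s

thetaCases : every thetaCase (states 3) ≡ true
thetaCases = refl

data ThetaView (s : Vec (Bool × Bool) 3) : Set where
  only : ∀ j z → z ∈ˡ span thetaM → onlyOn s z j ≡ true → ThetaView s
  toK4 : ∀ b → b ∈ˡ thetaPerms → ∀ z → z ∈ˡ span thetaM → matched s z (moveLegs b lsK4) ≡ true → ThetaView s
  toThree : ∀ z → z ∈ˡ span thetaM → allPres s z lsThree ≡ true → ThetaView s

thetaView : ∀ s → thetaCase s ≡ true → ThetaView s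
thetaView s = ∨-elim (thetaUnit s) (thetaMoves s) fromUnit fromMoves
  where
  fromOnly : ∀ j → Hit (span thetaM) (λ z → onlyOn s z j) → ThetaView s
  fromOnly j (hit z z∈ o) = only j z z∈ o
  fromUnit : thetaUnit s ≡ true → ThetaView s
  fromUnit p = let (j , q) = someF-∃ (λ j → some (λ z → onlyOn s z j) (span thetaM)) p in fromOnly j (toHit (λ z → onlyOn s z j) (span thetaM) q)
  fromTurn : ∀ b → b ∈ˡ thetaPerms → Hit (span thetaM) (thetaTurn s b) → ThetaView s
  fromTurn b b∈ (hit z z∈ r) = ∨-elim (matched s z (moveLegs b lsK4)) (allPres s z lsThree) (toK4 b b∈ z z∈) (toThree z z∈) r
  fromPerm : Hit thetaPerms (λ b → some (thetaTurn s b) (span thetaM)) → ThetaView s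
  fromPerm (hit b b∈ q) = fromTurn b b∈ (toHit (thetaTurn s b) (span thetaM) q)
  fromMoves : thetaMoves s ≡ true → ThetaView s
  fromMoves p = fromPerm (toHit (λ b → some (thetaTurn s b) (span thetaM)) thetaPerms p)

theta-k4 : every (realises thetaM k4M lsK4) thetaPerms ≡ true
theta-k4 = refl

theta-three : checkBad thetaM lsThree [] threeWit ≡ true
theta-three = refl

others : Fin 3 → Fin 3 × Fin 3
others zero = # 1 , # 2
others (suc zero) = # 0 , # 2
others (suc (suc zero)) = # 0 , # 1

-- Positions 0 and 1 hold the ear and the additional element, 2 and 3 the second elements of the
-- other two legs, 4 to 6 the three legs. This is the F₂ configuration of four parallel paths.
thetaLegLabels thetaEarLabels : Fin 3 → Vec (Label 3) 7
thetaLegLabels j = L∙ ∷ (just j , true) ∷ (just (proj₁ (others j)) , false) ∷ (just (proj₂ (others j)) , false) ∷ legLabels (unit j)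
thetaEarLabels j = L∙ ∷ L∙ ∷ (just (proj₁ (others j)) , false) ∷ (just (proj₂ (others j)) , false) ∷ legLabels (unit j)

legPos : Fin 3 → Fin 7
legPos l = suc (suc (suc (suc l)))

thetaDups : Fin 3 → List (Fin 7 × Fin 7)
thetaDups j = (# 2 , legPos (proj₁ (others j))) ∷ (# 3 , legPos (proj₂ (others j))) ∷ []

theta-longLeg : everyF (λ j → checkBad thetaM (thetaLegLabels j) ((# 1 , legPos j) ∷ thetaDups j) (lookup thetaLongLeg j)) ≡ true
theta-longLeg = refl

theta-longEar : everyF (λ j → checkBad thetaM (thetaEarLabels j) ((# 0 , # 1) ∷ thetaDups j) (lookup thetaLongEar j)) ≡ true
theta-longEar = refl

k4-w4-at : ∀ b → b ∈ˡ k4Perms → realises k4M w4M lsW4 b ≡ true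
k4-w4-at = check-∈ (realises k4M w4M lsW4) k4Perms k4-w4

k4-prism-at : ∀ b → b ∈ˡ k4Perms → realises k4M prismM lsPrism b ≡ true
k4-prism-at = check-∈ (realises k4M prismM lsPrism) k4Perms k4-prism

k4-k33-at : ∀ b → b ∈ˡ k4Perms → realises k4M k33M lsK33 b ≡ true
k4-k33-at = check-∈ (realises k4M k33M lsK33) k4Perms k4-k33

triangleBad : Vec (Fin 6) 6 → Bool
triangleBad b = checkBad k4M (moveLegs b lsTriangle) [] triangleWit

k4-triangle-at : ∀ b → b ∈ˡ k4Perms → triangleBad b ≡ true
k4-triangle-at = check-∈ triangleBad k4Perms k4-triangle

k4View-at : ∀ s → (∀ l → (sel (lookup s l) false ∨ sel (lookup s l) true) ≡ true) → K4View s
k4View-at s h = k4View s (check-∈ k4Case (states 6) k4Cases s (∈-states s h))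

theta-k4-at : ∀ b → b ∈ˡ thetaPerms → realises thetaM k4M lsK4 b ≡ true
theta-k4-at = check-∈ (realises thetaM k4M lsK4) thetaPerms theta-k4

thetaView-at : ∀ s → (∀ l → (sel (lookup s l) false ∨ sel (lookup s l) true) ≡ true) → ThetaView s
thetaView-at s h = thetaView s (check-∈ thetaCase (states 3) thetaCases s (∈-states s h))

module _ {n} {Z : Space n} {U : V n} (nb : NoBad Z U) (ZU : ∀ v → Z ∋ v → v ⊑ U) (simple : Simple Z) where

  -- if v′ = v + z meets only leg j of K₄, it is parallel to part of it
  module _ (R : Real Z k4M) where
    open Real R
    open Ears nb ZU {k4M} refl R
    open States nb ZU {k4M} refl R

    k4-onlyOn : ∀ {v} → Ear v → ∀ j z → z ∈ˡ span k4M → onlyOn (state v) z j ≡ true → ⊥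
    k4-onlyOn {v} E j z z∈ h = go (pres (state v) z (just j , true)) refl
      where
      z∈′ = span-sound k4M z∈
      go : ∀ b → pres (state v) z (just j , true) ≡ b → ⊥
      go true p = build (unitRes E z z∈′ j h p)
        where
        build : (∃ λ ρ → Res (v′ E z z∈′) (𝟙 j) ρ) → ⊥
        build (ρ , res) = subleg simple (E′ E z z∈′) j res (off-state E z z∈′ j h) (lookup k4LongLeg j) (lookup k4LongEar j)
          (everyF-∀ (λ j → checkBad k4M (L∙ ∷ (just j , true) ∷ legLabels (unit j)) ((suc zero , suc (suc j)) ∷ []) (lookup k4LongLeg j)) k4-longLeg j)
          (everyF-∀ (λ j → checkBad k4M (L∙ ∷ L∙ ∷ legLabels (unit j)) ((zero , suc zero) ∷ []) (lookup k4LongEar j)) k4-longEar j)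
      go false p = noZeroState E z z∈′ (zeros h)
        where
        zeros : onlyOn (state v) z j ≡ true → everyF (λ l → not (pres (state v) z (just l , true))) ≡ true
        zeros h = every-intro (λ l → not (pres (state v) z (just l , true))) λ l → at-l l (∨-true {⌊ l Fin.≟ j ⌋} (everyF-∀ (λ l → ⌊ l Fin.≟ j ⌋ ∨ not (pres (state v) z (just l , true))) h l))
          where
          every-intro : ∀ {k} (f : Fin k → Bool) → (∀ l → f l ≡ true) → everyF f ≡ true
          every-intro {zero} f q = refl
          every-intro {suc k} f q = cong₂ _∧_ (q zero) (every-intro (f ∘ suc) (q ∘ suc))
          at-l : ∀ l → ⌊ l Fin.≟ j ⌋ ≡ true ⊎ not (pres (state v) z (just l , true)) ≡ true → not (pres (state v) z (just l , true)) ≡ true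
          at-l l (inj₂ q) = q
          at-l l (inj₁ q) = trans (cong (λ i → not (pres (state v) z (just i , true))) (⌊⌋-true {d = l Fin.≟ j} q)) (cong not p)

    k4Pattern : ∀ {v m d′} → Ear v → ∀ {b} → b ∈ˡ k4Perms → ∀ {z} → z ∈ˡ span k4M → (ls : Vec (Label 6) m) (g : Mat d′ m) →
                matched (state v) z (moveLegs b ls) ≡ true → realises k4M g ls b ≡ true → Real Z g
    k4Pattern {v} E {b} b∈ {z} z∈ ls g m r = newPattern E z (span-sound k4M z∈) (moveLegs b ls) g
        (∧₁ (allPres (state v) z (moveLegs b ls)) (covered (state v) z (moveLegs b ls)) m)
        (∧₂ (allPres (state v) z (moveLegs b ls)) (covered (state v) z (moveLegs b ls)) m)
        (∧₁ (distinctL (moveLegs b ls)) (sameSpan (earMat k4M (moveLegs b ls)) g) r)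
        (∧₂ (distinctL (moveLegs b ls)) (sameSpan (earMat k4M (moveLegs b ls)) g) r)

    k4FromView : ∀ {v} → Ear v → K4View (state v) → Real Z w4M ⊎ Real Z prismM ⊎ Real Z k33M
    k4FromView E (flaw (hit z z∈ p)) = ⊥-elim (newBad E z (span-sound k4M z∈) k4FlawLabels k4BadWit p k4-bad)
    k4FromView E (only j (hit z z∈ o)) = ⊥-elim (k4-onlyOn E j z z∈ o)
    k4FromView E (turn b b∈ z z∈ (toW4 m)) = inj₁ (k4Pattern E b∈ z∈ lsW4 w4M m (k4-w4-at b b∈))
    k4FromView E (turn b b∈ z z∈ (toPrism m)) = inj₂ (inj₁ (k4Pattern E b∈ z∈ lsPrism prismM m (k4-prism-at b b∈)))
    k4FromView E (turn b b∈ z z∈ (toK33 m)) = inj₂ (inj₂ (k4Pattern E b∈ z∈ lsK33 k33M m (k4-k33-at b b∈)))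
    k4FromView E (turn b b∈ z z∈ (toTriangle m)) = ⊥-elim (newBad E z (span-sound k4M z∈) (moveLegs b lsTriangle) triangleWit m
      (k4-triangle-at b b∈))

    k4Step : ∀ {v} → Ear v → Real Z w4M ⊎ Real Z prismM ⊎ Real Z k33M
    k4Step {v} E = k4FromView E (k4View-at (state v) (nonempty v))

  module _ (R : Real Z thetaM) where
    open Real R
    open Ears nb ZU {thetaM} refl R
    open States nb ZU {thetaM} refl R

    thetaFromView : ∀ {v} → Ear v → ThetaView (state v) → Real Z k4M ⊎ (∃ λ j → ∃ λ z → z ∈ˡ span thetaM × onlyOn (state v) z j ≡ true)
    thetaFromView E (only j z z∈ o) = inj₂ (j , z , z∈ , o)
    thetaFromView {v} E (toK4 b b∈ z z∈ m) = inj₁ (newPattern E z (span-sound thetaM z∈) (moveLegs b lsK4) k4M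
        (∧₁ (allPres (state v) z (moveLegs b lsK4)) (covered (state v) z (moveLegs b lsK4)) m)
        (∧₂ (allPres (state v) z (moveLegs b lsK4)) (covered (state v) z (moveLegs b lsK4)) m)
        (∧₁ (distinctL (moveLegs b lsK4)) (sameSpan (earMat thetaM (moveLegs b lsK4)) k4M) r)
        (∧₂ (distinctL (moveLegs b lsK4)) (sameSpan (earMat thetaM (moveLegs b lsK4)) k4M) r))
      where
      r : realises thetaM k4M lsK4 b ≡ true
      r = theta-k4-at b b∈
    thetaFromView E (toThree z z∈ m) = ⊥-elim (newBad E z (span-sound thetaM z∈) lsThree threeWit m theta-three)

    thetaStep : ∀ {v} → Ear v → Real Z k4M ⊎ (∃ λ j → ∃ λ z → z ∈ˡ span thetaM × onlyOn (state v) z j ≡ true)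
    thetaStep {v} E = thetaFromView E (thetaView-at (state v) (nonempty v))

    Long : Set
    Long = ∀ l → ∃ λ e → κ e ≡ just l × e ≢ rep l

    -- An ear parallel to a part of leg `j` yields four parallel paths: the other two legs, both of
    -- length at least two, that part, and the ear. As `Z` is simple, one of the last two has a
    -- second element as well, and F₂ appears.
    thetaLong : Long → ∀ {v} → Ear v → ∀ j z → z ∈ˡ span thetaM → onlyOn (state v) z j ≡ true → ⊥
    thetaLong long {v} E j z z∈ h = go (pres (state v) z (just j , true)) refl
      where
      z∈′ = span-sound thetaM z∈
      go : ∀ b → pres (state v) z (just j , true) ≡ b → ⊥
      go false p = noZeroState E z z∈′ (zeros (λ l → at-l l (∨-true {⌊ l Fin.≟ j ⌋} (everyF-∀ (λ l → ⌊ l Fin.≟ j ⌋ ∨ not (pres (state v) z (just l , true))) h l))))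
        where
        zeros : (∀ l → not (pres (state v) z (just l , true)) ≡ true) → everyF (λ l → not (pres (state v) z (just l , true))) ≡ true
        zeros q = cong₂ _∧_ (q zero) (cong₂ _∧_ (q (suc zero)) (cong₂ _∧_ (q (suc (suc zero))) refl))
        at-l : ∀ l → ⌊ l Fin.≟ j ⌋ ≡ true ⊎ not (pres (state v) z (just l , true)) ≡ true → not (pres (state v) z (just l , true)) ≡ true
        at-l l (inj₂ q) = q
        at-l l (inj₁ q) = trans (cong (λ i → not (pres (state v) z (just i , true))) (⌊⌋-true {d = l Fin.≟ j} q)) (cong not p)
      go true p = step (Fin.any? λ e → (u e Bool.≟ true) ×-dec (¬? (e Fin.≟ x) ×-dec ¬? (e Fin.≟ y)))
        where
        u = v′ E z z∈′
        F′ : Ear u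
        F′ = E′ E z z∈′
        found = find-pres E z z∈′ (just j , true) p
        x = proj₁ found
        y = proj₁ (outside F′)
        κx : κ x ≡ just j
        κx = cong proj₁ (proj₁ (proj₂ found))
        ux : u x ≡ true
        ux = cong proj₂ (proj₁ (proj₂ found))
        off = off-state E z z∈′ j h
        ρ : Fin 3 → Fin n
        ρ l = if ⌊ j Fin.≟ l ⌋ then x else rep l
        ρj : ρ j ≡ x
        ρj = cong (λ b → if b then x else rep j) (𝟙-refl j)
        ρ-else : ∀ {l} → j ≢ l → ρ l ≡ rep l
        ρ-else {l} q = cong (λ b → if b then x else rep l) (𝟙-≢ q)
        res : Res u (lookup (unit j)) ρ
        res = mkRes λ l → at-ρ l (j Fin.≟ l)
          where
          at-ρ : ∀ l → Dec (j ≡ l) → κ (ρ l) ≡ just l × u (ρ l) ≡ lookup (unit j) l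
          at-ρ l (yes refl) = trans (cong κ ρj) κx , trans (cong u ρj) (trans ux (sym (trans (Vec.lookup∘tabulate (𝟙 j) j) (𝟙-refl j))))
          at-ρ l (no q) = trans (cong κ (ρ-else q)) (κ-rep l) , trans (trans (cong u (ρ-else q)) (off (rep l) l (κ-rep l) (q ∘ sym)))
                              (sym (trans (Vec.lookup∘tabulate (𝟙 j) l) (𝟙-≢ q)))
        y-lab : lab u y ≡ L∙
        y-lab = ear-lab F′
        x≢y : x ≢ y
        x≢y q = ∉nothing (trans (sym κx) (trans (cong κ q) (cong proj₁ y-lab)))
        others≢ : ∀ j → j ≢ proj₁ (others j) × j ≢ proj₂ (others j)
        others≢ zero = (λ ()) , λ ()
        others≢ (suc zero) = (λ ()) , λ ()
        others≢ (suc (suc zero)) = (λ ()) , λ ()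
        o₁ = proj₁ (others j)
        o₂ = proj₂ (others j)
        j≢o₁ = proj₁ (others≢ j)
        j≢o₂ = proj₂ (others≢ j)
        second : ∀ l → Fin n
        second l = proj₁ (long l)
        second-lab : ∀ {l} → j ≢ l → lab u (second l) ≡ (just l , false)
        second-lab {l} q = cong₂ _,_ (proj₁ (proj₂ (long l))) (off (second l) l (proj₁ (proj₂ (long l))) (q ∘ sym))
        second≢ : ∀ {l} → j ≢ l → second l ≢ lookup (tabulate ρ) l
        second≢ {l} q r = proj₂ (proj₂ (long l)) (trans r (trans (Vec.lookup∘tabulate ρ l) (ρ-else q)))
        finish : ∀ {a} e → lab u e ≡ a → ∀ D w → checkBad thetaM (L∙ ∷ a ∷ (just o₁ , false) ∷ (just o₂ , false) ∷ legLabels (unit j)) D w ≡ true →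
                 All (λ (i , i′) → lookup (y ∷ e ∷ second o₁ ∷ second o₂ ∷ tabulate ρ) i ≢ lookup (y ∷ e ∷ second o₁ ∷ second o₂ ∷ tabulate ρ) i′) D → ⊥
        finish {a} e el D w ok diff = badEar F′ (y ∷ e ∷ second o₁ ∷ second o₂ ∷ tabulate ρ) (L∙ ∷ a ∷ (just o₁ , false) ∷ (just o₂ , false) ∷ legLabels (unit j))
          (λ { zero → y-lab ; (suc zero) → el ; (suc (suc zero)) → second-lab j≢o₁ ; (suc (suc (suc zero))) → second-lab j≢o₂
             ; (suc (suc (suc (suc l)))) → legs-es (unit j) res l }) D w ok diff
        step : Dec (∃ λ e → u e ≡ true × e ≢ x × e ≢ y) → ⊥
        step (no ¬e) = simple x y x≢y (resp≈ Z eq (EarOn.v∈ F′))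
          where
          eq : u ≈ 𝟙 x ⊕ 𝟙 y
          eq e = go″ (x Fin.≟ e) (y Fin.≟ e)
            where
            go″ : Dec (x ≡ e) → Dec (y ≡ e) → u e ≡ (𝟙 x ⊕ 𝟙 y) e
            go″ (yes p) (yes q) = ⊥-elim (x≢y (trans p (sym q)))
            go″ (yes p) (no q) = trans (trans (cong u (sym p)) ux) (sym (cong₂ _xor_ (trans (cong (𝟙 x) (sym p)) (𝟙-refl x)) (𝟙-≢ q)))
            go″ (no p) (yes q) = trans (trans (cong u (sym q)) (cong proj₂ y-lab)) (sym (cong₂ _xor_ (𝟙-≢ p) (trans (cong (𝟙 y) (sym q)) (𝟙-refl y))))
            go″ (no p) (no q) = trans (≢true⇒false λ r → ¬e (e , r , p ∘ sym , q ∘ sym)) (sym (cong₂ _xor_ (𝟙-≢ p) (𝟙-≢ q)))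
        step (yes (e , ue , e≢x , e≢y)) = go′ (κ e) refl
          where
          go′ : ∀ a → κ e ≡ a → ⊥
          go′ nothing q = finish e (cong₂ _,_ q ue) ((# 0 , # 1) ∷ thetaDups j) (lookup thetaLongEar j)
            (everyF-∀ (λ j → checkBad thetaM (thetaEarLabels j) ((# 0 , # 1) ∷ thetaDups j) (lookup thetaLongEar j)) theta-longEar j)
            ((e≢y ∘ sym) ∷ second≢ j≢o₁ ∷ second≢ j≢o₂ ∷ [])
          go′ (just l) q with j Fin.≟ l
          ... | no j≢l = true≢false (trans (sym ue) (off e l q (j≢l ∘ sym)))
          ... | yes refl = finish e (cong₂ _,_ q ue) ((# 1 , legPos j) ∷ thetaDups j) (lookup thetaLongLeg j)
            (everyF-∀ (λ j → checkBad thetaM (thetaLegLabels j) ((# 1 , legPos j) ∷ thetaDups j) (lookup thetaLongLeg j)) theta-longLeg j)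
            ((λ r → e≢x (trans r (trans (Vec.lookup∘tabulate ρ j) ρj))) ∷ second≢ j≢o₁ ∷ second≢ j≢o₂ ∷ [])

  Maximal : ∀ {d k} → Mat d k → Set
  Maximal g = Σ (Real Z g) λ R → ∀ v → Z ∋ v → Z ∋ v ⊓ dom (Real.κ R)

  -- One step suffices: an ear turns K₄ into W₄, the prism or K₃,₃, and the tables of these patterns
  -- exclude any further ear.
  k4Closure : Real Z k4M → Maximal k4M ⊎ Maximal w4M ⊎ Maximal prismM ⊎ Maximal k33M
  k4Closure R = step (anyV? {P = λ v → Z ∋ v × ¬ (Z ∋ v ⊓ X)} (λ p (a , b) → resp≈ Z p a , λ q → b (resp≈ Z (λ i → cong (_∧ X i) (sym (p i))) q))
                        (λ v → mem? Z v ×-dec ¬? (mem? Z (v ⊓ X))))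
    where
    X = dom (Real.κ R)
    grown : Real Z w4M ⊎ Real Z prismM ⊎ Real Z k33M → Maximal k4M ⊎ Maximal w4M ⊎ Maximal prismM ⊎ Maximal k33M
    grown (inj₁ R) = inj₂ (inj₁ (R , Closed.closed nb ZU simple refl R w4T w4-bad w4-mixed w4-long w4-class w4-pair))
    grown (inj₂ (inj₁ R)) = inj₂ (inj₂ (inj₁ (R , Closed.closed nb ZU simple refl R prismT prism-bad prism-mixed prism-long prism-class prism-pair)))
    grown (inj₂ (inj₂ R)) = inj₂ (inj₂ (inj₂ (R , Closed.closed nb ZU simple refl R k33T k33-bad k33-mixed k33-long k33-class k33-pair)))
    step : Dec (∃ λ v → Z ∋ v × ¬ (Z ∋ v ⊓ X)) → _
    step (no ¬e) = inj₁ (R , closed)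
      where
      closed : ∀ v → Z ∋ v → Z ∋ v ⊓ X
      closed v v∈ with mem? Z (v ⊓ X)
      ... | yes p = p
      ... | no ¬p = ⊥-elim (¬e (v , v∈ , ¬p))
    step (yes (v , v∈ , v∉)) = grown (k4Step R (proj₂ (Ears.findEar nb ZU {k4M} refl R v v∈ v∉)))

-- a graph given by one number, each edge being two decimal digits
coded : ∀ v {m} → ℕ → Graph (suc v) m
coded v N zero = pos ((N % 100) / 10) , pos (N % 10)
coded v {suc m} N (suc e) = coded v (N / 100) e

-- Splittings of a realised pattern, read off from explicit graphs

module Tabled {n d k} {Z : Space n} {g : Mat d k} (R : Real Z g) (S : V n) (S⊑ : S ⊑ dom (Real.κ R)) where
  open Real R
  open GenBy

  X : V n
  X = dom κ

  Covers : ∀ {m} → Vec (Label k) m → Set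
  Covers ls = ∀ e → X e ≡ true → has ls (κ e , S e) ≡ true

  gv : Fin (suc d) → V n
  gv = S ◂ (pull κ ∘ rows g)

  split-lin : ∀ c → lin c gv ⊕ c zero · S ≈ lin (c ∘ suc) (pull κ ∘ rows g)
  split-lin c e = trans (cong (_xor (c zero ∧ S e)) (Bool.xor-comm (c zero ∧ S e) _)) (xor-cancelʳ (lin (c ∘ suc) (pull κ ∘ rows g) e) (c zero ∧ S e))

  to-lin : ∀ b w → Z ↾ X ∋ w ⊕ b · S → ∃ λ c → w ≈ lin (b ◂ c) gv
  to-lin b w h = let (c , p) = generate gen (w ⊕ b · S) h in
    c , λ e → trans (sym (xor-cancelʳ (w e) (b ∧ S e))) (trans (cong (_xor (b ∧ S e)) (p e)) (Bool.xor-comm (lin c (pull κ ∘ rows g) e) (b ∧ S e)))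

  from-lin : ∀ c w → w ≈ lin c gv → Z ↾ X ∋ w ⊕ c zero · S
  from-lin c w p = resp≈ (Z ↾ X) (λ e → sym (trans (cong (_xor (c zero ∧ S e)) (p e)) (split-lin c e))) (GenBy-lin gen (c ∘ suc))

  module _ {m} (ls : Vec (Label k) m) (cover : Covers ls) where

    idx : Fin n → Maybe (Fin m)
    idx e = if X e then findLabel ls (κ e , S e) else nothing

    M : Mat (suc d) m
    M = earMat g ls

    gv≈ : ∀ i → gv i ≈ pull idx (rows M i)
    gv≈ i e = go (X e) refl
      where
      outside : ∀ i → X e ≡ false → gv i e ≡ false
      outside zero p = ⊑-false S⊑ p
      outside (suc i) p = ⊑-false (pull⊑dom κ (rows g i)) p
      go : ∀ b → X e ≡ b → gv i e ≡ pull idx (rows M i) e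
      go false p = trans (outside i p) (sym (cong (λ b → legBit (rows M i) (if b then findLabel ls (κ e , S e) else nothing)) p))
      go true p = build (findLabel-complete ls (κ e , S e) (cover e p))
        where
        build : (∃ λ j → findLabel ls (κ e , S e) ≡ just j) → gv i e ≡ pull idx (rows M i) e
        build (j , q) = trans (at i) (sym (trans (cong (λ b → legBit (rows M i) (if b then findLabel ls (κ e , S e) else nothing)) p) (cong (legBit (rows M i)) q)))
          where
          lj : lookup ls j ≡ (κ e , S e)
          lj = findLabel-sound ls (κ e , S e) q
          at : ∀ i → gv i e ≡ rows M i j
          at zero = sym (trans (rows-earMat₀ g ls j) (cong proj₂ lj))
          at (suc i) = sym (trans (rows-earMat g ls i j) (cong (legBit (rows g i) ∘ proj₁) lj))

    lin≈ : ∀ c → lin c gv ≈ pull idx (lin c (rows M))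
    lin≈ c e = trans (Σ₂-cong λ i → cong (c i ∧_) (gv≈ i e)) (sym (pull-lin idx c (rows M) e))

    -- Elements with one label have equal columns and become parallel edges; elements outside the
    -- pattern become loops at `zero`.
    spread : ∀ {v} → Graph (suc v) m → Graph (suc v) n
    spread H e with idx e
    ... | just j = H j
    ... | nothing = zero , zero

    spread-δ : ∀ {v} (H : Graph (suc v) m) T → δ (spread H) T ≈ pull idx (δ H T)
    spread-δ H T e with idx e
    ... | just j = refl
    ... | nothing = Bool.xor-same (T zero)

    graphical-table : ∀ {v} (H : Graph (suc v) m) → sameSpan M (stars H) ≡ true → Graphical (Ext (Z ↾ X) S)
    graphical-table {v} H ok = suc v , spread H , to ⸴ from
      where
      same : Span M ≐ Cut H
      same = ≐-trans (sameSpan-sound M (stars H) ok) (Span-stars H)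
      to : ∀ w → Ext (Z ↾ X) S ∋ w → Cut (spread H) ∋ w
      to w (b , h) = let (c , p) = to-lin b w h
                         (T , q) = ≐⇒ same (lin (b ◂ c) (rows M)) (b ◂ c , λ _ → refl) in
        T , λ e → trans (p e) (trans (lin≈ (b ◂ c) e) (trans (pull-cong idx q e) (sym (spread-δ H T e))))
      from : ∀ w → Cut (spread H) ∋ w → Ext (Z ↾ X) S ∋ w
      from w (T , p) = let (c , q) = ≐⇐ same (δ H T) (T , λ _ → refl) in
        c zero , from-lin c w λ e → trans (p e) (trans (spread-δ H T e) (trans (pull-cong idx q e) (sym (lin≈ c e))))

    -- The additional label `L∙` is an element that lies in `S` only. Its edge has the coefficient
    -- of `S` as potential difference, so its ends are the marked vertices once the edge is removed.
    nrep-table : ∀ {v} (H : Graph (suc v) (suc m)) → sameSpan (earMat g (L∙ ∷ ls)) (stars H) ≡ true → NRep (Z ↾ X) S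
    nrep-table {v} H ok = suc v , spread (H ∘ suc) , proj₁ (H zero) , proj₂ (H zero) , to , from
      where
      M⁺ = earMat g (L∙ ∷ ls)
      same : Span M⁺ ≐ Cut H
      same = ≐-trans (sameSpan-sound M⁺ (stars H) ok) (Span-stars H)
      tail : ∀ c j → lin c (rows M⁺) (suc j) ≡ lin c (rows M) j
      tail c j = Σ₂-cong λ i → cong (c i ∧_) (at i)
        where
        at : ∀ i → rows M⁺ i (suc j) ≡ rows M i j
        at zero = trans (rows-earMat₀ g (L∙ ∷ ls) (suc j)) (sym (rows-earMat₀ g ls j))
        at (suc i) = trans (rows-earMat g (L∙ ∷ ls) i (suc j)) (sym (rows-earMat g ls i j))
      head₀ : ∀ c → lin c (rows M⁺) zero ≡ c zero
      head₀ c = trans (cong₂ _xor_ (Bool.∧-identityʳ (c zero)) (Σ₂-0 λ i → trans (cong (c (suc i) ∧_) (rows-earMat g (L∙ ∷ ls) i zero)) (Bool.∧-zeroʳ (c (suc i))))) (Bool.xor-identityʳ (c zero))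
      to : ∀ b w → Z ↾ X ∋ w ⊕ b · S → ∃ λ T → T (proj₁ (H zero)) xor T (proj₂ (H zero)) ≡ b × w ≈ δ (spread (H ∘ suc)) T
      to b w h = let (c , p) = to-lin b w h
                     (T , q) = ≐⇒ same (lin (b ◂ c) (rows M⁺)) (b ◂ c , λ _ → refl) in
        T , trans (sym (q zero)) (head₀ (b ◂ c))
          , λ e → trans (p e) (trans (lin≈ (b ◂ c) e) (trans (pull-cong idx (λ j → trans (sym (tail (b ◂ c) j)) (q (suc j))) e) (sym (spread-δ (H ∘ suc) T e))))
      from : ∀ T → Z ↾ X ∋ δ (spread (H ∘ suc)) T ⊕ (T (proj₁ (H zero)) xor T (proj₂ (H zero))) · S
      from T = let (c , q) = ≐⇐ same (δ H T) (T , λ _ → refl) in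
        resp≈ (Z ↾ X) (λ e → cong (λ b → δ (spread (H ∘ suc)) T e xor (b ∧ S e)) (sym (trans (q zero) (head₀ c))))
          (from-lin c (δ (spread (H ∘ suc)) T) λ e → trans (spread-δ (H ∘ suc) T e)
            (trans (pull-cong idx (λ j → trans (q (suc j)) (tail c j)) e) (sym (lin≈ c e))))

  onLeg? : ∀ e l → Dec (κ e ≡ just l)
  onLeg? e l = map′ (eqMaybe-≡ (κ e) (just l)) (λ p → trans (cong (λ a → eqMaybe a (just l)) p) (eqMaybe-refl (just l)))
                    (eqMaybe (κ e) (just l) Bool.≟ true)

  meets? : ∀ l → Dec (∃ λ e → κ e ≡ just l × S e ≡ true)
  meets? l = Fin.any? λ e → onLeg? e l ×-dec (S e Bool.≟ true)

  meets : V k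
  meets l = ⌊ meets? l ⌋

  meets-intro : ∀ {e l} → κ e ≡ just l → S e ≡ true → meets l ≡ true
  meets-intro {e} {l} p q with meets? l
  ... | yes _ = refl
  ... | no ¬m = ⊥-elim (¬m (e , p , q))

  meets-elim : ∀ {l} → meets l ≡ true → ∃ λ e → κ e ≡ just l × S e ≡ true
  meets-elim {l} p = ⌊⌋-true {d = meets? l} p

  pick : ∀ l → ∃ λ e → κ e ≡ just l × (meets l ≡ true → S e ≡ true)
  pick l = go (meets l) refl
    where
    go : ∀ b → meets l ≡ b → ∃ λ e → κ e ≡ just l × (meets l ≡ true → S e ≡ true)
    go true p = let (e , q , r) = meets-elim p in e , q , λ _ → r
    go false p = rep l , κ-rep l , λ q → ⊥-elim (true≢false (trans (sym q) p))

  pick-inj : ∀ {a b} → proj₁ (pick a) ≡ proj₁ (pick b) → a ≡ b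
  pick-inj {a} {b} p = MaybeP.just-injective (trans (sym (proj₁ (proj₂ (pick a)))) (trans (cong κ p) (proj₁ (proj₂ (pick b)))))

  -- Legs are disjoint, so choosing an element of `S` on every leg that is met is injective.
  ∥meets∥≤ : ∀ {j} (b : Fin j → Fin k) → Injective _≡_ _≡_ b → ∥ meets ∘ b ∥ ≤ ∥ S ∥
  ∥meets∥≤ {j} b b-inj = ℕ.≤-trans (ℕ.≤-reflexive (sym (∥push∥ chosen chosen-inj (meets ∘ b)))) (∥∥-mono below)
    where
    chosen : Fin j → Fin n
    chosen l = proj₁ (pick (b l))
    chosen-inj : Injective _≡_ _≡_ chosen
    chosen-inj p = b-inj (pick-inj p)
    below : push chosen (meets ∘ b) ⊑ S
    below e p = go (Fin.any? λ l → chosen l Fin.≟ e)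
      where
      go : Dec (∃ λ l → chosen l ≡ e) → S e ≡ true
      go (yes (l , refl)) = proj₂ (proj₂ (pick (b l))) (trans (sym (push-∘ chosen chosen-inj (meets ∘ b) l)) p)
      go (no ¬q) = ⊥-elim (true≢false (trans (sym p) (push-∉ chosen (meets ∘ b) e λ l q → ¬q (l , q))))

thetaFree : Fin 3 → Vec (Label 3) 5
thetaFree j = (just a , false) ∷ (just a , true) ∷ (just b , false) ∷ (just b , true) ∷ (just j , false) ∷ []
  where
  a = proj₁ (others j)
  b = proj₂ (others j)

thetaAll : Vec (Label 3) 6
thetaAll = (just (# 0) , false) ∷ (just (# 0) , true) ∷ (just (# 1) , false) ∷ (just (# 1) , true) ∷ (just (# 2) , false) ∷ (just (# 2) , true) ∷ []

-- The number encodes K₄. The edge of `L∙` is 01, the leg that `S` misses is the opposite edge 23,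
-- and each of the other two legs is split into two edges meeting at the vertex 2 or 3.
theta-free-ok : everyF (λ j → sameSpan (earMat thetaM (L∙ ∷ thetaFree j)) (stars (coded 3 {6} 231303120201))) ≡ true
theta-free-ok = refl

-- Again K₄: the two labels of each leg form one of its perfect matchings. Here `L∙` cannot be
-- added, since with it the seven labels form F₇.
theta-all-ok : sameSpan (earMat thetaM thetaAll) (stars (coded 3 {6} 130203122301)) ≡ true
theta-all-ok = refl

theta-free-covers : ∀ j l b → (b ≡ true → l ≢ j) → has (thetaFree j) (just l , b) ≡ true
theta-free-covers zero zero true h = ⊥-elim (h refl refl)
theta-free-covers zero zero false h = refl
theta-free-covers zero (suc zero) false h = refl
theta-free-covers zero (suc zero) true h = refl
theta-free-covers zero (suc (suc zero)) false h = refl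
theta-free-covers zero (suc (suc zero)) true h = refl
theta-free-covers (suc zero) zero false h = refl
theta-free-covers (suc zero) zero true h = refl
theta-free-covers (suc zero) (suc zero) true h = ⊥-elim (h refl refl)
theta-free-covers (suc zero) (suc zero) false h = refl
theta-free-covers (suc zero) (suc (suc zero)) false h = refl
theta-free-covers (suc zero) (suc (suc zero)) true h = refl
theta-free-covers (suc (suc zero)) zero false h = refl
theta-free-covers (suc (suc zero)) zero true h = refl
theta-free-covers (suc (suc zero)) (suc zero) false h = refl
theta-free-covers (suc (suc zero)) (suc zero) true h = refl
theta-free-covers (suc (suc zero)) (suc (suc zero)) true h = ⊥-elim (h refl refl)
theta-free-covers (suc (suc zero)) (suc (suc zero)) false h = refl

theta-all-covers : ∀ l b → has thetaAll (just l , b) ≡ true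
theta-all-covers zero false = refl
theta-all-covers zero true = refl
theta-all-covers (suc zero) false = refl
theta-all-covers (suc zero) true = refl
theta-all-covers (suc (suc zero)) false = refl
theta-all-covers (suc (suc zero)) true = refl

module _ {n} {Z : Space n} (R : Real Z thetaM) (S : V n) (S⊑ : S ⊑ dom (Real.κ R)) where
  open Real R
  open Tabled R S S⊑

  private
    label : ∀ {m} (ls : Vec (Label 3) m) → (∀ e l → κ e ≡ just l → has ls (just l , S e) ≡ true) → Covers ls
    label ls h e p = let (l , q) = just-dom κ p in subst (λ a → has ls (a , S e) ≡ true) (sym q) (h e l q)

    free : ∀ j → meets j ≡ false → NRep (Z ↾ X) S
    free j p = nrep-table (thetaFree j) (label (thetaFree j) λ e l q → theta-free-covers j l (S e)
        λ r l≡j → true≢false (trans (sym (meets-intro q r)) (trans (cong meets l≡j) p))) (coded 3 {6} 231303120201)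
        (everyF-∀ (λ j → sameSpan (earMat thetaM (L∙ ∷ thetaFree j)) (stars (coded 3 {6} 231303120201))) theta-free-ok j)

    all-or-free : (∀ j → meets j ≡ true) ⊎ (∃ λ j → meets j ≡ false)
    all-or-free with Fin.any? (λ j → meets j Bool.≟ false)
    ... | yes p = inj₂ p
    ... | no ¬p = inj₁ λ j → ≢false⇒true λ q → ¬p (j , q)

  theta-NRep : ∥ S ∥ ≤ 2 → NRep (Z ↾ X) S
  theta-NRep le = go all-or-free
    where
    three : (∀ j → meets j ≡ true) → 3 ≤ ∥ meets ∥
    three h = ℕ.≤-reflexive (sym (∥∥-cong {v = λ (_ : Fin 3) → true} h))
    go : (∀ j → meets j ≡ true) ⊎ (∃ λ j → meets j ≡ false) → NRep (Z ↾ X) S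
    go (inj₁ h) = ⊥-elim (ℕ.<⇒≱ (s≤s le) (ℕ.≤-trans (three h) (∥meets∥≤ id id)))
    go (inj₂ (j , p)) = free j p

  theta-Graphical : Graphical (Ext (Z ↾ X) S)
  theta-Graphical = graphical-table thetaAll (label thetaAll λ e l q → theta-all-covers l (S e)) (coded 3 {6} 130203122301) theta-all-ok

∥∥-+ : ∀ {n} {S A B : V n} → (∀ i → b→ℕ (S i) ≡ b→ℕ (A i) +ℕ b→ℕ (B i)) → ∥ S ∥ ≡ ∥ A ∥ +ℕ ∥ B ∥
∥∥-+ {zero} h = refl
∥∥-+ {suc n} {S} {A} {B} h = trans (cong₂ _+ℕ_ (h zero) (∥∥-+ {S = S ∘ suc} {A ∘ suc} {B ∘ suc} (h ∘ suc)))
  (+-swap (b→ℕ (A zero)) (b→ℕ (B zero)) ∥ A ∘ suc ∥ ∥ B ∘ suc ∥)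
  where
  +-swap : ∀ a b c d → (a +ℕ b) +ℕ (c +ℕ d) ≡ (a +ℕ c) +ℕ (b +ℕ d)
  +-swap a b c d = trans (ℕ.+-assoc a b (c +ℕ d)) (trans (cong (a +ℕ_) (trans (sym (ℕ.+-assoc b c d)) (trans (cong (_+ℕ d) (ℕ.+-comm b c)) (ℕ.+-assoc c b d)))) (sym (ℕ.+-assoc a c (b +ℕ d))))

∥∥-parts : ∀ {n} (S X Y : V n) → (∀ e → X e ≡ true → Y e ≡ false) → S ⊑ X ⊔ᵛ Y → ∥ S ∥ ≡ ∥ S ⊓ X ∥ +ℕ ∥ S ⊓ Y ∥
∥∥-parts S X Y d S⊑ = ∥∥-+ at
  where
  at : ∀ i → b→ℕ (S i) ≡ b→ℕ ((S ⊓ X) i) +ℕ b→ℕ ((S ⊓ Y) i)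
  at i with S i in p | X i in q | Y i in r
  ... | false | _ | _ = refl
  ... | true | true | false = refl
  ... | true | false | true = refl
  ... | true | true | true = ⊥-elim (true≢false (trans (sym r) (d i q)))
  ... | true | false | false = ⊥-elim (true≢false (trans (sym (S⊑ i p)) (cong₂ _∨_ q r)))

↾-resp : ∀ {n} (Z : Space n) {X Y} → X ≈ Y → Z ↾ X ≐ Z ↾ Y
↾-resp Z p = (λ v (a , b) → a , ⊑-respʳ p b) ⸴ λ v (a , b) → a , ⊑-respʳ (≈-sym p) b

-- Summands all of whose small splittings are graphic

two : Bool → Bool → V 2
two a b zero = a
two a b (suc zero) = b

-- A set of three elements is distributed over two summands either with at most two in each, where
-- both need marked vertices, or entirely within one, where a graph without marked vertices is
-- enough. Hence the two clauses, which together are preserved by direct sums.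
Good : ∀ {n} → Space n → V n → Set
Good Z A = ∀ S → S ⊑ A → (∥ S ∥ ≤ 2 → NRep (Z ↾ A) S) × (∥ S ∥ ≡ 3 → Graphical (Ext (Z ↾ A) S))

module _ {n} (Z : Space n) where

  universal⇒Good : ∀ {A} → (∀ S → S ⊑ A → NRep (Z ↾ A) S) → Good Z A
  universal⇒Good h S S⊑ = (λ _ → h S S⊑) , λ _ → NRep⇒Graphical (h S S⊑)

  Good-resp : ∀ {A B} → A ≈ B → Good Z A → Good Z B
  Good-resp p g S S⊑ = let (f , h) = g S (⊑-respʳ (≈-sym p) S⊑) in
    (λ le → NRep-resp (↾-resp Z p) (f le)) , λ eq → graphical-resp (Ext-mono S (↾-resp Z p)) (h eq)

  Sep : V n → Set
  Sep A = ∀ v → Z ∋ v → Z ∋ v ⊓ A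

  NRep-0⇒Graphical : ∀ {W : Space n} → NRep W 0ᵛ → Graphical W
  NRep-0⇒Graphical {W} r = graphical-resp ((λ w (b , h) → resp≈ W (λ i → drop b (w i)) h) ⸴ λ w h → false , resp≈ W (λ i → sym (Bool.xor-identityʳ (w i))) h) (NRep⇒Graphical {W = W} {0ᵛ} r)
    where
    drop : ∀ b x → x xor (b ∧ false) ≡ x
    drop b x = trans (cong (x xor_) (Bool.∧-zeroʳ b)) (Bool.xor-identityʳ x)

  Good-sum : ∀ {X Y} → (∀ e → X e ≡ true → Y e ≡ false) → Sep X → Good Z X → Good Z Y → Good Z (X ⊔ᵛ Y)
  Good-sum {X} {Y} disj sep gX gY S S⊑ = (λ le → NRep-sum Z X Y disj (λ v Zv _ → sep v Zv) S⊑
      (proj₁ (gX S₁ S₁⊑) (ℕ.≤-trans (ℕ.m≤m+n ∥ S₁ ∥ ∥ S₂ ∥) (ℕ.≤-trans (ℕ.≤-reflexive (sym size-split)) le)))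
      (proj₁ (gY S₂ S₂⊑) (ℕ.≤-trans (ℕ.m≤n+m ∥ S₂ ∥ ∥ S₁ ∥) (ℕ.≤-trans (ℕ.≤-reflexive (sym size-split)) le))))
    , λ eq → three ∥ S₁ ∥ ∥ S₂ ∥ refl refl (trans (sym size-split) eq)
    where
    S₁ = S ⊓ X
    S₂ = S ⊓ Y
    S₁⊑ : S₁ ⊑ X
    S₁⊑ = ⊓-⊑ʳ S X
    S₂⊑ : S₂ ⊑ Y
    S₂⊑ = ⊓-⊑ʳ S Y
    size-split : ∥ S ∥ ≡ ∥ S₁ ∥ +ℕ ∥ S₂ ∥
    size-split = ∥∥-parts S X Y disj S⊑
    disj′ : ∀ e → Y e ≡ true → X e ≡ false
    disj′ e p = ≢true⇒false λ q → true≢false (trans (sym p) (disj e q))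
    null : ∀ {A} → ∥ S ⊓ A ∥ ≡ 0 → ∀ {B} → S ⊑ A ⊔ᵛ B → S ⊑ B
    null {A} z {B} h e p = at (⊔ᵛ-true {u = A} {B} (h e p))
      where
      at : A e ≡ true ⊎ B e ≡ true → B e ≡ true
      at (inj₂ q) = q
      at (inj₁ q) = ⊥-elim (true≢false (trans (sym (cong₂ _∧_ p q)) (∥∥≡0 {u = S ⊓ A} z e)))
    comm : Y ⊔ᵛ X ≈ X ⊔ᵛ Y
    comm e = Bool.∨-comm (Y e) (X e)
    sepY : ∀ v → Z ∋ v → v ⊑ Y ⊔ᵛ X → Z ∋ v ⊓ Y
    sepY v Zv h = resp≈ Z eq (mem⊕ Z Zv (sep v Zv))
      where
      eq : v ⊕ (v ⊓ X) ≈ v ⊓ Y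
      eq e with v e in p | X e in q | Y e in r
      ... | false | _ | _ = refl
      ... | true | true | false = refl
      ... | true | false | true = refl
      ... | true | true | true = ⊥-elim (true≢false (trans (sym r) (disj e q)))
      ... | true | false | false = ⊥-elim (true≢false (trans (sym (h e p)) (cong₂ _∨_ r q)))
    zero-of : ∀ {A} → Good Z A → Graphical (Z ↾ A)
    zero-of g = NRep-0⇒Graphical (proj₁ (g 0ᵛ (λ _ ())) (ℕ.≤-trans (ℕ.≤-reflexive (∥0∥ n)) z≤n))
      where
      ∥0∥ : ∀ m → ∥_∥ {m} 0ᵛ ≡ 0
      ∥0∥ zero = refl
      ∥0∥ (suc m) = ∥0∥ m
    Result = Graphical (Ext (Z ↾ (X ⊔ᵛ Y)) S)
    both : ∥ S₁ ∥ ≤ 2 → ∥ S₂ ∥ ≤ 2 → Result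
    both l₁ l₂ = NRep⇒Graphical (NRep-sum Z X Y disj (λ v Zv _ → sep v Zv) S⊑ (proj₁ (gX S₁ S₁⊑) l₁) (proj₁ (gY S₂ S₂⊑) l₂))
    three : ∀ a b → ∥ S₁ ∥ ≡ a → ∥ S₂ ∥ ≡ b → a +ℕ b ≡ 3 → Result
    three 0 b p q eq = graphical-resp (Ext-mono S (↾-resp Z comm)) (graphical-sum Z Y X disj′ sepY S⊑Y (proj₂ (gY S S⊑Y) (trans size-split (trans (cong₂ _+ℕ_ p q) eq))) (zero-of gX))
      where
      S⊑Y : S ⊑ Y
      S⊑Y = null {X} p S⊑
    three 1 b p q eq = both (ℕ.≤-trans (ℕ.≤-reflexive p) (s≤s z≤n)) (ℕ.≤-reflexive (trans q (ℕ.suc-injective eq)))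
    three 2 b p q eq = both (ℕ.≤-reflexive p) (ℕ.≤-trans (ℕ.≤-reflexive (trans q (ℕ.suc-injective (ℕ.suc-injective eq)))) (s≤s z≤n))
    three (suc (suc (suc a))) b p q eq = graphical-sum Z X Y disj (λ v Zv _ → sep v Zv) S⊑X (proj₂ (gX S S⊑X) (trans size-split (trans (cong₂ _+ℕ_ p q) eq))) (zero-of gY)
      where
      b≡0 : b ≡ 0
      b≡0 = ℕ.m+n≡0⇒n≡0 a (ℕ.suc-injective (ℕ.suc-injective (ℕ.suc-injective eq)))
      S⊑X : S ⊑ X
      S⊑X = null {Y} (trans q b≡0) (⊑-respʳ (≈-sym comm) S⊑)

  -- With `S` inside a single coloop, the graph consists of a pendant edge at one marked vertex
  -- while the other marked vertex stays isolated.
  Good-loop : ∀ e → Z ∋ 𝟙 e → Good Z (𝟙 e)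
  Good-loop e Ze = universal⇒Good λ S S⊑ → 3 , G , # 0 , # 1 , to S S⊑ , from S S⊑
    where
    G : Graph 3 n
    G i with e Fin.≟ i
    ... | yes _ = # 0 , # 2
    ... | no _ = # 0 , # 0
    G-e : ∀ T → δ G T e ≡ T (# 0) xor T (# 2)
    G-e T with e Fin.≟ e
    ... | yes _ = refl
    ... | no ¬p = ⊥-elim (¬p refl)
    G-else : ∀ T {i} → e ≢ i → δ G T i ≡ false
    G-else T {i} p with e Fin.≟ i
    ... | yes q = ⊥-elim (p q)
    ... | no _ = Bool.xor-same (T zero)
    below : ∀ v → v ⊑ 𝟙 e → Z ↾ 𝟙 e ∋ v
    below v h = resp≈ Z eq (mem-· Z (v e) Ze) , h
      where
      eq : v e · 𝟙 e ≈ v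
      eq i = go (e Fin.≟ i)
        where
        go : Dec (e ≡ i) → v e ∧ 𝟙 e i ≡ v i
        go (yes refl) = trans (cong (v e ∧_) (𝟙-refl e)) (Bool.∧-identityʳ (v e))
        go (no q) = trans (trans (cong (v e ∧_) (𝟙-≢ q)) (Bool.∧-zeroʳ (v e))) (sym (⊑-false h (𝟙-≢ q)))
    to : ∀ S → S ⊑ 𝟙 e → ∀ b w → Z ↾ 𝟙 e ∋ w ⊕ b · S → ∃ λ T → T (# 0) xor T (# 1) ≡ b × w ≈ δ G T
    to S S⊑ b w (_ , h) = T , refl , eq
      where
      T : V 3
      T = false ◂ two b (w e)
      w⊑ : w ⊑ 𝟙 e
      w⊑ = ⊑-respˡ (λ i → xor-cancelʳ (w i) (b ∧ S i)) (⊑-⊕ h (λ i p → S⊑ i (⊓-⊑ʳ (λ _ → b) S i p)))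
      eq : w ≈ δ G T
      eq i = go (e Fin.≟ i)
        where
        go : Dec (e ≡ i) → w i ≡ δ G T i
        go (yes refl) = sym (G-e T)
        go (no q) = trans (⊑-false w⊑ (𝟙-≢ q)) (sym (G-else T q))
    from : ∀ S → S ⊑ 𝟙 e → ∀ T → Z ↾ 𝟙 e ∋ δ G T ⊕ (T (# 0) xor T (# 1)) · S
    from S S⊑ T = below _ (⊑-⊕ (λ i p → ≢false⇒true λ q → true≢false (trans (sym p) (G-else T (λ r → true≢false (trans (sym (trans (cong (𝟙 e) (sym r)) (𝟙-refl e))) q)))))
                              (λ i p → S⊑ i (⊓-⊑ʳ (λ _ → T (# 0) xor T (# 1)) S i p)))

  -- Only multiples of `S` have to be represented: the elements of `S` become edges between the two
  -- marked vertices, all others loops.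
  Good-zero : ∀ {A} → (∀ v → Z ↾ A ∋ v → v ≈ 0ᵛ) → Good Z A
  Good-zero {A} h = universal⇒Good λ S S⊑ → 2 , (λ e → # 0 , (if S e then # 1 else # 0)) , # 0 , # 1
      , (λ b w p → two false b , refl , λ e → trans (xor≡false⇒≡ (h _ p e)) (at b (S e)))
      , λ T → mem-0 (Z ↾ A) λ e → trans (cong (_xor ((T (# 0) xor T (# 1)) ∧ S e)) (at′ T (S e))) (Bool.xor-same ((T (# 0) xor T (# 1)) ∧ S e))
    where
    at : ∀ b s → b ∧ s ≡ two false b (if s then # 1 else # 0)
    at b true = Bool.∧-identityʳ b
    at b false = Bool.∧-zeroʳ b
    at′ : ∀ (T : V 2) s → T (# 0) xor T (if s then # 1 else # 0) ≡ (T (# 0) xor T (# 1)) ∧ s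
    at′ T true = sym (Bool.∧-identityʳ _)
    at′ T false = trans (Bool.xor-same (T zero)) (sym (Bool.∧-zeroʳ _))

-- A circuit C of Z together with an ear v, as a theta graph with legs C − v, C ∩ v, v − C
module Theta {n} (Z : Space n) (C v : V n) (ZC : Z ∋ C) (Zv : Z ∋ v) (circ : ∀ u → Z ∋ u → u ⊑ C → u ≈ 0ᵛ ⊎ u ≈ C)
             (minimal : ∀ z → Z ∋ z → z ⊑ C ⊔ᵛ v → z ⊓ ~ C ≈ 0ᵛ ⊎ z ⊓ ~ C ≈ v ⊓ ~ C)
             (a : Fin n) (Ca : C a ≡ true) (va : v a ≡ false) (b : Fin n) (Cb : C b ≡ true) (vb : v b ≡ true)
             (y : Fin n) (Cy : C y ≡ false) (vy : v y ≡ true) where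

  leg : Bool → Bool → Maybe (Fin 3)
  leg true false = just (# 0)
  leg true true = just (# 1)
  leg false true = just (# 2)
  leg false false = nothing

  κ : Fin n → Maybe (Fin 3)
  κ e = leg (C e) (v e)

  dom≈ : dom κ ≈ C ⊔ᵛ v
  dom≈ e with C e | v e
  ... | true | true = refl
  ... | true | false = refl
  ... | false | true = refl
  ... | false | false = refl

  rep : Fin 3 → Fin n
  rep zero = a
  rep (suc zero) = b
  rep (suc (suc zero)) = y

  row₀ : pull κ (rows thetaM (# 0)) ≈ C ⊕ v
  row₀ e with C e | v e
  ... | true | true = refl
  ... | true | false = refl
  ... | false | true = refl
  ... | false | false = refl

  row₁ : pull κ (rows thetaM (# 1)) ≈ C
  row₁ e with C e | v e
  ... | true | true = refl
  ... | true | false = refl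
  ... | false | true = refl
  ... | false | false = refl

  v⊑ : v ⊑ C ⊔ᵛ v
  v⊑ e p = trans (cong (C e ∨_) p) (Bool.∨-zeroʳ (C e))

  combine : ∀ x y z → z ≈ x · (C ⊕ v) ⊕ y · C → z ≈ lin (two x y) (pull κ ∘ rows thetaM)
  combine x y z p e = trans (p e) (cong₂ _xor_ (cong (x ∧_) (sym (row₀ e))) (trans (cong (y ∧_) (sym (row₁ e))) (sym (Bool.xor-identityʳ _))))

  ⊑C : ∀ {z} → z ⊓ ~ C ≈ 0ᵛ → z ⊑ C
  ⊑C h e p = ≢false⇒true λ q → true≢false (trans (sym (cong₂ _∧_ p (cong not q))) (h e))

  real : Real Z thetaM
  real = record
    { κ = κ ; rep = rep
    ; κ-rep = λ { zero → cong₂ leg Ca va ; (suc zero) → cong₂ leg Cb vb ; (suc (suc zero)) → cong₂ leg Cy vy }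
    ; gen = record { member = mb ; generate = gn } }
    where
    mb : ∀ i → Z ↾ dom κ ∋ pull κ (rows thetaM i)
    mb zero = resp≈ Z (≈-sym row₀) (mem⊕ Z ZC Zv) , pull⊑dom κ (rows thetaM zero)
    mb (suc zero) = resp≈ Z (≈-sym row₁) ZC , pull⊑dom κ (rows thetaM (suc zero))
    gn : ∀ z → Z ↾ dom κ ∋ z → ∃ λ c → z ≈ lin c (pull κ ∘ rows thetaM)
    gn z (Zz , z⊑) = step (minimal z Zz (⊑-respʳ dom≈ z⊑))
      where
      Result = ∃ λ c → z ≈ lin c (pull κ ∘ rows thetaM)
      step : z ⊓ ~ C ≈ 0ᵛ ⊎ z ⊓ ~ C ≈ v ⊓ ~ C → Result
      step (inj₁ h) = go (circ z Zz (⊑C h))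
        where
        go : z ≈ 0ᵛ ⊎ z ≈ C → Result
        go (inj₁ p) = two false false , combine false false z p
        go (inj₂ p) = two false true , combine false true z p
      step (inj₂ h) = go (circ (z ⊕ v) (mem⊕ Z Zz Zv) (⊑C λ e → trans (⊓-⊕ z v (~ C) e) (trans (cong (_xor (v ⊓ ~ C) e) (h e)) (Bool.xor-same ((v ⊓ ~ C) e)))))
        where
        go : z ⊕ v ≈ 0ᵛ ⊎ z ⊕ v ≈ C → Result
        go (inj₁ p) = two true true , combine true true z λ e → trans (xor≡false⇒≡ (p e)) (lem (C e) (v e))
          where
          lem : ∀ c w → w ≡ (c xor w) xor c
          lem c w = sym (trans (cong (_xor c) (Bool.xor-comm c w)) (xor-cancelʳ w c))
        go (inj₂ p) = two true false , combine true false z λ e → trans (sym (xor-cancelʳ (z e) (v e))) (trans (cong (_xor v e) (p e)) (sym (Bool.xor-identityʳ (C e xor v e))))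

separated? : ∀ {n} (Z : Space n) X → (∃ λ v → Z ∋ v × ¬ (Z ∋ v ⊓ X)) ⊎ Sep Z X
separated? Z X = go (anyV? {P = λ v → Z ∋ v × ¬ (Z ∋ v ⊓ X)} (λ p (a , b) → resp≈ Z p a , λ q → b (resp≈ Z (λ i → cong (_∧ X i) (sym (p i))) q)) (λ v → mem? Z v ×-dec ¬? (mem? Z (v ⊓ X))))
  where
  go : Dec (∃ λ v → Z ∋ v × ¬ (Z ∋ v ⊓ X)) → (∃ λ v → Z ∋ v × ¬ (Z ∋ v ⊓ X)) ⊎ Sep Z X
  go (yes p) = inj₁ p
  go (no ¬p) = inj₂ λ v Zv → at v Zv (mem? Z (v ⊓ X))
    where
    at : ∀ v → Z ∋ v → Dec (Z ∋ v ⊓ X) → Z ∋ v ⊓ X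
    at v Zv (yes q) = q
    at v Zv (no q) = ⊥-elim (¬p (v , Zv , q))

≤-flip : ∀ {a b} → ¬ (a < b) → b ≤ a
≤-flip = ℕ.≮⇒≥

weight-𝟙 : ∀ {n} (a : Fin n) → ∥ 𝟙 a ∥ ≡ 1
weight-𝟙 {n} a = trans (∥∥-cong {v = push {k = 1} (λ _ → a) (λ _ → true)} λ e → sym (Bool.xor-identityʳ (𝟙 a e)))
                       (∥push∥ {k = 1} (λ _ → a) (λ { {zero} {zero} _ → refl }) (λ _ → true))

𝟙-⊑ : ∀ {n} {u : V n} {a} → u a ≡ true → 𝟙 a ⊑ u
𝟙-⊑ {u = u} p e q = trans (cong u (sym (𝟙-true q))) p

two≤∥∥ : ∀ {n} {u : V n} {a b} → a ≢ b → u a ≡ true → u b ≡ true → 2 ≤ ∥ u ∥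
two≤∥∥ {u = u} {a} {b} ne p q = ℕ.≤-trans (ℕ.≤-reflexive (cong suc (sym (weight-𝟙 a)))) (∥∥-mono-< (𝟙-⊑ {u = u} p) b (𝟙-≢ ne) q)

circuit-dichotomy : ∀ {n} {K : Space n} {C} → IsCircuit K C → ∀ v → K ∋ v → v ⊑ C → v ≈ 0ᵛ ⊎ v ≈ C
circuit-dichotomy (_ , _ , min) v Kv v⊑ = go (Nz? v)
  where
  go : Dec (Nz v) → _
  go (yes nz) = inj₂ (min v Kv v⊑ nz)
  go (no ¬nz) = inj₁ (¬Nz⇒0 ¬nz)

IsCircuit? : ∀ {n} (K : Space n) c → Dec (IsCircuit K c)
IsCircuit? K c = mem? K c ×-dec (Nz? c ×-dec allV? (λ {u} {v} p f Kv v⊑ nz → ≈-trans (≈-sym p) (f (resp≈ K (≈-sym p) Kv) (⊑-respˡ (≈-sym p) v⊑) (Nz-resp (≈-sym p) nz)))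
  (λ u → mem? K u →-dec (⊑? u c →-dec (Nz? u →-dec (u ≈? c)))))

IsCircuit-resp : ∀ {n} (K : Space n) → Respects (IsCircuit K)
IsCircuit-resp K p (a , b , c) = resp≈ K p a , Nz-resp p b , λ u Ku u⊑ nz → ≈-trans (c u Ku (⊑-respʳ (≈-sym p) u⊑) nz) p

LongestCircuit : ∀ {n} → Space n → V n → Set
LongestCircuit K C = IsCircuit K C × (∀ C′ → IsCircuit K C′ → ∥ C′ ∥ ≤ ∥ C ∥)

longestCircuit : ∀ {n} (K : Space n) C → IsCircuit K C → ∃ (LongestCircuit K)
longestCircuit {n} K C circ = go n C circ (ℕ.m≤n+m n _)
  where
  Longer : V n → V n → Set
  Longer C C′ = IsCircuit K C′ × ∥ C ∥ < ∥ C′ ∥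
  longer? : ∀ C → Dec (∃ (Longer C))
  longer? C = anyV? (λ p (a , b) → IsCircuit-resp K p a , ℕ.≤-trans b (ℕ.≤-reflexive (∥∥-cong p))) (λ C′ → IsCircuit? K C′ ×-dec (suc ∥ C ∥ ℕ.≤? ∥ C′ ∥))
  go : ∀ m C → IsCircuit K C → n ≤ ∥ C ∥ +ℕ m → ∃ (LongestCircuit K)
  go m C circ le = step (longer? C)
    where
    next-circuit : ∀ m C′ → IsCircuit K C′ → n ≤ ∥ C ∥ +ℕ m → ∥ C ∥ < ∥ C′ ∥ → ∃ (LongestCircuit K)
    next-circuit zero C′ circ′ le lt = ⊥-elim (ℕ.<⇒≱ lt (ℕ.≤-trans (∥∥≤n C′) (ℕ.≤-trans le (ℕ.≤-reflexive (ℕ.+-identityʳ _)))))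
    next-circuit (suc m) C′ circ′ le lt = go m C′ circ′ (ℕ.≤-trans le (ℕ.≤-trans (ℕ.≤-reflexive (ℕ.+-suc ∥ C ∥ m)) (ℕ.+-monoˡ-≤ m lt)))
    step : Dec (∃ (Longer C)) → ∃ (LongestCircuit K)
    step (yes (C′ , circ′ , lt)) = next-circuit m C′ circ′ le lt
    step (no ¬l) = C , circ , λ C′ circ′ → ≤-flip λ lt → ¬l (C′ , circ′ , lt)

-- A circuit formed by an ear and one side of C
ear-circuit : ∀ {n} (K : Space n) {C v} → IsCircuit K C → K ∋ v →
              (∀ z → K ∋ z → z ⊑ C ⊔ᵛ v → z ⊓ ~ C ≈ 0ᵛ ⊎ z ⊓ ~ C ≈ v ⊓ ~ C) →
              ∀ a → C a ≡ true → v a ≡ false → Nz v → IsCircuit K v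
ear-circuit {n} K {C} {v} circ Kv minimal a Ca va nz = Kv , nz , λ u Ku u⊑ nzu → step u Ku u⊑ nzu (minimal u Ku (λ e p → trans (cong (C e ∨_) (u⊑ e p)) (Bool.∨-zeroʳ (C e))))
  where
  a∉ : ∀ {u} → u ⊑ v → u ≈ C → ⊥
  a∉ u⊑ p = true≢false (trans (sym Ca) (trans (sym (p a)) (⊑-false u⊑ va)))
  ⊑C : ∀ {z} → z ⊓ ~ C ≈ 0ᵛ → z ⊑ C
  ⊑C h e p = ≢false⇒true λ q → true≢false (trans (sym (cong₂ _∧_ p (cong not q))) (h e))
  step : ∀ u → K ∋ u → u ⊑ v → Nz u → u ⊓ ~ C ≈ 0ᵛ ⊎ u ⊓ ~ C ≈ v ⊓ ~ C → u ≈ v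
  step u Ku u⊑ nzu (inj₁ h) = go (circuit-dichotomy {K = K} circ u Ku (⊑C h))
    where
    go : u ≈ 0ᵛ ⊎ u ≈ C → u ≈ v
    go (inj₁ p) = ⊥-elim (true≢false (trans (sym (proj₂ nzu)) (p (proj₁ nzu))))
    go (inj₂ p) = ⊥-elim (a∉ u⊑ p)
  step u Ku u⊑ nzu (inj₂ h) = go (circuit-dichotomy {K = K} circ (u ⊕ v) (mem⊕ K Ku Kv) (⊑C λ e → trans (⊓-⊕ u v (~ C) e) (trans (cong (_xor (v ⊓ ~ C) e) (h e)) (Bool.xor-same ((v ⊓ ~ C) e)))))
    where
    go : u ⊕ v ≈ 0ᵛ ⊎ u ⊕ v ≈ C → u ≈ v
    go (inj₁ p) e = xor≡false⇒≡ (p e)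
    go (inj₂ p) = ⊥-elim (a∉ (⊑-⊕ u⊑ (λ _ q → q)) p)

-- Decomposition along a longest circuit

module Claim {n} {Z : Space n} {U : V n} (nb : NoBad Z U) (ZU : ∀ v → Z ∋ v → v ⊑ U) (simple : Simple Z) where

  Outcome : V n → Set
  Outcome A = Good Z A ⊎ Real Z k4M

  Claimed : V n → Set
  Claimed A = Sep Z A → Outcome A

  module AtSet (A : V n) (sepA : Sep Z A) (rec : ∀ B → ∥ B ∥ < ∥ A ∥ → Claimed B) where

    -- A good separated part splits off as a direct summand; what is left is separated too and
    -- smaller, so the recursion applies to it.
    peel : ∀ X → X ⊑ A → Nz X → Sep Z X → Good Z X → Outcome A
    peel X X⊑ (x , Xx) sepX good = step (rec B smaller sepB)
      where
      B = A ⊓ ~ X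
      whole : X ⊔ᵛ B ≈ A
      whole e with X e in p
      ... | true = sym (X⊑ e p)
      ... | false = Bool.∧-identityʳ (A e)
      disj : ∀ e → X e ≡ true → B e ≡ false
      disj e p = trans (cong (λ b → A e ∧ not b) p) (Bool.∧-zeroʳ (A e))
      smaller : ∥ B ∥ < ∥ A ∥
      smaller = ∥∥-mono-< (⊓-⊑ˡ A (~ X)) x (disj x Xx) (X⊑ x Xx)
      sepB : Sep Z B
      sepB v Zv = resp≈ Z eq (mem⊕ Z (sepA v Zv) (sepX v Zv))
        where
        eq : (v ⊓ A) ⊕ (v ⊓ X) ≈ v ⊓ B
        eq e with v e | X e in p
        ... | false | _ = refl
        ... | true | false = trans (Bool.xor-identityʳ (A e)) (sym (Bool.∧-identityʳ (A e)))
        ... | true | true = trans (cong (_xor true) (X⊑ e p)) (sym (Bool.∧-zeroʳ (A e)))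
      step : Outcome B → Outcome A
      step (inj₂ R) = inj₂ R
      step (inj₁ g) = inj₁ (Good-resp Z whole (Good-sum Z {X} {B} disj sepX good g))

    module AtCircuit (no-loop : ∀ e → A e ≡ true → ¬ (Z ∋ 𝟙 e)) (C : V n) (longest : LongestCircuit (Z ↾ A) C) where

      K : Space n
      K = Z ↾ A
      circK : IsCircuit K C
      circK = proj₁ longest
      ZC : Z ∋ C
      ZC = proj₁ (proj₁ circK)
      C⊑A : C ⊑ A
      C⊑A = proj₂ (proj₁ circK)
      c₀ : Fin n
      c₀ = proj₁ (proj₁ (proj₂ circK))
      Cc₀ : C c₀ ≡ true
      Cc₀ = proj₂ (proj₁ (proj₂ circK))
      circ : ∀ v → Z ∋ v → v ⊑ C → v ≈ 0ᵛ ⊎ v ≈ C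
      circ v Zv v⊑ = circuit-dichotomy {K = K} circK v (Zv , ⊑-trans v⊑ C⊑A) v⊑

      -- Both sides of a chord would do. Requiring that `c₀` be missing selects one of them and
      -- ensures that no two sides cover `C`.
      Side : Fin n → V n → Set
      Side x P = P ⊑ C × P c₀ ≡ false × Z ∋ P ⊕ 𝟙 x

      side? : ∀ x → Dec (∃ (Side x))
      side? x = anyV? (λ p (a , b , c) → ⊑-respˡ p a , trans (sym (p c₀)) b , resp≈ Z (λ e → cong (_xor 𝟙 x e) (p e)) c)
                      (λ P → ⊑? P C ×-dec ((P c₀ Bool.≟ false) ×-dec mem? Z (P ⊕ 𝟙 x)))

      sideOf : ∀ {x} → Dec (∃ (Side x)) → V n
      sideOf (yes (P , _)) = P
      sideOf (no _) = 0ᵛ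

      P : Fin n → V n
      P x = sideOf (side? x)

      Ch : V n
      Ch x = A x ∧ (not (C x) ∧ ⌊ side? x ⌋)

      Ch-A : ∀ x → Ch x ≡ true → A x ≡ true
      Ch-A x p = ∧₁ (A x) (not (C x) ∧ ⌊ side? x ⌋) p

      Ch∌C : ∀ x → Ch x ≡ true → C x ≡ false
      Ch∌C x p = not-true (∧₁ (not (C x)) ⌊ side? x ⌋ (∧₂ (A x) (not (C x) ∧ ⌊ side? x ⌋) p))

      side : ∀ x → Ch x ≡ true → Side x (P x)
      side x p = go (side? x) (∧₂ (not (C x)) ⌊ side? x ⌋ (∧₂ (A x) (not (C x) ∧ ⌊ side? x ⌋) p))
        where
        go : (d : Dec (∃ (Side x))) → ⌊ d ⌋ ≡ true → Side x (sideOf d)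
        go (yes (_ , s)) _ = s

      chord : ∀ x → A x ≡ true → C x ≡ false → ∃ (Side x) → Ch x ≡ true
      chord x Ax Cx s = cong₂ _∧_ Ax (cong₂ _∧_ (cong not Cx) (go (side? x)))
        where
        go : (d : Dec (∃ (Side x))) → ⌊ d ⌋ ≡ true
        go (yes _) = refl
        go (no ¬s) = ⊥-elim (¬s s)

      P⊑ : ∀ x → Ch x ≡ true → P x ⊑ C
      P⊑ x p = proj₁ (side x p)

      P-c₀ : ∀ x → Ch x ≡ true → P x c₀ ≡ false
      P-c₀ x p = proj₁ (proj₂ (side x p))

      ZP : ∀ x → Ch x ≡ true → Z ∋ P x ⊕ 𝟙 x
      ZP x p = proj₂ (proj₂ (side x p))

      P-nz : ∀ x → Ch x ≡ true → Nz (P x)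
      P-nz x p = go (Nz? (P x))
        where
        go : Dec (Nz (P x)) → Nz (P x)
        go (yes nz) = nz
        go (no ¬nz) = ⊥-elim (no-loop x (Ch-A x p) (resp≈ Z (λ e → cong (_xor 𝟙 x e) (¬Nz⇒0 ¬nz e)) (ZP x p)))

      -- Two chords with the same side would form a series pair, against simplicity.
      P-inj : ∀ x y → Ch x ≡ true → Ch y ≡ true → P x ≈ P y → x ≡ y
      P-inj x y p q eq = go (x Fin.≟ y)
        where
        go : Dec (x ≡ y) → x ≡ y
        go (yes r) = r
        go (no r) = ⊥-elim (simple x y r (resp≈ Z (λ e → trans (xor-interchange (P x e) (𝟙 x e) (P y e) (𝟙 y e))
            (trans (cong (_xor (𝟙 x e xor 𝟙 y e)) (trans (cong (_xor P y e) (eq e)) (Bool.xor-same (P y e)))) refl)) (mem⊕ Z (ZP x p) (ZP y q))))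

      open Chords Z C Ch P ZC circ Ch∌C P⊑ ZP using (comb; comb∈; comb-else; comb⊑) renaming (X to U₀)
      module Tree = Chords Z C Ch P ZC circ Ch∌C P⊑ ZP

      C⊑U₀ : C ⊑ U₀
      C⊑U₀ e p = cong (_∨ Ch e) p

      U₀⊑A : U₀ ⊑ A
      U₀⊑A e p = go (⊔ᵛ-true {u = C} {Ch} p)
        where
        go : C e ≡ true ⊎ Ch e ≡ true → A e ≡ true
        go (inj₁ q) = C⊑A e q
        go (inj₂ q) = Ch-A e q

      ⊔~ : ∀ {v z} → z ⊑ C ⊔ᵛ v → z ⊓ ~ C ⊑ v ⊓ ~ C
      ⊔~ {v} {z} h e p = cong₂ _∧_ (go (⊔ᵛ-true {u = C} {v} (h e (⊓-⊑ˡ z (~ C) e p)))) (⊓-⊑ʳ z (~ C) e p)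
        where
        go : C e ≡ true ⊎ v e ≡ true → v e ≡ true
        go (inj₂ q) = q
        go (inj₁ q) = ⊥-elim (true≢false (trans (sym (⊓-⊑ʳ z (~ C) e p)) (cong not q)))

      -- Only three of the four regions of `C` are required to be nonempty: the fourth, outside both
      -- sides, contains `c₀`.
      Crossing : Fin n → Fin n → Set
      Crossing x y = Ch x ≡ true × Ch y ≡ true × (∃ λ e → P x e ≡ true × P y e ≡ false) × (∃ λ e → P x e ≡ false × P y e ≡ true) × (∃ λ e → P x e ≡ true × P y e ≡ true)

      crossing? : ∀ x y → Dec (Crossing x y)
      crossing? x y = (Ch x Bool.≟ true) ×-dec ((Ch y Bool.≟ true) ×-dec (attained? true false ×-dec (attained? false true ×-dec attained? true true)))
        where
        attained? : ∀ a b → Dec (∃ λ e → P x e ≡ a × P y e ≡ b)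
        attained? a b = Fin.any? λ e → (P x e Bool.≟ a) ×-dec (P y e Bool.≟ b)

      below-𝟙 : ∀ {u : V n} x → u ⊑ 𝟙 x → u ≈ 0ᵛ ⊎ u ≈ 𝟙 x
      below-𝟙 {u} x h = go (u x) refl
        where
        go : ∀ b → u x ≡ b → u ≈ 0ᵛ ⊎ u ≈ 𝟙 x
        go true p = inj₂ (⊑-antisym h (𝟙-⊑ {u = u} p))
        go false p = inj₁ λ e → ≢true⇒false λ q → true≢false (trans (sym q) (trans (cong u (sym (𝟙-true (h e q)))) p))

      -- two crossing chords and C form a subdivided K₄
      module Crossed (x y : Fin n) (cx : Ch x ≡ true) (cy : Ch y ≡ true) (e₁ : Fin n) (x₁ : P x e₁ ≡ true) (y₁ : P y e₁ ≡ false)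
                     (e₂ : Fin n) (x₂ : P x e₂ ≡ false) (y₂ : P y e₂ ≡ true) (e₃ : Fin n) (x₃ : P x e₃ ≡ true) (y₃ : P y e₃ ≡ true) where

        chordV : Fin n → V n
        chordV z = P z ⊕ 𝟙 z

        at-C : ∀ z → Ch z ≡ true → ∀ {e} → C e ≡ true → chordV z e ≡ P z e
        at-C z cz {e} Ce = trans (cong (P z e xor_) (𝟙-≢ λ p → true≢false (trans (sym Ce) (trans (cong C (sym p)) (Ch∌C z cz))))) (Bool.xor-identityʳ (P z e))

        at-~C : ∀ z → Ch z ≡ true → chordV z ⊓ ~ C ≈ 𝟙 z
        at-~C z cz e = go (C e) refl
          where
          go : ∀ b → C e ≡ b → (chordV z ⊓ ~ C) e ≡ 𝟙 z e
          go true p = trans (trans (cong (λ b → chordV z e ∧ not b) p) (Bool.∧-zeroʳ (chordV z e))) (sym (𝟙-≢ λ q → true≢false (trans (sym p) (trans (cong C (sym q)) (Ch∌C z cz)))))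
          go false p = trans (trans (cong (λ b → chordV z e ∧ not b) p) (Bool.∧-identityʳ (chordV z e))) (cong (_xor 𝟙 z e) (⊑-false (P⊑ z cz) p))

        minimal₁ : ∀ z → Z ∋ z → z ⊑ C ⊔ᵛ chordV x → z ⊓ ~ C ≈ 0ᵛ ⊎ z ⊓ ~ C ≈ chordV x ⊓ ~ C
        minimal₁ z Zz z⊑ = go (below-𝟙 {z ⊓ ~ C} x (⊑-respʳ (at-~C x cx) (⊔~ {chordV x} {z} z⊑)))
          where
          go : z ⊓ ~ C ≈ 0ᵛ ⊎ z ⊓ ~ C ≈ 𝟙 x → z ⊓ ~ C ≈ 0ᵛ ⊎ z ⊓ ~ C ≈ chordV x ⊓ ~ C
          go (inj₁ p) = inj₁ p
          go (inj₂ p) = inj₂ (≈-trans p (≈-sym (at-~C x cx)))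

        Cx : C x ≡ false
        Cx = Ch∌C x cx
        on : ∀ {e} → P x e ≡ true → C e ≡ true
        on p = P⊑ x cx _ p
        on′ : ∀ {e} → P y e ≡ true → C e ≡ true
        on′ p = P⊑ y cy _ p

        open Theta Z C (chordV x) ZC (ZP x cx) circ minimal₁ c₀ Cc₀ (trans (at-C x cx Cc₀) (P-c₀ x cx)) e₁ (on x₁) (trans (at-C x cx (on x₁)) x₁)
                   x Cx (cong₂ _xor_ (⊑-false (P⊑ x cx) Cx) (𝟙-refl x))

        w : V n
        w = chordV y

        off-dom : w ⊓ ~ dom κ ≈ 𝟙 y
        off-dom e = trans (cong (λ b → w e ∧ not b) (dom≈ e)) (go (C e) refl (chordV x e) refl)
          where
          go : ∀ b → C e ≡ b → ∀ c → chordV x e ≡ c → w e ∧ not (C e ∨ chordV x e) ≡ 𝟙 y e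
          go true p _ _ = trans (trans (cong (λ b → w e ∧ not (b ∨ chordV x e)) p) (trans (Bool.∧-zeroʳ (w e)) (sym (trans (cong (λ b → w e ∧ not b) p) (Bool.∧-zeroʳ (w e)))))) (at-~C y cy e)
          go false p false q = trans (trans (cong (λ b → w e ∧ not (b ∨ chordV x e)) p) (trans (cong (λ b → w e ∧ not b) q) (sym (cong (λ b → w e ∧ not b) p)))) (at-~C y cy e)
          go false p true q = trans (trans (cong (λ b → w e ∧ not b) (trans (cong (C e ∨_) q) (Bool.∨-zeroʳ (C e)))) (Bool.∧-zeroʳ (w e)))
              (sym (𝟙-≢ λ r → x≢y (trans (𝟙-true (trans (sym (at-~C x cx e)) (cong₂ _∧_ q (cong not p)))) (sym r))))
            where
            x≢y : x ≢ y
            x≢y refl = true≢false (trans (sym x₁) y₁)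

        ear : EarOn Z (dom κ) w
        ear = record { v∈ = ZP y cy ; v∉ = notin ; minimal = λ z Zz z⊑ → go z (below-𝟙 {z ⊓ ~ dom κ} y (⊑-respʳ off-dom z⊑)) }
          where
          go : ∀ z → z ⊓ ~ dom κ ≈ 0ᵛ ⊎ z ⊓ ~ dom κ ≈ 𝟙 y → z ⊓ ~ dom κ ≈ 0ᵛ ⊎ z ⊓ ~ dom κ ≈ w ⊓ ~ dom κ
          go z (inj₁ p) = inj₁ p
          go z (inj₂ p) = inj₂ (≈-trans p (≈-sym off-dom))
          notin : ¬ (Z ∋ w ⊓ dom κ)
          notin h = no-loop y (Ch-A y cy) (resp≈ Z (λ e → trans (cong (_xor (w ⊓ dom κ) e) (⊓-split w (dom κ) e))
              (trans (cong (_xor (w ⊓ dom κ) e) (Bool.xor-comm ((w ⊓ dom κ) e) ((w ⊓ ~ dom κ) e))) (trans (xor-cancelʳ ((w ⊓ ~ dom κ) e) ((w ⊓ dom κ) e)) (off-dom e))))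
            (mem⊕ Z (ZP y cy) h))

        open States nb ZU {thetaM} refl real

        mixed-leg : ∀ l → Takes w l true → Takes w l false → ∀ z j → onlyOn (state w) z j ≡ true → l ≡ j
        mixed-leg l (e , p , q) (e′ , p′ , q′) z j h = go (∨-true {⌊ l Fin.≟ j ⌋} (everyF-∀ (λ l → ⌊ l Fin.≟ j ⌋ ∨ not (pres (state w) z (just l , true))) h l))
          where
          hit-any : ∀ b → sel (lookup (state w) l) b ≡ true
          hit-any b = trans (sel-state w l b) (taken b (takes? w l b))
            where
            taken : ∀ b (d : Dec (Takes w l b)) → ⌊ d ⌋ ≡ true
            taken b (yes _) = refl
            taken true (no ¬t) = ⊥-elim (¬t (e , p , q))
            taken false (no ¬t) = ⊥-elim (¬t (e′ , p′ , q′))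
          go : ⌊ l Fin.≟ j ⌋ ≡ true ⊎ not (pres (state w) z (just l , true)) ≡ true → l ≡ j
          go (inj₁ r) = ⌊⌋-true {d = l Fin.≟ j} r
          go (inj₂ r) = ⊥-elim (true≢false (trans (sym r) (cong not (hit-any (true xor lookup z l)))))

        takes : ∀ e {a b} → C e ≡ true → P x e ≡ a → P y e ≡ b → κ e ≡ leg true a × w e ≡ b
        takes e p q r = cong₂ leg p (trans (at-C x cx p) q) , trans (at-C y cy p) r

        impossible : ¬ (∃ λ j → ∃ λ z → z ∈ˡ span thetaM × onlyOn (state w) z j ≡ true)
        impossible (j , z , _ , h) = 0≢1 (trans
            (mixed-leg (# 0) (e₂ , takes e₂ (on′ y₂) x₂ y₂) (c₀ , takes c₀ Cc₀ (P-c₀ x cx) (P-c₀ y cy)) z j h)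
            (sym (mixed-leg (# 1) (e₃ , takes e₃ (on x₃) x₃ y₃) (e₁ , takes e₁ (on x₁) x₁ y₁) z j h)))
          where
          0≢1 : zero ≢ suc (zero {1})
          0≢1 ()

        k4 : Real Z k4M
        k4 = go (thetaStep nb ZU simple real ear)
          where
          go : Real Z k4M ⊎ (∃ λ j → ∃ λ z → z ∈ˡ span thetaM × onlyOn (state w) z j ≡ true) → Real Z k4M
          go (inj₁ R) = R
          go (inj₂ h) = ⊥-elim (impossible h)

      chordal : Sep Z U₀ → Outcome A
      chordal sep = step (Fin.any? λ x → Fin.any? λ y → crossing? x y)
        where
        step : Dec (∃ λ x → ∃ λ y → Crossing x y) → Outcome A
        step (yes (x , y , cx , cy , (e₁ , x₁ , y₁) , (e₂ , x₂ , y₂) , (e₃ , x₃ , y₃))) = inj₂ (Crossed.k4 x y cx cy e₁ x₁ y₁ e₂ x₂ y₂ e₃ x₃ y₃)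
        step (no ¬c) = peel U₀ U₀⊑A (c₀ , C⊑U₀ c₀ Cc₀) sep (universal⇒Good Z (Tree.Laminar.universal P-nz P-inj laminar))
          where
          laminar : ∀ x y → Ch x ≡ true → Ch y ≡ true → P x ⊑ P y ⊎ P y ⊑ P x ⊎ (∀ e → P x e ≡ true → P y e ≡ false)
          laminar x y cx cy = go (⊑? (P x) (P y)) (⊑? (P y) (P x)) (Fin.any? λ e → (P x e Bool.≟ true) ×-dec (P y e Bool.≟ true))
            where
            notBelow : ∀ {u v : V n} → ¬ (u ⊑ v) → ∃ λ e → u e ≡ true × v e ≡ false
            notBelow {u} {v} h = found (Fin.any? λ e → (u e Bool.≟ true) ×-dec (v e Bool.≟ false))
              where
              found : Dec (∃ λ e → u e ≡ true × v e ≡ false) → ∃ λ e → u e ≡ true × v e ≡ false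
              found (yes p) = p
              found (no ¬p) = ⊥-elim (h λ e p → ≢false⇒true λ q → ¬p (e , p , q))
            go : Dec (P x ⊑ P y) → Dec (P y ⊑ P x) → Dec (∃ λ e → P x e ≡ true × P y e ≡ true) → P x ⊑ P y ⊎ P y ⊑ P x ⊎ (∀ e → P x e ≡ true → P y e ≡ false)
            go (yes p) _ _ = inj₁ p
            go (no _) (yes p) _ = inj₂ (inj₁ p)
            go (no _) (no _) (no ¬m) = inj₂ (inj₂ λ e p → ≢true⇒false λ q → ¬m (e , p , q))
            go (no p) (no q) (yes m) = ⊥-elim (¬c (x , y , cx , cy , notBelow p , (let (e , r , s) = notBelow q in e , s , r) , m))

      module Eared (v : V n) (E : EarOn K U₀ v) where

        Kv : K ∋ v
        Kv = EarOn.v∈ E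

        -- The ear freed of chords: outside `C`, `comb v` agrees with `v` on the chords and vanishes
        -- elsewhere, so nothing changes outside `U₀`.
        v₁ : V n
        v₁ = v ⊕ comb v

        Kv₁ : K ∋ v₁
        Kv₁ = mem⊕ K Kv (comb∈ v , ⊑-trans (comb⊑ v) U₀⊑A)

        off-Ch : ∀ e → Ch e ≡ true → v₁ e ≡ false
        off-Ch e p = trans (cong (v e xor_) (trans (comb-else v e (Ch∌C e p)) (cong (_∧ v e) p))) (Bool.xor-same (v e))

        off-U₀ : ∀ {e} → C e ≡ false → Ch e ≡ false → v₁ e ≡ v e
        off-U₀ {e} p q = trans (cong (v e xor_) (trans (comb-else v e p) (cong (_∧ v e) q))) (Bool.xor-identityʳ (v e))

        ~C≈~U₀ : ∀ {u} → (∀ e → Ch e ≡ true → u e ≡ false) → u ⊓ ~ C ≈ u ⊓ ~ U₀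
        ~C≈~U₀ {u} h e = go (C e) refl (Ch e) refl
          where
          go : ∀ a → C e ≡ a → ∀ b → Ch e ≡ b → (u ⊓ ~ C) e ≡ (u ⊓ ~ U₀) e
          go true p _ _ = trans (trans (cong (λ c → u e ∧ not c) p) (Bool.∧-zeroʳ (u e))) (sym (trans (cong (λ c → u e ∧ not c) (cong (_∨ Ch e) p)) (Bool.∧-zeroʳ (u e))))
          go false p true q = trans (cong (_∧ not (C e)) (h e q)) (sym (cong (_∧ not (U₀ e)) (h e q)))
          go false p false q = cong (λ c → u e ∧ not c) (trans p (sym (cong₂ _∨_ p q)))

        L≈ : v₁ ⊓ ~ C ≈ v ⊓ ~ U₀
        L≈ e = trans (~C≈~U₀ {v₁} off-Ch e) (go (U₀ e) refl)
          where
          go : ∀ b → U₀ e ≡ b → (v₁ ⊓ ~ U₀) e ≡ (v ⊓ ~ U₀) e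
          go true p = trans (trans (cong (λ c → v₁ e ∧ not c) p) (Bool.∧-zeroʳ (v₁ e))) (sym (trans (cong (λ c → v e ∧ not c) p) (Bool.∧-zeroʳ (v e))))
          go false p = cong (_∧ not (U₀ e)) (off-U₀ (∨-false₁ p) (∨-false₂ {C e} p))

        minimal₁ : ∀ z → K ∋ z → z ⊑ C ⊔ᵛ v₁ → z ⊓ ~ C ≈ 0ᵛ ⊎ z ⊓ ~ C ≈ v₁ ⊓ ~ C
        minimal₁ z Kz z⊑ = go (EarOn.minimal E z Kz (⊑-respˡ same (⊑-respʳ L≈ (⊔~ {v₁} {z} z⊑))))
          where
          same : z ⊓ ~ C ≈ z ⊓ ~ U₀
          same = ~C≈~U₀ {z} λ e p → ≢true⇒false λ q → true≢false (trans (sym (z⊑ e q)) (cong₂ _∨_ (Ch∌C e p) (off-Ch e p)))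
          go : z ⊓ ~ U₀ ≈ 0ᵛ ⊎ z ⊓ ~ U₀ ≈ v ⊓ ~ U₀ → z ⊓ ~ C ≈ 0ᵛ ⊎ z ⊓ ~ C ≈ v₁ ⊓ ~ C
          go (inj₁ p) = inj₁ (≈-trans same p)
          go (inj₂ p) = inj₂ (≈-trans same (≈-trans p (≈-sym L≈)))

        P∉ : ¬ (Z ∋ v₁ ⊓ C)
        P∉ h = EarOn.v∉ E (resp≈ Z eq (mem⊕ Z h (comb∈ v)) , ⊑-trans (⊓-⊑ʳ v U₀) U₀⊑A)
          where
          eq : (v₁ ⊓ C) ⊕ comb v ≈ v ⊓ U₀
          eq e = go (C e) refl
            where
            go : ∀ b → C e ≡ b → ((v₁ ⊓ C) ⊕ comb v) e ≡ (v ⊓ U₀) e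
            go true p = trans (cong (λ c → (v₁ e ∧ c) xor comb v e) p) (trans (cong (_xor comb v e) (Bool.∧-identityʳ (v₁ e))) (trans (xor-cancelʳ (v e) (comb v e))
                (sym (trans (cong (v e ∧_) (cong (_∨ Ch e) p)) (Bool.∧-identityʳ (v e))))))
            go false p = trans (cong₂ (λ c d → (v₁ e ∧ c) xor d) p (comb-else v e p)) (trans (cong (_xor (Ch e ∧ v e)) (Bool.∧-zeroʳ (v₁ e)))
                (trans (Bool.∧-comm (Ch e) (v e)) (sym (cong (v e ∧_) (cong (_∨ Ch e) p)))))

        hits : ∃ λ e → C e ≡ true × v₁ e ≡ true
        hits = go (Fin.any? λ e → (C e Bool.≟ true) ×-dec (v₁ e Bool.≟ true))
          where
          go : Dec (∃ λ e → C e ≡ true × v₁ e ≡ true) → ∃ λ e → C e ≡ true × v₁ e ≡ true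
          go (yes p) = p
          go (no ¬p) = ⊥-elim (P∉ (mem-0 Z λ e → ≢true⇒false λ q → ¬p (e , ⊓-⊑ʳ v₁ C e q , ⊓-⊑ˡ v₁ C e q)))

        misses : ∃ λ e → C e ≡ true × v₁ e ≡ false
        misses = go (Fin.any? λ e → (C e Bool.≟ true) ×-dec (v₁ e Bool.≟ false))
          where
          go : Dec (∃ λ e → C e ≡ true × v₁ e ≡ false) → ∃ λ e → C e ≡ true × v₁ e ≡ false
          go (yes p) = p
          go (no ¬p) = ⊥-elim (P∉ (resp≈ Z (⊑-antisym (λ e q → cong₂ _∧_ (≢false⇒true λ r → ¬p (e , q , r)) q) (⊓-⊑ʳ v₁ C)) ZC))

        out : ∃ λ e → C e ≡ false × v₁ e ≡ true
        out = go (Fin.any? λ e → (C e Bool.≟ false) ×-dec (v₁ e Bool.≟ true))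
          where
          go : Dec (∃ λ e → C e ≡ false × v₁ e ≡ true) → ∃ λ e → C e ≡ false × v₁ e ≡ true
          go (yes p) = p
          go (no ¬p) = ⊥-elim (P∉ (resp≈ Z (≈-sym (⊑⇒⊓ {u = v₁} {C} λ e q → ≢false⇒true λ r → ¬p (e , r , q))) (proj₁ Kv₁)))

        a b y : Fin n
        a = proj₁ misses
        b = proj₁ hits
        y = proj₁ out
        Ca : C a ≡ true
        Ca = proj₁ (proj₂ misses)
        va : v₁ a ≡ false
        va = proj₂ (proj₂ misses)
        Cb : C b ≡ true
        Cb = proj₁ (proj₂ hits)
        vb : v₁ b ≡ true
        vb = proj₂ (proj₂ hits)
        Cy : C y ≡ false
        Cy = proj₁ (proj₂ out)
        vy : v₁ y ≡ true
        vy = proj₂ (proj₂ out)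

        -- otherwise y would be a chord
        out₂ : ∃ λ e → C e ≡ false × v₁ e ≡ true × y ≢ e
        out₂ = go (Fin.any? λ e → (C e Bool.≟ false) ×-dec ((v₁ e Bool.≟ true) ×-dec ¬? (y Fin.≟ e)))
          where
          go : Dec (∃ λ e → C e ≡ false × v₁ e ≡ true × y ≢ e) → ∃ λ e → C e ≡ false × v₁ e ≡ true × y ≢ e
          go (yes p) = p
          go (no ¬p) = ⊥-elim (true≢false (trans (sym vy) (off-Ch y (chord y (proj₂ Kv₁ y vy) Cy (normal (v₁ c₀) refl)))))
            where
            side₁ : Z ∋ (v₁ ⊓ C) ⊕ 𝟙 y
            side₁ = resp≈ Z eq (proj₁ Kv₁)
              where
              eq : v₁ ≈ (v₁ ⊓ C) ⊕ 𝟙 y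
              eq e = at (C e) refl (y Fin.≟ e)
                where
                at : ∀ b → C e ≡ b → Dec (y ≡ e) → v₁ e ≡ (v₁ e ∧ C e) xor 𝟙 y e
                at true p _ = sym (trans (cong₂ (λ c d → (v₁ e ∧ c) xor d) p (𝟙-≢ λ q → true≢false (trans (sym p) (trans (cong C (sym q)) Cy)))) (trans (Bool.xor-identityʳ _) (Bool.∧-identityʳ (v₁ e))))
                at false p (yes refl) = trans vy (sym (cong₂ _xor_ (trans (cong (v₁ e ∧_) p) (Bool.∧-zeroʳ (v₁ e))) (𝟙-refl e)))
                at false p (no q) = trans (≢true⇒false λ r → ¬p (e , p , r , q)) (sym (cong₂ _xor_ (trans (cong (v₁ e ∧_) p) (Bool.∧-zeroʳ (v₁ e))) (𝟙-≢ q)))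
            normal : ∀ b → v₁ c₀ ≡ b → ∃ (Side y)
            normal false p = v₁ ⊓ C , ⊓-⊑ʳ v₁ C , cong (_∧ C c₀) p , side₁
            normal true p = C ⊕ (v₁ ⊓ C) , ⊑-⊕ (λ _ q → q) (⊓-⊑ʳ v₁ C) , cong₂ _xor_ Cc₀ (cong₂ _∧_ p Cc₀)
              , resp≈ Z (λ e → sym (Bool.xor-assoc (C e) ((v₁ ⊓ C) e) (𝟙 y e))) (mem⊕ Z ZC side₁)

        -- a side with only one element could be replaced by the ear, giving a longer circuit
        long-side : ∀ w → K ∋ w → (∀ e → C e ≡ false → w e ≡ v₁ e) → Nz w → ∀ c → C c ≡ true → w c ≡ false → ∃ λ e → C e ≡ true × w e ≡ false × e ≢ c
        long-side w Kw off nz c Cc wc = go (Fin.any? λ e → (C e Bool.≟ true) ×-dec ((w e Bool.≟ false) ×-dec ¬? (e Fin.≟ c)))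
          where
          same : w ⊓ ~ C ≈ v₁ ⊓ ~ C
          same e = at (C e) refl
            where
            at : ∀ b → C e ≡ b → w e ∧ not (C e) ≡ v₁ e ∧ not (C e)
            at true p = trans (cong (λ b → w e ∧ not b) p) (trans (Bool.∧-zeroʳ (w e)) (sym (trans (cong (λ b → v₁ e ∧ not b) p) (Bool.∧-zeroʳ (v₁ e)))))
            at false p = cong (_∧ not (C e)) (off e p)
          join : ∀ {z} → z ⊑ C ⊔ᵛ w → z ⊑ C ⊔ᵛ v₁
          join {z} h e p = at (C e) refl
            where
            at : ∀ b → C e ≡ b → C e ∨ v₁ e ≡ true
            at true q = cong (_∨ v₁ e) q
            at false q = trans (cong (C e ∨_) (sym (off e q))) (h e p)
          min : ∀ z → K ∋ z → z ⊑ C ⊔ᵛ w → z ⊓ ~ C ≈ 0ᵛ ⊎ z ⊓ ~ C ≈ w ⊓ ~ C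
          min z Kz h = tr (minimal₁ z Kz (join {z} h))
            where
            tr : z ⊓ ~ C ≈ 0ᵛ ⊎ z ⊓ ~ C ≈ v₁ ⊓ ~ C → z ⊓ ~ C ≈ 0ᵛ ⊎ z ⊓ ~ C ≈ w ⊓ ~ C
            tr (inj₁ p) = inj₁ p
            tr (inj₂ p) = inj₂ (≈-trans p (≈-sym same))
          go : Dec (∃ λ e → C e ≡ true × w e ≡ false × e ≢ c) → ∃ λ e → C e ≡ true × w e ≡ false × e ≢ c
          go (yes p) = p
          go (no ¬p) = ⊥-elim (ℕ.<⇒≱ heavier (proj₂ longest w (ear-circuit K circK Kw min c Cc wc nz)))
            where
            parts : ∀ (u v : V n) → ∥ u ∥ ≡ ∥ u ⊓ v ∥ +ℕ ∥ u ⊓ ~ v ∥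
            parts u v = ∥∥-parts u v (~ v) (λ e p → cong not p) (λ e _ → Bool.∨-inverseʳ (v e))
            missing : C ⊓ ~ w ⊑ 𝟙 c
            missing e p = ≢false⇒true λ q → ¬p (e , ⊓-⊑ˡ C (~ w) e p , not-true (⊓-⊑ʳ C (~ w) e p) , λ r → true≢false (trans (sym (trans (cong (𝟙 c) r) (𝟙-refl c))) q))
            extra : 2 ≤ ∥ w ⊓ ~ C ∥
            extra = let (e , p , q , r) = out₂ in two≤∥∥ {u = w ⊓ ~ C} r (cong₂ _∧_ (trans (off y Cy) vy) (cong not Cy)) (cong₂ _∧_ (trans (off e p) q) (cong not p))
            -- The circuit `w` misses only `c` of `C`, while `extra` gives it at least two elements
            -- outside `C`.
            heavier : ∥ C ∥ < ∥ w ∥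
            heavier = ℕ.≤-trans (s≤s (ℕ.≤-trans (ℕ.≤-reflexive (parts C w)) (ℕ.+-monoʳ-≤ ∥ C ⊓ w ∥ (ℕ.≤-trans (∥∥-mono missing) (ℕ.≤-reflexive (weight-𝟙 c))))))
              (ℕ.≤-trans (ℕ.≤-reflexive (sym (ℕ.+-suc ∥ C ⊓ w ∥ 1))) (ℕ.≤-trans (ℕ.+-mono-≤ (ℕ.≤-reflexive (∥∥-cong λ e → Bool.∧-comm (C e) (w e))) extra) (ℕ.≤-reflexive (sym (parts w C)))))

        CvA : C ⊔ᵛ v₁ ⊑ A
        CvA e p = go (⊔ᵛ-true {u = C} {v₁} p)
          where
          go : C e ≡ true ⊎ v₁ e ≡ true → A e ≡ true
          go (inj₁ q) = C⊑A e q
          go (inj₂ q) = proj₂ Kv₁ e q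

        open Theta Z C v₁ ZC (proj₁ Kv₁) circ (λ z Zz z⊑ → minimal₁ z (Zz , ⊑-trans z⊑ CvA) z⊑) a Ca va b Cb vb y Cy vy
          using (real; κ; leg; dom≈)

        -- The legs are the two parts of `C` cut off by the ear and the ear itself. The parts have
        -- second elements because `C` is a longest circuit, the ear because it is not a chord.
        long : Long nb ZU simple real
        long zero = let (e , p , q , r) = long-side v₁ Kv₁ (λ _ _ → refl) (y , vy) a Ca va in e , cong₂ leg p q , r
        long (suc zero) = let (e , p , q , r) = long-side (v₁ ⊕ C) (mem⊕ K Kv₁ (proj₁ circK)) (λ e p → trans (cong (v₁ e xor_) p) (Bool.xor-identityʳ (v₁ e)))
                                (y , cong₂ _xor_ vy Cy) b Cb (cong₂ _xor_ vb Cb) in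
          e , cong₂ leg p (trans (xor≡false⇒≡ q) p) , r
        long (suc (suc zero)) = let (e , p , q , r) = out₂ in e , cong₂ leg p q , (λ s → r (sym s))

        X : V n
        X = dom κ

        X⊑A : X ⊑ A
        X⊑A = ⊑-respˡ (≈-sym dom≈) CvA

        good : Good Z X
        good S S⊑ = theta-NRep real S S⊑ , λ _ → theta-Graphical real S S⊑

        -- If the theta graph is separated, it is peeled off. Otherwise a further ear makes it K₄,
        -- since its long legs exclude an ear parallel to one leg.
        eared : Outcome A
        eared = step (separated? Z X)
          where
          step : (∃ λ v → Z ∋ v × ¬ (Z ∋ v ⊓ X)) ⊎ Sep Z X → Outcome A
          step (inj₂ sep) = peel X X⊑A (a , trans (dom≈ a) (cong (_∨ v₁ a) Ca)) sep good
          step (inj₁ (u , Zu , u∉)) = ear (proj₂ (Ears.findEar nb ZU {thetaM} refl real u Zu u∉))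
            where
            ear : ∀ {u} → EarOn Z X u → Outcome A
            ear E′ = go (thetaStep nb ZU simple real E′)
              where
              go : Real Z k4M ⊎ _ → Outcome A
              go (inj₁ R) = inj₂ R
              go (inj₂ (j , z , z∈ , o)) = ⊥-elim (thetaLong nb ZU simple real long E′ j z z∈ o)

      atCircuit : Outcome A
      atCircuit = step (separated? Z U₀)
        where
        step : (∃ λ v → Z ∋ v × ¬ (Z ∋ v ⊓ U₀)) ⊎ Sep Z U₀ → Outcome A
        step (inj₂ sep) = chordal sep
        step (inj₁ (v , Zv , v∉)) = let (u , E) = findEarOn K U₀ (v ⊓ A) (sepA v Zv , ⊓-⊑ʳ v A) (λ (h , _) → v∉ (resp≈ Z (λ e → trans (Bool.∧-assoc (v e) (A e) (U₀ e)) (cong (v e ∧_) (trans (Bool.∧-comm (A e) (U₀ e)) (⊑⇒⊓ U₀⊑A e)))) h)) in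
          Eared.eared u E

    atSet : Outcome A
    atSet = step (Fin.any? λ e → (A e Bool.≟ true) ×-dec mem? Z (𝟙 e))
      where
      nonzero : (∀ e → A e ≡ true → ¬ (Z ∋ 𝟙 e)) → Dec (∃ λ v → Z ↾ A ∋ v × Nz v) → Outcome A
      nonzero nl (no ¬v) = inj₁ (Good-zero Z λ v Kv → ¬Nz⇒0 λ nz → ¬v (v , Kv , nz))
      nonzero nl (yes (v , Kv , nz)) = AtCircuit.atCircuit nl (proj₁ best) (proj₂ best)
        where
        best : ∃ (LongestCircuit (Z ↾ A))
        best = let (c , _ , circ) = circuit-below (Z ↾ A) v Kv nz in longestCircuit (Z ↾ A) c circ
      step : Dec (∃ λ e → A e ≡ true × Z ∋ 𝟙 e) → Outcome A
      -- Coloops are removed first, so that afterwards the side of a chord is never empty.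
      step (yes (e , Ae , Ze)) = peel (𝟙 e) (𝟙-⊑ {u = A} Ae) (e , 𝟙-refl e) sep (Good-loop Z e Ze)
        where
        sep : Sep Z (𝟙 e)
        sep v Zv = resp≈ Z eq (mem-· Z (v e) Ze)
          where
          eq : v e · 𝟙 e ≈ v ⊓ 𝟙 e
          eq i = go (e Fin.≟ i)
            where
            go : Dec (e ≡ i) → v e ∧ 𝟙 e i ≡ v i ∧ 𝟙 e i
            go (yes refl) = refl
            go (no q) = trans (cong (v e ∧_) (𝟙-≢ q)) (trans (Bool.∧-zeroʳ (v e)) (sym (trans (cong (v i ∧_) (𝟙-≢ q)) (Bool.∧-zeroʳ (v i)))))
      step (no nl) = nonzero (λ e p q → nl (e , p , q)) (anyV? (λ p (a , b) → resp≈ (Z ↾ A) p a , Nz-resp p b) λ v → mem? (Z ↾ A) v ×-dec Nz? v)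

  claim : ∀ A → Claimed A
  claim A = go A (<-wellFounded ∥ A ∥)
    where
    go : ∀ A → Acc _<_ ∥ A ∥ → Claimed A
    go A (acc rec) sep = AtSet.atSet A sep λ B lt → go B (rec lt)

-- Graphs for the splittings of the maximal patterns

legOptions : ∀ {k} → Bool → Bool → Fin k → List (Label k)
legOptions free false l = (just l , false) ∷ []
legOptions true true l = (just l , false) ∷ (just l , true) ∷ []
legOptions false true l = (just l , true) ∷ []

-- Leg (lookup b j) meets S when r j holds; it then consists of a single element unless j is free.
freeLabels : ∀ {k} → Vec Bool k → Vec (Fin k) k → Vec Bool k → List (Label k)
freeLabels {k} free b r = concatMap (λ j → legOptions (lookup free j) (lookup r j) (lookup b j)) (allFin k)

exactLabels : ∀ {k m} → Vec (Fin k) m → Vec Bool m → List (Label k)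
exactLabels {m = m} legOf r = List.map (λ j → just (lookup legOf j) , lookup r j) (allFin m)

graphOk : ∀ {d k} → Mat d k → ℕ → List (Label k) → ℕ → Bool
graphOk g v ls N = sameSpan (earMat g (Vec₀.fromList ls)) (stars (coded v N))

tableOk : ∀ {d j k} → Mat d k → ℕ → (Vec Bool j → List (Label k)) → List (Vec Bool j) → List ℕ → Bool
tableOk g v lab [] _ = true
tableOk g v lab (r ∷ rs) [] = false
tableOk g v lab (r ∷ rs) (N ∷ Ns) = graphOk g v (lab r) N ∧ tableOk g v lab rs Ns

atMost₃? : ∀ {k} (r : Vec Bool k) → Dec (∥ lookup r ∥ ≤ 3)
atMost₃? r = ∥ lookup r ∥ ℕ.≤? 3

One⊎Three : ℕ → Set
One⊎Three m = m ≡ 1 ⊎ m ≡ 3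

one⊎three? : ∀ {k} (r : Vec Bool k) → Dec (One⊎Three ∥ lookup r ∥)
one⊎three? r = (∥ lookup r ∥ ℕ.≟ 1) ⊎-dec (∥ lookup r ∥ ℕ.≟ 3)

-- The legs in order, preceded by one additional element for each entry of the given vector. All
-- bits are `false`: no ear is involved.
dupLabels : ∀ {k p} → Vec (Fin k) p → Vec (Label k) (p +ℕ k)
dupLabels [] = tabulate λ l → just l , false
dupLabels (x ∷ xs) = (just x , false) ∷ dupLabels xs

-- One code per subset, in the order in which `vecs` lists them. There are 42 sets of at most three
-- legs of K₄, 93 for W₄ and 130 for the prism. The lists for the eight elements of a doubly
-- subdivided K₄ and for K₃,₃ run over sets of size one or three, 64 and 93 in number.
k4TriangleGraphs : List ℕ
k4TriangleGraphs =
    231303120201 ∷ 12404230302 ∷ 340124032302 ∷ 342401230302 ∷ 34240104230302 ∷ 24131403021201 ∷ 23140413021201 ∷ 23130304120201 ∷ 230313041201 ∷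
    231303120401 ∷ 132303120104 ∷ 42434131201 ∷ 14032413023401 ∷ 24143404122301 ∷ 24140434122301 ∷ 23130312040201 ∷ 34041412130201 ∷ 14342402031201 ∷
    24143412230201 ∷ 2414340412230201 ∷ 1403241302341201 ∷ 1304142302341201 ∷ 24041413031201 ∷ 23130312020401 ∷ 24143412022301 ∷ 1403241302123401 ∷
    23130312020401 ∷ 34140402122301 ∷ 14342402122301 ∷ 14243412022301 ∷ 3414240413031201 ∷ 2413140302123401 ∷ 2314041302123401 ∷ 14021234242301 ∷
    14120224342301 ∷ 23130312020104 ∷ 1402031234242301 ∷ 3414041323031201 ∷ 3404141213022301 ∷ 1434240203122301 ∷ 341424041323031201 ∷
    2404141303122301 ∷ []

k4StarGraphs : List ℕ
k4StarGraphs =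
    231303120201 ∷ 12404230302 ∷ 340124032302 ∷ 342401230302 ∷ 342401230302 ∷ 340124032302 ∷ 12404230302 ∷ 231303120201 ∷ 23130304120201 ∷
    34140413120201 ∷ 24341423021201 ∷ 14243403120201 ∷ 14243403120201 ∷ 24341423021201 ∷ 34140413120201 ∷ 23130312040201 ∷ 34041412130201 ∷
    14342402031201 ∷ 24143412230201 ∷ 24143412230201 ∷ 14342402031201 ∷ 34041412130201 ∷ 2414041312030201 ∷ 3414041312030201 ∷ 1434241302031201 ∷
    1424340312130201 ∷ 23130312020401 ∷ 34140402122301 ∷ 14342402122301 ∷ 14243412022301 ∷ 14243412022301 ∷ 14342402122301 ∷ 34140402122301 ∷
    3404142303131201 ∷ 3414041302122301 ∷ 3424142303131201 ∷ 1424340312022301 ∷ 3414041323031201 ∷ 3404141213022301 ∷ 1434240203122301 ∷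
    3414241323031201 ∷ 241404031213022301 ∷ []

k4OppositeGraphs : List ℕ
k4OppositeGraphs =
    124042303023402 ∷ 3401240323023402 ∷ 3424012303023402 ∷ 2313031202010401 ∷ 2303130412012301 ∷ 424133412012301 ∷ 3423142413010201 ∷
    2313031204012301 ∷ 2313031204012301 ∷ 3423142413010201 ∷ 424133412012301 ∷ 2303130412012301 ∷ 2313031202010401 ∷ 3424012303023402 ∷
    3401240323023402 ∷ 2313031202042301 ∷ 1334241404230201 ∷ 1324340414230201 ∷ 3414040212233401 ∷ 1314043424230201 ∷ 113120302230104 ∷
    1223240403341201 ∷ 314042434231201 ∷ 1223240403341201 ∷ 113120302230104 ∷ 3414040212233401 ∷ 2313031202010401 ∷ 3424012303023402 ∷
    3401240323023402 ∷ 124042303023402 ∷ 2313031204012301 ∷ 3423142413010201 ∷ 424133412012301 ∷ 2303130412012301 ∷ 424133412012301 ∷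
    3423142413010201 ∷ 124042303023402 ∷ 3414040212233401 ∷ 1324340414230201 ∷ 1334241404230201 ∷ 314042434231201 ∷ 1314043424230201 ∷
    113120302230104 ∷ 1314043424230201 ∷ 314042434231201 ∷ 1223240403341201 ∷ 1334241404230201 ∷ 2313031202042301 ∷ 3414040212233401 ∷
    1324340414230201 ∷ 3414040212233401 ∷ 2313031202042301 ∷ 1223240403341201 ∷ 424133412012301 ∷ 2303130412012301 ∷ 2313031204012301 ∷
    3401240323023402 ∷ 3424012303023402 ∷ 1223240403341201 ∷ 314042434231201 ∷ 1314043424230201 ∷ 1324340414230201 ∷ 1334241404230201 ∷
    3423142413010201 ∷ []

w4Graphs : List ℕ
w4Graphs =
    1434240413230201 ∷ 145352504342302 ∷ 250145350524340302 ∷ 351534240413230201 ∷ 2545010524340302 ∷ 2534150413230201 ∷ 143534250413230201 ∷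
    153534250413230201 ∷ 254535010524340302 ∷ 153424051403231201 ∷ 4353424151403231201 ∷ 5353424151403231201 ∷ 143435250413022301 ∷
    53425151403231201 ∷ 4353425151403231201 ∷ 434241405231201 ∷ 3424140423120105 ∷ 154535250514230201 ∷ 350534241445231201 ∷ 1425350413450201 ∷
    2524053445131201 ∷ 143425350413450201 ∷ 31514251302453401 ∷ 152535054512233401 ∷ 3231514251302453401 ∷ 130524250312344501 ∷ 1434240413050201 ∷
    2504353413124501 ∷ 153545250514230201 ∷ 353405241445231201 ∷ 1424340412230501 ∷ 2514153403450201 ∷ 142534350413450201 ∷ 142405350412234501 ∷
    150324052312453401 ∷ 3152314251302453401 ∷ 152535450512233401 ∷ 2501350534240302 ∷ 3525241423031201 ∷ 254501350524340302 ∷ 1435250413230201 ∷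
    43524151403231201 ∷ 1424340412230501 ∷ 2514153403450201 ∷ 142534350413450201 ∷ 152503042312344501 ∷ 1434240413050201 ∷ 2504353413124501 ∷
    153545250514230201 ∷ 152535450512233401 ∷ 51314152302344501 ∷ 13052324250312344501 ∷ 142405350412234501 ∷ 1435250413230201 ∷ 3545250134240302 ∷
    143435250413230201 ∷ 2501350534240302 ∷ 143525150403231201 ∷ 2545010524340302 ∷ 2534150413230201 ∷ 143534250413230201 ∷ 1434240413230201 ∷
    143435250413022301 ∷ 1425350413450201 ∷ 3424140423120105 ∷ 434241405231201 ∷ 350534241445231201 ∷ 154535250514230201 ∷ 2524053445131201 ∷
    1425350413450201 ∷ 150325042312344501 ∷ 152535054512233401 ∷ 31514251302453401 ∷ 5132524152302453401 ∷ 152504053412234501 ∷ 145352504342302 ∷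
    1434240413230201 ∷ 351534240413230201 ∷ 2534150413230201 ∷ 153424051403231201 ∷ 3525241423031201 ∷ 2501350534240302 ∷ 353415240413230201 ∷
    3545250134240302 ∷ 153534052413022301 ∷ 2504353413124501 ∷ 3545250134240302 ∷ 1435250413230201 ∷ 153435250413230201 ∷ 3525241423031201 ∷
    143424040513230201 ∷ 2514153403450201 ∷ 2524053445131201 ∷ []

prismGraphs : List ℕ
prismGraphs =
    231213342414030201 ∷ 1342324453525040302 ∷ 34012324453525040302 ∷ 3523151213342414030201 ∷ 34230124453525040302 ∷ 2523121513342414030201 ∷
    2335122513342414030201 ∷ 152335122513342414030201 ∷ 342324013525040302 ∷ 45231213252414030201 ∷ 23451213351424030201 ∷ 1523351213451424030201 ∷
    23124513251424030201 ∷ 2523121513452414030201 ∷ 2335122513451424030201 ∷ 342324450125040302 ∷ 45231213343514030201 ∷ 23451213143534030201 ∷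
    3523151213344514030201 ∷ 23124513142534030201 ∷ 1523122513144534030201 ∷ 2335122513144534030201 ∷ 342324453501040302 ∷ 45231213253514030201 ∷
    23451213253534030201 ∷ 23124513352534030201 ∷ 342324453501040302 ∷ 45231213253514030201 ∷ 23451213253534030201 ∷ 1523351213243445030201 ∷
    23124513352534030201 ∷ 1523122513243445030201 ∷ 2335122513243445030201 ∷ 342324450125040302 ∷ 45231213343514030201 ∷ 23451213143534030201 ∷
    23124513142534030201 ∷ 342324013525040302 ∷ 45231213252414030201 ∷ 23451213351424030201 ∷ 23124513251424030201 ∷ 231213342414030201 ∷
    352325453424010302 ∷ 23251215452414030201 ∷ 15351225451424030201 ∷ 2315351225451424030201 ∷ 25121315452414030201 ∷ 2325121315452414030201 ∷
    1535121325451424030201 ∷ 251215342414030201 ∷ 23251215342414030201 ∷ 15351225342414030201 ∷ 25121315342414030201 ∷ 151225243445030201 ∷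
    23151225243445030201 ∷ 15351225243445030201 ∷ 15121325243445030201 ∷ 151225144534030201 ∷ 151225144534030201 ∷ 23151225144534030201 ∷
    15351225144534030201 ∷ 15121325144534030201 ∷ 151225243445030201 ∷ 251215342414030201 ∷ 241412233413020501 ∷ 23351513344514030201 ∷
    35121513344514030201 ∷ 2335121513344514030201 ∷ 15352513144534030201 ∷ 2315352513144534030201 ∷ 1512352513144534030201 ∷ 153513243445030201 ∷
    23153513243445030201 ∷ 15123513243445030201 ∷ 15352513243445030201 ∷ 351513342414030201 ∷ 23351513342414030201 ∷ 35121513342414030201 ∷
    15352513342414030201 ∷ 153513451424030201 ∷ 153513451424030201 ∷ 23153513451424030201 ∷ 15123513451424030201 ∷ 15352513451424030201 ∷
    351513342414030201 ∷ 153513243445030201 ∷ 122414132334020105 ∷ 5233525243445131201 ∷ 23023525243445131201 ∷ 23350325243445131201 ∷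
    233525044534131201 ∷ 233525450424131201 ∷ 233525342404131201 ∷ 122414132334020105 ∷ 5233525243445131201 ∷ 23023525243445131201 ∷
    1523123525243445030201 ∷ 23350325243445131201 ∷ 1523351325243445030201 ∷ 2312351325243445030201 ∷ 233525044534131201 ∷ 15233525144534030201 ∷
    23123525144534030201 ∷ 23351325144534030201 ∷ 233525450424131201 ∷ 15233525451424030201 ∷ 23123525451424030201 ∷ 23351325451424030201 ∷
    233525342404131201 ∷ 233525342404131201 ∷ 15233525342414030201 ∷ 23123525342414030201 ∷ 23351325342414030201 ∷ 233525450424131201 ∷
    233525044534131201 ∷ 241412233413020501 ∷ 23351513344514030201 ∷ 35121513344514030201 ∷ 15352513144534030201 ∷ 153513243445030201 ∷
    351513342414030201 ∷ 153513451424030201 ∷ 352325453424010302 ∷ 23251215452414030201 ∷ 15351225451424030201 ∷ 25121315452414030201 ∷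
    251215342414030201 ∷ 151225243445030201 ∷ 151225144534030201 ∷ 231213342414030201 ∷ []

k33Graphs : List ℕ
k33Graphs =
    13504452524032302 ∷ 350104254524230302 ∷ 250401353445230302 ∷ 140523353445021201 ∷ 452524013504032302 ∷ 254524350104230302 ∷ 242334140305120201 ∷
    343545150423021201 ∷ 254524350104230302 ∷ 452524013504032302 ∷ 343545150423021201 ∷ 242334140305120201 ∷ 350104254524230302 ∷ 13504452524032302 ∷
    140523353445021201 ∷ 242334140305120201 ∷ 343545150423021201 ∷ 452524013504032302 ∷ 254524350104230302 ∷ 250401353445230302 ∷ 140523353445021201 ∷
    13504452524032302 ∷ 140523353445021201 ∷ 250401353445230302 ∷ 350104254524230302 ∷ 343545150423021201 ∷ 142412032302053401 ∷ 241412230302340501 ∷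
    341413240402230105 ∷ 151335040224234501 ∷ 143502053412234501 ∷ 341502350412452301 ∷ 140325150234452301 ∷ 341502350412452301 ∷ 143502053412234501 ∷
    140325051234234501 ∷ 241412230302340501 ∷ 140325150234452301 ∷ 140325051234234501 ∷ 143502053412234501 ∷ 341413240402230105 ∷ 151335040224234501 ∷
    241412230302340501 ∷ 142412032302053401 ∷ 151335040224234501 ∷ 341413240402230105 ∷ 341502350412452301 ∷ 143502053412234501 ∷ 140325051234234501 ∷
    143502053412234501 ∷ 341502350412452301 ∷ 140325150234452301 ∷ 142412032302053401 ∷ 140325051234234501 ∷ 140325150234452301 ∷ 341502350412452301 ∷
    151335040224234501 ∷ 341413240402230105 ∷ 350104254524230302 ∷ 13504452524032302 ∷ 140523353445021201 ∷ 254524350104230302 ∷ 452524013504032302 ∷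
    343545150423021201 ∷ 341413240402230105 ∷ 151335040224234501 ∷ 142412032302053401 ∷ 241412230302340501 ∷ 140325150234452301 ∷ 140325051234234501 ∷
    143502053412234501 ∷ 140325051234234501 ∷ 140325150234452301 ∷ 341502350412452301 ∷ 151335040224234501 ∷ 143502053412234501 ∷ 341502350412452301 ∷
    140325150234452301 ∷ 142412032302053401 ∷ 241412230302340501 ∷ 250401353445230302 ∷ 140523353445021201 ∷ 13504452524032302 ∷ 242334140305120201 ∷
    343545150423021201 ∷ 452524013504032302 ∷ 140523353445021201 ∷ 250401353445230302 ∷ 350104254524230302 ∷ 343545150423021201 ∷ 242334140305120201 ∷
    254524350104230302 ∷ 151335040224234501 ∷ []

triangles starPerms : List (Vec (Fin 6) 6)
triangles = places 5 (0 ∷ 1 ∷ 2 ∷ 3 ∷ 4 ∷ 5 ∷ []) ∷ places 5 (0 ∷ 2 ∷ 1 ∷ 4 ∷ 3 ∷ 5 ∷ []) ∷ places 5 (1 ∷ 2 ∷ 0 ∷ 5 ∷ 3 ∷ 4 ∷ []) ∷ places 5 (3 ∷ 4 ∷ 0 ∷ 5 ∷ 1 ∷ 2 ∷ []) ∷ []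
starPerms = places 5 (0 ∷ 1 ∷ 2 ∷ 3 ∷ 4 ∷ 5 ∷ []) ∷ places 5 (0 ∷ 3 ∷ 4 ∷ 1 ∷ 2 ∷ 5 ∷ []) ∷ places 5 (1 ∷ 3 ∷ 5 ∷ 0 ∷ 2 ∷ 4 ∷ []) ∷ places 5 (2 ∷ 4 ∷ 5 ∷ 0 ∷ 1 ∷ 3 ∷ []) ∷ []
w4Rotations : List (Vec (Fin 8) 8)
w4Rotations = places 7 (0 ∷ 1 ∷ 2 ∷ 3 ∷ 4 ∷ 5 ∷ 6 ∷ 7 ∷ []) ∷ places 7 (1 ∷ 2 ∷ 3 ∷ 0 ∷ 5 ∷ 6 ∷ 7 ∷ 4 ∷ []) ∷ []

triangleLegs starLegs : Vec Bool 6
triangleLegs = supp (0 ∷ 1 ∷ 3 ∷ [])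
starLegs = supp (0 ∷ 1 ∷ 2 ∷ [])

oppositeRims : Vec Bool 8
oppositeRims = supp (4 ∷ 6 ∷ [])

matching : Vec Bool 9
matching = supp (6 ∷ 7 ∷ 8 ∷ [])

triangle-ok : every (λ b → tableOk k4M 4 (freeLabels triangleLegs b) (filter atMost₃? (vecs 6)) k4TriangleGraphs) triangles ≡ true
triangle-ok = refl

star-ok : every (λ b → tableOk k4M 4 (freeLabels starLegs b) (filter atMost₃? (vecs 6)) k4StarGraphs) starPerms ≡ true
star-ok = refl

rims-ok : every (λ b → tableOk w4M 5 (freeLabels oppositeRims b) (filter atMost₃? (vecs 8)) w4Graphs) w4Rotations ≡ true
rims-ok = refl

matching-ok : tableOk prismM 5 (freeLabels matching (Vec₀.allFin 9)) (filter atMost₃? (vecs 9)) prismGraphs ≡ true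
matching-ok = refl

k33-graphs-ok : tableOk k33M 5 (exactLabels (Vec₀.allFin 9)) (filter one⊎three? (vecs 9)) k33Graphs ≡ true
k33-graphs-ok = refl


∥∥-image : ∀ {n k} (φ : Fin k → Fin n) → Injective _≡_ _≡_ φ → ∀ {S} → (∀ e → S e ≡ true → ∃ λ j → φ j ≡ e) → ∥ S ∘ φ ∥ ≡ ∥ S ∥
∥∥-image φ inj {S} onto = trans (sym (∥push∥ φ inj (S ∘ φ))) (∥∥-cong same)
  where
  same : push φ (S ∘ φ) ≈ S
  same e = go (Fin.any? λ j → φ j Fin.≟ e)
    where
    go : Dec (∃ λ j → φ j ≡ e) → push φ (S ∘ φ) e ≡ S e
    go (yes (j , refl)) = push-∘ φ inj (S ∘ φ) j
    go (no ¬j) = trans (push-∉ φ (S ∘ φ) e λ j p → ¬j (j , p)) (sym (≢true⇒false λ p → ¬j (onto e p)))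

has-∈ : ∀ {k} (ls : List (Label k)) {l} → l ∈ˡ ls → has (Vec₀.fromList ls) l ≡ true
has-∈ (x ∷ ls) {l} (here p) = cong (_∨ has (Vec₀.fromList ls) l) (trans (cong (eqLabel x) p) (eqLabel-refl x))
has-∈ (x ∷ ls) {l} (there p) = trans (cong (eqLabel x l ∨_) (has-∈ ls p)) (Bool.∨-zeroʳ (eqLabel x l))

tableOk-∈ : ∀ {d j k} (g : Mat d k) v (lab : Vec Bool j → List (Label k)) rs Ns → tableOk g v lab rs Ns ≡ true →
            ∀ {r} → r ∈ˡ rs → ∃ λ N → graphOk g v (lab r) N ≡ true
tableOk-∈ g v lab (r ∷ rs) (N ∷ Ns) h (here refl) = N , ∧₁ (graphOk g v (lab r) N) (tableOk g v lab rs Ns) h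
tableOk-∈ g v lab (r ∷ rs) (N ∷ Ns) h (there r∈) = tableOk-∈ g v lab rs Ns (∧₂ (graphOk g v (lab r) N) (tableOk g v lab rs Ns) h) r∈

onto : ∀ {k j} → Vec (Fin k) j → Bool
onto b = everyF λ l → someF λ j → ⌊ lookup b j Fin.≟ l ⌋

onto-sound : ∀ {k j} (b : Vec (Fin k) j) → onto b ≡ true → ∀ l → ∃ λ i → lookup b i ≡ l
onto-sound b h l = let (i , p) = someF-∃ (λ j → ⌊ lookup b j Fin.≟ l ⌋) (everyF-∀ (λ l → someF λ j → ⌊ lookup b j Fin.≟ l ⌋) h l) in i , ⌊⌋-true {d = lookup b i Fin.≟ l} p

module Legs {n d k} {Z : Space n} {g : Mat d k} (R : Real Z g) where
  open Real R

  rep-inj : Injective _≡_ _≡_ rep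
  rep-inj {i} {j} p = MaybeP.just-injective (trans (sym (κ-rep i)) (trans (cong κ p) (κ-rep j)))

  just-unique : ∀ {e i j} → κ e ≡ just i → κ e ≡ just j → i ≡ j
  just-unique p q = MaybeP.just-injective (trans (sym p) q)

  Short : Fin k → Set
  Short l = ∀ e → κ e ≡ just l → e ≡ rep l

  Extra : Fin k → Fin n → Set
  Extra l e = κ e ≡ just l × e ≢ rep l

  onLeg : ∀ e l → Dec (κ e ≡ just l)
  onLeg e l = map′ (eqMaybe-≡ (κ e) (just l)) (λ p → trans (cong (λ a → eqMaybe a (just l)) p) (eqMaybe-refl (just l)))
                   (eqMaybe (κ e) (just l) Bool.≟ true)

  long? : ∀ l → Dec (∃ (Extra l))
  long? l = Fin.any? λ e → onLeg e l ×-dec ¬? (e Fin.≟ rep l)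

  ¬long⇒short : ∀ {l} → ¬ ∃ (Extra l) → Short l
  ¬long⇒short {l} h e p = go (e Fin.≟ rep l)
    where
    go : Dec (e ≡ rep l) → e ≡ rep l
    go (yes q) = q
    go (no q) = ⊥-elim (h (e , p , q))

  elems : ∀ {p} → Vec (Fin n) p → Vec (Fin n) (p +ℕ k)
  elems [] = tabulate rep
  elems (e ∷ es) = e ∷ elems es

  data Extras : ∀ {p} → Vec (Fin k) p → Vec (Fin n) p → Set where
    [] : Extras [] []
    extra : ∀ {p l e} {xs : Vec (Fin k) p} {es : Vec (Fin n) p} → Extra l e → (∀ i → lookup es i ≢ e) → Extras xs es → Extras (l ∷ xs) (e ∷ es)

  elems-label : ∀ {p} {xs : Vec (Fin k) p} {es} → Extras xs es → ∀ j → (κ (lookup (elems es) j) , false) ≡ lookup (dupLabels xs) j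
  elems-label [] j = trans (cong (λ e → κ e , false) (Vec.lookup∘tabulate rep j)) (trans (cong (_, false) (κ-rep j)) (sym (Vec.lookup∘tabulate (λ l → just l , false) j)))
  elems-label (extra (p , _) _ E) zero = cong (_, false) p
  elems-label (extra _ _ E) (suc j) = elems-label E j

  elems∈dom : ∀ {p} {xs : Vec (Fin k) p} {es} → Extras xs es → ∀ j → dom κ (lookup (elems es) j) ≡ true
  elems∈dom [] j = trans (cong (dom κ) (Vec.lookup∘tabulate rep j)) (dom-just {κ = κ} (κ-rep j))
  elems∈dom (extra (p , _) _ E) zero = dom-just {κ = κ} p
  elems∈dom (extra _ _ E) (suc j) = elems∈dom E j

  elems-≢ : ∀ {p} (es : Vec (Fin n) p) {e} → (∀ l → rep l ≢ e) → (∀ i → lookup es i ≢ e) → ∀ j → lookup (elems es) j ≢ e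
  elems-≢ [] {e} r h j q = r j (trans (sym (Vec.lookup∘tabulate rep j)) q)
  elems-≢ (x ∷ es) r h zero = h zero
  elems-≢ (x ∷ es) r h (suc j) = elems-≢ es r (h ∘ suc) j

  ∷-inj : ∀ {p} {e} {es : Vec (Fin n) p} → (∀ j → lookup es j ≢ e) → Injective _≡_ _≡_ (lookup es) → Injective _≡_ _≡_ (lookup (e ∷ es))
  ∷-inj h inj {zero} {zero} p = refl
  ∷-inj h inj {zero} {suc j} p = ⊥-elim (h j (sym p))
  ∷-inj h inj {suc i} {zero} p = ⊥-elim (h i p)
  ∷-inj h inj {suc i} {suc j} p = cong suc (inj p)

  elems-inj : ∀ {p} {xs : Vec (Fin k) p} {es} → Extras xs es → Injective _≡_ _≡_ (lookup (elems es))
  elems-inj [] {i} {j} p = rep-inj (trans (sym (Vec.lookup∘tabulate rep i)) (trans p (Vec.lookup∘tabulate rep j)))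
  elems-inj {es = e ∷ es} (extra {l = l} (p , e≢) h E) = ∷-inj {es = elems es} (elems-≢ es (λ j q → e≢ (trans (sym q) (cong rep (just-unique {e} (trans (cong κ (sym q)) (κ-rep j)) p)))) h) (elems-inj E)

  module _ {S : V n} (S⊑ : S ⊑ dom κ) where
    open Tabled R S S⊑ using (meets; meets-intro; meets-elim; ∥meets∥≤; graphical-table; Covers)

    from-table : ∀ v ls N → Covers (Vec₀.fromList ls) → graphOk g v ls N ≡ true → Graphical (Ext (Z ↾ dom κ) S)
    from-table v ls N cover ok = graphical-table (Vec₀.fromList ls) cover (coded v N) ok

    -- A short leg is a single element and carries one label; only a free leg that `S` meets can
    -- carry both. So the set of legs met by `S` decides which entry of the table covers all labels.
    free-Graphical : ∀ (free : Vec Bool k) (b : Vec (Fin k) k) v Ns → distinctᵇ b ≡ true → onto b ≡ true → (∀ j → lookup free j ≡ true ⊎ Short (lookup b j)) →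
                     tableOk g v (freeLabels free b) (filter atMost₃? (vecs k)) Ns ≡ true → ∥ S ∥ ≤ 3 → Graphical (Ext (Z ↾ dom κ) S)
    free-Graphical free b v Ns b-inj b-onto short ok le = build (tableOk-∈ g v (freeLabels free b) (filter atMost₃? (vecs k)) Ns ok (∈-filter⁺ atMost₃? (∈-vecs r) r≤3))
      where
      r : Vec Bool k
      r = tabulate (meets ∘ lookup b)
      r≤3 : ∥ lookup r ∥ ≤ 3
      r≤3 = ℕ.≤-trans (ℕ.≤-reflexive (∥∥-cong (Vec.lookup∘tabulate (meets ∘ lookup b)))) (ℕ.≤-trans (∥meets∥≤ (lookup b) (distinct-sound b b-inj)) le)
      option : ∀ f x (l : Fin k) {s} → (s ≡ true → x ≡ true) → (s ≡ false → x ≡ true → f ≡ true) → (just l , s) ∈ˡ legOptions f x l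
      option f false l {false} p q = here refl
      option f false l {true} p q = ⊥-elim (true≢false (sym (p refl)))
      option false true l {false} p q = ⊥-elim (true≢false (sym (q refl refl)))
      option true true l {false} p q = here refl
      option true true l {true} p q = there (here refl)
      option false true l {true} p q = here refl
      cover : Covers (Vec₀.fromList (freeLabels free b r))
      cover e p = build (just-dom κ p)
        where
        build : (∃ λ l → κ e ≡ just l) → has (Vec₀.fromList (freeLabels free b r)) (κ e , S e) ≡ true
        build (l , q) = at (onto-sound b b-onto l)
          where
          at : (∃ λ j → lookup b j ≡ l) → has (Vec₀.fromList (freeLabels free b r)) (κ e , S e) ≡ true
          at (j , bj) = trans (cong (λ a → has (Vec₀.fromList (freeLabels free b r)) (a , S e)) (trans q (cong just (sym bj))))
              (has-∈ (freeLabels free b r) (∈-concatMap⁺ (λ j → legOptions (lookup free j) (lookup r j) (lookup b j))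
                (Any.map (λ { refl → option (lookup free j) (lookup r j) (lookup b j) met (free-if (short j)) }) (∈-allFin j))))
            where
            κe : κ e ≡ just (lookup b j)
            κe = trans q (cong just (sym bj))
            rj : lookup r j ≡ meets (lookup b j)
            rj = Vec.lookup∘tabulate (meets ∘ lookup b) j
            met : S e ≡ true → lookup r j ≡ true
            met s = trans rj (meets-intro κe s)
            free-if : lookup free j ≡ true ⊎ Short (lookup b j) → S e ≡ false → lookup r j ≡ true → lookup free j ≡ true
            free-if (inj₁ f) _ _ = f
            free-if (inj₂ sh) s m = ⊥-elim (unmet (meets-elim (trans (sym rj) m)))
              where
              unmet : (∃ λ e′ → κ e′ ≡ just (lookup b j) × S e′ ≡ true) → ⊥
              unmet (e′ , p′ , s′) = true≢false (trans (sym s′) (trans (cong S (trans (sh e′ p′) (sym (sh e κe)))) s))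
      build : (∃ λ N → graphOk g v (freeLabels free b r) N ≡ true) → Graphical (Ext (Z ↾ dom κ) S)
      build (N , ok) = from-table v (freeLabels free b r) N cover ok

    exact-Graphical : ∀ {m} (legOf : Vec (Fin k) m) (φ : Fin m → Fin n) v Ns → Injective _≡_ _≡_ φ → (∀ j → κ (φ j) ≡ just (lookup legOf j)) →
                      (∀ e → dom κ e ≡ true → ∃ λ j → φ j ≡ e) →
                      tableOk g v (exactLabels legOf) (filter one⊎three? (vecs m)) Ns ≡ true → One⊎Three ∥ S ∥ → Graphical (Ext (Z ↾ dom κ) S)
    exact-Graphical {m} legOf φ v Ns inj κφ surj ok sz = build (tableOk-∈ g v (exactLabels legOf) (filter one⊎three? (vecs m)) Ns ok (∈-filter⁺ one⊎three? (∈-vecs r) (subst One⊎Three (sym ∥r∥) sz)))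
      where
      r : Vec Bool m
      r = tabulate (S ∘ φ)
      ∥r∥ : ∥ lookup r ∥ ≡ ∥ S ∥
      ∥r∥ = trans (∥∥-cong (Vec.lookup∘tabulate (S ∘ φ))) (∥∥-image φ inj λ e p → surj e (S⊑ e p))
      cover : Covers (Vec₀.fromList (exactLabels legOf r))
      cover e p = at (surj e p)
        where
        at : (∃ λ j → φ j ≡ e) → has (Vec₀.fromList (exactLabels legOf r)) (κ e , S e) ≡ true
        at (j , refl) = trans (cong₂ (λ a s → has (Vec₀.fromList (exactLabels legOf r)) (a , s)) (κφ j) (sym (Vec.lookup∘tabulate (S ∘ φ) j)))
          (has-∈ (exactLabels legOf r) (∈-map⁺ (λ j → just (lookup legOf j) , lookup r j) (∈-allFin j)))
      build : (∃ λ N → graphOk g v (exactLabels legOf r) N ≡ true) → Graphical (Ext (Z ↾ dom κ) S)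
      build (N , ok) = from-table v (exactLabels legOf r) N cover ok

-- The elements outside a maximal pattern

checkDup : ∀ {d k p} → Mat d k → Vec (Fin k) p → Wit (p +ℕ k) → Bool
checkDup g xs w = okWit (earMat g (dupLabels xs)) w

checkOut : ∀ {d k p} → Mat d k → Bool → Vec (Fin k) p → Wit (suc (p +ℕ k)) → Bool
checkOut g b xs w = okWit (earMat g ((nothing , b) ∷ dupLabels xs)) w

module Finish {n d k} {Z : Space n} {U : V n} (nb : NoBad Z U) (ZU : ∀ v → Z ∋ v → v ⊑ U) (simple : Simple Z)
              {g : Mat d k} (cov : covers g ≡ true) (R : Real Z g) (closed : Sep Z (dom (Real.κ R))) where
  open Real R
  open Legs R
  open Ears nb ZU cov R using (X; X⊑U; badWith)

  badDup : ∀ {p} {xs : Vec (Fin k) p} {es} → Extras xs es → ∀ w → checkDup g xs w ≡ true → ⊥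
  -- The zero vector takes the place of the ear: the first row of `earMat` vanishes because all
  -- labels have the bit `false`.
  badDup {xs = xs} {es} E w ok = badWith {0ᵛ} X⊑U G (elems es) (dupLabels xs) (elems-label E) (elems-inj E) (elems∈dom E) w ok
    where
    G : GenBy Z X (0ᵛ ◂ (pull κ ∘ rows g))
    G = record
      { member = λ { zero → mem0 (Z ↾ X) ; (suc i) → member gen i }
      ; generate = λ z h → let (c , p) = generate gen z h in false ◂ c , p }

  -- The pattern is a direct summand, so on `X` and `e` a member of `Z` is a member of the pattern
  -- plus a multiple of `𝟙 e`. The bit `b` distinguishes a coloop from an element that becomes a
  -- loop once the rest is contracted.
  module Outside (e : Fin n) (Ue : U e ≡ true) (Xe : X e ≡ false) (b : Bool) (Z⇒b : Z ∋ 𝟙 e → b ≡ true) (b⇒Z : b ≡ true → Z ∋ 𝟙 e) where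

    Y : V n
    Y = X ⊔ᵛ 𝟙 e

    v : V n
    v = b · 𝟙 e

    κe : κ e ≡ nothing
    κe = go (κ e) refl
      where
      go : ∀ a → κ e ≡ a → κ e ≡ nothing
      go nothing p = p
      go (just l) p = ⊥-elim (true≢false (trans (sym (dom-just {κ = κ} p)) Xe))

    Zv : Z ∋ v
    Zv = go b refl
      where
      go : ∀ c → b ≡ c → Z ∋ c · 𝟙 e
      go true p = b⇒Z p
      go false p = mem0 Z

    v-else : ∀ {i} → X i ≡ true → v i ≡ false
    v-else {i} p = trans (cong (b ∧_) (𝟙-≢ {i = e} {i} λ q → true≢false (trans (sym p) (trans (cong X (sym q)) Xe)))) (Bool.∧-zeroʳ b)

    G : GenBy Z Y (v ◂ (pull κ ∘ rows g))
    G = record { member = mb ; generate = gn }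
      where
      mb : ∀ i → Z ↾ Y ∋ (v ◂ (pull κ ∘ rows g)) i
      mb zero = Zv , λ i p → trans (cong (X i ∨_) (∧₂ b (𝟙 e i) p)) (Bool.∨-zeroʳ (X i))
      mb (suc i) = proj₁ (member gen i) , λ j p → cong (_∨ 𝟙 e j) (proj₂ (member gen i) j p)
      gn : ∀ z → Z ↾ Y ∋ z → ∃ λ c → z ≈ lin c (v ◂ (pull κ ∘ rows g))
      gn z (Zz , z⊑) = build (generate gen (z ⊓ X) (closed z Zz , ⊓-⊑ʳ z X))
        where
        rest : ∀ i → z i ≡ (z e ∧ 𝟙 e i) xor (z ⊓ X) i
        rest i = go (e Fin.≟ i)
          where
          go : Dec (e ≡ i) → z i ≡ (z e ∧ 𝟙 e i) xor (z i ∧ X i)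
          go (yes refl) = sym (trans (cong₂ _xor_ (trans (cong (z e ∧_) (𝟙-refl e)) (Bool.∧-identityʳ (z e))) (trans (cong (z e ∧_) Xe) (Bool.∧-zeroʳ (z e)))) (Bool.xor-identityʳ (z e)))
          go (no q) = sym (trans (cong (_xor (z i ∧ X i)) (trans (cong (z e ∧_) (𝟙-≢ q)) (Bool.∧-zeroʳ (z e)))) (at (z i) refl))
            where
            at : ∀ c → z i ≡ c → z i ∧ X i ≡ z i
            at false p = trans (cong (_∧ X i) p) (sym p)
            at true p = trans (cong (z i ∧_) (trans (sym (trans (cong (X i ∨_) (𝟙-≢ q)) (Bool.∨-identityʳ (X i)))) (z⊑ i p))) (Bool.∧-identityʳ (z i))
        z⇒b : z e ≡ true → b ≡ true
        z⇒b p = Z⇒b (resp≈ Z (λ i → trans (cong (_xor (z ⊓ X) i) (rest i)) (trans (xor-cancelʳ (z e ∧ 𝟙 e i) ((z ⊓ X) i)) (cong (_∧ 𝟙 e i) p))) (mem⊕ Z Zz (closed z Zz)))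
        absorb : ∀ y c t → (y ≡ true → c ≡ true) → y ∧ (c ∧ t) ≡ y ∧ t
        absorb false c t h = refl
        absorb true c t h = cong (_∧ t) (h refl)
        build : (∃ λ c → z ⊓ X ≈ lin c (pull κ ∘ rows g)) → ∃ λ c → z ≈ lin c (v ◂ (pull κ ∘ rows g))
        build (c , p) = z e ◂ c , λ i → trans (rest i) (cong₂ _xor_ (sym (absorb (z e) b (𝟙 e i) z⇒b)) (p i))

    badOut : ∀ {p} {xs : Vec (Fin k) p} {es} → Extras xs es → ∀ w → checkOut g b xs w ≡ true → ⊥
    badOut {xs = xs} {es} E w ok = badWith {v} Y⊑U G (e ∷ elems es) ((nothing , b) ∷ dupLabels xs) labels
        (∷-inj {es = elems es} (λ j q → true≢false (trans (sym (elems∈dom E j)) (trans (cong X q) Xe))) (elems-inj E)) in-Y w ok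
      where
      Y⊑U : Y ⊑ U
      Y⊑U i p = go (⊔ᵛ-true {u = X} {𝟙 e} p)
        where
        go : X i ≡ true ⊎ 𝟙 e i ≡ true → U i ≡ true
        go (inj₁ q) = X⊑U i q
        go (inj₂ q) = trans (cong U (sym (𝟙-true q))) Ue
      labels : ∀ j → (κ (lookup (e ∷ elems es) j) , v (lookup (e ∷ elems es) j)) ≡ lookup ((nothing , b) ∷ dupLabels xs) j
      labels zero = cong₂ _,_ κe (trans (cong (b ∧_) (𝟙-refl e)) (Bool.∧-identityʳ b))
      labels (suc j) = trans (cong (κ (lookup (elems es) j) ,_) (v-else (elems∈dom E j))) (elems-label E j)
      in-Y : ∀ j → Y (lookup (e ∷ elems es) j) ≡ true
      in-Y zero = trans (cong (X e ∨_) (𝟙-refl e)) (Bool.∨-zeroʳ (X e))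
      in-Y (suc j) = cong (_∨ 𝟙 e (lookup (elems es) j)) (elems∈dom E j)

  OuterColoop : Set
  OuterColoop = ∃ λ e → X e ≡ false × Z ∋ 𝟙 e

  noColoop : ∀ {p} {xs : Vec (Fin k) p} {es} → Extras xs es → ∀ w → checkOut g true xs w ≡ true → ¬ OuterColoop
  noColoop E w ok (e , Xe , Ze) = Outside.badOut e (ZU (𝟙 e) Ze e (𝟙-refl e)) Xe true (λ _ → refl) (λ _ → Ze) E w ok

  -- An outer element that is no coloop would supply the loop of F₁, and two outer coloops would be
  -- a series pair, so at most one coloop is left. It lies in `S`, may be removed from `S` because
  -- it belongs to `Z`, and returns as a pendant edge. Thus the size of `S′` may become even, but
  -- only in the presence of an outer coloop, which is what `OuterColoop ⊎ One⊎Three` records.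
  finish : ∀ w → checkOut g false [] w ≡ true → ∀ S → S ⊑ U → One⊎Three ∥ S ∥ → (∀ e → Z ∋ 𝟙 e → S e ≡ true) →
           (∀ S′ → S′ ⊑ X → ∥ S′ ∥ ≤ 3 → OuterColoop ⊎ One⊎Three ∥ S′ ∥ → Graphical (Ext (Z ↾ X) S′)) → Graphical (Ext Z S)
  finish w ok S S⊑U sz coloop⇒S table = step (Fin.any? λ e → (U e Bool.≟ true) ×-dec (X e Bool.≟ false))
    where
    ≤3 : One⊎Three ∥ S ∥ → ∥ S ∥ ≤ 3
    ≤3 (inj₁ p) = ℕ.≤-trans (ℕ.≤-reflexive p) (s≤s z≤n)
    ≤3 (inj₂ p) = ℕ.≤-reflexive p
    coloop : ∀ e → U e ≡ true → X e ≡ false → Z ∋ 𝟙 e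
    coloop e Ue Xe = go (mem? Z (𝟙 e))
      where
      go : Dec (Z ∋ 𝟙 e) → Z ∋ 𝟙 e
      go (yes p) = p
      go (no ¬p) = ⊥-elim (Outside.badOut e Ue Xe false (λ q → ⊥-elim (¬p q)) (λ ()) [] w ok)
    step : Dec (∃ λ e → U e ≡ true × X e ≡ false) → Graphical (Ext Z S)
    step (no ¬e) = graphical-resp (Ext-mono S whole) (table S (⊑-trans S⊑U U⊑X) (≤3 sz) (inj₂ sz))
      where
      U⊑X : U ⊑ X
      U⊑X e p = ≢false⇒true λ q → ¬e (e , p , q)
      whole : Z ↾ X ≐ Z
      whole = (λ v → proj₁) ⸴ λ v Zv → Zv , ⊑-trans (ZU v Zv) U⊑X
    step (yes (e , Ue , Xe)) = graphical-resp (Ext-shift Z shifted)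
        (uncontract-coloop (Ext Z S′) e (Ext-base {W = Z} {S′} (𝟙 e) Ze) (graphical-resp (≐-trans (Ext-mono S′ avoid) (Avoid-Ext Z e S′e))
          (table S′ (⊓-⊑ʳ S X) (ℕ.≤-trans (∥∥-mono (⊓-⊑ˡ S X)) (≤3 sz)) (inj₁ (e , Xe , Ze)))))
      where
      S′ : V n
      S′ = S ⊓ X
      Ze : Z ∋ 𝟙 e
      Ze = coloop e Ue Xe
      S′e : S′ e ≡ false
      S′e = trans (cong (S e ∧_) Xe) (Bool.∧-zeroʳ (S e))
      unique : ∀ {i} → U i ≡ true → X i ≡ false → e ≡ i
      unique {i} Ui Xi = go (e Fin.≟ i)
        where
        go : Dec (e ≡ i) → e ≡ i
        go (yes p) = p
        go (no p) = ⊥-elim (simple e i p (mem⊕ Z Ze (coloop i Ui Xi)))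
      shifted : Z ∋ S′ ⊕ S
      shifted = resp≈ Z eq Ze
        where
        eq : 𝟙 e ≈ S′ ⊕ S
        eq i = go (X i) refl (S i) refl (e Fin.≟ i)
          where
          go : ∀ a → X i ≡ a → ∀ s → S i ≡ s → Dec (e ≡ i) → 𝟙 e i ≡ (S i ∧ X i) xor S i
          go _ _ _ _ (yes refl) = trans (𝟙-refl e) (sym (cong₂ _xor_ S′e (coloop⇒S e Ze)))
          go true p _ _ (no q) = trans (𝟙-≢ q) (sym (trans (cong (_xor S i) (trans (cong (S i ∧_) p) (Bool.∧-identityʳ (S i)))) (Bool.xor-same (S i))))
          go false p false s (no q) = trans (𝟙-≢ q) (sym (cong₂ _xor_ (trans (cong (S i ∧_) p) (Bool.∧-zeroʳ (S i))) s))
          go false p true s (no q) = ⊥-elim (q (unique (S⊑U i s) p))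
      avoid : Z ↾ X ≐ Avoid Z e
      avoid = (λ v (Zv , v⊑) → Zv , ⊑-false v⊑ Xe) ⸴ λ v (Zv , ve) → Zv , λ i p → ≢false⇒true λ q →
        true≢false (trans (sym p) (trans (cong v (sym (unique (ZU v Zv i p) q))) ve))

-- Which legs of a maximal pattern may be long

Conflicts : ℕ → Set
Conflicts k = List (∃ λ p → Vec (Fin k) p × Wit (p +ℕ k))

-- An opposite pair of long legs admits no third long leg, by F₂.
k4Conflicts : Conflicts 6
k4Conflicts =
    (3 , places 5 (0 ∷ 5 ∷ 1 ∷ []) , w₂ (0 ∷ 1 ∷ 2 ∷ 7 ∷ 3 ∷ 8 ∷ 4 ∷ []) [])
  ∷ (3 , places 5 (0 ∷ 5 ∷ 2 ∷ []) , w₂ (0 ∷ 1 ∷ 2 ∷ 6 ∷ 3 ∷ 8 ∷ 5 ∷ []) [])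
  ∷ (3 , places 5 (0 ∷ 5 ∷ 3 ∷ []) , w₂ (0 ∷ 1 ∷ 2 ∷ 5 ∷ 3 ∷ 8 ∷ 6 ∷ []) [])
  ∷ (3 , places 5 (0 ∷ 5 ∷ 4 ∷ []) , w₂ (0 ∷ 1 ∷ 2 ∷ 4 ∷ 3 ∷ 8 ∷ 7 ∷ []) [])
  ∷ (3 , places 5 (1 ∷ 4 ∷ 0 ∷ []) , w₂ (0 ∷ 1 ∷ 2 ∷ 8 ∷ 4 ∷ 7 ∷ 3 ∷ []) [])
  ∷ (3 , places 5 (1 ∷ 4 ∷ 2 ∷ []) , w₂ (0 ∷ 1 ∷ 2 ∷ 6 ∷ 4 ∷ 7 ∷ 5 ∷ []) [])
  ∷ (3 , places 5 (1 ∷ 4 ∷ 3 ∷ []) , w₂ (0 ∷ 1 ∷ 2 ∷ 5 ∷ 4 ∷ 7 ∷ 6 ∷ []) [])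
  ∷ (3 , places 5 (1 ∷ 4 ∷ 5 ∷ []) , w₂ (0 ∷ 1 ∷ 2 ∷ 3 ∷ 4 ∷ 7 ∷ 8 ∷ []) [])
  ∷ (3 , places 5 (2 ∷ 3 ∷ 0 ∷ []) , w₂ (0 ∷ 1 ∷ 2 ∷ 8 ∷ 5 ∷ 6 ∷ 3 ∷ []) [])
  ∷ (3 , places 5 (2 ∷ 3 ∷ 1 ∷ []) , w₂ (0 ∷ 1 ∷ 2 ∷ 7 ∷ 5 ∷ 6 ∷ 4 ∷ []) [])
  ∷ (3 , places 5 (2 ∷ 3 ∷ 4 ∷ []) , w₂ (0 ∷ 1 ∷ 2 ∷ 4 ∷ 5 ∷ 6 ∷ 7 ∷ []) [])
  ∷ (3 , places 5 (2 ∷ 3 ∷ 5 ∷ []) , w₂ (0 ∷ 1 ∷ 2 ∷ 3 ∷ 5 ∷ 6 ∷ 8 ∷ []) [])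
  ∷ []

-- A long spoke gives F₂, and two adjacent long rims give F₅.
w4Conflicts : Conflicts 8
w4Conflicts =
    (1 , places 7 (0 ∷ []) , w₂ (0 ∷ 3 ∷ 4 ∷ 2 ∷ 1 ∷ 6 ∷ 8 ∷ []) (7 ∷ []))
  ∷ (1 , places 7 (1 ∷ []) , w₂ (0 ∷ 3 ∷ 4 ∷ 1 ∷ 2 ∷ 6 ∷ 8 ∷ []) (7 ∷ []))
  ∷ (1 , places 7 (2 ∷ []) , w₂ (0 ∷ 1 ∷ 2 ∷ 4 ∷ 3 ∷ 8 ∷ 6 ∷ []) (5 ∷ []))
  ∷ (1 , places 7 (3 ∷ []) , w₂ (0 ∷ 1 ∷ 2 ∷ 3 ∷ 4 ∷ 8 ∷ 6 ∷ []) (5 ∷ []))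
  ∷ (2 , places 7 (4 ∷ 5 ∷ []) , w₅ (3 ∷ 2 ∷ 5 ∷ 4 ∷ 1 ∷ 0 ∷ 9 ∷ 8 ∷ 7 ∷ 6 ∷ []) [])
  ∷ (2 , places 7 (5 ∷ 6 ∷ []) , w₅ (4 ∷ 3 ∷ 2 ∷ 5 ∷ 1 ∷ 0 ∷ 6 ∷ 9 ∷ 8 ∷ 7 ∷ []) [])
  ∷ (2 , places 7 (6 ∷ 7 ∷ []) , w₅ (5 ∷ 2 ∷ 3 ∷ 4 ∷ 0 ∷ 1 ∷ 6 ∷ 7 ∷ 8 ∷ 9 ∷ []) [])
  ∷ (2 , places 7 (7 ∷ 4 ∷ []) , w₅ (2 ∷ 3 ∷ 4 ∷ 5 ∷ 0 ∷ 1 ∷ 7 ∷ 8 ∷ 9 ∷ 6 ∷ []) [])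
  ∷ []

prismConflicts : Conflicts 9
prismConflicts =
    (1 , places 8 (0 ∷ []) , w₂ (0 ∷ 4 ∷ 6 ∷ 3 ∷ 1 ∷ 8 ∷ 9 ∷ []) (5 ∷ []))
  ∷ (1 , places 8 (1 ∷ []) , w₂ (0 ∷ 5 ∷ 6 ∷ 3 ∷ 2 ∷ 8 ∷ 7 ∷ []) (4 ∷ []))
  ∷ (1 , places 8 (2 ∷ []) , w₂ (0 ∷ 5 ∷ 6 ∷ 2 ∷ 3 ∷ 8 ∷ 7 ∷ []) (4 ∷ []))
  ∷ (1 , places 8 (3 ∷ []) , w₂ (0 ∷ 1 ∷ 3 ∷ 6 ∷ 4 ∷ 8 ∷ 9 ∷ []) (2 ∷ []))
  ∷ (1 , places 8 (4 ∷ []) , w₂ (0 ∷ 2 ∷ 3 ∷ 6 ∷ 5 ∷ 8 ∷ 7 ∷ []) (1 ∷ []))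
  ∷ (1 , places 8 (5 ∷ []) , w₂ (0 ∷ 2 ∷ 3 ∷ 5 ∷ 6 ∷ 8 ∷ 7 ∷ []) (1 ∷ []))
  ∷ []

k33Conflicts : Conflicts 9
k33Conflicts =
    (1 , places 8 (0 ∷ []) , w₂ (0 ∷ 3 ∷ 7 ∷ 5 ∷ 1 ∷ 6 ∷ 8 ∷ []) (9 ∷ []))
  ∷ (1 , places 8 (1 ∷ []) , w₂ (0 ∷ 3 ∷ 7 ∷ 4 ∷ 2 ∷ 6 ∷ 8 ∷ []) (9 ∷ []))
  ∷ (1 , places 8 (2 ∷ []) , w₂ (0 ∷ 2 ∷ 4 ∷ 7 ∷ 3 ∷ 8 ∷ 6 ∷ []) (5 ∷ []))
  ∷ (1 , places 8 (3 ∷ []) , w₂ (0 ∷ 3 ∷ 7 ∷ 2 ∷ 4 ∷ 6 ∷ 8 ∷ []) (9 ∷ []))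
  ∷ (1 , places 8 (4 ∷ []) , w₂ (0 ∷ 2 ∷ 4 ∷ 9 ∷ 5 ∷ 3 ∷ 7 ∷ []) (1 ∷ []))
  ∷ (1 , places 8 (5 ∷ []) , w₂ (0 ∷ 2 ∷ 4 ∷ 8 ∷ 6 ∷ 3 ∷ 7 ∷ []) (1 ∷ []))
  ∷ (1 , places 8 (6 ∷ []) , w₂ (0 ∷ 2 ∷ 4 ∷ 3 ∷ 7 ∷ 8 ∷ 6 ∷ []) (5 ∷ []))
  ∷ (1 , places 8 (7 ∷ []) , w₂ (0 ∷ 2 ∷ 4 ∷ 6 ∷ 8 ∷ 3 ∷ 7 ∷ []) (1 ∷ []))
  ∷ (1 , places 8 (8 ∷ []) , w₂ (0 ∷ 2 ∷ 4 ∷ 5 ∷ 9 ∷ 3 ∷ 7 ∷ []) (1 ∷ []))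
  ∷ []

-- Column 0 is the outer element. Here and in the next three witnesses it becomes the loop of F₁; in
-- `k33Coloop` it is a coloop and becomes the pendant edge of F₇.
k4Zero : Wit 7
k4Zero = w₁ (1 ∷ 2 ∷ 4 ∷ 3 ∷ 5 ∷ 6 ∷ 0 ∷ []) []

w4Zero : Wit 9
w4Zero = w₁ (2 ∷ 3 ∷ 6 ∷ 4 ∷ 8 ∷ 7 ∷ 0 ∷ []) (1 ∷ [])

prismZero : Wit 10
prismZero = w₁ (4 ∷ 5 ∷ 6 ∷ 8 ∷ 7 ∷ 9 ∷ 0 ∷ []) (1 ∷ [])

k33Zero : Wit 10
k33Zero = w₁ (3 ∷ 5 ∷ 6 ∷ 8 ∷ 9 ∷ 7 ∷ 0 ∷ []) (1 ∷ [])

k33Coloop : Wit 10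
k33Coloop = w₇ (2 ∷ 5 ∷ 6 ∷ 8 ∷ 9 ∷ 4 ∷ 3 ∷ 7 ∷ 0 ∷ []) (1 ∷ [])

-- One entry per opposite pair of legs of K₄, which `b` puts into positions 0 and 5. A third element
-- on either leg gives F₄, an outer coloop gives F₇.
pairCases : List (Vec (Fin 6) 6 × Wit 9 × Wit 9 × Wit 9)
pairCases =
    (places 5 (0 ∷ 1 ∷ 2 ∷ 3 ∷ 4 ∷ 5 ∷ []) , w₄ (0 ∷ 4 ∷ 6 ∷ 5 ∷ 7 ∷ 2 ∷ 1 ∷ 3 ∷ 8 ∷ []) [] , w₄ (0 ∷ 4 ∷ 5 ∷ 6 ∷ 7 ∷ 2 ∷ 1 ∷ 8 ∷ 3 ∷ []) [] , w₇ (1 ∷ 4 ∷ 6 ∷ 5 ∷ 7 ∷ 2 ∷ 3 ∷ 8 ∷ 0 ∷ []) [])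
  ∷ (places 5 (1 ∷ 0 ∷ 2 ∷ 3 ∷ 5 ∷ 4 ∷ []) , w₄ (0 ∷ 3 ∷ 6 ∷ 5 ∷ 8 ∷ 2 ∷ 1 ∷ 4 ∷ 7 ∷ []) [] , w₄ (0 ∷ 3 ∷ 5 ∷ 6 ∷ 8 ∷ 2 ∷ 1 ∷ 7 ∷ 4 ∷ []) [] , w₇ (1 ∷ 3 ∷ 6 ∷ 5 ∷ 8 ∷ 2 ∷ 4 ∷ 7 ∷ 0 ∷ []) [])
  ∷ (places 5 (2 ∷ 0 ∷ 1 ∷ 4 ∷ 5 ∷ 3 ∷ []) , w₄ (0 ∷ 3 ∷ 7 ∷ 4 ∷ 8 ∷ 2 ∷ 1 ∷ 5 ∷ 6 ∷ []) [] , w₄ (0 ∷ 3 ∷ 4 ∷ 7 ∷ 8 ∷ 2 ∷ 1 ∷ 6 ∷ 5 ∷ []) [] , w₇ (1 ∷ 3 ∷ 7 ∷ 4 ∷ 8 ∷ 2 ∷ 5 ∷ 6 ∷ 0 ∷ []) [])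
  ∷ []

conflictsOk : ∀ {d k} → Mat d k → Conflicts k → Bool
conflictsOk g = every λ (p , xs , w) → distinctᵇ xs ∧ checkDup g xs w

clash : ∀ {k} → Vec Bool k → Conflicts k → Bool
clash sh = some λ (p , xs , _) → everyF λ i → not (lookup sh (lookup xs i))

fits : ∀ {k} → Vec Bool k → Vec Bool k → Vec (Fin k) k → Bool
fits free sh b = everyF λ j → lookup free j ∨ lookup sh (lookup b j)

goodPerm : ∀ {k} → Vec (Fin k) k → Bool
goodPerm b = distinctᵇ b ∧ onto b

pairLegs : Vec Bool 6
pairLegs = supp (0 ∷ 5 ∷ [])

pairFits : Vec Bool 6 → Vec (Fin 6) 6 → Bool
pairFits sh b = fits pairLegs sh b ∧ (not (lookup sh (lookup b (# 0))) ∧ not (lookup sh (lookup b (# 5))))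

-- the eight elements are those of dupLabels (b 0 ∷ b 5 ∷ []), the legs being taken in the order given by b
pairOrder : Vec (Fin 6) 6 → Vec (Fin 8) 8
pairOrder b = # 0 ∷ # 1 ∷ Vec₀.map (λ l → suc (suc l)) b

pairLegOf : Vec (Fin 6) 6 → Vec (Fin 6) 8
pairLegOf b = lookup b (# 0) ∷ lookup b (# 5) ∷ b

pairCaseOk : Vec (Fin 6) 6 × Wit 9 × Wit 9 × Wit 9 → Bool
pairCaseOk (b , w , w′ , w″) = (goodPerm (pairOrder b) ∧ everyF (λ j → eqLabel (lookup (dupLabels (x ∷ y ∷ [])) (lookup (pairOrder b) j)) (just (lookup (pairLegOf b) j) , false)))
  ∧ ((checkDup k4M (x ∷ x ∷ y ∷ []) w ∧ checkDup k4M (y ∷ y ∷ x ∷ []) w′)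
  ∧ (checkOut k4M true (x ∷ y ∷ []) w″ ∧ (not ⌊ x Fin.≟ y ⌋ ∧ tableOk k4M 4 (exactLabels (pairLegOf b)) (filter one⊎three? (vecs 8)) k4OppositeGraphs)))
  where
  x = lookup b (# 0)
  y = lookup b (# 5)

-- Edges of K₄ without an opposite pair lie in a triangle or a star. If an opposite pair is long,
-- the conflicts leave nothing else, and exactly that pair remains.
k4Shape : Vec Bool 6 → Bool
k4Shape sh = clash sh k4Conflicts ∨ (some (fits triangleLegs sh) triangles ∨ (some (fits starLegs sh) starPerms ∨ some (λ (b , _) → pairFits sh b) pairCases))

w4Shape : Vec Bool 8 → Bool
w4Shape sh = clash sh w4Conflicts ∨ some (fits oppositeRims sh) w4Rotations

prismShape k33Shape : Vec Bool 9 → Bool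
prismShape sh = clash sh prismConflicts ∨ fits matching sh (Vec₀.allFin 9)
k33Shape sh = clash sh k33Conflicts ∨ fits (supp []) sh (Vec₀.allFin 9)

k4-shape : every k4Shape (vecs 6) ≡ true
k4-shape = refl

w4-shape : every w4Shape (vecs 8) ≡ true
w4-shape = refl

prism-shape : every prismShape (vecs 9) ≡ true
prism-shape = refl

k33-shape : every k33Shape (vecs 9) ≡ true
k33-shape = refl

k4-conflicts : conflictsOk k4M k4Conflicts ≡ true
k4-conflicts = refl

w4-conflicts : conflictsOk w4M w4Conflicts ≡ true
w4-conflicts = refl

prism-conflicts : conflictsOk prismM prismConflicts ≡ true
prism-conflicts = refl

k33-conflicts : conflictsOk k33M k33Conflicts ≡ true
k33-conflicts = refl

k4-zero : checkOut k4M false [] k4Zero ≡ true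
k4-zero = refl

w4-zero : checkOut w4M false [] w4Zero ≡ true
w4-zero = refl

prism-zero : checkOut prismM false [] prismZero ≡ true
prism-zero = refl

k33-zero : checkOut k33M false [] k33Zero ≡ true
k33-zero = refl

k33-coloop : checkOut k33M true [] k33Coloop ≡ true
k33-coloop = refl

pairs-ok : every pairCaseOk pairCases ≡ true
pairs-ok = refl

triangle-perms : every goodPerm triangles ≡ true
triangle-perms = refl

star-perms : every goodPerm starPerms ≡ true
star-perms = refl

rotation-perms : every goodPerm w4Rotations ≡ true
rotation-perms = refl

identity-perm : goodPerm (Vec₀.allFin 9) ≡ true
identity-perm = refl

-- From the long legs of a pattern to its table of graphs

module Shape {n d k} {Z : Space n} {U : V n} (nb : NoBad Z U) (ZU : ∀ v → Z ∋ v → v ⊑ U) (simple : Simple Z)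
             {g : Mat d k} (cov : covers g ≡ true) (R : Real Z g) (closed : Sep Z (dom (Real.κ R))) where
  open Real R
  open Legs R public
  open Finish nb ZU simple cov R closed public

  shorts : Vec Bool k
  shorts = tabulate λ l → not ⌊ long? l ⌋

  short : ∀ {l} → lookup shorts l ≡ true → Short l
  short {l} p = go (long? l) (trans (sym (Vec.lookup∘tabulate (λ l → not ⌊ long? l ⌋) l)) p)
    where
    go : (d : Dec (∃ (Extra l))) → not ⌊ d ⌋ ≡ true → Short l
    go (no ¬e) _ = ¬long⇒short ¬e

  long : ∀ {l} → not (lookup shorts l) ≡ true → ∃ (Extra l)
  long {l} p = go (long? l) (trans (cong not (sym (Vec.lookup∘tabulate (λ l → not ⌊ long? l ⌋) l))) p)
    where
    go : (d : Dec (∃ (Extra l))) → not (not ⌊ d ⌋) ≡ true → ∃ (Extra l)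
    go (yes e) _ = e

  extras : ∀ {p} (xs : Vec (Fin k) p) → Injective _≡_ _≡_ (lookup xs) → (∀ i → ∃ (Extra (lookup xs i))) →
           ∃ λ es → Extras xs es × (∀ i → κ (lookup es i) ≡ just (lookup xs i))
  extras [] inj h = [] , [] , λ ()
  extras (x ∷ xs) inj h = build (extras xs (λ p → Fin.suc-injective (inj p)) (h ∘ suc))
    where
    e = proj₁ (h zero)
    0≢s : ∀ {m} {i : Fin m} → zero ≢ suc i
    0≢s ()
    build : (∃ λ es → Extras xs es × (∀ i → κ (lookup es i) ≡ just (lookup xs i))) →
            ∃ λ es → Extras (x ∷ xs) es × (∀ i → κ (lookup es i) ≡ just (lookup (x ∷ xs) i))
    build (es , E , κes) = e ∷ es
      , extra (proj₂ (h zero)) (λ i p → 0≢s (inj (just-unique (proj₁ (proj₂ (h zero))) (trans (cong κ (sym p)) (κes i))))) E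
      , λ { zero → proj₁ (proj₂ (h zero)) ; (suc i) → κes i }

  noClash : ∀ T → conflictsOk g T ≡ true → clash shorts T ≡ true → ⊥
  noClash T ok h = build (some-∈ (λ (p , xs , _) → everyF λ i → not (lookup shorts (lookup xs i))) h)
    where
    build : (∃ λ t → t ∈ˡ T × everyF (λ i → not (lookup shorts (lookup (proj₁ (proj₂ t)) i))) ≡ true) → ⊥
    build ((p , xs , w) , t∈ , all) = badDup (proj₁ (proj₂ es)) w (∧₂ (distinctᵇ xs) (checkDup g xs w) ok′)
      where
      ok′ : distinctᵇ xs ∧ checkDup g xs w ≡ true
      ok′ = check-∈ (λ (p , xs , w) → distinctᵇ xs ∧ checkDup g xs w) T ok (p , xs , w) t∈
      es = extras xs (distinct-sound xs (∧₁ (distinctᵇ xs) (checkDup g xs w) ok′)) λ i → long (everyF-∀ (λ i → not (lookup shorts (lookup xs i))) all i)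

  Covered : Set
  Covered = ∀ S → S ⊑ dom κ → ∥ S ∥ ≤ 3 → Graphical (Ext (Z ↾ dom κ) S)

  free-or-short : ∀ free b → fits free shorts b ≡ true → ∀ j → lookup free j ≡ true ⊎ Short (lookup b j)
  free-or-short free b h j = go (∨-split (lookup free j) (lookup shorts (lookup b j)) (everyF-∀ (λ j → lookup free j ∨ lookup shorts (lookup b j)) h j))
    where
    go : lookup free j ≡ true ⊎ lookup shorts (lookup b j) ≡ true → lookup free j ≡ true ⊎ Short (lookup b j)
    go (inj₁ p) = inj₁ p
    go (inj₂ p) = inj₂ (short p)

  fits-Graphical : ∀ free b v Ns → goodPerm b ≡ true → tableOk g v (freeLabels free b) (filter atMost₃? (vecs k)) Ns ≡ true → fits free shorts b ≡ true → Covered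
  fits-Graphical free b v Ns perm ok fit S S⊑ le = free-Graphical S⊑ free b v Ns (∧₁ (distinctᵇ b) (onto b) perm) (∧₂ (distinctᵇ b) (onto b) perm)
    (free-or-short free b fit) ok le

  some-fits : ∀ free bs v Ns → every goodPerm bs ≡ true → every (λ b → tableOk g v (freeLabels free b) (filter atMost₃? (vecs k)) Ns) bs ≡ true →
              some (fits free shorts) bs ≡ true → Covered
  some-fits free bs v Ns perms ok h = build (some-∈ (fits free shorts) h)
    where
    build : (∃ λ b → b ∈ˡ bs × fits free shorts b ≡ true) → Covered
    build (b , b∈ , fit) = fits-Graphical free b v Ns (check-∈ goodPerm bs perms b b∈)
      (check-∈ (λ b → tableOk g v (freeLabels free b) (filter atMost₃? (vecs k)) Ns) bs ok b b∈) fit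

module Endings {n} {Z : Space n} {U : V n} (nb : NoBad Z U) (ZU : ∀ v → Z ∋ v → v ⊑ U) (simple : Simple Z)
               (S : V n) (S⊑U : S ⊑ U) (sz : One⊎Three ∥ S ∥) (coloop⇒S : ∀ e → Z ∋ 𝟙 e → S e ≡ true) where

  Done : Set
  Done = Graphical (Ext Z S)

  w4-end : Maximal nb ZU simple w4M → Done
  w4-end (R , closed) = finish w4Zero w4-zero S S⊑U sz coloop⇒S λ S′ S′⊑ le _ →
      go (∨-split (clash shorts w4Conflicts) (some (fits oppositeRims shorts) w4Rotations) (check-∈ w4Shape (vecs 8) w4-shape shorts (∈-vecs shorts))) S′ S′⊑ le
    where
    open Shape nb ZU simple {w4M} refl R closed
    go : clash shorts w4Conflicts ≡ true ⊎ some (fits oppositeRims shorts) w4Rotations ≡ true → Covered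
    go (inj₁ h) = ⊥-elim (noClash w4Conflicts w4-conflicts h)
    go (inj₂ h) = some-fits oppositeRims w4Rotations 5 w4Graphs rotation-perms rims-ok h

  prism-end : Maximal nb ZU simple prismM → Done
  prism-end (R , closed) = finish prismZero prism-zero S S⊑U sz coloop⇒S λ S′ S′⊑ le _ →
      go (∨-split (clash shorts prismConflicts) (fits matching shorts (Vec₀.allFin 9)) (check-∈ prismShape (vecs 9) prism-shape shorts (∈-vecs shorts))) S′ S′⊑ le
    where
    open Shape nb ZU simple {prismM} refl R closed
    go : clash shorts prismConflicts ≡ true ⊎ fits matching shorts (Vec₀.allFin 9) ≡ true → Covered
    go (inj₁ h) = ⊥-elim (noClash prismConflicts prism-conflicts h)
    go (inj₂ h) = fits-Graphical matching (Vec₀.allFin 9) 5 prismGraphs identity-perm matching-ok h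

  k33-end : Maximal nb ZU simple k33M → Done
  k33-end (R , closed) = finish k33Zero k33-zero S S⊑U sz coloop⇒S λ S′ S′⊑ le out →
      go (∨-split (clash shorts k33Conflicts) (fits (supp []) shorts (Vec₀.allFin 9)) (check-∈ k33Shape (vecs 9) k33-shape shorts (∈-vecs shorts))) S′ S′⊑ (odd-size S′ out)
    where
    open Shape nb ZU simple {k33M} refl R closed
    open Real R
    -- K₃,₃ with a coloop contains F₇, so `S` is never reduced and the sizes one and three suffice.
    odd-size : ∀ S′ → OuterColoop ⊎ One⊎Three ∥ S′ ∥ → One⊎Three ∥ S′ ∥
    odd-size S′ (inj₁ c) = ⊥-elim (noColoop [] k33Coloop k33-coloop c)
    odd-size S′ (inj₂ s) = s
    go : clash shorts k33Conflicts ≡ true ⊎ fits (supp []) shorts (Vec₀.allFin 9) ≡ true → ∀ S → S ⊑ dom κ → One⊎Three ∥ S ∥ → Graphical (Ext (Z ↾ dom κ) S)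
    go (inj₁ h) = ⊥-elim (noClash k33Conflicts k33-conflicts h)
    go (inj₂ h) S S⊑ = exact-Graphical S⊑ (Vec₀.allFin 9) rep 5 k33Graphs rep-inj (λ j → trans (κ-rep j) (cong just (sym (Vec.lookup-allFin j)))) surj k33-graphs-ok
      where
      isShort : ∀ l → lookup (supp {9} []) l ≡ true ⊎ Short (lookup (Vec₀.allFin 9) l) → Short l
      isShort l (inj₁ p) = ⊥-elim (true≢false (trans (sym p) (Vec.lookup∘tabulate (λ _ → false) l)))
      isShort l (inj₂ q) = subst Short (Vec.lookup-allFin l) q
      surj : ∀ e → dom κ e ≡ true → ∃ λ j → rep j ≡ e
      surj e p = let (l , q) = just-dom κ p in l , sym (isShort l (free-or-short (supp []) (Vec₀.allFin 9) h l) e q)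

  -- Two opposite legs x, y of K₄ are long: then each has exactly two elements and there is no coloop.
  module Pair (R : Real Z k4M) (closed : Sep Z (dom (Real.κ R))) (b : Vec (Fin 6) 6) (w w′ w″ : Wit 9) (ok : pairCaseOk (b , w , w′ , w″) ≡ true) where
    open Shape nb ZU simple {k4M} refl R closed
    open Real R

    x y : Fin 6
    x = lookup b (# 0)
    y = lookup b (# 5)

    σ : Vec (Fin 8) 8
    σ = pairOrder b

    σOk labelsOk xxy yyx coloopOk x≠y graphsOk : Bool
    σOk = goodPerm σ
    labelsOk = everyF λ j → eqLabel (lookup (dupLabels (x ∷ y ∷ [])) (lookup σ j)) (just (lookup (pairLegOf b) j) , false)
    xxy = checkDup k4M (x ∷ x ∷ y ∷ []) w
    yyx = checkDup k4M (y ∷ y ∷ x ∷ []) w′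
    coloopOk = checkOut k4M true (x ∷ y ∷ []) w″
    x≠y = not ⌊ x Fin.≟ y ⌋
    graphsOk = tableOk k4M 4 (exactLabels (pairLegOf b)) (filter one⊎three? (vecs 8)) k4OppositeGraphs

    first : σOk ∧ labelsOk ≡ true
    first = ∧₁ (σOk ∧ labelsOk) ((xxy ∧ yyx) ∧ (coloopOk ∧ (x≠y ∧ graphsOk))) ok
    rest : (xxy ∧ yyx) ∧ (coloopOk ∧ (x≠y ∧ graphsOk)) ≡ true
    rest = ∧₂ (σOk ∧ labelsOk) ((xxy ∧ yyx) ∧ (coloopOk ∧ (x≠y ∧ graphsOk))) ok
    dups : xxy ∧ yyx ≡ true
    dups = ∧₁ (xxy ∧ yyx) (coloopOk ∧ (x≠y ∧ graphsOk)) rest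
    rest′ : coloopOk ∧ (x≠y ∧ graphsOk) ≡ true
    rest′ = ∧₂ (xxy ∧ yyx) (coloopOk ∧ (x≠y ∧ graphsOk)) rest
    rest″ : x≠y ∧ graphsOk ≡ true
    rest″ = ∧₂ coloopOk (x≠y ∧ graphsOk) rest′
    σ-inj : Injective _≡_ _≡_ (lookup σ)
    σ-inj = distinct-sound σ (∧₁ (distinctᵇ σ) (onto σ) (∧₁ σOk labelsOk first))
    σ-onto : ∀ i → ∃ λ j → lookup σ j ≡ i
    σ-onto = onto-sound σ (∧₂ (distinctᵇ σ) (onto σ) (∧₁ σOk labelsOk first))

    x≢y : x ≢ y
    x≢y p = go (x Fin.≟ y) (∧₁ x≠y graphsOk rest″)
      where
      go : (d : Dec (x ≡ y)) → not ⌊ d ⌋ ≡ true → ⊥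
      go (no q) _ = q p

    graphical : pairFits shorts b ≡ true → ∀ S → S ⊑ dom κ → OuterColoop ⊎ One⊎Three ∥ S ∥ → Graphical (Ext (Z ↾ dom κ) S)
    graphical h S S⊑ out = exact-Graphical S⊑ (pairLegOf b) φ 4 k4OppositeGraphs φ-inj κφ surj (∧₂ x≠y graphsOk rest″) (odd-size out)
      where
      h₁ : fits pairLegs shorts b ≡ true
      h₁ = ∧₁ (fits pairLegs shorts b) (not (lookup shorts x) ∧ not (lookup shorts y)) h
      h₂ : not (lookup shorts x) ∧ not (lookup shorts y) ≡ true
      h₂ = ∧₂ (fits pairLegs shorts b) (not (lookup shorts x) ∧ not (lookup shorts y)) h
      lx : ∃ (Extra x)
      lx = long (∧₁ (not (lookup shorts x)) (not (lookup shorts y)) h₂)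
      ly : ∃ (Extra y)
      ly = long (∧₂ (not (lookup shorts x)) (not (lookup shorts y)) h₂)
      e = proj₁ lx
      f = proj₁ ly
      f≢ : ∀ {i} → κ i ≡ just x → f ≢ i
      f≢ p q = x≢y (just-unique p (trans (cong κ (sym q)) (proj₁ (proj₂ ly))))
      e≢ : ∀ {i} → κ i ≡ just y → e ≢ i
      e≢ p q = x≢y (just-unique (proj₁ (proj₂ lx)) (trans (cong κ q) p))
      E : Extras (x ∷ y ∷ []) (e ∷ f ∷ [])
      E = extra (proj₂ lx) (λ { zero → f≢ (proj₁ (proj₂ lx)) }) (extra (proj₂ ly) (λ ()) [])
      E′ : Extras (y ∷ x ∷ []) (f ∷ e ∷ [])
      E′ = extra (proj₂ ly) (λ { zero → e≢ (proj₁ (proj₂ ly)) }) (extra (proj₂ lx) (λ ()) [])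
      odd-size : OuterColoop ⊎ One⊎Three ∥ S ∥ → One⊎Three ∥ S ∥
      odd-size (inj₁ c) = ⊥-elim (noColoop E w″ (∧₁ coloopOk (x≠y ∧ graphsOk) rest′) c)
      odd-size (inj₂ s) = s
      on-x : ∀ i → κ i ≡ just x → i ≡ rep x ⊎ i ≡ e
      on-x i p = go (i Fin.≟ rep x) (e Fin.≟ i)
        where
        go : Dec (i ≡ rep x) → Dec (e ≡ i) → i ≡ rep x ⊎ i ≡ e
        go (yes q) _ = inj₁ q
        go (no _) (yes q) = inj₂ (sym q)
        go (no q) (no r) = ⊥-elim (badDup (extra (p , q) (λ { zero → r ; (suc zero) → f≢ p }) E) w (∧₁ xxy yyx dups))
      on-y : ∀ i → κ i ≡ just y → i ≡ rep y ⊎ i ≡ f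
      on-y i p = go (i Fin.≟ rep y) (f Fin.≟ i)
        where
        go : Dec (i ≡ rep y) → Dec (f ≡ i) → i ≡ rep y ⊎ i ≡ f
        go (yes q) _ = inj₁ q
        go (no _) (yes q) = inj₂ (sym q)
        go (no q) (no r) = ⊥-elim (badDup (extra (p , q) (λ { zero → r ; (suc zero) → e≢ p }) E′) w′ (∧₂ xxy yyx dups))
      φ : Fin 8 → Fin n
      φ j = lookup (elems (e ∷ f ∷ [])) (lookup σ j)
      φ-inj : Injective _≡_ _≡_ φ
      φ-inj p = σ-inj (elems-inj E p)
      κφ : ∀ j → κ (φ j) ≡ just (lookup (pairLegOf b) j)
      κφ j = cong proj₁ (trans (elems-label E (lookup σ j)) (eqLabel-≡ (lookup (dupLabels (x ∷ y ∷ [])) (lookup σ j)) (just (lookup (pairLegOf b) j) , false)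
        (everyF-∀ (λ j → eqLabel (lookup (dupLabels (x ∷ y ∷ [])) (lookup σ j)) (just (lookup (pairLegOf b) j) , false)) (∧₂ σOk labelsOk first) j)))
      at-σ : ∀ i {a} → lookup (elems (e ∷ f ∷ [])) i ≡ a → ∃ λ j → φ j ≡ a
      at-σ i p = let (j , q) = σ-onto i in j , trans (cong (lookup (elems (e ∷ f ∷ []))) q) p
      at-rep : ∀ l {a} → a ≡ rep l → ∃ λ j → φ j ≡ a
      at-rep l p = at-σ (suc (suc l)) (trans (Vec.lookup∘tabulate rep l) (sym p))
      perm-leg : ∀ l → ∃ λ j → lookup b j ≡ l
      perm-leg l = leg-of (σ-onto (suc (suc l)))
        where
        leg-of : (∃ λ j → lookup σ j ≡ suc (suc l)) → ∃ λ j → lookup b j ≡ l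
        leg-of (suc (suc j) , p) = j , Fin.suc-injective (Fin.suc-injective (trans (sym (Vec.lookup-map j (λ l → suc (suc l)) b)) p))
      surj : ∀ i → dom κ i ≡ true → ∃ λ j → φ j ≡ i
      surj i p = build (just-dom κ p)
        where
        place : ∀ j → κ i ≡ just (lookup b j) → lookup pairLegs j ≡ true ⊎ Short (lookup b j) → ∃ λ j → φ j ≡ i
        place j q (inj₂ s) = at-rep (lookup b j) (s i q)
        place zero q (inj₁ _) = [ at-rep x , (λ r → at-σ zero (sym r)) ]′ (on-x i q)
        place (suc (suc (suc (suc (suc zero))))) q (inj₁ _) = [ at-rep y , (λ r → at-σ (suc zero) (sym r)) ]′ (on-y i q)
        build : (∃ λ l → κ i ≡ just l) → ∃ λ j → φ j ≡ i
        build (l , q) = leg (perm-leg l)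
          where
          leg : (∃ λ j → lookup b j ≡ l) → ∃ λ j → φ j ≡ i
          leg (j , r) = place j (trans q (cong just (sym r))) (free-or-short pairLegs b h₁ j)

  k4-end : Maximal nb ZU simple k4M → Done
  k4-end (R , closed) = finish k4Zero k4-zero S S⊑U sz coloop⇒S λ S′ S′⊑ le out → go (view shape) S′ S′⊑ le out
    where
    open Shape nb ZU simple {k4M} refl R closed
    open Real R
    c t s p : Bool
    c = clash shorts k4Conflicts
    t = some (fits triangleLegs shorts) triangles
    s = some (fits starLegs shorts) starPerms
    p = some (λ (b , _) → pairFits shorts b) pairCases
    shape : c ∨ (t ∨ (s ∨ p)) ≡ true
    shape = check-∈ k4Shape (vecs 6) k4-shape shorts (∈-vecs shorts)
    view : c ∨ (t ∨ (s ∨ p)) ≡ true → c ≡ true ⊎ t ≡ true ⊎ s ≡ true ⊎ p ≡ true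
    view h = [ inj₁ , (λ h → inj₂ ([ inj₁ , (λ h → inj₂ (∨-split s p h)) ]′ (∨-split t (s ∨ p) h))) ]′ (∨-split c (t ∨ (s ∨ p)) h)
    go : c ≡ true ⊎ t ≡ true ⊎ s ≡ true ⊎ p ≡ true → ∀ S → S ⊑ dom κ → ∥ S ∥ ≤ 3 → OuterColoop ⊎ One⊎Three ∥ S ∥ → Graphical (Ext (Z ↾ dom κ) S)
    go (inj₁ h) = ⊥-elim (noClash k4Conflicts k4-conflicts h)
    go (inj₂ (inj₁ h)) S S⊑ le _ = some-fits triangleLegs triangles 4 k4TriangleGraphs triangle-perms triangle-ok h S S⊑ le
    go (inj₂ (inj₂ (inj₁ h))) S S⊑ le _ = some-fits starLegs starPerms 4 k4StarGraphs star-perms star-ok h S S⊑ le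
    go (inj₂ (inj₂ (inj₂ h))) S S⊑ le out = build (some-∈ (λ (b , _) → pairFits shorts b) h)
      where
      build : (∃ λ q → q ∈ˡ pairCases × pairFits shorts (proj₁ q) ≡ true) → Graphical (Ext (Z ↾ dom κ) S)
      build ((b , w , w′ , w″) , q∈ , fit) = Pair.graphical R closed b w w′ w″ (check-∈ pairCaseOk pairCases pairs-ok (b , w , w′ , w″) q∈) fit S S⊑ out

-- Induction over the live elements

NoBad-Avoid : ∀ {n} {Z : Space n} {U : V n} → NoBad Z U → ∀ e → NoBad (Avoid Z e) (U ⊓ ~ 𝟙 e)
NoBad-Avoid {Z = Z} {U} nb e t m = nb t record
  { φ = φ m ; φ-inj = φ-inj m ; D = D m ; φ∉D = φ∉D m ; D⊇ = λ x p → D⊇ m x (cong (_∧ not (𝟙 e x)) p)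
  ; Q≐ = ≐-trans (Q≐ m) ((λ w (v , (Zv , _) , a , b) → v , Zv , a , b) ⸴ λ w (v , Zv , a , b) → v , (Zv , a e De) , a , b) }
  where
  open Minor
  De : D m e ≡ true
  De = D⊇ m e (trans (cong (λ b → U e ∧ not b) (𝟙-refl e)) (Bool.∧-zeroʳ (U e)))

∥∥-remove : ∀ {n} {S : V n} {e} → S e ≡ true → ∥ S ∥ ≡ suc ∥ S ⊕ 𝟙 e ∥
∥∥-remove {S = S} {e} Se = trans (∥∥-+ {S = S} {𝟙 e} {S ⊕ 𝟙 e} at) (cong (_+ℕ ∥ S ⊕ 𝟙 e ∥) (weight-𝟙 e))
  where
  at : ∀ i → b→ℕ (S i) ≡ b→ℕ (𝟙 e i) +ℕ b→ℕ (S i xor 𝟙 e i)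
  at i = go (S i) refl (𝟙 e i) refl
    where
    go : ∀ s → S i ≡ s → ∀ t → 𝟙 e i ≡ t → b→ℕ (S i) ≡ b→ℕ (𝟙 e i) +ℕ b→ℕ (S i xor 𝟙 e i)
    go true p true q rewrite p | q = refl
    go true p false q rewrite p | q = refl
    go false p false q rewrite p | q = refl
    go false p true q = ⊥-elim (true≢false (trans (sym Se) (trans (cong S (𝟙-true q)) p)))

-- Size one is included because cancelling a series pair inside a three-element set leaves a single
-- element.
Extendable : ∀ {n} → Space n → V n → Set
Extendable Z U = ∀ S → S ⊑ U → One⊎Three ∥ S ∥ → Graphical (Ext Z S)

module Reduce {n} {Z : Space n} {U : V n} (nb : NoBad Z U) (ZU : ∀ v → Z ∋ v → v ⊑ U)
              (rec : ∀ e → U e ≡ true → Extendable (Avoid Z e) (U ⊓ ~ 𝟙 e)) where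

  avoided : ∀ e → U e ≡ true → ∀ S → S ⊑ U → S e ≡ false → One⊎Three ∥ S ∥ → Graphical (Avoid (Ext Z S) e)
  avoided e Ue S S⊑ Se sz = graphical-resp (Avoid-Ext Z e Se) (rec e Ue S below sz)
    where
    below : S ⊑ U ⊓ ~ 𝟙 e
    below i p = cong₂ _∧_ (S⊑ i p) (cong not (𝟙-≢ λ q → true≢false (trans (sym p) (trans (cong S (sym q)) Se))))

  pair-at : ∀ {e f : Fin n} → e ≢ f → (𝟙 e ⊕ 𝟙 f) e ≡ true
  pair-at {e} e≢f = cong₂ _xor_ (𝟙-refl e) (𝟙-≢ (e≢f ∘ sym))

  -- The element `e` is contracted, which is harmless as it is not in `S`, and is put back by
  -- subdividing `f`.
  series : ∀ e f → e ≢ f → Z ∋ 𝟙 e ⊕ 𝟙 f → ∀ S → S ⊑ U → S e ≡ false → One⊎Three ∥ S ∥ → Graphical (Ext Z S)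
  series e f e≢f Zef S S⊑ Se sz = uncontract-series (Ext Z S) e f e≢f (Ext-base {W = Z} {S} (𝟙 e ⊕ 𝟙 f) Zef)
    (avoided e (ZU (𝟙 e ⊕ 𝟙 f) Zef e (pair-at e≢f)) S S⊑ Se sz)

  module _ (S : V n) (S⊑ : S ⊑ U) (sz : One⊎Three ∥ S ∥) where

    -- S may be replaced by S + e + f, which no longer contains e
    cancel : ∀ e f → e ≢ f → Z ∋ 𝟙 e ⊕ 𝟙 f → S e ≡ true → S f ≡ true → Graphical (Ext Z S)
    cancel e f e≢f Zef Se Sf = graphical-resp (Ext-shift Z shifted) (series e f e≢f Zef S′ S′⊑ S′e (small sz))
      where
      S′ : V n
      S′ = (S ⊕ 𝟙 e) ⊕ 𝟙 f
      S′e : S′ e ≡ false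
      S′e = cong₂ _xor_ (cong₂ _xor_ Se (𝟙-refl e)) (𝟙-≢ (e≢f ∘ sym))
      S′⊑ : S′ ⊑ U
      S′⊑ = ⊑-⊕ (⊑-⊕ S⊑ (𝟙-⊑ {u = U} (S⊑ e Se))) (𝟙-⊑ {u = U} (S⊑ f Sf))
      two-less : ∥ S ∥ ≡ suc (suc ∥ S′ ∥)
      two-less = trans (∥∥-remove {S = S} Se) (cong suc (∥∥-remove {S = S ⊕ 𝟙 e} (cong₂ _xor_ Sf (𝟙-≢ e≢f))))
      small : One⊎Three ∥ S ∥ → One⊎Three ∥ S′ ∥
      small (inj₁ p) = ⊥-elim (1≢2+ (trans (sym p) two-less))
        where
        1≢2+ : ∀ {m} → 1 ≢ suc (suc m)
        1≢2+ ()
      small (inj₂ p) = inj₁ (ℕ.suc-injective (ℕ.suc-injective (trans (sym two-less) p)))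
      shifted : Z ∋ S′ ⊕ S
      shifted = resp≈ Z (λ i → sym (lem (S i) (𝟙 e i) (𝟙 f i))) Zef
        where
        lem : ∀ a b c → ((a xor b) xor c) xor a ≡ b xor c
        lem a b c = trans (cong (_xor a) (trans (Bool.xor-assoc a b c) (Bool.xor-comm a (b xor c)))) (xor-cancelʳ (b xor c) a)

    -- Either `Z` decomposes entirely into good summands, and the bounds of `Good` match the two
    -- sizes of `S`, or K₄ occurs and one of the four maximal patterns accounts for everything up to
    -- a coloop.
    reduced : Simple Z → (∀ e → Z ∋ 𝟙 e → S e ≡ true) → Graphical (Ext Z S)
    reduced simple coloop⇒S = go (Claim.claim nb ZU simple U λ v Zv → resp≈ Z (≈-sym (⊑⇒⊓ (ZU v Zv))) Zv)
      where
      open Endings nb ZU simple S S⊑ sz coloop⇒S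
      whole : Z ↾ U ≐ Z
      whole = (λ v → proj₁) ⸴ λ v Zv → Zv , ZU v Zv
      good : Good Z U → One⊎Three ∥ S ∥ → Graphical (Ext Z S)
      good h (inj₁ p) = NRep⇒Graphical (NRep-resp whole (proj₁ (h S S⊑) (ℕ.≤-trans (ℕ.≤-reflexive p) (s≤s z≤n))))
      good h (inj₂ p) = graphical-resp (Ext-mono S whole) (proj₂ (h S S⊑) p)
      ends : Maximal nb ZU simple k4M ⊎ Maximal nb ZU simple w4M ⊎ Maximal nb ZU simple prismM ⊎ Maximal nb ZU simple k33M → Graphical (Ext Z S)
      ends (inj₁ m) = k4-end m
      ends (inj₂ (inj₁ m)) = w4-end m
      ends (inj₂ (inj₂ (inj₁ m))) = prism-end m
      ends (inj₂ (inj₂ (inj₂ m))) = k33-end m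
      go : Good Z U ⊎ Real Z k4M → Graphical (Ext Z S)
      go (inj₁ h) = good h sz
      go (inj₂ R) = ends (k4Closure nb ZU simple R)

    extend : Graphical (Ext Z S)
    -- Coloops outside `S` go first, then series pairs. What then remains is simple with all coloops
    -- in `S`, as `finish` requires.
    extend = loops (Fin.any? λ e → (S e Bool.≟ false) ×-dec mem? Z (𝟙 e))
      where
      pairs : (∀ e → Z ∋ 𝟙 e → S e ≡ true) → Dec (∃ λ e → ∃ λ f → e ≢ f × Z ∋ 𝟙 e ⊕ 𝟙 f) → Graphical (Ext Z S)
      pairs h (no ¬p) = reduced (λ e f e≢f Zef → ¬p (e , f , e≢f , Zef)) h
      pairs h (yes (e , f , e≢f , Zef)) = go (S e) refl (S f) refl
        where
        go : ∀ a → S e ≡ a → ∀ b → S f ≡ b → Graphical (Ext Z S)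
        go false p _ _ = series e f e≢f Zef S S⊑ p sz
        go true p false q = series f e (e≢f ∘ sym) (resp≈ Z (λ i → Bool.xor-comm (𝟙 e i) (𝟙 f i)) Zef) S S⊑ q sz
        go true p true q = cancel e f e≢f Zef p q
      loops : Dec (∃ λ e → S e ≡ false × Z ∋ 𝟙 e) → Graphical (Ext Z S)
      loops (yes (e , Se , Ze)) = uncontract-coloop (Ext Z S) e (Ext-base {W = Z} {S} (𝟙 e) Ze) (avoided e (ZU (𝟙 e) Ze e (𝟙-refl e)) S S⊑ Se sz)
      loops (no ¬l) = pairs (λ e Ze → ≢false⇒true λ p → ¬l (e , p , Ze)) (Fin.any? λ e → Fin.any? λ f → ¬? (e Fin.≟ f) ×-dec mem? Z (𝟙 e ⊕ 𝟙 f))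

-- The number of elements `n` is fixed, so the induction is on the size of `U`, which drops by one
-- with each contraction.
extendable : ∀ {n} (Z : Space n) U → NoBad Z U → (∀ v → Z ∋ v → v ⊑ U) → Extendable Z U
extendable {n} Z U nb ZU = go Z U nb ZU (<-wellFounded ∥ U ∥)
  where
  go : ∀ (Z : Space n) U → NoBad Z U → (∀ v → Z ∋ v → v ⊑ U) → Acc _<_ ∥ U ∥ → Extendable Z U
  go Z U nb ZU (acc rec) = Reduce.extend nb ZU λ e Ue → go (Avoid Z e) (U ⊓ ~ 𝟙 e) (NoBad-Avoid nb e) (below e) (rec (smaller e Ue))
    where
    below : ∀ e v → Avoid Z e ∋ v → v ⊑ U ⊓ ~ 𝟙 e
    below e v (Zv , ve) i p = cong₂ _∧_ (ZU v Zv i p) (cong not (𝟙-≢ λ q → true≢false (trans (sym p) (trans (cong v (sym q)) ve))))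
    smaller : ∀ e → U e ≡ true → ∥ U ⊓ ~ 𝟙 e ∥ < ∥ U ∥
    smaller e Ue = ∥∥-mono-< (⊓-⊑ˡ U (~ 𝟙 e)) e (trans (cong (λ b → U e ∧ not b) (𝟙-refl e)) (Bool.∧-zeroʳ (U e))) Ue

theorem1p5 : ∀ {m n : ℕ} (A : Mat m n) → Cographic M[ A ] →
    (InC₃ A ⇔ (∀ (i : Fin 7) → ¬ HasMinor M[ A ] (MG (GraphOf (F i)))))
theorem1p5 A cog = inC₃⇒noMinor A , λ none S ∣S∣≡3 → graphical⇒graphic A S (build none S ∣S∣≡3 (cographic⇒cycleSpace A cog))
  where
  build : (∀ i → ¬ HasMinor M[ A ] (MG (GraphOf (F i)))) → ∀ S → ∣ S ∣ ≡ 3 → (∃ λ v → Σ (Graph v _) λ G → Row A ≐ Cyc G) → Graphical (Ext (Row A) (lookup S))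
  build none S ∣S∣≡3 (v , G , same) = extendable (Row A) (λ _ → true) (noBad A G same none) (λ _ _ _ _ → refl) (lookup S) (λ _ _ → refl)
    (inj₂ (trans (sym (∣∣-∥∥ S)) ∣S∣≡3))
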